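{- Let $M=2^s m$ where $s\ge 2$ and $m\ge 1$ is odd. Suppose $a=\phi(b)>1$ for some positive integer $b$ which is neither a prime nor twice an odd prime. Then the arithmetic progression $a \pmod M$ contains infinitely many totients.
   Context: $\phi$ is Euler's function. A totient is a value $\phi(n)$ for some positive integer $n$. -}

module Defs where

open import Data.Nat using (ℕ; zero; suc; _≤_; _<_; _+_)
open import Data.Nat.GCD using (gcd)
open import Data.Nat.Properties using (_≟_)
open import Data.List using (List; length; filter)
open import Data.List using (applyUpTo)
open import Data.Product using (∃; _×_)
open import Relation.Binary.PropositionalEquality using (_≡_)

range1 : ℕ → List ℕ
range1 n = applyUpTo suc n

φ : ℕ → ℕ
φ n = length (filter (λ k → gcd k n ≟ 1) (range1 n))

IsTotient : ℕ → Set
IsTotient t = ∃ λ n → 1 ≤ n × φ n ≡ t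

{-# OPTIONS --safe #-}
module Submission where

-- By Dirichlet's theorem there are arbitrarily large primes q in every unit class modulo M, so it suffices to
-- change b, prime by prime, into a number with the same totient modulo M. If p² divides b, with p^k exactly
-- dividing b, p^k is replaced by q^k, where q ≡ p modulo the part of M prime to p, and modulo the p-part of M
-- q solves q^(k-1) (q-1) ≡ p^(k-1) (p-1) with q ≡ 1 (mod p). A simple factor 3 is replaced by q² with q ≡ -1,
-- as φ(q²) ≡ 2. Otherwise b has two simple prime factors p, r > 3, and they are replaced by two primes that
-- solve (u-1)(v-1) ≡ (p-1)(r-1) in units modulo each part of M.
--
-- Dirichlet's theorem is proved by Selberg's elementary method, in rational arithmetic: log is replaced by a
-- completely additive function that is close to it up to a bound B. By Selberg's formula the classes g satisfy
-- Σ_{p ≡ g} log² p / p + Σ_{pr ≡ g} log p log r / (pr) = log² x / φ(M) + O(log x). Hence no class holds more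
-- than twice its share of the primes, and if the class c holds none, then h and c/h are both nearly empty or
-- both nearly full, for each h. A product of full classes is then empty, so the empty classes form a subgroup
-- of index 2, and almost all primes lie where the corresponding real character χ is -1. This contradicts
-- L(1,χ) ≠ 0, which is proved by Monsky's argument.

open import Defs
open import Level using (0ℓ)
open import Algebra.Bundles using (CommutativeRing)
open import Algebra.Structures using (IsCommutativeRing)
import Algebra.Properties.CommutativeSemigroup as CommutativeSemigroupProperties
import Algebra.Properties.Group as GroupProperties
import Algebra.Properties.Ring as RingProperties
open import Data.Bool using (Bool; true; false)
open import Data.Empty using (⊥; ⊥-elim)
open import Data.Integer as ℤ using (ℤ; -[1+_])
import Data.Integer.DivMod as ℤ
import Data.Integer.Properties as ℤ
open import Data.List using (List; []; _∷_; _∷ʳ_; _++_; length; filter)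
open import Data.List.Properties using (≡-dec; applyUpTo-∷ʳ; filter-++; length-++)
open import Data.List.Relation.Unary.All using (All; []; _∷_)
open import Data.Nat as ℕ using (ℕ; zero; suc; z≤n; s≤s)
open import Data.Nat.Coprimality as Coprimality using (Coprime; coprime?; coprime-divisor; coprime-Bézout; coprime⇒gcd≡1; gcd≡1⇒coprime)
open import Data.Nat.Divisibility using (_∣_; _∣?_; divides; ∣-refl; ∣-trans; ∣⇒≤; ∣1⇒≡1; m∣m*n; n∣m*n; ∣m⇒∣m*n; ∣n⇒∣m*n; ∣m∣n⇒∣m+n; ∣m+n∣m⇒∣n; *-monoʳ-∣; *-cancelˡ-∣)
import Data.Nat.DivMod as ℕ
open import Data.Nat.GCD using (gcd; module Bézout)
open import Data.Nat.Induction using (<-rec)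
open import Data.Nat.ListAction using (product)
open import Data.Nat.Primality using (Prime; prime?; prime[2]; prime⇒nonZero; euclidsLemma)
open import Data.Nat.Primality.Factorisation using (PrimeFactorisation; factorise)
import Data.Nat.Properties as ℕ
open import Data.Nat.Tactic.RingSolver using (solve-∀)
open import Data.Product using (∃; _×_; _,_; proj₁; proj₂)
open import Data.Rational as ℚ using (ℚ)
import Data.Rational.Properties as ℚ
import Data.Rational.Unnormalised as ℚᵘ
import Data.Rational.Unnormalised.Properties as ℚᵘ
open import Data.Sum using (_⊎_; inj₁; inj₂; [_,_]′)
open import Relation.Binary.Definitions using (tri<; tri≈; tri>)
open import Relation.Binary.PropositionalEquality hiding (J)
open import Relation.Nullary using (¬_; Dec; yes; no)
open import Relation.Nullary.Decidable using (_×-dec_; from-yes)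
open import Relation.Unary using (Decidable)

-- What is refuted is finite: that no prime up to an explicit `B` lies in a class. So all functions
-- need to behave well only up to `B`, and no limit is taken. The constants are fixed in the order
-- Q, k, L, B: Q measures how sharply classes split into empty and full, the number k of sample
-- points beats the harmonic sum that sampling costs, and L = log Y beats every error of Selberg's
-- formula.
--
-- The dichotomy is a case of equality. If c holds no primes, the pairs p r ≡ c alone must supply
-- log² x / φ(M). Their sum is a convolution of the masses of h and c/h, and it would have just this
-- size if every c/h grew at the maximal rate, twice its share. Hence a class with mass cannot have
-- a partner that falls short of the maximum.
--
-- A full class exhausts Selberg's formula by its primes alone and leaves no room for products p r.
-- A product of two full classes receives many of them, so it is not full.
--
-- The error in the number of empty classes is made smaller than 1, so integrality makes this number
-- exactly φ(M)/2, and multiplicativity of the character follows by counting.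

-- Primes, coprimality and residue classes.

module Elementary where

  open import Data.Nat
  open import Data.Nat.Properties
  open import Data.Nat.DivMod
  open import Data.Nat.Divisibility
  open import Data.Nat.Primality

  prime⇒2≤ : ∀ {p} → Prime p → 2 ≤ p
  prime⇒2≤ {zero} pr = ⊥-elim (¬prime[0] pr)
  prime⇒2≤ {suc zero} pr = ⊥-elim (¬prime[1] pr)
  prime⇒2≤ {suc (suc p)} pr = s≤s (s≤s z≤n)

  prime⇒1≤ : ∀ {p} → Prime p → 1 ≤ p
  prime⇒1≤ pr = ≤-trans (s≤s z≤n) (prime⇒2≤ pr)

  prime-induction : (P : ℕ → Set) → P 1 → (∀ p m → Prime p → 1 ≤ m → P m → P (p * m)) →
                    ∀ n → 1 ≤ n → P n
  prime-induction P base step n@(suc _) _ = subst P (sym (PrimeFactorisation.isFactorisation f))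
      (go (PrimeFactorisation.factors f) (PrimeFactorisation.factorsPrime f))
    where
    f = factorise n
    go : ∀ ps → All Prime ps → P (product ps)
    go [] [] = base
    go (p ∷ ps) (pr ∷ prs) = step p (product ps) pr (productOfPrimes≥1 prs) (go ps prs)

  prime-factor : ∀ n → 2 ≤ n → ∃ λ p → Prime p × p ∣ n
  prime-factor n 2≤n = [ (λ n≡1 → ⊥-elim (<⇒≢ 2≤n (sym n≡1))) , (λ x → x) ]′
    (prime-induction (λ n → n ≡ 1 ⊎ (∃ λ p → Prime p × p ∣ n)) (inj₁ refl)
      (λ p m pr _ _ → inj₂ (p , pr , m∣m*n m)) n (≤-trans (s≤s z≤n) 2≤n))

  prime∤⇒coprime : ∀ {p n} → Prime p → ¬ p ∣ n → Coprime p n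
  prime∤⇒coprime pr ¬d (d∣p , d∣n) with prime⇒irreducible pr d∣p
  ... | inj₁ d≡1 = d≡1
  ... | inj₂ refl = ⊥-elim (¬d d∣n)

  prime∣^⇒∣ : ∀ {p} q j → Prime p → p ∣ q ^ j → p ∣ q
  prime∣^⇒∣ q zero pr d = ⊥-elim (<⇒≱ (prime⇒2≤ pr) (∣⇒≤ d))
  prime∣^⇒∣ q (suc j) pr d with euclidsLemma q (q ^ j) pr d
  ... | inj₁ e = e
  ... | inj₂ e = prime∣^⇒∣ q j pr e

  prime∣prime⇒≡ : ∀ {p q} → Prime p → Prime q → p ∣ q → p ≡ q
  prime∣prime⇒≡ pp pq d with prime⇒irreducible pq d
  ... | inj₁ p≡1 = ⊥-elim (<⇒≢ (prime⇒2≤ pp) (sym p≡1))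
  ... | inj₂ e = e

  coprime-*ˡ : ∀ {a b n} → Coprime a n → Coprime b n → Coprime (a * b) n
  coprime-*ˡ {a} {b} {n} p q {d} (d∣ab , d∣n) =
    q (Coprimality.coprime-divisor (λ (e∣d , e∣a) → p (e∣a , ∣-trans e∣d d∣n)) d∣ab , d∣n)

  coprime-^ˡ : ∀ {a n} j → Coprime a n → Coprime (a ^ j) n
  coprime-^ˡ zero p (d∣1 , _) = ∣1⇒≡1 d∣1
  coprime-^ˡ {a} (suc j) p = coprime-*ˡ {a} {a ^ j} p (coprime-^ˡ j p)

  coprime-∣ : ∀ {a b m n} → a ∣ m → b ∣ n → Coprime m n → Coprime a b
  coprime-∣ p q c (d∣a , d∣b) = c (∣-trans d∣a p , ∣-trans d∣b q)

  coprime-*-∣ : ∀ {a b n} → Coprime a b → a ∣ n → b ∣ n → a * b ∣ n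
  coprime-*-∣ {a} {b} c (divides k e) b∣n = subst (a * b ∣_) (trans (*-comm a k) (sym e))
    (*-monoʳ-∣ a (Coprimality.coprime-divisor (Coprimality.sym c) (subst (b ∣_) (trans e (*-comm k a)) b∣n)))

  n<2^n : ∀ n → n < 2 ^ n
  n<2^n zero = s≤s z≤n
  n<2^n (suc n) = ≤-trans (+-mono-≤ (≤-trans (s≤s z≤n) (n<2^n n)) (n<2^n n))
    (≤-reflexive (cong (2 ^ n +_) (sym (+-identityʳ (2 ^ n)))))

  n<p^n : ∀ {p} n → 2 ≤ p → n < p ^ n
  n<p^n n 2≤p = ≤-trans (n<2^n n) (^-monoˡ-≤ n 2≤p)

  module Residues (m : ℕ) where

    M : ℕ
    M = suc m

    infix 4 _≋_
    -- A record instead of a bare equation between remainders, so that `a` and `b` can be inferred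
    -- from the type.
    record _≋_ (a b : ℕ) : Set where
      constructor mk≋
      field residue : a % M ≡ b % M

    open _≋_ public

    ≋-refl : ∀ {a} → a ≋ a
    ≋-refl = mk≋ refl

    ≋-sym : ∀ {a b} → a ≋ b → b ≋ a
    ≋-sym (mk≋ e) = mk≋ (sym e)

    ≋-trans : ∀ {a b c} → a ≋ b → b ≋ c → a ≋ c
    ≋-trans (mk≋ e) (mk≋ f) = mk≋ (trans e f)

    ≡⇒≋ : ∀ {a b} → a ≡ b → a ≋ b
    ≡⇒≋ e = mk≋ (cong (_% M) e)

    +M-≋ : ∀ a k → a + k * M ≋ a
    +M-≋ a k = mk≋ ([m+kn]%n≡m%n a k M)

    ≋-* : ∀ {a a′ b b′} → a ≋ a′ → b ≋ b′ → a * b ≋ a′ * b′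
    ≋-* {a} {a′} {b} {b′} (mk≋ p) (mk≋ q) =
      mk≋ (trans (%-distribˡ-* a b M) (trans (cong₂ (λ x y → (x * y) % M) p q) (sym (%-distribˡ-* a′ b′ M))))

    ≋-*ˡ : ∀ c {a b} → a ≋ b → c * a ≋ c * b
    ≋-*ˡ c = ≋-* {c} ≋-refl

    ≋-*ʳ : ∀ c {a b} → a ≋ b → a * c ≋ b * c
    ≋-*ʳ c e = ≋-* e ≋-refl

    ∣-resp-≋ : ∀ {d a b} → d ∣ M → a ≋ b → d ∣ a → d ∣ b
    ∣-resp-≋ {d} d∣M (mk≋ e) d∣a = ∣n∣m%n⇒∣m d∣M (subst (d ∣_) e (%-presˡ-∣ d∣a d∣M))

    coprime-resp-≋ : ∀ {a b} → a ≋ b → Coprime a M → Coprime b M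
    coprime-resp-≋ e c (d∣b , d∣M) = c (∣-resp-≋ d∣M (≋-sym e) d∣b , d∣M)

    coprime-factorˡ : ∀ {a b} → Coprime (a * b) M → Coprime a M
    coprime-factorˡ {a} {b} c (d∣a , d∣M) = c (∣m⇒∣m*n b d∣a , d∣M)

    coprime-factorʳ : ∀ {a b} → Coprime (a * b) M → Coprime b M
    coprime-factorʳ {a} {b} c (d∣b , d∣M) = c (∣n⇒∣m*n a d∣b , d∣M)

    inverse : ∀ {d} → Coprime d M → ∃ λ d′ → d * d′ ≋ 1
    inverse {d} c with coprime-Bézout c
    ... | Bézout.+- x y eq = x , ≋-trans (≡⇒≋ (trans (*-comm d x) (sym eq))) (+M-≋ 1 y)
    -- Here d x ≡ -1, and `m` is -1 modulo `M`, so `x * m` is the inverse.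
    ... | Bézout.-+ x y eq = x * m , ≋-trans (≡⇒≋ (trans (sym (*-assoc d x m)) (cong (_* m) (*-comm d x))))
        (≋-trans (≋-sym (+M-≋ (t * m) y)) (≋-trans (≡⇒≋ e) (+M-≋ 1 t)))
      where
      open ≡-Reasoning
      t = x * d
      e : t * m + y * M ≡ 1 + t * M
      e = begin
        t * m + y * M ≡⟨ cong (t * m +_) (sym eq) ⟩
        t * m + (1 + t) ≡⟨ trans (+-suc (t * m) t) (cong suc (trans (+-comm (t * m) t) (sym (*-suc t m)))) ⟩
        1 + t * M ∎

    inverse-coprime : ∀ d {d′} → d * d′ ≋ 1 → Coprime d′ M
    inverse-coprime d e = coprime-factorʳ {d} (coprime-resp-≋ (≋-sym e) (λ (p , _) → ∣1⇒≡1 p))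

    ≋-divide : ∀ d d′ {r t} → d * d′ ≋ 1 → d * r ≋ t → d′ * t ≋ r
    ≋-divide d d′ {r} e h = ≋-trans (≋-*ˡ d′ (≋-sym h)) (≋-trans (≡⇒≋ (trans (sym (*-assoc d′ d r)) (cong (_* r) (*-comm d′ d))))
      (≋-trans (≋-*ʳ r e) (≡⇒≋ (*-identityˡ r))))

    ≋-multiply : ∀ d d′ {r t} → d * d′ ≋ 1 → d′ * t ≋ r → d * r ≋ t
    ≋-multiply d d′ {r} {t} e h = ≋-trans (≋-*ˡ d (≋-sym h)) (≋-trans (≡⇒≋ (sym (*-assoc d d′ t)))
      (≋-trans (≋-*ʳ t e) (≡⇒≋ (*-identityˡ t))))

    -- Representatives run from 1 to `M`, the range of the sums below, so the class of 0 is
    -- represented by `M`.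
    representative : ∀ n → ∃ λ r → 1 ≤ r × r ≤ M × n ≋ r
    representative n with n % M in eq
    ... | zero = M , s≤s z≤n , ≤-refl , mk≋ (trans eq (sym (n%n≡0 M)))
    ... | suc k = suc k , s≤s z≤n , <⇒≤ lt , mk≋ (trans eq (sym (m<n⇒m%n≡m lt)))
      where
      lt : suc k < M
      lt = subst (_< M) eq (m%n<n n M)

    representative-unique : ∀ {r t} → 1 ≤ r → r ≤ M → 1 ≤ t → t ≤ M → r ≋ t → r ≡ t
    representative-unique {r} {t} 1≤r r≤M 1≤t t≤M (mk≋ e) with r ≟ M | t ≟ M
    ... | yes refl | yes refl = refl
    ... | no r≢M | no t≢M = trans (sym (m<n⇒m%n≡m (≤∧≢⇒< r≤M r≢M))) (trans e (m<n⇒m%n≡m (≤∧≢⇒< t≤M t≢M)))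
    ... | yes refl | no t≢M = ⊥-elim (<⇒≢ 1≤t (trans (sym (n%n≡0 M)) (trans e (m<n⇒m%n≡m (≤∧≢⇒< t≤M t≢M)))))
    ... | no r≢M | yes refl = ⊥-elim (<⇒≢ 1≤r (trans (sym (n%n≡0 M)) (trans (sym e) (m<n⇒m%n≡m (≤∧≢⇒< r≤M r≢M)))))

-- Abstract interfaces to the integers and the rationals, and a ring solver.

-- Shared by the rationals and the integers, so that one solver serves both; `ι` provides its
-- coefficients.
record ℤ-Algebra : Set₁ where
  infixl 6 _+_ _-_
  infixl 7 _*_
  infix 8 -_
  field
    Carrier : Set
    _+_ _*_ : Carrier → Carrier → Carrier
    -_ : Carrier → Carrier
    ι : ℤ → Carrier
    isCommutativeRing : IsCommutativeRing _≡_ _+_ _*_ -_ (ι (ℤ.+ 0)) (ι (ℤ.+ 1))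
    ι-+ : ∀ a b → ι (a ℤ.+ b) ≡ ι a + ι b
    ι-* : ∀ a b → ι (a ℤ.* b) ≡ ι a * ι b
    ι-neg : ∀ a → ι (ℤ.- a) ≡ - ι a

  # : ℕ → Carrier
  # n = ι (ℤ.+ n)

  _-_ : Carrier → Carrier → Carrier
  x - y = x + - y

-- Both `inv` and `_⁻¹` are total; the value 0 of `inv` at 0 makes `inv-*` hold for all arguments.
record OrderedField : Set₁ where
  infix 9 _⁻¹
  infix 4 _≤_
  field
    algebra : ℤ-Algebra
  open ℤ-Algebra algebra renaming (Carrier to F) public
  field
    _≤_ : F → F → Set
    ≤-refl : ∀ {x} → x ≤ x
    ≤-trans : ∀ {x y z} → x ≤ y → y ≤ z → x ≤ z
    ≤-total : ∀ x y → x ≤ y ⊎ y ≤ x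
    _≤?_ : ∀ x y → Dec (x ≤ y)
    +-mono-≤ : ∀ {x y u v} → x ≤ y → u ≤ v → x + u ≤ y + v
    *-nonneg : ∀ {x y} → # 0 ≤ x → # 0 ≤ y → # 0 ≤ x * y
    #-nonneg : ∀ n → # 0 ≤ # n
    1≰0 : ¬ (# 1 ≤ # 0)
    inv : ℕ → F
    inv-zero : inv 0 ≡ # 0
    inv-suc : ∀ n → # (suc n) * inv (suc n) ≡ # 1
    inv-nonneg : ∀ n → # 0 ≤ inv n
    _⁻¹ : F → F
    ⁻¹-inverse : ∀ {x} → ¬ (x ≤ # 0) → x * x ⁻¹ ≡ # 1

private
  fromℤ : ℤ → ℚ
  fromℤ z = z ℚ./ 1

  toᵘ-fromℤ : ∀ z → ℚ.toℚᵘ (fromℤ z) ℚᵘ.≃ z ℚᵘ./ 1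
  toᵘ-fromℤ z = ℚ.toℚᵘ-fromℚᵘ (z ℚᵘ./ 1)

  fromℤ-+ : ∀ a b → fromℤ (a ℤ.+ b) ≡ fromℤ a ℚ.+ fromℤ b
  fromℤ-+ a b = ℚ.toℚᵘ-injective (ℚᵘ.≃-trans (toᵘ-fromℤ (a ℤ.+ b))
    (ℚᵘ.≃-trans (ℚᵘ.*≡* (cong (ℤ._* ℤ.+ 1) (cong₂ ℤ._+_ (sym (ℤ.*-identityʳ a)) (sym (ℤ.*-identityʳ b)))))
    (ℚᵘ.≃-sym (ℚᵘ.≃-trans (ℚ.toℚᵘ-homo-+ (fromℤ a) (fromℤ b)) (ℚᵘ.+-cong (toᵘ-fromℤ a) (toᵘ-fromℤ b))))))

  fromℤ-* : ∀ a b → fromℤ (a ℤ.* b) ≡ fromℤ a ℚ.* fromℤ b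
  fromℤ-* a b = ℚ.toℚᵘ-injective (ℚᵘ.≃-trans (toᵘ-fromℤ (a ℤ.* b))
    (ℚᵘ.≃-sym (ℚᵘ.≃-trans (ℚ.toℚᵘ-homo-* (fromℤ a) (fromℤ b)) (ℚᵘ.*-cong (toᵘ-fromℤ a) (toᵘ-fromℤ b)))))

  fromℤ-neg : ∀ a → fromℤ (ℤ.- a) ≡ ℚ.- fromℤ a
  fromℤ-neg a = ℚ.toℚᵘ-injective (ℚᵘ.≃-trans (toᵘ-fromℤ (ℤ.- a))
    (ℚᵘ.≃-sym (ℚᵘ.≃-trans (ℚ.toℚᵘ-homo‿- (fromℤ a)) (ℚᵘ.-‿cong (toᵘ-fromℤ a)))))

  recip : ℕ → ℚ
  recip zero = ℚ.0ℚ
  recip (suc n) = ℤ.+ 1 ℚ./ suc n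

  fromℤ*recip : ∀ n → fromℤ (ℤ.+ suc n) ℚ.* recip (suc n) ≡ fromℤ (ℤ.+ 1)
  fromℤ*recip n = ℚ.toℚᵘ-injective (ℚᵘ.≃-trans (ℚ.toℚᵘ-homo-* (fromℤ (ℤ.+ suc n)) (recip (suc n)))
    (ℚᵘ.≃-trans (ℚᵘ.*-cong (toᵘ-fromℤ (ℤ.+ suc n)) (ℚ.toℚᵘ-fromℚᵘ (ℤ.+ 1 ℚᵘ./ suc n)))
      (ℚᵘ.*≡* (trans (ℤ.*-identityʳ _) (trans (ℤ.*-comm (ℤ.+ suc n) (ℤ.+ 1)) (cong (ℤ._*_ (ℤ.+ 1)) (sym (ℤ.*-identityˡ (ℤ.+ suc n)))))))))

  recip-nonneg : ∀ n → ℚ.0ℚ ℚ.≤ recip n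
  recip-nonneg zero = ℚ.≤-refl
  recip-nonneg (suc n) = ℚ.nonNegative⁻¹ (recip (suc n)) {{ℚ.normalize-nonNeg 1 (suc n)}}

  reciprocal : ℚ → ℚ
  reciprocal x with x ℚ.≟ ℚ.0ℚ
  ... | yes _ = ℚ.0ℚ
  ... | no x≢0 = (ℚ.1/ x) {{ℚ.≢-nonZero x≢0}}

  *-reciprocal : ∀ {x} → ¬ (x ℚ.≤ ℚ.0ℚ) → x ℚ.* reciprocal x ≡ ℚ.1ℚ
  *-reciprocal {x} x≰0 with x ℚ.≟ ℚ.0ℚ
  ... | yes refl = ⊥-elim (x≰0 ℚ.≤-refl)
  ... | no x≢0 = ℚ.*-inverseʳ x {{ℚ.≢-nonZero x≢0}}

abstract
  -- Sealed, so that rational arithmetic never computes during type checking; equations between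
  -- field elements come from the solver.
  𝔽 : OrderedField
  𝔽 = record
    { algebra = record
      { Carrier = ℚ ; _+_ = ℚ._+_ ; _*_ = ℚ._*_ ; -_ = ℚ.-_ ; ι = fromℤ
      ; isCommutativeRing = ℚ.+-*-isCommutativeRing
      ; ι-+ = fromℤ-+ ; ι-* = fromℤ-* ; ι-neg = fromℤ-neg }
    ; _≤_ = ℚ._≤_ ; ≤-refl = ℚ.≤-refl ; ≤-trans = ℚ.≤-trans
    ; ≤-total = ℚ.≤-total ; _≤?_ = ℚ._≤?_ ; +-mono-≤ = ℚ.+-mono-≤
    ; *-nonneg = λ {x} {y} p q → ℚ.nonNegative⁻¹ (x ℚ.* y)
        {{ℚ.nonNeg*nonNeg⇒nonNeg x {{ℚ.nonNegative p}} y {{ℚ.nonNegative q}}}}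
    ; #-nonneg = λ n → ℚ.nonNegative⁻¹ (fromℤ (ℤ.+ n)) {{ℚ.normalize-nonNeg n 1}}
    ; 1≰0 = λ { (ℚ.*≤* (ℤ.+≤+ ())) }
    ; inv = recip ; inv-zero = refl ; inv-suc = fromℤ*recip ; inv-nonneg = recip-nonneg
    ; _⁻¹ = reciprocal ; ⁻¹-inverse = *-reciprocal
    }

-- A reflective solver for polynomial identities: both sides are expanded into lists of monomials (sorted
-- lists of variable indices) with integer coefficients.

infixl 6 _:+_ _:-_
infixl 7 _:*_
infix 8 :-_
infix 4 _:=_

data Expr : Set where
  var num : ℕ → Expr
  _:+_ _:*_ : Expr → Expr → Expr
  :-_ : Expr → Expr

_:-_ : Expr → Expr → Expr
a :- b = a :+ :- b

_:=_ : Expr → Expr → Expr × Expr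
_:=_ = _,_

module RingSolver (A : ℤ-Algebra) where

  open ℤ-Algebra A

  private
    commutativeRing : CommutativeRing 0ℓ 0ℓ
    commutativeRing = record { isCommutativeRing = isCommutativeRing }

    open CommutativeRing commutativeRing
      using (+-assoc; *-assoc; *-comm; +-identityˡ; +-identityʳ; *-identityˡ; distribˡ; distribʳ; zeroˡ; zeroʳ; -‿inverseʳ)
    module +-Props = CommutativeSemigroupProperties (CommutativeRing.+-commutativeSemigroup commutativeRing)
    module *-Props = CommutativeSemigroupProperties (CommutativeRing.*-commutativeSemigroup commutativeRing)
    open GroupProperties (CommutativeRing.+-group commutativeRing) using (x∙y⁻¹≈ε⇒x≈y)

    at : List Carrier → ℕ → Carrier
    at [] i = ι (ℤ.+ 0)
    at (x ∷ ρ) zero = x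
    at (x ∷ ρ) (suc i) = at ρ i

    ⟦_⟧ : Expr → List Carrier → Carrier
    ⟦ var i ⟧ ρ = at ρ i
    ⟦ num n ⟧ ρ = # n
    ⟦ a :+ b ⟧ ρ = ⟦ a ⟧ ρ + ⟦ b ⟧ ρ
    ⟦ a :* b ⟧ ρ = ⟦ a ⟧ ρ * ⟦ b ⟧ ρ
    ⟦ :- a ⟧ ρ = - ⟦ a ⟧ ρ

    Mono : Set
    Mono = List ℕ

    Poly : Set
    Poly = List (ℤ × Mono)

    ⟦_⟧ᵐ : Mono → List Carrier → Carrier
    ⟦ [] ⟧ᵐ ρ = ι (ℤ.+ 1)
    ⟦ i ∷ m ⟧ᵐ ρ = at ρ i * ⟦ m ⟧ᵐ ρ

    ⟦_⟧ᵖ : Poly → List Carrier → Carrier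
    ⟦ [] ⟧ᵖ ρ = ι (ℤ.+ 0)
    ⟦ (c , m) ∷ p ⟧ᵖ ρ = ι c * ⟦ m ⟧ᵐ ρ + ⟦ p ⟧ᵖ ρ

    insert : ℕ → Mono → Mono
    insert i [] = i ∷ []
    insert i (j ∷ m) with i ℕ.≤ᵇ j
    ... | true = i ∷ j ∷ m
    ... | false = j ∷ insert i m

    insert-correct : ∀ i m ρ → ⟦ insert i m ⟧ᵐ ρ ≡ at ρ i * ⟦ m ⟧ᵐ ρ
    insert-correct i [] ρ = refl
    insert-correct i (j ∷ m) ρ with i ℕ.≤ᵇ j
    ... | true = refl
    ... | false = trans (cong (at ρ j *_) (insert-correct i m ρ)) (*-Props.x∙yz≈y∙xz (at ρ j) (at ρ i) (⟦ m ⟧ᵐ ρ))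

    mulᵐ : Mono → Mono → Mono
    mulᵐ [] m = m
    mulᵐ (i ∷ l) m = insert i (mulᵐ l m)

    mulᵐ-correct : ∀ l m ρ → ⟦ mulᵐ l m ⟧ᵐ ρ ≡ ⟦ l ⟧ᵐ ρ * ⟦ m ⟧ᵐ ρ
    mulᵐ-correct [] m ρ = sym (*-identityˡ _)
    mulᵐ-correct (i ∷ l) m ρ = trans (insert-correct i (mulᵐ l m) ρ)
      (trans (cong (at ρ i *_) (mulᵐ-correct l m ρ)) (sym (*-assoc _ _ _)))

    addTerm : ℤ → Mono → Poly → Poly
    addTerm c m [] = (c , m) ∷ []
    addTerm c m ((d , l) ∷ p) with ≡-dec ℕ._≟_ m l
    ... | yes _ = (c ℤ.+ d , l) ∷ p
    ... | no _ = (d , l) ∷ addTerm c m p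

    addTerm-correct : ∀ c m p ρ → ⟦ addTerm c m p ⟧ᵖ ρ ≡ ι c * ⟦ m ⟧ᵐ ρ + ⟦ p ⟧ᵖ ρ
    addTerm-correct c m [] ρ = refl
    addTerm-correct c m ((d , l) ∷ p) ρ with ≡-dec ℕ._≟_ m l
    ... | yes refl = trans (cong (λ z → z * ⟦ l ⟧ᵐ ρ + ⟦ p ⟧ᵖ ρ) (ι-+ c d))
      (trans (cong (_+ ⟦ p ⟧ᵖ ρ) (distribʳ (⟦ l ⟧ᵐ ρ) (ι c) (ι d))) (+-assoc _ _ _))
    ... | no _ = trans (cong (λ z → ι d * ⟦ l ⟧ᵐ ρ + z) (addTerm-correct c m p ρ)) (+-Props.x∙yz≈y∙xz _ _ _)

    addᵖ : Poly → Poly → Poly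
    addᵖ [] q = q
    addᵖ ((c , m) ∷ p) q = addTerm c m (addᵖ p q)

    addᵖ-correct : ∀ p q ρ → ⟦ addᵖ p q ⟧ᵖ ρ ≡ ⟦ p ⟧ᵖ ρ + ⟦ q ⟧ᵖ ρ
    addᵖ-correct [] q ρ = sym (+-identityˡ _)
    addᵖ-correct ((c , m) ∷ p) q ρ = trans (addTerm-correct c m (addᵖ p q) ρ)
      (trans (cong (λ z → ι c * ⟦ m ⟧ᵐ ρ + z) (addᵖ-correct p q ρ)) (sym (+-assoc _ _ _)))

    mulTerm : ℤ → Mono → Poly → Poly
    mulTerm c m [] = []
    mulTerm c m ((d , l) ∷ p) = (c ℤ.* d , mulᵐ m l) ∷ mulTerm c m p

    mulTerm-correct : ∀ c m p ρ → ⟦ mulTerm c m p ⟧ᵖ ρ ≡ ι c * ⟦ m ⟧ᵐ ρ * ⟦ p ⟧ᵖ ρ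
    mulTerm-correct c m [] ρ = sym (zeroʳ _)
    mulTerm-correct c m ((d , l) ∷ p) ρ = trans (cong₂ _+_ (trans (cong₂ _*_ (ι-* c d) (mulᵐ-correct m l ρ))
      (*-Props.interchange (ι c) (ι d) (⟦ m ⟧ᵐ ρ) (⟦ l ⟧ᵐ ρ))) (mulTerm-correct c m p ρ)) (sym (distribˡ _ _ _))

    mulᵖ : Poly → Poly → Poly
    mulᵖ [] q = []
    mulᵖ ((c , m) ∷ p) q = addᵖ (mulTerm c m q) (mulᵖ p q)

    mulᵖ-correct : ∀ p q ρ → ⟦ mulᵖ p q ⟧ᵖ ρ ≡ ⟦ p ⟧ᵖ ρ * ⟦ q ⟧ᵖ ρ
    mulᵖ-correct [] q ρ = sym (zeroˡ _)
    mulᵖ-correct ((c , m) ∷ p) q ρ = trans (addᵖ-correct (mulTerm c m q) (mulᵖ p q) ρ)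
      (trans (cong₂ _+_ (mulTerm-correct c m q ρ) (mulᵖ-correct p q ρ)) (sym (distribʳ _ _ _)))

    expand : Expr → Poly
    expand (var i) = (ℤ.+ 1 , i ∷ []) ∷ []
    expand (num n) = (ℤ.+ n , []) ∷ []
    expand (a :+ b) = addᵖ (expand a) (expand b)
    expand (a :* b) = mulᵖ (expand a) (expand b)
    expand (:- a) = mulTerm (ℤ.- ℤ.+ 1) [] (expand a)

    expand-correct : ∀ e ρ → ⟦ expand e ⟧ᵖ ρ ≡ ⟦ e ⟧ ρ
    expand-correct (var i) ρ = trans (+-identityʳ _) (trans (*-identityˡ _) (trans (*-comm _ _) (*-identityˡ _)))
    expand-correct (num n) ρ = trans (+-identityʳ _) (trans (*-comm _ _) (*-identityˡ _))
    expand-correct (a :+ b) ρ = trans (addᵖ-correct (expand a) (expand b) ρ) (cong₂ _+_ (expand-correct a ρ) (expand-correct b ρ))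
    expand-correct (a :* b) ρ = trans (mulᵖ-correct (expand a) (expand b) ρ) (cong₂ _*_ (expand-correct a ρ) (expand-correct b ρ))
    expand-correct (:- a) ρ = trans (mulTerm-correct (ℤ.- ℤ.+ 1) [] (expand a) ρ)
      (trans (cong₂ _*_ (trans (*-comm _ _) (trans (*-identityˡ _) (ι-neg (ℤ.+ 1)))) (expand-correct a ρ))
        (RingProperties.-1*x≈-x (CommutativeRing.ring commutativeRing) (⟦ a ⟧ ρ)))

    isZero : Poly → Bool
    isZero [] = true
    isZero ((ℤ.+ 0 , _) ∷ p) = isZero p
    isZero _ = false

    isZero-correct : ∀ p ρ → isZero p ≡ true → ⟦ p ⟧ᵖ ρ ≡ ι (ℤ.+ 0)
    isZero-correct [] ρ e = refl
    isZero-correct ((ℤ.+ zero , m) ∷ p) ρ e = trans (cong₂ _+_ (zeroˡ _) (isZero-correct p ρ e)) (+-identityˡ _)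

    Curried : Set → Set → ℕ → Set
    Curried A B zero = B
    Curried A B (suc n) = A → Curried A B n

    applyVars : ∀ n → ℕ → Curried Expr (Expr × Expr) n → Expr × Expr
    applyVars zero i e = e
    applyVars (suc n) i f = applyVars n (suc i) (f (var i))

    ∀ⁿ : ℕ → (List Carrier → Set) → Set
    ∀ⁿ zero P = P []
    ∀ⁿ (suc n) P = ∀ x → ∀ⁿ n (λ ρ → P (x ∷ ρ))

    curryⁿ : ∀ n {P} → (∀ ρ → P ρ) → ∀ⁿ n P
    curryⁿ zero h = h []
    curryⁿ (suc n) h x = curryⁿ n (λ ρ → h (x ∷ ρ))

  -- Vanishing is tested on the expanded difference of the two sides. Its coefficients are concrete
  -- integers, so the hypothesis can be proved by `refl`.
  solve : ∀ n (f : Curried Expr (Expr × Expr) n) → let e = applyVars n 0 f in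
          isZero (expand (proj₁ e :- proj₂ e)) ≡ true → ∀ⁿ n (λ ρ → ⟦ proj₁ e ⟧ ρ ≡ ⟦ proj₂ e ⟧ ρ)
  solve n f h = curryⁿ n (λ ρ → x∙y⁻¹≈ε⇒x≈y _ _
    (trans (sym (expand-correct (proj₁ e :- proj₂ e) ρ)) (isZero-correct (expand (proj₁ e :- proj₂ e)) ρ h)))
    where e = applyVars n 0 f

-- Inequalities, finite sums and products, floor division.

module Analysis where

  open Elementary
  open OrderedField 𝔽
  open RingSolver algebra

  infixl 6 _⊕_
  infixl 7 _⊗_

  _⊕_ : ∀ {x y} → # 0 ≤ x → # 0 ≤ y → # 0 ≤ x + y
  _⊕_ {x} {y} p q = subst (_≤ x + y) (solve 0 (num 0 :+ num 0 := num 0) refl) (+-mono-≤ p q)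

  _⊗_ : ∀ {x y} → # 0 ≤ x → # 0 ≤ y → # 0 ≤ x * y
  _⊗_ = *-nonneg

  nn : ∀ n → # 0 ≤ # n
  nn = #-nonneg

  ↑ : ∀ {x y} → x ≤ y → # 0 ≤ y - x
  ↑ {x} {y} p = subst (_≤ y - x) (solve 1 (λ a → a :- a := num 0) refl x) (+-mono-≤ p ≤-refl)

  -- The standard form of an inequality proof: `b - a` is written as a combination `e` of terms that
  -- are nonnegative for known reasons, and the solver checks the identity. Hypotheses enter through
  -- `↑`, equations through `eq*`, and `⊕` and `⊗` combine them.
  lin : ∀ {a b e} → # 0 ≤ e → b - a ≡ e → a ≤ b
  lin {a} {b} p q = subst₂ _≤_ (solve 1 (λ a → num 0 :+ a := a) refl a)
    (solve 2 (λ a b → b :- a :+ a := b) refl a b) (+-mono-≤ (subst (# 0 ≤_) (sym q) p) (≤-refl {a}))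

  ≡⇒≤ : ∀ {x y} → x ≡ y → x ≤ y
  ≡⇒≤ refl = ≤-refl

  -- An equation as an entry of such a certificate; as its difference is 0, the multiplier `c` may
  -- have either sign.
  eq* : ∀ c {x y} → x ≡ y → # 0 ≤ c * (y - x)
  eq* c {x} refl = ≡⇒≤ (solve 2 (λ c x → num 0 := c :* (x :- x)) refl c x)

  -- For certificates whose coefficients become integers after multiplication by `suc n`.
  lin/ : ∀ n {a b e} → # 0 ≤ e → # (suc n) * (b - a) ≡ e → a ≤ b
  lin/ n {a} {b} p q = lin (subst (# 0 ≤_) (sym q) p ⊗ inv-nonneg (suc n))
    (trans (trans (solve 1 (λ x → x := num 1 :* x) refl (b - a)) (cong (_* (b - a)) (sym (inv-suc n))))
      (solve 3 (λ n i x → n :* i :* x := n :* x :* i) refl (# (suc n)) (inv (suc n)) (b - a)))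

  #-mono : ∀ {m n} → m ℕ.≤ n → # m ≤ # n
  #-mono {m} {n} p = lin (nn (n ℕ.∸ m))
    (trans (cong (λ k → # k - # m) (sym (ℕ.m∸n+n≡m p))) (trans (cong (_- # m) (ι-+ (ℤ.+ (n ℕ.∸ m)) (ℤ.+ m)))
      (solve 2 (λ a b → a :+ b :- b := a) refl (# (n ℕ.∸ m)) (# m))))

  #-+ : ∀ m n → # (m ℕ.+ n) ≡ # m + # n
  #-+ m n = ι-+ (ℤ.+ m) (ℤ.+ n)

  #-suc : ∀ n → # (suc n) ≡ # n + # 1
  #-suc n = trans (cong # (ℕ.+-comm 1 n)) (#-+ n 1)

  #-* : ∀ m n → # (m ℕ.* n) ≡ # m * # n
  #-* m n = trans (cong ι (ℤ.pos-* m n)) (ι-* (ℤ.+ m) (ℤ.+ n))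

  #-cancel-≤ : ∀ {m n} → # m ≤ # n → m ℕ.≤ n
  #-cancel-≤ {m} {n} p with m ℕ.≤? n
  ... | yes q = q
  ... | no q = ⊥-elim (1≰0 (lin (↑ p ⊕ ↑ (#-mono (ℕ.≰⇒> q)) ⊕ eq* (- # 1) (#-suc n)) (solve 3 (λ a b c → num 0
        :- num 1 := a :- b :+ (b :- c) :+ :- (num 1) :* (a :+ num 1 :- c)) refl (# n) (# m) (# (suc n)))))

  #-injective : ∀ {m n} → # m ≡ # n → m ≡ n
  #-injective e = ℕ.≤-antisym (#-cancel-≤ (≡⇒≤ e)) (#-cancel-≤ (≡⇒≤ (sym e)))

  *-monoˡ : ∀ {x y} c → # 0 ≤ c → x ≤ y → c * x ≤ c * y
  *-monoˡ {x} {y} c p q = lin (↑ q ⊗ p) (solve 3 (λ a b c → a :* c :- a :* b := (c :- b) :* a) refl c x y)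

  *-mono : ∀ {x y u v} → # 0 ≤ x → # 0 ≤ v → x ≤ y → u ≤ v → x * u ≤ y * v
  *-mono {x} {y} {u} {v} a b p q = lin (↑ q ⊗ a ⊕ ↑ p ⊗ b) (solve 4 (λ a b c d → c :* d :- a :* b := (d :- b)
        :* a :+ (c :- a) :* d) refl x u y v)

  inv-inverse : ∀ {n} → 1 ℕ.≤ n → # n * inv n ≡ # 1
  inv-inverse {suc n} _ = inv-suc n

  inv-≤ : ∀ {m n} → 1 ℕ.≤ m → m ℕ.≤ n → inv n ≤ inv m
  inv-≤ {m} {n} p q =
    (lin (↑ (#-mono q) ⊗ (inv-nonneg m ⊗ inv-nonneg n) ⊕ eq* (- # 1 * (inv n)) (inv-inverse p) ⊕ eq* (# 1 *
          (inv m)) (inv-inverse (ℕ.≤-trans p q))) (solve 4 (λ a b c d → b :- a := (c :- d) :* (b :* a) :+ :-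
          (num 1) :* a :* (num 1 :- d :* b) :+ num 1 :* b :* (num 1 :- c :* a)) refl (inv n) (inv m) (# n) (#
          m)))

  inv-* : ∀ m n → inv (m ℕ.* n) ≡ inv m * inv n
  inv-* zero n = trans inv-zero (sym (trans (cong (_* inv n) inv-zero) (solve 1 (λ a → num 0 :* a := num 0)
        refl (inv n))))
  inv-* m@(suc _) zero = trans (cong inv (ℕ.*-zeroʳ m)) (trans inv-zero (sym (trans (cong (inv m *_) inv-zero) (solve
        1 (λ a → a :* num 0 := num 0) refl (inv m)))))
  inv-* (suc m) (suc n) = begin
      i                               ≡⟨ (solve 1 (λ a → a := a :* num 1 :* num 1) refl i) ⟩
      i * # 1 * # 1                   ≡⟨ cong₂ (λ x y → i * x * y) (sym (inv-suc m)) (sym (inv-suc n)) ⟩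
      i * (M * inv (suc m)) * (N * inv (suc n)) ≡⟨ (solve 5 (λ a b c d e → a :* (b :* c) :* (d :* e) := b :* d
            :* a :* (c :* e)) refl i M (inv (suc m)) N (inv (suc n))) ⟩
      M * N * i * (inv (suc m) * inv (suc n)) ≡⟨ cong (λ x → x * i * (inv (suc m) * inv (suc n))) (sym (#-* (suc m) (suc n))) ⟩
      # (suc m ℕ.* suc n) * i * (inv (suc m) * inv (suc n)) ≡⟨ cong (_* (inv (suc m) * inv (suc n))) (inv-suc (n ℕ.+ m ℕ.* suc n)) ⟩
      # 1 * (inv (suc m) * inv (suc n)) ≡⟨ (solve 2 (λ a b → num 1 :* (a :* b) := a :* b) refl (inv (suc m))
            (inv (suc n))) ⟩
      inv (suc m) * inv (suc n) ∎
    where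
    open ≡-Reasoning
    M = # (suc m)
    N = # (suc n)
    i = inv (suc m ℕ.* suc n)

  inv-1 : inv 1 ≡ # 1
  inv-1 = trans (solve 1 (λ a → a := num 1 :* a) refl (inv 1)) (inv-suc 0)

  inv-≤1 : ∀ n → inv n ≤ # 1
  inv-≤1 zero = subst (_≤ # 1) (sym inv-zero) (nn 1)
  inv-≤1 (suc n) = subst (inv (suc n) ≤_) inv-1 (inv-≤ (s≤s z≤n) (s≤s z≤n))

  -- Absolute values are only used through upper bounds.

  infix 4 ∣_∣≤_
  ∣_∣≤_ : F → F → Set
  ∣ x ∣≤ c = (x ≤ c) × (- x ≤ c)

  ∣∣-+ : ∀ {x y c d} → ∣ x ∣≤ c → ∣ y ∣≤ d → ∣ x + y ∣≤ c + d
  ∣∣-+ {x} {y} {c} {d} (p , q) (r , s) =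
    +-mono-≤ p r , (lin (↑ q ⊕ ↑ s) (solve 4 (λ a b c d → c :+ d :- :- (a :+ b) := c :- :- a :+ (d :- :- b))
          refl x y c d))

  ∣∣-neg : ∀ {x c} → ∣ x ∣≤ c → ∣ - x ∣≤ c
  ∣∣-neg {x} {c} (p , q) = q , (lin (↑ p) (solve 2 (λ a b → b :- :- (:- a) := b :- a) refl x c))

  -- No case distinction on signs: 2(cd - xy) = (c - x)(d + y) + (c + x)(d - y), and similarly for
  -- -xy.
  ∣∣-* : ∀ {x y c d} → ∣ x ∣≤ c → ∣ y ∣≤ d → ∣ x * y ∣≤ c * d
  ∣∣-* {x} {y} {c} {d} (p , q) (r , s) =
      (lin/ 1 (↑ p ⊗ ↑ s ⊕ ↑ q ⊗ ↑ r) (solve 4 (λ a b c d → num 2 :* (c :* d :- a :* b) := (c :- a) :* (d :- :-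
            b) :+ (c :- :- a) :* (d :- b)) refl x y c d))
    , (lin/ 1 (↑ p ⊗ ↑ r ⊕ ↑ q ⊗ ↑ s) (solve 4 (λ a b c d → num 2 :* (c :* d :- :- (a :* b)) := (c :- a) :* (d
          :- b) :+ (c :- :- a) :* (d :- :- b)) refl x y c d))

  ∣∣-weaken : ∀ {x c d} → c ≤ d → ∣ x ∣≤ c → ∣ x ∣≤ d
  ∣∣-weaken l (p , q) = ≤-trans p l , ≤-trans q l

  ∣∣-of-nonneg : ∀ {x} → # 0 ≤ x → ∣ x ∣≤ x
  ∣∣-of-nonneg {x} p = ≤-refl , (lin (nn 2 ⊗ (p)) (solve 1 (λ a → a :- :- a := num 2 :* a) refl x))

  ∣∣-zero : ∣ # 0 ∣≤ # 0
  ∣∣-zero = ≤-refl , (lin (nn 0) (solve 0 (num 0 :- :- (num 0) := num 0) refl))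

  ∑ : ℕ → (ℕ → F) → F
  ∑ zero f = # 0
  ∑ (suc n) f = ∑ n f + f (suc n)

  ∑-cong : ∀ n {f g} → (∀ i → 1 ℕ.≤ i → i ℕ.≤ n → f i ≡ g i) → ∑ n f ≡ ∑ n g
  ∑-cong zero h = refl
  ∑-cong (suc n) h = cong₂ _+_ (∑-cong n (λ i a b → h i a (ℕ.m≤n⇒m≤1+n b))) (h (suc n) (s≤s z≤n) ℕ.≤-refl)

  ∑-cong′ : ∀ n {f g} → (∀ i → f i ≡ g i) → ∑ n f ≡ ∑ n g
  ∑-cong′ n h = ∑-cong n (λ i _ _ → h i)

  ∑-mono : ∀ n {f g} → (∀ i → 1 ℕ.≤ i → i ℕ.≤ n → f i ≤ g i) → ∑ n f ≤ ∑ n g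
  ∑-mono zero h = ≤-refl
  ∑-mono (suc n) h = +-mono-≤ (∑-mono n (λ i a b → h i a (ℕ.m≤n⇒m≤1+n b))) (h (suc n) (s≤s z≤n) ℕ.≤-refl)

  ∑-zero : ∀ n → ∑ n (λ _ → # 0) ≡ # 0
  ∑-zero zero = refl
  ∑-zero (suc n) = trans (cong (_+ # 0) (∑-zero n)) (solve 0 (num 0 :+ num 0 := num 0) refl)

  ∑-zero′ : ∀ n {f} → (∀ i → 1 ℕ.≤ i → i ℕ.≤ n → f i ≡ # 0) → ∑ n f ≡ # 0
  ∑-zero′ n h = trans (∑-cong n h) (∑-zero n)

  ∑-+ : ∀ n f g → ∑ n (λ i → f i + g i) ≡ ∑ n f + ∑ n g
  ∑-+ zero f g = solve 0 (num 0 := num 0 :+ num 0) refl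
  ∑-+ (suc n) f g = trans (cong (_+ (f (suc n) + g (suc n))) (∑-+ n f g))
    (solve 4 (λ a b c d → a :+ b :+ (c :+ d) := a :+ c :+ (b :+ d)) refl (∑ n f) (∑ n g) (f (suc n)) (g (suc
          n)))

  ∑-*ˡ : ∀ n c f → ∑ n (λ i → c * f i) ≡ c * ∑ n f
  ∑-*ˡ zero c f = solve 1 (λ a → num 0 := a :* num 0) refl c
  ∑-*ˡ (suc n) c f = trans (cong (_+ c * f (suc n)) (∑-*ˡ n c f)) (solve 3 (λ a b c → a :* b :+ a :* c := a :*
        (b :+ c)) refl c (∑ n f) (f (suc n)))

  ∑-*ʳ : ∀ n c f → ∑ n (λ i → f i * c) ≡ ∑ n f * c
  ∑-*ʳ n c f = trans (∑-cong′ n (λ i → (solve 2 (λ a b → a :* b := b :* a) refl (f i) c))) (trans (∑-*ˡ n c f) (solve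
        2 (λ a b → a :* b := b :* a) refl c (∑ n f)))

  ∑-neg : ∀ n f → ∑ n (λ i → - f i) ≡ - ∑ n f
  ∑-neg n f = trans (∑-cong′ n (λ i → (solve 1 (λ a → :- a := :- (num 1) :* a) refl (f i)))) (trans (∑-*ˡ n (- # 1) f) (solve
        1 (λ a → :- (num 1) :* a := :- a) refl (∑ n f)))

  ∑-- : ∀ n f g → ∑ n (λ i → f i - g i) ≡ ∑ n f - ∑ n g
  ∑-- n f g = trans (∑-+ n f (λ i → - g i)) (cong (∑ n f +_) (∑-neg n g))

  ∑-const : ∀ n c → ∑ n (λ _ → c) ≡ # n * c
  ∑-const zero c = solve 1 (λ a → num 0 := num 0 :* a) refl c
  ∑-const (suc n) c = trans (cong (_+ c) (∑-const n c)) (trans (solve 2 (λ a b → a :* b :+ b := (a :+ num 1) :*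
        b) refl (# n) c) (cong (_* c) (sym (#-suc n))))

  ∑-swap : ∀ m n (f : ℕ → ℕ → F) → ∑ m (λ i → ∑ n (f i)) ≡ ∑ n (λ j → ∑ m (λ i → f i j))
  ∑-swap zero n f = sym (∑-zero n)
  ∑-swap (suc m) n f = trans (cong (_+ ∑ n (f (suc m))) (∑-swap m n f))
    (sym (∑-+ n (λ j → ∑ m (λ i → f i j)) (f (suc m))))

  ∑-split : ∀ m n f → ∑ (m ℕ.+ n) f ≡ ∑ m f + ∑ n (λ i → f (m ℕ.+ i))
  ∑-split m zero f = trans (cong (λ k → ∑ k f) (ℕ.+-identityʳ m)) (solve 1 (λ a → a := a :+ num 0) refl (∑ m
        f))
  ∑-split m (suc n) f = trans (cong (λ k → ∑ k f) (ℕ.+-suc m n)) (trans (cong₂ _+_ (∑-split m n f) (cong f (sym (ℕ.+-suc m n))))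
    (solve 3 (λ a b c → a :+ b :+ c := a :+ (b :+ c)) refl (∑ m f) (∑ n (λ i → f (m ℕ.+ i))) (f (m ℕ.+ suc n))))

  ∑-nonneg : ∀ n {f} → (∀ i → 1 ℕ.≤ i → i ℕ.≤ n → # 0 ≤ f i) → # 0 ≤ ∑ n f
  ∑-nonneg n {f} h = subst (_≤ ∑ n f) (∑-zero n) (∑-mono n h)

  ∑-mono-range : ∀ {m n} f → m ℕ.≤ n → (∀ i → m ℕ.< i → i ℕ.≤ n → # 0 ≤ f i) → ∑ m f ≤ ∑ n f
  ∑-mono-range {m} {n} f p h = subst (λ k → ∑ m f ≤ ∑ k f) (ℕ.m+[n∸m]≡n p)
    (lin (∑-nonneg (n ℕ.∸ m) {λ i → f (m ℕ.+ i)} (λ i a b → h (m ℕ.+ i) (ℕ.m<m+n m a)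
        (subst (m ℕ.+ i ℕ.≤_) (ℕ.m+[n∸m]≡n p) (ℕ.+-monoʳ-≤ m b))))
      (trans (cong (_- ∑ m f) (∑-split m (n ℕ.∸ m) f))
        (solve 2 (λ a b → a :+ b :- a := b) refl (∑ m f) (∑ (n ℕ.∸ m) (λ i → f (m ℕ.+ i))))))

  ∑-∣∣ : ∀ n {f g} → (∀ i → 1 ℕ.≤ i → i ℕ.≤ n → ∣ f i ∣≤ g i) → ∣ ∑ n f ∣≤ ∑ n g
  ∑-∣∣ zero h = ∣∣-zero
  ∑-∣∣ (suc n) h = ∣∣-+ (∑-∣∣ n (λ i a b → h i a (ℕ.m≤n⇒m≤1+n b))) (h (suc n) (s≤s z≤n) ℕ.≤-refl)

  ∑-telescope : ∀ n (f : ℕ → F) → ∑ n (λ i → f i - f (ℕ.pred i)) ≡ f n - f 0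
  ∑-telescope zero f = solve 1 (λ a → num 0 := a :- a) refl (f 0)
  ∑-telescope (suc n) f = trans (cong (_+ (f (suc n) - f n)) (∑-telescope n f))
    (solve 3 (λ a b c → a :- b :+ (c :- a) := c :- b) refl (f n) (f 0) (f (suc n)))

  𝟙 : ∀ {P : Set} → Dec P → F
  𝟙 (yes _) = # 1
  𝟙 (no _) = # 0

  𝟙-yes : ∀ {P : Set} (d : Dec P) → P → 𝟙 d ≡ # 1
  𝟙-yes (yes _) _ = refl
  𝟙-yes (no ¬p) p = ⊥-elim (¬p p)

  𝟙-no : ∀ {P : Set} (d : Dec P) → ¬ P → 𝟙 d ≡ # 0
  𝟙-no (yes p) ¬p = ⊥-elim (¬p p)
  𝟙-no (no _) _ = refl

  𝟙-cong : ∀ {P Q : Set} (d : Dec P) (e : Dec Q) → (P → Q) → (Q → P) → 𝟙 d ≡ 𝟙 e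
  𝟙-cong (yes p) e f g = sym (𝟙-yes e (f p))
  𝟙-cong (no ¬p) e f g = sym (𝟙-no e (λ q → ¬p (g q)))

  𝟙-nonneg : ∀ {P : Set} (d : Dec P) → # 0 ≤ 𝟙 d
  𝟙-nonneg (yes _) = nn 1
  𝟙-nonneg (no _) = ≤-refl

  𝟙-≤1 : ∀ {P : Set} (d : Dec P) → 𝟙 d ≤ # 1
  𝟙-≤1 (yes _) = ≤-refl
  𝟙-≤1 (no _) = nn 1

  -- Makes the fact `P`, such as primality of an index, available inside a sum over all indices.
  𝟙-guard : ∀ {P : Set} (d : Dec P) {x y} → (P → x ≡ y) → 𝟙 d * x ≡ 𝟙 d * y
  𝟙-guard (yes p) h = cong (# 1 *_) (h p)
  𝟙-guard (no _) {x} {y} h = solve 2 (λ a b → num 0 :* a := num 0 :* b) refl x y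

  𝟙-yes* : ∀ {P : Set} (d : Dec P) → P → ∀ x → 𝟙 d * x ≡ x
  𝟙-yes* d p x = trans (cong (_* x) (𝟙-yes d p)) (solve 1 (λ a → num 1 :* a := a) refl x)

  𝟙-no* : ∀ {P : Set} (d : Dec P) → ¬ P → ∀ x → 𝟙 d * x ≡ # 0
  𝟙-no* d p x = trans (cong (_* x) (𝟙-no d p)) (solve 1 (λ a → num 0 :* a := num 0) refl x)

  ∑-𝟙-outside : ∀ n k (f : ℕ → F) → n ℕ.< k → ∑ n (λ i → 𝟙 (i ℕ.≟ k) * f i) ≡ # 0
  ∑-𝟙-outside n k f p = ∑-zero′ n (λ i _ q → 𝟙-no* (i ℕ.≟ k) (λ e → ℕ.<⇒≱ p (subst (ℕ._≤ n) e q)) (f i))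

  ∑-𝟙 : ∀ n k (f : ℕ → F) → 1 ℕ.≤ k → k ℕ.≤ n → ∑ n (λ i → 𝟙 (i ℕ.≟ k) * f i) ≡ f k
  ∑-𝟙 zero k f a b = ⊥-elim (ℕ.<⇒≱ a b)
  ∑-𝟙 (suc n) k f a b with suc n ℕ.≟ k
  ... | yes refl = trans (cong (_+ # 1 * f (suc n)) (∑-𝟙-outside n (suc n) f ℕ.≤-refl)) (solve 1 (λ a → num 0
        :+ num 1 :* a := a) refl (f (suc n)))
  ... | no ne = trans (cong (_+ # 0 * f (suc n)) (∑-𝟙 n k f a (ℕ.≤-pred (ℕ.≤∧≢⇒< b (λ e → ne (sym e))))))
    (solve 2 (λ a b → a :+ num 0 :* b := a) refl (f k) (f (suc n)))

  ∑-truncate : ∀ {m n} f → m ℕ.≤ n → ∑ n (λ i → 𝟙 (i ℕ.≤? m) * f i) ≡ ∑ m f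
  ∑-truncate {m} {n} f p = begin
    ∑ n g ≡⟨ cong (λ k → ∑ k g) (sym (ℕ.m+[n∸m]≡n p)) ⟩
    ∑ (m ℕ.+ (n ℕ.∸ m)) g ≡⟨ ∑-split m (n ℕ.∸ m) g ⟩
    ∑ m g + ∑ (n ℕ.∸ m) (λ i → g (m ℕ.+ i)) ≡⟨ cong₂ _+_ (∑-cong m (λ i _ b → 𝟙-yes* (i ℕ.≤? m) b (f i)))
       (∑-zero′ (n ℕ.∸ m) (λ i a _ → 𝟙-no* (m ℕ.+ i ℕ.≤? m) (ℕ.<⇒≱ (ℕ.m<m+n m a)) (f (m ℕ.+ i)))) ⟩
    ∑ m f + # 0 ≡⟨ (solve 1 (λ a → a :+ num 0 := a) refl (∑ m f)) ⟩
    ∑ m f ∎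
    where
    open ≡-Reasoning
    g = λ i → 𝟙 (i ℕ.≤? m) * f i

  infixl 7 _÷_
  -- Total, so that it can stand under a sum over the divisor without a proof that the divisor is
  -- nonzero.
  _÷_ : ℕ → ℕ → ℕ
  x ÷ zero = 0
  x ÷ a@(suc _) = x ℕ./ a

  ÷-≤ : ∀ x a → x ÷ a ℕ.≤ x
  ÷-≤ x zero = z≤n
  ÷-≤ x a@(suc _) = ℕ.m/n≤m x a

  *-÷-≤ : ∀ x a → a ℕ.* (x ÷ a) ℕ.≤ x
  *-÷-≤ x zero = z≤n
  *-÷-≤ x a@(suc _) = subst (ℕ._≤ x) (ℕ.*-comm (x ℕ./ a) a) (ℕ.m/n*n≤m x a)

  ≤÷⇒*≤ : ∀ {x a b} → b ℕ.≤ x ÷ a → a ℕ.* b ℕ.≤ x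
  ≤÷⇒*≤ {x} {a} p = ℕ.≤-trans (ℕ.*-monoʳ-≤ a p) (*-÷-≤ x a)

  *≤⇒≤÷ : ∀ {x a b} → 1 ℕ.≤ a → a ℕ.* b ℕ.≤ x → b ℕ.≤ x ÷ a
  *≤⇒≤÷ {x} {a@(suc _)} {b} _ p = subst (ℕ._≤ x ℕ./ a) (ℕ.m*n/n≡m b a) (ℕ./-monoˡ-≤ a (subst (ℕ._≤ x) (ℕ.*-comm a b) p))

  <-*-suc÷ : ∀ x a → 1 ℕ.≤ a → x ℕ.< a ℕ.* suc (x ÷ a)
  <-*-suc÷ x a p = ℕ.≰⇒> (λ q → ℕ.<-irrefl refl (*≤⇒≤÷ p q))

  ÷-÷ : ∀ x a b → 1 ℕ.≤ a → 1 ℕ.≤ b → (x ÷ a) ÷ b ≡ x ÷ (a ℕ.* b)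
  ÷-÷ x a@(suc _) b@(suc _) _ _ = ℕ.m/n/o≡m/[n*o] x a b

  1≤÷ : ∀ {x a} → 1 ℕ.≤ a → a ℕ.≤ x → 1 ℕ.≤ x ÷ a
  1≤÷ {x} {a} p q = *≤⇒≤÷ p (subst (ℕ._≤ x) (sym (ℕ.*-identityʳ a)) q)

  ∑-÷ : ∀ x a f → 1 ℕ.≤ a → ∑ (x ÷ a) f ≡ ∑ x (λ b → 𝟙 (a ℕ.* b ℕ.≤? x) * f b)
  ∑-÷ x a f p = trans (sym (∑-truncate f (÷-≤ x a)))
    (∑-cong′ x (λ b → cong (_* f b) (𝟙-cong (b ℕ.≤? x ÷ a) (a ℕ.* b ℕ.≤? x) (≤÷⇒*≤ {x} {a}) (*≤⇒≤÷ p))))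

  -- Both sides run over the pairs with a b ≤ x.
  ∑-÷-swap : ∀ x (h : ℕ → ℕ → F) → ∑ x (λ a → ∑ (x ÷ a) (h a)) ≡ ∑ x (λ b → ∑ (x ÷ b) (λ a → h a b))
  ∑-÷-swap x h = begin
    ∑ x (λ a → ∑ (x ÷ a) (h a)) ≡⟨ ∑-cong x (λ a p _ → ∑-÷ x a (h a) p) ⟩
    ∑ x (λ a → ∑ x (λ b → 𝟙 (a ℕ.* b ℕ.≤? x) * h a b)) ≡⟨ ∑-swap x x _ ⟩
    ∑ x (λ b → ∑ x (λ a → 𝟙 (a ℕ.* b ℕ.≤? x) * h a b)) ≡⟨ ∑-cong′ x (λ b → ∑-cong′ x (λ a → cong (_* h a b)
       (𝟙-cong (a ℕ.* b ℕ.≤? x) (b ℕ.* a ℕ.≤? x) (subst (ℕ._≤ x) (ℕ.*-comm a b)) (subst (ℕ._≤ x) (ℕ.*-comm b a))))) ⟩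
    ∑ x (λ b → ∑ x (λ a → 𝟙 (b ℕ.* a ℕ.≤? x) * h a b)) ≡⟨ ∑-cong x (λ b p _ → sym (∑-÷ x b (λ a → h a b) p)) ⟩
    ∑ x (λ b → ∑ (x ÷ b) (λ a → h a b)) ∎
    where open ≡-Reasoning

  factor-pos : ∀ {a n} q → 1 ℕ.≤ n → n ≡ a ℕ.* q → 1 ℕ.≤ q
  factor-pos {a} zero p e = ⊥-elim (ℕ.<⇒≱ p (ℕ.≤-reflexive (trans e (ℕ.*-zeroʳ a))))
  factor-pos (suc q) p e = s≤s z≤n

  ∑-multiples : ∀ x a (f : ℕ → F) → 1 ℕ.≤ a → ∑ (x ÷ a) (λ b → f (a ℕ.* b)) ≡ ∑ x (λ n → 𝟙 (a ∣? n) * f n)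
  ∑-multiples x a f p = begin
    ∑ (x ÷ a) (λ b → f (a ℕ.* b)) ≡⟨ ∑-÷ x a _ p ⟩
    ∑ x (λ b → 𝟙 (a ℕ.* b ℕ.≤? x) * f (a ℕ.* b)) ≡⟨ ∑-cong x (λ b q _ → sym (pick b q)) ⟩
    ∑ x (λ b → ∑ x (λ n → 𝟙 (n ℕ.≟ a ℕ.* b) * f n)) ≡⟨ ∑-swap x x _ ⟩
    ∑ x (λ n → ∑ x (λ b → 𝟙 (n ℕ.≟ a ℕ.* b) * f n)) ≡⟨ ∑-cong x (λ n q r → trans (∑-*ʳ x (f n) _) (cong (_* f n) (count n q r))) ⟩
    ∑ x (λ n → 𝟙 (a ∣? n) * f n) ∎
    where
    open ≡-Reasoning
    pick : ∀ b → 1 ℕ.≤ b → ∑ x (λ n → 𝟙 (n ℕ.≟ a ℕ.* b) * f n) ≡ 𝟙 (a ℕ.* b ℕ.≤? x) * f (a ℕ.* b)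
    pick b q with a ℕ.* b ℕ.≤? x
    ... | yes r = trans (∑-𝟙 x (a ℕ.* b) f (ℕ.*-mono-≤ p q) r) (solve 1 (λ a → a := num 1 :* a) refl (f (a ℕ.*
          b)))
    ... | no r = trans (∑-𝟙-outside x (a ℕ.* b) f (ℕ.≰⇒> r)) (solve 1 (λ a → num 0 := num 0 :* a) refl (f (a
          ℕ.* b)))
    count : ∀ n → 1 ℕ.≤ n → n ℕ.≤ x → ∑ x (λ b → 𝟙 (n ℕ.≟ a ℕ.* b)) ≡ 𝟙 (a ∣? n)
    count n q r with a ∣? n
    ... | no ¬d = ∑-zero′ x (λ b _ _ → 𝟙-no (n ℕ.≟ a ℕ.* b) (λ e → ¬d (divides b (trans e (ℕ.*-comm a b)))))
    ... | yes (divides k e) = trans (∑-cong x (λ b _ _ → trans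
         (𝟙-cong (n ℕ.≟ a ℕ.* b) (b ℕ.≟ k)
           (λ e′ → ℕ.*-cancelˡ-≡ b k a {{ℕ.>-nonZero p}} (trans (sym e′) (trans e (ℕ.*-comm k a))))
           (λ e′ → trans e (trans (cong (ℕ._* a) (sym e′)) (ℕ.*-comm b a))))
         (solve 1 (λ a → a := a :* num 1) refl (𝟙 (b ℕ.≟ k)))))
       (∑-𝟙 x k (λ _ → # 1) kpos (ℕ.≤-trans (ℕ.m≤m*n k a {{ℕ.>-nonZero p}}) (subst (ℕ._≤ x) e r)))
       where
       kpos : 1 ℕ.≤ k
       kpos = factor-pos {a} k q (trans e (ℕ.*-comm k a))

  ∏ : ℕ → (ℕ → F) → F
  ∏ zero f = # 1
  ∏ (suc n) f = ∏ n f * f (suc n)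

  ∏-1 : ∀ n {f} → (∀ i → f i ≡ # 1) → ∏ n f ≡ # 1
  ∏-1 zero h = refl
  ∏-1 (suc n) h = trans (cong₂ _*_ (∏-1 n h) (h (suc n))) (solve 0 (num 1 :* num 1 := num 1) refl)

  ∏-cong : ∀ n {f g} → (∀ i → i ℕ.≤ n → f i ≡ g i) → ∏ n f ≡ ∏ n g
  ∏-cong zero h = refl
  ∏-cong (suc n) h = cong₂ _*_ (∏-cong n (λ i q → h i (ℕ.m≤n⇒m≤1+n q))) (h (suc n) ℕ.≤-refl)

  -- For the Möbius function: multiplying the argument by a prime changes a single local factor.
  ∏-change : ∀ n r c {f g} → 1 ℕ.≤ r → r ℕ.≤ n → (∀ i → i ≢ r → f i ≡ g i) → f r ≡ c * g r → ∏ n f ≡ c * ∏ n g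
  ∏-change zero r c a b h e = ⊥-elim (ℕ.<⇒≱ a b)
  ∏-change (suc n) r c {f} {g} a b h e with suc n ℕ.≟ r
  ... | yes refl = trans (cong₂ _*_ (∏-cong n (λ i q → h i (ℕ.<⇒≢ (s≤s q)))) e)
    (solve 3 (λ a b c → a :* (b :* c) := b :* (a :* c)) refl (∏ n g) c (g r))
  ... | no ne = trans (cong₂ _*_ (∏-change n r c a (ℕ.≤-pred (ℕ.≤∧≢⇒< b (λ q → ne (sym q)))) h e) (h (suc n) ne))
    (solve 3 (λ a b c → a :* b :* c := a :* (b :* c)) refl c (∏ n g) (g (suc n)))

  ∏-∣∣ : ∀ n {f} → (∀ i → ∣ f i ∣≤ # 1) → ∣ ∏ n f ∣≤ # 1
  ∏-∣∣ zero h = ≤-refl , (lin (nn 2) (solve 0 (num 1 :- :- (num 1) := num 2) refl))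
  ∏-∣∣ (suc n) h = ∣∣-weaken (lin (nn 0) (solve 0 (num 1 :- num 1 :* num 1 := num 0) refl)) (∣∣-* (∏-∣∣ n h) (h (suc n)))

  -- The arithmetic functions below are the classical ones for arguments up to B, with lam p in the role of log p.

  module Arithmetic (B : ℕ) (lam : ℕ → F) where

    -- For 1 ≤ n ≤ B and p prime this is the exponent of p in n, since p^B already exceeds n.
    vp : ℕ → ℕ → F
    vp p n = ∑ B (λ j → 𝟙 (p ℕ.^ j ∣? n))

    ℓ : ℕ → F
    ℓ n = ∑ B (λ p → 𝟙 (prime? p) * (lam p * vp p n))

    -- Von Mangoldt's function.
    Λ : ℕ → F
    Λ n = ∑ B (λ p → 𝟙 (prime? p) * (lam p * ∑ B (λ j → 𝟙 (n ℕ.≟ p ℕ.^ j))))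

    -- A factor of the Möbius function: 1 off the prime divisors of n, -1 at a simple one, 0 at a
    -- multiple one.
    local : ℕ → ℕ → F
    local n p = # 1 + 𝟙 (prime? p) * (𝟙 (p ℕ.* p ∣? n) - # 2 * 𝟙 (p ∣? n))

    μ : ℕ → F
    μ n = ∏ B (local n)

    ∑Λ : ∀ x (g : ℕ → F) → ∑ x (λ a → Λ a * g a) ≡
         ∑ B (λ p → 𝟙 (prime? p) * (lam p * ∑ B (λ j → ∑ x (λ a → 𝟙 (a ℕ.≟ p ℕ.^ j) * g a))))
    ∑Λ x g = begin
      ∑ x (λ a → Λ a * g a) ≡⟨ ∑-cong′ x (λ a → sym (∑-*ʳ B (g a) _)) ⟩
      ∑ x (λ a → ∑ B (λ p → 𝟙 (prime? p) * (lam p * ∑ B (λ j → 𝟙 (a ℕ.≟ p ℕ.^ j))) * g a)) ≡⟨ ∑-swap x B _ ⟩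
      ∑ B (λ p → ∑ x (λ a → 𝟙 (prime? p) * (lam p * ∑ B (λ j → 𝟙 (a ℕ.≟ p ℕ.^ j))) * g a)) ≡⟨ ∑-cong′ B inner ⟩
      ∑ B (λ p → 𝟙 (prime? p) * (lam p * ∑ B (λ j → ∑ x (λ a → 𝟙 (a ℕ.≟ p ℕ.^ j) * g a)))) ∎
      where
      open ≡-Reasoning
      inner : ∀ p → ∑ x (λ a → 𝟙 (prime? p) * (lam p * ∑ B (λ j → 𝟙 (a ℕ.≟ p ℕ.^ j))) * g a) ≡
              𝟙 (prime? p) * (lam p * ∑ B (λ j → ∑ x (λ a → 𝟙 (a ℕ.≟ p ℕ.^ j) * g a)))
      inner p = begin
        ∑ x (λ a → 𝟙 (prime? p) * (lam p * ∑ B (λ j → 𝟙 (a ℕ.≟ p ℕ.^ j))) * g a)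
          ≡⟨ ∑-cong′ x (λ a → (solve 4 (λ a b c d → a :* (b :* c) :* d := a :* b :* (c :* d)) refl (𝟙 (prime?
                p)) (lam p) (∑ B (λ j → 𝟙 (a ℕ.≟ p ℕ.^ j))) (g a))) ⟩
        ∑ x (λ a → 𝟙 (prime? p) * lam p * (∑ B (λ j → 𝟙 (a ℕ.≟ p ℕ.^ j)) * g a)) ≡⟨ ∑-*ˡ x (𝟙 (prime? p) * lam p) _ ⟩
        𝟙 (prime? p) * lam p * ∑ x (λ a → ∑ B (λ j → 𝟙 (a ℕ.≟ p ℕ.^ j)) * g a)
          ≡⟨ cong (𝟙 (prime? p) * lam p *_) (trans (∑-cong′ x (λ a → sym (∑-*ʳ B (g a) _))) (∑-swap x B _)) ⟩
        𝟙 (prime? p) * lam p * Z ≡⟨ (solve 3 (λ a b c → a :* b :* c := a :* (b :* c)) refl (𝟙 (prime? p)) (lam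
              p) Z) ⟩
        𝟙 (prime? p) * (lam p * Z) ∎
        where Z = ∑ B (λ j → ∑ x (λ a → 𝟙 (a ℕ.≟ p ℕ.^ j) * g a))

    -- A prime power p^j is counted on the left exactly when it divides n, as in `vp`. This is the
    -- identity Σ Λ(a) = log n over the divisors a of n.
    ∑∣Λ : ∀ {x n} → 1 ℕ.≤ n → n ℕ.≤ x → ∑ x (λ a → 𝟙 (a ∣? n) * Λ a) ≡ ℓ n
    ∑∣Λ {x} {n} 1≤n n≤x = trans (∑-cong′ x (λ a → (solve 2 (λ a b → a :* b := b :* a) refl (𝟙 (a ∣? n)) (Λ a)))) (trans (∑Λ x (λ a → 𝟙 (a ∣? n)))
      (∑-cong′ B (λ p → 𝟙-guard (prime? p) (λ pr → cong (lam p *_) (∑-cong′ B (pick p pr))))))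
      where
      pick : ∀ p → Prime p → ∀ j → ∑ x (λ a → 𝟙 (a ℕ.≟ p ℕ.^ j) * 𝟙 (a ∣? n)) ≡ 𝟙 (p ℕ.^ j ∣? n)
      pick p pr j with p ℕ.^ j ℕ.≤? x
      ... | yes q = ∑-𝟙 x (p ℕ.^ j) (λ a → 𝟙 (a ∣? n)) (ℕ.m^n>0 p {{prime⇒nonZero pr}} j) q
      ... | no q = trans (∑-𝟙-outside x (p ℕ.^ j) (λ a → 𝟙 (a ∣? n)) (ℕ.≰⇒> q))
        (sym (𝟙-no (p ℕ.^ j ∣? n) (λ d → q (ℕ.≤-trans (∣⇒≤ {{ℕ.>-nonZero 1≤n}} d) n≤x))))

    -- For p = r the count shifts by one index: the exponent 0 enters and the exponent B leaves, and
    -- the latter contributed 0 because p^B > B ≥ m.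
    vp-* : ∀ {p r m} → Prime p → Prime r → 1 ℕ.≤ m → m ℕ.≤ B → vp p (r ℕ.* m) ≡ vp p m + 𝟙 (p ℕ.≟ r)
    vp-* {p} {r} {m} pp pr 1≤m m≤B with p ℕ.≟ r
    ... | no ne = trans (∑-cong′ B (λ j → 𝟙-cong (p ℕ.^ j ∣? r ℕ.* m) (p ℕ.^ j ∣? m)
        (coprime-divisor (coprime-^ˡ j (prime∤⇒coprime pp (λ d → ne (prime∣prime⇒≡ pp pr d))))) (∣n⇒∣m*n r)))
        (solve 1 (λ a → a := a :+ num 0) refl (vp p m))
    ... | yes refl = trans (∑-cong B (λ { (suc j) _ _ → 𝟙-cong (p ℕ.^ suc j ∣? p ℕ.* m) (p ℕ.^ j ∣? m)
          (*-cancelˡ-∣ p {{prime⇒nonZero pp}}) (*-monoʳ-∣ p) })) (shift B (ℕ.≤-trans 1≤m m≤B) big)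
      where
      big : ¬ p ℕ.^ B ∣ m
      big d = ℕ.<⇒≱ (n<p^n B (prime⇒2≤ pp)) (ℕ.≤-trans (∣⇒≤ {{ℕ.>-nonZero 1≤m}} d) m≤B)
      partial : ∀ b → ∑ (suc b) (λ j → 𝟙 (p ℕ.^ ℕ.pred j ∣? m)) ≡ ∑ b (λ j → 𝟙 (p ℕ.^ j ∣? m)) + # 1
      partial zero = cong (# 0 +_) (𝟙-yes (1 ∣? m) (divides m (sym (ℕ.*-identityʳ m))))
      partial (suc b) = trans (cong (_+ 𝟙 (p ℕ.^ suc b ∣? m)) (partial b))
        (solve 2 (λ a b → a :+ num 1 :+ b := a :+ b :+ num 1) refl (∑ b (λ j → 𝟙 (p ℕ.^ j ∣? m))) (𝟙 (p ℕ.^ suc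
              b ∣? m)))
      shift : ∀ b → 1 ℕ.≤ b → ¬ p ℕ.^ b ∣ m → ∑ b (λ j → 𝟙 (p ℕ.^ ℕ.pred j ∣? m)) ≡ ∑ b (λ j → 𝟙 (p ℕ.^ j ∣? m)) + # 1
      shift (suc b) _ ¬d = trans (partial b) (cong (_+ # 1) (trans (solve 1 (λ a → a := a :+ num 0) refl (∑ b
            (λ j → 𝟙 (p ℕ.^ j ∣? m))))
        (cong (∑ b (λ j → 𝟙 (p ℕ.^ j ∣? m)) +_) (sym (𝟙-no (p ℕ.^ suc b ∣? m) ¬d)))))

    ℓ-prime-* : ∀ {r m} → Prime r → 1 ℕ.≤ m → r ℕ.* m ℕ.≤ B → ℓ (r ℕ.* m) ≡ lam r + ℓ m
    ℓ-prime-* {r} {m} pr 1≤m rm≤B = begin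
      ℓ (r ℕ.* m) ≡⟨ ∑-cong′ B (λ p → trans (𝟙-guard (prime? p) (λ pp → cong (lam p *_) (vp-* pp pr 1≤m m≤B)))
          (solve 4 (λ a b c d → a :* (b :* (c :+ d)) := d :* (a :* b) :+ a :* (b :* c)) refl (𝟙 (prime? p))
                (lam p) (vp p m) (𝟙 (p ℕ.≟ r)))) ⟩
      ∑ B (λ p → 𝟙 (p ℕ.≟ r) * (𝟙 (prime? p) * lam p) + 𝟙 (prime? p) * (lam p * vp p m)) ≡⟨ ∑-+ B _ _ ⟩
      ∑ B (λ p → 𝟙 (p ℕ.≟ r) * (𝟙 (prime? p) * lam p)) + ℓ m ≡⟨ cong (_+ ℓ m) (∑-𝟙 B r _ (prime⇒1≤ pr) r≤B) ⟩
      𝟙 (prime? r) * lam r + ℓ m ≡⟨ cong (_+ ℓ m) (𝟙-yes* (prime? r) pr (lam r)) ⟩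
      lam r + ℓ m ∎
      where
      open ≡-Reasoning
      m≤B : m ℕ.≤ B
      m≤B = ℕ.≤-trans (ℕ.m≤n*m m r {{prime⇒nonZero pr}}) rm≤B
      r≤B : r ℕ.≤ B
      r≤B = ℕ.≤-trans (ℕ.m≤m*n r m {{ℕ.>-nonZero 1≤m}}) rm≤B

    prime^≢1 : ∀ {p} j → Prime p → 1 ℕ.≤ j → p ℕ.^ j ≢ 1
    prime^≢1 {p} j pp q e = ℕ.<⇒≱ (ℕ.≤-<-trans q (n<p^n j (prime⇒2≤ pp))) (ℕ.≤-reflexive e)

    ℓ-1 : ℓ 1 ≡ # 0
    ℓ-1 = ∑-zero′ B (λ p _ _ → trans (𝟙-guard (prime? p) {y = # 0} (λ pp → trans (cong (lam p *_)
        (∑-zero′ B (λ j q _ → 𝟙-no (p ℕ.^ j ∣? 1) (λ d → prime^≢1 j pp q (∣1⇒≡1 d))))) (solve 1 (λ a → a :* num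
              0 := num 0) refl (lam p))))
      (solve 1 (λ a → a :* num 0 := num 0) refl (𝟙 (prime? p))))

    Λ-1 : Λ 1 ≡ # 0
    Λ-1 = ∑-zero′ B (λ p _ _ → trans (𝟙-guard (prime? p) {y = # 0} (λ pp → trans (cong (lam p *_)
        (∑-zero′ B (λ j q _ → 𝟙-no (1 ℕ.≟ p ℕ.^ j) (λ d → prime^≢1 j pp q (sym d))))) (solve 1 (λ a → a :* num
              0 := num 0) refl (lam p))))
      (solve 1 (λ a → a :* num 0 := num 0) refl (𝟙 (prime? p))))

    ℓ-* : ∀ {a b} → 1 ℕ.≤ a → 1 ℕ.≤ b → a ℕ.* b ℕ.≤ B → ℓ (a ℕ.* b) ≡ ℓ a + ℓ b
    ℓ-* {a} {b} 1≤a 1≤b = prime-induction (λ a → a ℕ.* b ℕ.≤ B → ℓ (a ℕ.* b) ≡ ℓ a + ℓ b) base step a 1≤a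
      where
      base : 1 ℕ.* b ℕ.≤ B → ℓ (1 ℕ.* b) ≡ ℓ 1 + ℓ b
      base _ = trans (cong ℓ (ℕ.*-identityˡ b)) (trans (solve 1 (λ a → a := num 0 :+ a) refl (ℓ b)) (cong (_+ ℓ b) (sym ℓ-1)))
      step : ∀ p m → Prime p → 1 ℕ.≤ m → (m ℕ.* b ℕ.≤ B → ℓ (m ℕ.* b) ≡ ℓ m + ℓ b) →
             p ℕ.* m ℕ.* b ℕ.≤ B → ℓ (p ℕ.* m ℕ.* b) ≡ ℓ (p ℕ.* m) + ℓ b
      step p m pp 1≤m ih le = begin
        ℓ (p ℕ.* m ℕ.* b) ≡⟨ cong ℓ (ℕ.*-assoc p m b) ⟩
        ℓ (p ℕ.* (m ℕ.* b)) ≡⟨ ℓ-prime-* pp (ℕ.*-mono-≤ 1≤m 1≤b) le′ ⟩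
        lam p + ℓ (m ℕ.* b) ≡⟨ cong (lam p +_) (ih (ℕ.≤-trans (ℕ.m≤n*m (m ℕ.* b) p {{prime⇒nonZero pp}}) le′)) ⟩
        lam p + (ℓ m + ℓ b) ≡⟨ (solve 3 (λ a b c → a :+ (b :+ c) := a :+ b :+ c) refl (lam p) (ℓ m) (ℓ b)) ⟩
        lam p + ℓ m + ℓ b ≡⟨ cong (_+ ℓ b) (sym (ℓ-prime-* pp 1≤m (ℕ.≤-trans (ℕ.m≤m*n (p ℕ.* m) b {{ℕ.>-nonZero 1≤b}}) le))) ⟩
        ℓ (p ℕ.* m) + ℓ b ∎
        where
        open ≡-Reasoning
        le′ : p ℕ.* (m ℕ.* b) ℕ.≤ B
        le′ = subst (ℕ._≤ B) (ℕ.*-assoc p m b) le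

    Λ-nonneg : (∀ p → # 0 ≤ lam p) → ∀ n → # 0 ≤ Λ n
    Λ-nonneg h n = ∑-nonneg B (λ p _ _ → 𝟙-nonneg (prime? p) ⊗ (h p ⊗ ∑-nonneg B (λ j _ _ → 𝟙-nonneg (n ℕ.≟ p ℕ.^ j))))

    local-∣∣ : ∀ n p → ∣ local n p ∣≤ # 1
    local-∣∣ n p with prime? p
    ... | no _ = (lin (nn 0) (solve 2 (λ a b → num 1 :- (num 1 :+ num 0 :* (a :- num 2 :* b)) := num 0) refl (𝟙
          (p ℕ.* p ∣? n)) (𝟙 (p ∣? n)))) , (lin (nn 2) (solve 2 (λ a b → num 1 :- :- (num 1 :+ num 0 :* (a :-
          num 2 :* b)) := num 2) refl (𝟙 (p ℕ.* p ∣? n)) (𝟙 (p ∣? n))))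
    ... | yes _ with p ℕ.* p ∣? n | p ∣? n
    ... | yes _ | yes _ = (lin (nn 1) (solve 0 (num 1 :- (num 1 :+ num 1 :* (num 1 :- num 2 :* num 1)) := num
          1) refl)) , (lin (nn 1) (solve 0 (num 1 :- :- (num 1 :+ num 1 :* (num 1 :- num 2 :* num 1)) := num 1)
          refl))
    ... | no _ | yes _ = (lin (nn 2) (solve 0 (num 1 :- (num 1 :+ num 1 :* (num 0 :- num 2 :* num 1)) := num 2)
          refl)) , (lin (nn 0) (solve 0 (num 1 :- :- (num 1 :+ num 1 :* (num 0 :- num 2 :* num 1)) := num 0)
          refl))
    ... | no _ | no _ = (lin (nn 0) (solve 0 (num 1 :- (num 1 :+ num 1 :* (num 0 :- num 2 :* num 0)) := num 0)
          refl)) , (lin (nn 2) (solve 0 (num 1 :- :- (num 1 :+ num 1 :* (num 0 :- num 2 :* num 0)) := num 2)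
          refl))
    ... | yes d | no ¬d = ⊥-elim (¬d (∣-trans (m∣m*n p) d))

    μ-∣∣ : ∀ n → ∣ μ n ∣≤ # 1
    μ-∣∣ n = ∏-∣∣ B (local-∣∣ n)

    μ-1 : μ 1 ≡ # 1
    μ-1 = ∏-1 B loc
      where
      loc : ∀ p → local 1 p ≡ # 1
      loc p with prime? p
      ... | no _ = solve 2 (λ a b → num 1 :+ num 0 :* (a :- num 2 :* b) := num 1) refl (𝟙 (p ℕ.* p ∣? 1)) (𝟙 (p
            ∣? 1))
      ... | yes pp = trans (cong₂ (λ u v → # 1 + # 1 * (u - # 2 * v))
          (𝟙-no (p ℕ.* p ∣? 1) (λ d → bad (∣-trans (m∣m*n p) d))) (𝟙-no (p ∣? 1) bad)) (solve 0 (num 1 :+ num 1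
                :* (num 0 :- num 2 :* num 0) := num 1) refl)
        where
        bad : ¬ p ∣ 1
        bad d = ℕ.<⇒≱ (prime⇒2≤ pp) (∣⇒≤ d)

    -- Only the factor at r changes: its sign flips if r does not divide e, and it becomes 0 if r
    -- divides e.
    μ-prime-* : ∀ {r e} → Prime r → r ℕ.≤ B → μ (r ℕ.* e) ≡ - (# 1 - 𝟙 (r ∣? e)) * μ e
    μ-prime-* {r} {e} pr r≤B = ∏-change B r (- (# 1 - 𝟙 (r ∣? e))) (prime⇒1≤ pr) r≤B other same
      where
      other : ∀ p → p ≢ r → local (r ℕ.* e) p ≡ local e p
      other p ne = cong (# 1 +_) (𝟙-guard (prime? p) (λ pp → cong₂ (λ u v → u - # 2 * v)
        (𝟙-cong (p ℕ.* p ∣? r ℕ.* e) (p ℕ.* p ∣? e) (coprime-divisor (coprime-*ˡ {p} {p} (cop pp) (cop pp))) (∣n⇒∣m*n r))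
        (𝟙-cong (p ∣? r ℕ.* e) (p ∣? e) (coprime-divisor (cop pp)) (∣n⇒∣m*n r))))
        where
        cop : Prime p → Coprime p r
        cop pp = prime∤⇒coprime pp (λ d → ne (prime∣prime⇒≡ pp pr d))
      same : local (r ℕ.* e) r ≡ - (# 1 - 𝟙 (r ∣? e)) * local e r
      same rewrite 𝟙-yes (prime? r) pr | 𝟙-yes (r ∣? r ℕ.* e) (m∣m*n e)
        | 𝟙-cong (r ℕ.* r ∣? r ℕ.* e) (r ∣? e) (*-cancelˡ-∣ r {{prime⇒nonZero pr}}) (*-monoʳ-∣ r) with r ∣? e
      ... | yes _ = solve 1 (λ a → num 1 :+ num 1 :* (num 1 :- num 2 :* num 1) := :- (num 1 :- num 1) :* (num 1
            :+ num 1 :* (a :- num 2 :* num 1))) refl (𝟙 (r ℕ.* r ∣? e))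
      ... | no ¬d = trans (solve 0 (num 1 :+ num 1 :* (num 0 :- num 2 :* num 1) := :- (num 1 :- num 0) :* (num
            1 :+ num 1 :* (num 0 :- num 2 :* num 0))) refl)
        (cong (λ u → - (# 1 - # 0) * (# 1 + # 1 * (u - # 2 * # 0))) (sym (𝟙-no (r ℕ.* r ∣? e) (λ d → ¬d (∣-trans (m∣m*n r) d)))))

    -- For n > 1 fix a prime r dividing n. The divisors r e with r not dividing e cancel the
    -- divisors e prime to r, and the divisors with r² have μ = 0.
    ∑∣μ : ∀ {x n} → 1 ℕ.≤ n → n ℕ.≤ x → n ℕ.≤ B → ∑ x (λ a → 𝟙 (a ∣? n) * μ a) ≡ 𝟙 (n ℕ.≟ 1)
    ∑∣μ {x} {suc zero} 1≤n n≤x _ = trans (∑-cong′ x (λ a → cong (_* μ a) (𝟙-cong (a ∣? 1) (a ℕ.≟ 1) ∣1⇒≡1 (λ { refl → ∣-refl }))))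
      (trans (∑-𝟙 x 1 μ ℕ.≤-refl n≤x) μ-1)
    ∑∣μ {x} {n@(suc (suc _))} 1≤n n≤x n≤B with prime-factor n (s≤s (s≤s z≤n))
    ... | r , pr , r∣n = begin
      ∑ x (λ a → 𝟙 (a ∣? n) * μ a)
        ≡⟨ ∑-cong′ x (λ a → (solve 3 (λ a b c → a :* b := c :* (a :* b) :+ (num 1 :- c) :* a :* b) refl (𝟙 (a
              ∣? n)) (μ a) (𝟙 (r ∣? a)))) ⟩
      ∑ x (λ a → 𝟙 (r ∣? a) * (𝟙 (a ∣? n) * μ a) + (# 1 - 𝟙 (r ∣? a)) * 𝟙 (a ∣? n) * μ a) ≡⟨ ∑-+ x _ _ ⟩
      ∑ x (λ a → 𝟙 (r ∣? a) * (𝟙 (a ∣? n) * μ a)) + Z ≡⟨ cong (_+ Z) (sym (∑-multiples x r (λ a → 𝟙 (a ∣? n) * μ a) (prime⇒1≤ pr))) ⟩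
      ∑ (x ÷ r) (λ e → 𝟙 (r ℕ.* e ∣? n) * μ (r ℕ.* e)) + Z ≡⟨ cong (_+ Z) (∑-÷ x r _ (prime⇒1≤ pr)) ⟩
      ∑ x (λ e → 𝟙 (r ℕ.* e ℕ.≤? x) * (𝟙 (r ℕ.* e ∣? n) * μ (r ℕ.* e))) + Z ≡⟨ cong (_+ Z) (∑-cong′ x term) ⟩
      ∑ x (λ e → - ((# 1 - 𝟙 (r ∣? e)) * 𝟙 (e ∣? n) * μ e)) + Z ≡⟨ cong (_+ Z) (∑-neg x _) ⟩
      - Z + Z ≡⟨ (solve 1 (λ a → :- a :+ a := num 0) refl Z) ⟩
      # 0 ∎
      where
      open ≡-Reasoning
      Z = ∑ x (λ a → (# 1 - 𝟙 (r ∣? a)) * 𝟙 (a ∣? n) * μ a)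
      r≤B : r ℕ.≤ B
      r≤B = ℕ.≤-trans (∣⇒≤ r∣n) n≤B
      term : ∀ e → 𝟙 (r ℕ.* e ℕ.≤? x) * (𝟙 (r ℕ.* e ∣? n) * μ (r ℕ.* e)) ≡ - ((# 1 - 𝟙 (r ∣? e)) * 𝟙 (e ∣? n) * μ e)
      term e rewrite μ-prime-* {r} {e} pr r≤B with r ∣? e
      ... | yes _ = solve 4 (λ a b c d → a :* (b :* (:- (num 1 :- num 1) :* c)) := :- ((num 1 :- num 1) :* d :*
            c)) refl (𝟙 (r ℕ.* e ℕ.≤? x)) (𝟙 (r ℕ.* e ∣? n)) (μ e) (𝟙 (e ∣? n))
      ... | no ¬d with e ∣? n
      ... | yes e∣n = trans (cong₂ (λ u v → u * (v * (- (# 1 - # 0) * μ e)))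
          (𝟙-yes (r ℕ.* e ℕ.≤? x) (ℕ.≤-trans (∣⇒≤ re∣n) n≤x)) (𝟙-yes (r ℕ.* e ∣? n) re∣n))
          (solve 1 (λ a → num 1 :* (num 1 :* (:- (num 1 :- num 0) :* a)) := :- ((num 1 :- num 0) :* num 1 :*
                a)) refl (μ e))
        where
        re∣n : r ℕ.* e ∣ n
        re∣n = coprime-*-∣ (prime∤⇒coprime pr ¬d) r∣n e∣n
      ... | no e∤n = trans (cong (λ v → 𝟙 (r ℕ.* e ℕ.≤? x) * (v * (- (# 1 - # 0) * μ e))) (𝟙-no (r ℕ.* e ∣? n) (λ d → e∤n (∣-trans (n∣m*n r) d))))
          (solve 2 (λ a b → a :* (num 0 :* (:- (num 1 :- num 0) :* b)) := :- ((num 1 :- num 0) :* num 0 :* b))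
                refl (𝟙 (r ℕ.* e ℕ.≤? x)) (μ e))

    -- The pairs are grouped by n = a b, and `∑∣Λ` evaluates each group.
    Λ-hyperbola : ∀ {x} (f : ℕ → F) → ∑ x (λ a → Λ a * ∑ (x ÷ a) (λ b → f (a ℕ.* b))) ≡ ∑ x (λ n → f n * ℓ n)
    Λ-hyperbola {x} f = begin
      ∑ x (λ a → Λ a * ∑ (x ÷ a) (λ b → f (a ℕ.* b)))
        ≡⟨ ∑-cong x (λ a p _ → trans (cong (Λ a *_) (∑-multiples x a f p)) (sym (∑-*ˡ x (Λ a) _))) ⟩
      ∑ x (λ a → ∑ x (λ n → Λ a * (𝟙 (a ∣? n) * f n))) ≡⟨ ∑-swap x x _ ⟩
      ∑ x (λ n → ∑ x (λ a → Λ a * (𝟙 (a ∣? n) * f n))) ≡⟨ ∑-cong x (λ n p q → trans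
         (∑-cong′ x (λ a → (solve 3 (λ a b c → a :* (b :* c) := c :* (b :* a)) refl (Λ a) (𝟙 (a ∣? n)) (f n)))) (trans (∑-*ˡ x (f n) _) (cong (f n *_) (∑∣Λ p q)))) ⟩
      ∑ x (λ n → f n * ℓ n) ∎
      where open ≡-Reasoning

    -- Möbius inversion: after grouping by n = a b only n = 1 survives.
    μ-hyperbola : ∀ {x} (f : ℕ → F) → 1 ℕ.≤ x → x ℕ.≤ B → ∑ x (λ a → μ a * ∑ (x ÷ a) (λ b → f (a ℕ.* b))) ≡ f 1
    μ-hyperbola {x} f 1≤x x≤B = begin
      ∑ x (λ a → μ a * ∑ (x ÷ a) (λ b → f (a ℕ.* b)))
        ≡⟨ ∑-cong x (λ a p _ → trans (cong (μ a *_) (∑-multiples x a f p)) (sym (∑-*ˡ x (μ a) _))) ⟩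
      ∑ x (λ a → ∑ x (λ n → μ a * (𝟙 (a ∣? n) * f n))) ≡⟨ ∑-swap x x _ ⟩
      ∑ x (λ n → ∑ x (λ a → μ a * (𝟙 (a ∣? n) * f n))) ≡⟨ ∑-cong x (λ n p q → trans
         (∑-cong′ x (λ a → (solve 3 (λ a b c → a :* (b :* c) := c :* (b :* a)) refl (μ a) (𝟙 (a ∣? n)) (f n)))) (trans (∑-*ˡ x (f n) _)
           (trans (cong (f n *_) (∑∣μ p q (ℕ.≤-trans q x≤B))) (solve 2 (λ a b → a :* b := b :* a) refl (f n) (𝟙
                 (n ℕ.≟ 1)))))) ⟩
      ∑ x (λ n → 𝟙 (n ℕ.≟ 1) * f n) ≡⟨ ∑-𝟙 x 1 f ℕ.≤-refl 1≤x ⟩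
      f 1 ∎
      where open ≡-Reasoning

  -- Harmonic sums as logarithms.

  #*-cancelˡ : ∀ {n u v} → 1 ℕ.≤ n → # n * u ≤ # n * v → u ≤ v
  #*-cancelˡ {n} {u} {v} p q = lin (↑ q ⊗ (inv-nonneg n) ⊕ eq* (# 1 * (v - u)) (inv-inverse p)) (solve 4 (λ a b
        c d → b :- a := (c :* b :- c :* a) :* d :+ num 1 :* (b :- a) :* (num 1 :- c :* d)) refl u v (# n) (inv
        n))

  H : ℕ → F
  H n = ∑ n inv

  -- The block consists of b terms, each at least 1/(b(i+1)).
  H-block-lower : ∀ b i → 1 ℕ.≤ b → inv (suc i) ≤ H (b ℕ.* suc i) - H (b ℕ.* i)
  H-block-lower b i 1≤b = lin (↑ le) (trans (cong (λ z → z - H (b ℕ.* i) - inv (suc i)) (trans (cong H (trans (ℕ.*-suc b i) (ℕ.+-comm b _))) (∑-split (b ℕ.* i) b inv)))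
      (solve 3 (λ a b c → a :+ b :- a :- c := b :- c) refl (H (b ℕ.* i)) T (inv (suc i))))
    where
    T = ∑ b (λ t → inv (b ℕ.* i ℕ.+ t))
    low : ∑ b (λ _ → inv (b ℕ.* suc i)) ≤ T
    low = ∑-mono b (λ t p q → inv-≤ (ℕ.≤-trans p (ℕ.m≤n+m t (b ℕ.* i)))
      (subst (b ℕ.* i ℕ.+ t ℕ.≤_) (trans (ℕ.+-comm _ b) (sym (ℕ.*-suc b i))) (ℕ.+-monoʳ-≤ (b ℕ.* i) q)))
    le : inv (suc i) ≤ T
    le = subst (_≤ T) (trans (∑-const b _) (trans (cong (# b *_) (inv-* b (suc i)))
      (trans (solve 3 (λ a b c → a :* (b :* c) := a :* b :* c) refl (# b) (inv b) (inv (suc i))) (trans (cong (_* inv (suc i)) (inv-inverse 1≤b)) (solve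
            1 (λ a → num 1 :* a := a) refl (inv (suc i))))))) low

  H-block-upper : ∀ b i → 1 ℕ.≤ b → 1 ℕ.≤ i → H (b ℕ.* suc i) - H (b ℕ.* i) ≤ inv i
  H-block-upper b i 1≤b 1≤i = lin (↑ le) (trans (cong (λ z → inv i - (z - H (b ℕ.* i))) (trans (cong H (trans (ℕ.*-suc b i) (ℕ.+-comm b _))) (∑-split (b ℕ.* i) b inv)))
      (solve 3 (λ a b c → a :- (b :+ c :- b) := a :- c) refl (inv i) (H (b ℕ.* i)) T))
    where
    T = ∑ b (λ t → inv (b ℕ.* i ℕ.+ t))
    up : T ≤ ∑ b (λ _ → inv (b ℕ.* i))
    up = ∑-mono b (λ t p q → inv-≤ (ℕ.*-mono-≤ 1≤b 1≤i) (ℕ.m≤m+n (b ℕ.* i) t))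
    le : T ≤ inv i
    le = subst (T ≤_) (trans (∑-const b _) (trans (cong (# b *_) (inv-* b i))
      (trans (solve 3 (λ a b c → a :* (b :* c) := a :* b :* c) refl (# b) (inv b) (inv i)) (trans (cong (_* inv i) (inv-inverse 1≤b)) (solve
            1 (λ a → num 1 :* a := a) refl (inv i)))))) up

  excess : ℕ → ℕ → F
  excess b i = H (b ℕ.* i) - H i

  -- From i to i + 1, H(b i) gains between 1/(i+1) and 1/i while H(i) gains 1/(i+1). So `excess`
  -- increases, and `excess` plus 1/i decreases.
  excess-bounds : ∀ b i t → 1 ℕ.≤ b → 1 ℕ.≤ i →
    (excess b i ≤ excess b (t ℕ.+ i)) × (excess b (t ℕ.+ i) + inv (t ℕ.+ i) ≤ excess b i + inv i)
  excess-bounds b i zero 1≤b 1≤i = ≤-refl , ≤-refl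
  excess-bounds b i (suc t) 1≤b 1≤i with excess-bounds b i t 1≤b 1≤i
  ... | p , q =
      (lin (↑ p ⊕ ↑ (H-block-lower b k 1≤b)) (solve 6 (λ a b c d e f → c :- (d :+ e) :- (a :- b) := f :- d :-
            (a :- b) :+ (c :- f :- e)) refl (H (b ℕ.* i)) (H i) (H (b ℕ.* suc k)) (H k) (inv (suc k)) (H (b ℕ.*
            k))))
    , (lin (↑ q ⊕ ↑ (H-block-upper b k 1≤b (ℕ.≤-trans 1≤i (ℕ.m≤n+m i t)))) (solve 8 (λ a b c d e f g h → d :- e
          :+ f :- (a :- (b :+ c) :+ c) := d :- e :+ f :- (g :- b :+ h) :+ (h :- (a :- g))) refl (H (b ℕ.* suc
          k)) (H k) (inv (suc k)) (H (b ℕ.* i)) (H i) (inv i) (H (b ℕ.* k)) (inv k)))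
    where k = t ℕ.+ i

  -- lg K n = 1/(K+1) + ⋯ + 1/(Kn) is within 1/K of being completely additive.

  lg : ℕ → ℕ → F
  lg K n = H (K ℕ.* n) - H K

  -- The defect lg(ab) - lg a - lg b is the change of `excess b` from K to K a, which
  -- `excess-bounds` places between 0 and 1/K.
  lg-* : ∀ {K a b} → 1 ℕ.≤ K → 1 ℕ.≤ a → 1 ℕ.≤ b →
    (lg K a + lg K b ≤ lg K (a ℕ.* b)) × (lg K (a ℕ.* b) ≤ lg K a + lg K b + inv K)
  lg-* {K} {a} {b} 1≤K 1≤a 1≤b =
      (lin (↑ (proj₁ bnd) ⊕ eq* (- # 1) e₁ ⊕ eq* (# 1) e₂) (solve 6 (λ a b c d e f → d :- b :- (a :- b :+ (c :-
            b)) := e :- a :- (f :- b) :+ :- (num 1) :* (c :- f) :+ num 1 :* (d :- e)) refl (H (K ℕ.* a)) (H K)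
            (H (K ℕ.* b)) (H (K ℕ.* (a ℕ.* b))) (H (b ℕ.* (K ℕ.* a))) (H (b ℕ.* K))))
    , (lin (↑ (proj₂ bnd) ⊕ (inv-nonneg (K ℕ.* a)) ⊕ eq* (# 1) e₁ ⊕ eq* (- # 1) e₂) (solve 8 (λ a b c d e f g h
          → c :- b :+ (d :- b) :+ e :- (a :- b) := f :- b :+ e :- (g :- c :+ h) :+ h :+ num 1 :* (d :- f) :+ :-
          (num 1) :* (a :- g)) refl (H (K ℕ.* (a ℕ.* b))) (H K) (H (K ℕ.* a)) (H (K ℕ.* b)) (inv K) (H (b ℕ.*
          K)) (H (b ℕ.* (K ℕ.* a))) (inv (K ℕ.* a))))
    where
    e₁ : H (b ℕ.* K) ≡ H (K ℕ.* b)
    e₁ = cong H (ℕ.*-comm b K)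
    e₂ : H (b ℕ.* (K ℕ.* a)) ≡ H (K ℕ.* (a ℕ.* b))
    e₂ = cong H (trans (ℕ.*-comm b (K ℕ.* a)) (ℕ.*-assoc K a b))
    bnd : (excess b K ≤ excess b (K ℕ.* a)) × (excess b (K ℕ.* a) + inv (K ℕ.* a) ≤ excess b K + inv K)
    bnd = subst (λ z → (excess b K ≤ excess b z) × (excess b z + inv z ≤ excess b K + inv K))
      (ℕ.m∸n+n≡m (ℕ.m≤m*n K a {{ℕ.>-nonZero 1≤a}})) (excess-bounds b K (K ℕ.* a ℕ.∸ K) 1≤b 1≤K)

  H-mono : ∀ {m n} → m ℕ.≤ n → H m ≤ H n
  H-mono p = ∑-mono-range inv p (λ i _ _ → inv-nonneg i)

  even-or-odd : ∀ n → (∃ λ k → n ≡ k ℕ.+ k) ⊎ (∃ λ k → n ≡ suc (k ℕ.+ k))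
  even-or-odd zero = inj₁ (0 , refl)
  even-or-odd (suc n) with even-or-odd n
  ... | inj₁ (k , e) = inj₂ (k , cong suc e)
  ... | inj₂ (k , e) = inj₁ (suc k , trans (cong suc e) (cong suc (sym (ℕ.+-suc k k))))

  -- A completely additive logarithm up to B, with the bounds of Chebyshev and Mertens.

  module Log (B : ℕ) where

    -- So large that the accumulated error n/scale in `ℓ-lg` is at most half of 1/n, the size of a
    -- step of the logarithm; see `tiny`.
    scale : ℕ
    scale = 2 ℕ.* suc B ℕ.* suc B

    lam : ℕ → F
    lam zero = # 0
    lam p@(suc _) = lg scale p

    open Arithmetic B lam public

    lam-nonneg : ∀ p → # 0 ≤ lam p
    lam-nonneg zero = nn 0
    lam-nonneg p@(suc _) = ↑ (H-mono (ℕ.m≤m*n scale p))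

    lam-lg : ∀ {p} → 1 ℕ.≤ p → lam p ≡ lg scale p
    lam-lg {suc p} _ = refl

    tiny : ∀ {n} → 1 ℕ.≤ n → n ℕ.≤ B → # 2 * (# n * inv scale) ≤ inv n
    tiny {n} 1≤n n≤B =
      (lin (↑ scale-large ⊗ (inv-nonneg n ⊗ inv-nonneg scale) ⊕ eq* (- # 2 * (# n * inv scale)) (inv-inverse
            1≤n) ⊕ eq* (# 1 * (inv n)) (inv-suc _)) (solve 4 (λ a b c d → c :- num 2 :* (a :* b) := (d :- num 2
            :* a :* a) :* (c :* b) :+ :- (num 2) :* (a :* b) :* (num 1 :- a :* c) :+ num 1 :* c :* (num 1 :- d
            :* b)) refl (# n) (inv scale) (inv n) (# scale)))
      where
      scale-large : # 2 * # n * # n ≤ # scale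
      scale-large = subst (_≤ # scale) (trans (#-* (2 ℕ.* n) n) (cong (_* # n) (#-* 2 n)))
        (#-mono (ℕ.*-mono-≤ (ℕ.*-monoʳ-≤ 2 (ℕ.m≤n⇒m≤1+n n≤B)) (ℕ.m≤n⇒m≤1+n n≤B)))

    lg-1 : lg scale 1 ≡ # 0
    lg-1 = trans (cong (λ z → H z - H scale) (ℕ.*-identityʳ scale)) (solve 1 (λ a → a :- a := num 0) refl (H
          scale))

    -- Each prime factor costs at most 1/scale, and n/scale has room for it because p m ≥ m + 1.
    ℓ-lg : ∀ n → 1 ℕ.≤ n → n ℕ.≤ B → (ℓ n ≤ lg scale n) × (lg scale n ≤ ℓ n + # n * inv scale)
    ℓ-lg = prime-induction _ base step
      where
      base : 1 ℕ.≤ B → (ℓ 1 ≤ lg scale 1) × (lg scale 1 ≤ ℓ 1 + # 1 * inv scale)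
      base _ = ≡⇒≤ (trans ℓ-1 (sym lg-1)) ,
        (lin (eq* (- # 1) ℓ-1 ⊕ eq* (# 1) lg-1 ⊕ (inv-nonneg scale)) (solve 3 (λ a b c → b :+ num 1 :* c :- a
              := :- (num 1) :* (num 0 :- b) :+ num 1 :* (num 0 :- a) :+ c) refl (lg scale 1) (ℓ 1) (inv scale)))
      step : ∀ p m → Prime p → 1 ℕ.≤ m → (m ℕ.≤ B → (ℓ m ≤ lg scale m) × (lg scale m ≤ ℓ m + # m * inv scale)) →
             p ℕ.* m ℕ.≤ B → (ℓ (p ℕ.* m) ≤ lg scale (p ℕ.* m)) × (lg scale (p ℕ.* m) ≤ ℓ (p ℕ.* m) + # (p ℕ.* m) * inv scale)
      step p m pp 1≤m ih le =
          (lin (eq* (# 1) e ⊕ ↑ (proj₁ hyp) ⊕ ↑ (proj₁ add)) (solve 5 (λ a b c d e → b :- a := num 1 :* (c :+ d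
                :- a) :+ (e :- d) :+ (b :- (c :+ e))) refl (ℓ (p ℕ.* m)) (lg scale (p ℕ.* m)) (lg scale p) (ℓ m)
                (lg scale m)))
        , (lin (eq* (- # 1) e ⊕ ↑ (proj₂ hyp) ⊕ ↑ (proj₂ add) ⊕ ↑ big ⊗ (inv-nonneg scale)) (solve 8 (λ a b c d
              e f g h → b :+ c :* d :- a := :- (num 1) :* (e :+ f :- b) :+ (f :+ g :* d :- h) :+ (e :+ h :+ d :-
              a) :+ (c :- (g :+ num 1)) :* d) refl (lg scale (p ℕ.* m)) (ℓ (p ℕ.* m)) (# (p ℕ.* m)) (inv scale)
              (lg scale p) (ℓ m) (# m) (lg scale m)))
        where
        hyp : (ℓ m ≤ lg scale m) × (lg scale m ≤ ℓ m + # m * inv scale)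
        hyp = ih (ℕ.≤-trans (ℕ.m≤n*m m p {{ℕ.>-nonZero (prime⇒1≤ pp)}}) le)
        add : (lg scale p + lg scale m ≤ lg scale (p ℕ.* m)) × (lg scale (p ℕ.* m) ≤ lg scale p + lg scale m + inv scale)
        add = lg-* {scale} {p} {m} (s≤s z≤n) (prime⇒1≤ pp) 1≤m
        e : ℓ (p ℕ.* m) ≡ lg scale p + ℓ m
        e = trans (ℓ-prime-* pp 1≤m le) (cong (_+ ℓ m) (lam-lg (prime⇒1≤ pp)))
        big : # m + # 1 ≤ # (p ℕ.* m)
        big = subst (_≤ # (p ℕ.* m)) (#-+ m 1) (#-mono (ℕ.≤-trans (ℕ.+-monoʳ-≤ m 1≤m)
          (ℕ.≤-trans (ℕ.≤-reflexive (cong (m ℕ.+_) (sym (ℕ.+-identityʳ m)))) (ℕ.*-monoˡ-≤ m (prime⇒2≤ pp)))))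

    -- The factorisations of n and n + 1 are unrelated, but both values are close to `lg`, whose
    -- step is at least 1/(n+1); the errors take at most half of that.
    ℓ-step-lower : ∀ {n} → 1 ℕ.≤ n → suc n ℕ.≤ B → inv (suc n) ≤ # 2 * (ℓ (suc n) - ℓ n)
    ℓ-step-lower {n} 1≤n n<B =
      (lin (nn 2 ⊗ (↑ (proj₂ (ℓ-lg (suc n) (s≤s z≤n) n<B))) ⊕ nn 2 ⊗ (↑ (proj₁ (ℓ-lg n 1≤n (ℕ.<⇒≤ n<B)))) ⊕ nn
            2 ⊗ (↑ (H-block-lower scale n (s≤s z≤n))) ⊕ ↑ (tiny {suc n} (s≤s z≤n) n<B)) (solve 8 (λ a b c d e f
            g h → num 2 :* (b :- c) :- a := num 2 :* (b :+ d :* e :- (f :- g)) :+ num 2 :* (h :- g :- c) :+ num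
            2 :* (f :- h :- a) :+ (a :- num 2 :* (d :* e))) refl (inv (suc n)) (ℓ (suc n)) (ℓ n) (# (suc n))
            (inv scale) (H (scale ℕ.* suc n)) (H scale) (H (scale ℕ.* n))))

    ℓ-step-upper : ∀ {n} → 1 ℕ.≤ n → suc n ℕ.≤ B → ℓ (suc n) - ℓ n ≤ # 2 * inv n
    ℓ-step-upper {n} 1≤n n<B =
      (lin/ 1 (nn 2 ⊗ (↑ (proj₁ (ℓ-lg (suc n) (s≤s z≤n) n<B))) ⊕ nn 2 ⊗ (↑ (proj₂ (ℓ-lg n 1≤n (ℕ.<⇒≤ n<B)))) ⊕
            nn 2 ⊗ (↑ (H-block-upper scale n (s≤s z≤n) 1≤n)) ⊕ ↑ (tiny {n} 1≤n (ℕ.<⇒≤ n<B)) ⊕ (inv-nonneg n))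
            (solve 8 (λ a b c d e f g h → num 2 :* (num 2 :* c :- (a :- b)) := num 2 :* (d :- e :- a) :+ num 2
            :* (b :+ f :* g :- (h :- e)) :+ num 2 :* (c :- (d :- h)) :+ (c :- num 2 :* (f :* g)) :+ c) refl (ℓ
            (suc n)) (ℓ n) (inv n) (H (scale ℕ.* suc n)) (H scale) (# n) (inv scale) (H (scale ℕ.* n))))

    ℓ-mono-+ : ∀ {m} k → 1 ℕ.≤ m → k ℕ.+ m ℕ.≤ B → ℓ m ≤ ℓ (k ℕ.+ m)
    ℓ-mono-+ zero 1≤m le = ≤-refl
    ℓ-mono-+ {m} (suc k) 1≤m le =
      (lin/ 1 (nn 2 ⊗ (↑ (ℓ-mono-+ {m} k 1≤m (ℕ.<⇒≤ le))) ⊕ ↑ (ℓ-step-lower (ℕ.≤-trans 1≤m (ℕ.m≤n+m m k)) le) ⊕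
            (inv-nonneg (suc k ℕ.+ m))) (solve 4 (λ a b c d → num 2 :* (b :- a) := num 2 :* (c :- a) :+ (num 2
            :* (b :- c) :- d) :+ d) refl (ℓ m) (ℓ (suc k ℕ.+ m)) (ℓ (k ℕ.+ m)) (inv (suc k ℕ.+ m))))

    ℓ-mono : ∀ {m n} → 1 ℕ.≤ m → m ℕ.≤ n → n ℕ.≤ B → ℓ m ≤ ℓ n
    ℓ-mono {m} {n} 1≤m m≤n n≤B = subst (λ z → ℓ m ≤ ℓ z) (ℕ.m∸n+n≡m m≤n)
      (ℓ-mono-+ (n ℕ.∸ m) 1≤m (subst (ℕ._≤ B) (sym (ℕ.m∸n+n≡m m≤n)) n≤B))

    ℓ-nonneg : ∀ {n} → 1 ℕ.≤ n → n ℕ.≤ B → # 0 ≤ ℓ n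
    ℓ-nonneg {n} 1≤n n≤B = subst (_≤ ℓ n) ℓ-1 (ℓ-mono ℕ.≤-refl 1≤n n≤B)

    ℓ-2 : 2 ℕ.≤ B → ℓ 2 ≤ # 2
    ℓ-2 2≤B = lin (↑ (ℓ-step-upper {1} ℕ.≤-refl 2≤B) ⊕ eq* (# 1) ℓ-1 ⊕ eq* (# 2) inv-1) (solve 3 (λ a b c → num
          2 :- a := num 2 :* b :- (a :- c) :+ num 1 :* (num 0 :- c) :+ num 2 :* (num 1 :- b)) refl (ℓ 2) (inv 1)
          (ℓ 1))

    H-≤-ℓ : ∀ {n} → 1 ℕ.≤ n → n ℕ.≤ B → H n ≤ # 1 + # 2 * ℓ n
    H-≤-ℓ {suc zero} _ _ = lin (eq* (# 1) inv-1 ⊕ eq* (- # 2) ℓ-1) (solve 2 (λ a b → num 1 :+ num 2 :* b :-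
          (num 0 :+ a) := num 1 :* (num 1 :- a) :+ :- (num 2) :* (num 0 :- b)) refl (inv 1) (ℓ 1))
    H-≤-ℓ {suc n@(suc _)} _ le = lin (↑ (H-≤-ℓ {n} (s≤s z≤n) (ℕ.<⇒≤ le)) ⊕ ↑ (ℓ-step-lower {n} (s≤s z≤n) le))
          (solve 4 (λ a b c d → num 1 :+ num 2 :* c :- (a :+ b) := num 1 :+ num 2 :* d :- a :+ (num 2 :* (c :-
          d) :- b)) refl (H n) (inv (suc n)) (ℓ (suc n)) (ℓ n))

    Λ≥0 : ∀ n → # 0 ≤ Λ n
    Λ≥0 = Λ-nonneg lam-nonneg

    -- Chebyshev's bound comes from comparing log (2y)! with 2 log y!.

    ψ : ℕ → F
    ψ x = ∑ x Λ

    -- Legendre's formula for log x!.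
    ∑ℓ : ∀ x → ∑ x ℓ ≡ ∑ x (λ a → Λ a * # (x ÷ a))
    ∑ℓ x = trans (∑-cong′ x (λ n → (solve 1 (λ a → a := num 1 :* a) refl (ℓ n)))) (trans (sym (Λ-hyperbola {x} (λ _ → # 1)))
      (∑-cong′ x (λ a → cong (Λ a *_) (trans (∑-const (x ÷ a) (# 1)) (solve 1 (λ a → a :* num 1 := a) refl (#
            (x ÷ a)))))))

    -- Both ℓ(2y+1) and ℓ(2y+2) are at most ℓ(2) + ℓ(y+1), and ℓ(2) ≤ 2.
    ∑ℓ-double : ∀ y → y ℕ.+ y ℕ.≤ B → ∑ (y ℕ.+ y) ℓ ≤ # 2 * ∑ y ℓ + # 4 * # y
    ∑ℓ-double zero _ = lin (nn 0) (solve 0 (num 2 :* num 0 :+ num 4 :* num 0 :- num 0 := num 0) refl)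
    ∑ℓ-double (suc y) le rewrite ℕ.+-suc y y =
      (lin (↑ (∑ℓ-double y (ℕ.<⇒≤ (ℕ.<⇒≤ le))) ⊕ ↑ (ℓ-mono (s≤s z≤n) (ℕ.n≤1+n _) le) ⊕ eq* (# 2) even ⊕ nn 2 ⊗
            (↑ (ℓ-2 (ℕ.≤-trans (s≤s (s≤s z≤n)) le))) ⊕ eq* (- # 4) (#-suc y)) (solve 8 (λ a b c d e f g h → num
            2 :* (d :+ e) :+ num 4 :* f :- (a :+ b :+ c) := num 2 :* d :+ num 4 :* g :- a :+ (c :- b) :+ num 2
            :* (h :+ e :- c) :+ num 2 :* (num 2 :- h) :+ :- (num 4) :* (g :+ num 1 :- f)) refl (∑ (y ℕ.+ y) ℓ)
            (ℓ (suc (y ℕ.+ y))) (ℓ (suc (suc (y ℕ.+ y)))) (∑ y ℓ) (ℓ (suc y)) (# (suc y)) (# y) (ℓ 2)))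
      where
      e : suc (suc (y ℕ.+ y)) ≡ 2 ℕ.* suc y
      e = cong suc (trans (sym (ℕ.+-suc y y)) (cong (y ℕ.+_) (cong suc (sym (ℕ.+-identityʳ y)))))
      even : ℓ (suc (suc (y ℕ.+ y))) ≡ ℓ 2 + ℓ (suc y)
      even = trans (cong ℓ e) (ℓ-* (s≤s z≤n) (s≤s z≤n) (subst (ℕ._≤ B) e le))

    -- In log (2y)! - 2 log y! = Σ Λ(a)(⌊2y/a⌋ - 2⌊y/a⌋) all coefficients are nonnegative, and they
    -- are at least 1 for y < a ≤ 2y.
    ψ-double : ∀ y → y ℕ.+ y ℕ.≤ B → ψ (y ℕ.+ y) ≤ ψ y + # 4 * # y
    ψ-double y le = lin (↑ (∑ℓ-double y le) ⊕ eq* (- # 1) (∑ℓ (y ℕ.+ y)) ⊕ eq* (- # 1) (∑-split y y (λ a → Λ a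
          * # ((y ℕ.+ y) ÷ a))) ⊕ ↑ small ⊕ ↑ large ⊕ eq* (# 1) (∑-split y y Λ)) (solve 9 (λ a b c d e f g h i →
          b :+ num 4 :* c :- a := num 2 :* d :+ num 4 :* c :- e :+ :- (num 1) :* (f :- e) :+ :- (num 1) :* (g :+
          h :- f) :+ (g :- num 2 :* d) :+ (h :- i) :+ num 1 :* (b :+ i :- a)) refl (ψ (y ℕ.+ y)) (ψ y) (# y) (∑
          y ℓ) (∑ (y ℕ.+ y) ℓ) (∑ (y ℕ.+ y) (λ a → Λ a * # ((y ℕ.+ y) ÷ a))) (∑ y (λ a → Λ a * # ((y ℕ.+ y) ÷
          a))) (∑ y (λ i → Λ (y ℕ.+ i) * # ((y ℕ.+ y) ÷ (y ℕ.+ i)))) (∑ y (λ i → Λ (y ℕ.+ i))))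
      where
      small : # 2 * ∑ y ℓ ≤ ∑ y (λ a → Λ a * # ((y ℕ.+ y) ÷ a))
      small = subst (_≤ ∑ y (λ a → Λ a * # ((y ℕ.+ y) ÷ a))) (trans (∑-*ˡ y (# 2) _) (cong (# 2 *_) (sym (∑ℓ y))))
        (∑-mono y (λ a p q → (lin (↑ (two a p) ⊗ (Λ≥0 a)) (solve 3 (λ a b c → a :* c :- num 2 :* (a :* b) := (c
              :- (b :+ b)) :* a) refl (Λ a) (# (y ÷ a)) (# ((y ℕ.+ y) ÷ a))))))
        where
        two : ∀ a → 1 ℕ.≤ a → # (y ÷ a) + # (y ÷ a) ≤ # ((y ℕ.+ y) ÷ a)
        two a p = subst (_≤ # ((y ℕ.+ y) ÷ a)) (#-+ (y ÷ a) (y ÷ a)) (#-mono (*≤⇒≤÷ p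
          (ℕ.≤-trans (ℕ.≤-reflexive (ℕ.*-distribˡ-+ a (y ÷ a) (y ÷ a))) (ℕ.+-mono-≤ (*-÷-≤ y a) (*-÷-≤ y a)))))
      large : ∑ y (λ i → Λ (y ℕ.+ i)) ≤ ∑ y (λ i → Λ (y ℕ.+ i) * # ((y ℕ.+ y) ÷ (y ℕ.+ i)))
      large = ∑-mono y (λ i p q → (lin (↑ (#-mono (1≤÷ (ℕ.≤-trans p (ℕ.m≤n+m i y)) (ℕ.+-monoʳ-≤ y q))) ⊗ (Λ≥0
            (y ℕ.+ i))) (solve 2 (λ a b → a :* b :- a := (b :- num 1) :* a) refl (Λ (y ℕ.+ i)) (# ((y ℕ.+ y) ÷
            (y ℕ.+ i))))))

    ψ-mono : ∀ {m n} → m ℕ.≤ n → ψ m ≤ ψ n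
    ψ-mono p = ∑-mono-range Λ p (λ i _ _ → Λ≥0 i)

    -- Repeated halving by `ψ-double`. An odd x is first rounded up to x + 1, whence the hypothesis
    -- on `suc x`.
    ψ-≤ : ∀ x → suc x ℕ.≤ B → ψ x ≤ # 8 * # x
    ψ-≤ = <-rec _ go
      where
      go : ∀ x → (∀ {y} → y ℕ.< x → suc y ℕ.≤ B → ψ y ≤ # 8 * # y) → suc x ℕ.≤ B → ψ x ≤ # 8 * # x
      go x ih le with even-or-odd x
      ... | inj₁ (zero , refl) = lin (nn 0) (solve 0 (num 8 :* num 0 :- num 0 := num 0) refl)
      ... | inj₁ (y@(suc _) , refl) = lin (↑ (ψ-double y (ℕ.<⇒≤ le)) ⊕ ↑ (ih {y} (ℕ.m<m+n y (s≤s z≤n))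
            (ℕ.≤-trans (s≤s (ℕ.m≤m+n y y)) le)) ⊕ eq* (- # 8) (#-+ y y) ⊕ nn 4 ⊗ ((nn y))) (solve 4 (λ a b c d →
            num 8 :* b :- a := c :+ num 4 :* d :- a :+ (num 8 :* d :- c) :+ :- (num 8) :* (d :+ d :- b) :+ num 4
            :* d) refl (ψ (y ℕ.+ y)) (# (y ℕ.+ y)) (ψ y) (# y))
      ... | inj₂ (zero , refl) = lin (eq* (# 1) Λ-1 ⊕ nn 8) (solve 1 (λ a → num 8 :* num 1 :- (num 0 :+ a) :=
            num 1 :* (num 0 :- a) :+ num 8) refl (Λ 1))
      ... | inj₂ (y@(suc _) , refl) = lin (↑ (ψ-mono (s≤s (ℕ.+-monoʳ-≤ y (ℕ.n≤1+n y)))) ⊕ ↑ (ψ-double (suc y)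
            (subst (ℕ._≤ B) (cong suc (sym (ℕ.+-suc y y))) le)) ⊕ ↑ (ih {suc y} (s≤s (ℕ.m<m+n y (s≤s z≤n)))
            (ℕ.≤-trans (s≤s (s≤s (ℕ.m≤m+n y y))) le)) ⊕ eq* (- # 8) (#-suc (y ℕ.+ y)) ⊕ eq* (- # 8) (#-+ y y) ⊕
            eq* (# 12) (#-suc y) ⊕ nn 4 ⊗ (↑ (#-mono {1} {y} (s≤s z≤n)))) (solve 7 (λ a b c d e f g → num 8 :* b
            :- a := c :- a :+ (d :+ num 4 :* e :- c) :+ (num 8 :* e :- d) :+ :- (num 8) :* (f :+ num 1 :- b) :+
            :- (num 8) :* (g :+ g :- f) :+ num 12 :* (g :+ num 1 :- e) :+ num 4 :* (g :- num 1)) refl (ψ (suc (y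
            ℕ.+ y))) (# (suc (y ℕ.+ y))) (ψ (suc y ℕ.+ suc y)) (ψ (suc y)) (# (suc y)) (# (y ℕ.+ y)) (# y))

    ∑ℓ-lower : ∀ x → x ℕ.≤ B → # x * ℓ x - # 2 * # x ≤ ∑ x ℓ
    ∑ℓ-lower zero _ = lin (nn 0) (solve 1 (λ a → num 0 :- (num 0 :* a :- num 2 :* num 0) := num 0) refl (ℓ 0))
    ∑ℓ-lower (suc zero) _ = lin (nn 2) (solve 1 (λ a → num 0 :+ a :- (num 1 :* a :- num 2 :* num 1) := num 2)
          refl (ℓ 1))
    ∑ℓ-lower (suc x@(suc _)) le = lin (↑ (∑ℓ-lower x (ℕ.<⇒≤ le)) ⊕ ↑ (ℓ-step-upper (s≤s z≤n) le) ⊗ (nn x) ⊕ eq*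
          (# 2) (inv-suc _) ⊕ eq* (# 1 * (ℓ (suc x))) (#-suc x) ⊕ eq* (- # 2) (#-suc x)) (solve 6 (λ a b c d e f
          → c :+ b :- (a :* b :- num 2 :* a) := c :- (d :* e :- num 2 :* d) :+ (num 2 :* f :- (b :- e)) :* d :+
          num 2 :* (num 1 :- d :* f) :+ num 1 :* b :* (d :+ num 1 :- a) :+ :- (num 2) :* (d :+ num 1 :- a)) refl
          (# (suc x)) (ℓ (suc x)) (∑ x ℓ) (# x) (ℓ x) (inv x))

    ∑ℓ-upper : ∀ x → x ℕ.≤ B → ∑ x ℓ ≤ # x * ℓ x
    ∑ℓ-upper x le = subst (∑ x ℓ ≤_) (∑-const x (ℓ x)) (∑-mono x (λ i p q → ℓ-mono p q le))

    Λ/ : ℕ → F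
    Λ/ a = Λ a * inv a

    Λ/≥0 : ∀ n → # 0 ≤ Λ/ n
    Λ/≥0 n = Λ≥0 n ⊗ inv-nonneg n

    -- x Σ Λ(a)/a exceeds log x! = Σ Λ(a)⌊x/a⌋ by at most ψ(x) ≤ 8x, and log x! lies between x log x
    -- - 2x and x log x.
    mertens : ∀ x → 1 ℕ.≤ x → suc x ℕ.≤ B → ∣ ∑ x Λ/ - ℓ x ∣≤ # 8
    mertens x 1≤x le = #*-cancelˡ 1≤x
        (lin (↑ up ⊕ eq* (- # 1) (∑ℓ x) ⊕ ↑ (ψ-≤ x le) ⊕ ↑ (∑ℓ-upper x (ℕ.<⇒≤ le))) (solve 6 (λ a b c d e f → a
              :* num 8 :- a :* (b :- c) := d :+ e :- a :* b :+ :- (num 1) :* (d :- f) :+ (num 8 :* a :- e) :+ (a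
              :* c :- f)) refl (# x) (∑ x Λ/) (ℓ x) (∑ x (λ a → Λ a * # (x ÷ a))) (ψ x) (∑ x ℓ)))
      , #*-cancelˡ 1≤x
        (lin (↑ low ⊕ eq* (# 1) (∑ℓ x) ⊕ ↑ (∑ℓ-lower x (ℕ.<⇒≤ le)) ⊕ nn 6 ⊗ ((nn x))) (solve 5 (λ a b c d e → a
              :* num 8 :- a :* :- (b :- c) := a :* b :- d :+ num 1 :* (d :- e) :+ (e :- (a :* c :- num 2 :* a))
              :+ num 6 :* a) refl (# x) (∑ x Λ/) (ℓ x) (∑ x (λ a → Λ a * # (x ÷ a))) (∑ x ℓ)))
      where
      low : ∑ x (λ a → Λ a * # (x ÷ a)) ≤ # x * ∑ x Λ/
      low = subst (∑ x (λ a → Λ a * # (x ÷ a)) ≤_) (∑-*ˡ x (# x) Λ/) (∑-mono x (λ a p q →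
        (lin (↑ (flr a) ⊗ (Λ≥0 a ⊗ inv-nonneg a) ⊕ eq* (- # 1 * (Λ a * # (x ÷ a))) (inv-inverse p)) (solve 5 (λ
              a b c d e → c :* (a :* d) :- a :* b := (c :- e :* b) :* (a :* d) :+ :- (num 1) :* (a :* b) :* (num
              1 :- e :* d)) refl (Λ a) (# (x ÷ a)) (# x) (inv a) (# a)))))
        where
        flr : ∀ a → # a * # (x ÷ a) ≤ # x
        flr a = subst (_≤ # x) (#-* a (x ÷ a)) (#-mono (*-÷-≤ x a))
      up : # x * ∑ x Λ/ ≤ ∑ x (λ a → Λ a * # (x ÷ a)) + ψ x
      up = subst₂ _≤_ (∑-*ˡ x (# x) Λ/) (∑-+ x _ Λ) (∑-mono x (λ a p q →
        (lin (↑ (ceil a p) ⊗ (Λ≥0 a ⊗ inv-nonneg a) ⊕ eq* (# 1 * (Λ a * (# (x ÷ a) + # 1))) (inv-inverse p))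
              (solve 5 (λ a b c d e → b :* d :+ b :- a :* (b :* c) := (e :* (d :+ num 1) :- a) :* (b :* c) :+
              num 1 :* (b :* (d :+ num 1)) :* (num 1 :- e :* c)) refl (# x) (Λ a) (inv a) (# (x ÷ a)) (# a)))))
        where
        ceil : ∀ a → 1 ℕ.≤ a → # x ≤ # a * (# (x ÷ a) + # 1)
        ceil a p = subst (# x ≤_) (trans (#-* a (suc (x ÷ a))) (cong (# a *_) (#-suc (x ÷ a)))) (#-mono (ℕ.<⇒≤ (<-*-suc÷ x a p)))

  -- Summation by parts, decreasing weights, geometric series.

  ∣∣-cong : ∀ {x y c} → x ≡ y → ∣ y ∣≤ c → ∣ x ∣≤ c
  ∣∣-cong refl h = h

  -- Abel summation. The induction runs on Σ e f - (Σ e) f(n), whose increment is the partial sum of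
  -- e times f(n) - f(n+1), so the bounds telescope.
  dirichlet-test : ∀ n (e f : ℕ → F) C → 1 ℕ.≤ n → (∀ k → ∣ ∑ k e ∣≤ C) →
    (∀ i → 1 ℕ.≤ i → suc i ℕ.≤ n → f (suc i) ≤ f i) → # 0 ≤ f n → ∣ ∑ n (λ i → e i * f i) ∣≤ C * f 1
  dirichlet-test n e f C 1≤n bound decr f≥0 = ∣∣-cong
      (solve 3 (λ a b c → a := a :- b :* c :+ b :* c) refl (∑ n (λ i → e i * f i)) (∑ n e) (f n))
      (∣∣-weaken (lin (nn 0) (solve 3 (λ a b c → a :* b :- (a :* (b :- c) :+ a :* c) := num 0) refl C (f 1) (f
            n)))
        (∣∣-+ (go n 1≤n decr) (∣∣-* (bound n) (∣∣-of-nonneg f≥0))))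
    where
    go : ∀ n → 1 ℕ.≤ n → (∀ i → 1 ℕ.≤ i → suc i ℕ.≤ n → f (suc i) ≤ f i) →
         ∣ ∑ n (λ i → e i * f i) - ∑ n e * f n ∣≤ C * (f 1 - f n)
    go (suc zero) _ _ = ∣∣-cong (solve 2 (λ a b → num 0 :+ a :* b :- (num 0 :+ a) :* b := num 0) refl (e 1) (f
          1)) (∣∣-weaken (lin (nn 0) (solve 2 (λ a b → a :* (b :- b) :- num 0 := num 0) refl C (f 1))) ∣∣-zero)
    go (suc n@(suc _)) _ decr = ∣∣-cong
      (solve 5 (λ a b c d e → a :+ b :* c :- (d :+ b) :* c := a :- d :* e :+ d :* (e :- c)) refl (∑ n (λ i → e
            i * f i)) (e (suc n)) (f (suc n)) (∑ n e) (f n))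
      (∣∣-weaken (lin (nn 0) (solve 4 (λ a b c d → a :* (b :- d) :- (a :* (b :- c) :+ a :* (c :- d)) := num 0)
            refl C (f 1) (f n) (f (suc n))))
        (∣∣-+ (go n (s≤s z≤n) (λ i p q → decr i p (ℕ.m≤n⇒m≤1+n q))) (∣∣-* (bound n) (∣∣-of-nonneg (↑ (decr n (s≤s z≤n) ℕ.≤-refl))))))

  ∑-periodic-∣∣ : ∀ M (e : ℕ → F) → 1 ℕ.≤ M → (∀ i → e (M ℕ.+ i) ≡ e i) → (∀ i → ∣ e i ∣≤ # 1) → ∑ M e ≡ # 0 →
    ∀ n → ∣ ∑ n e ∣≤ # M
  ∑-periodic-∣∣ M e 1≤M per one zer = <-rec _ go
    where
    go : ∀ n → (∀ {k} → k ℕ.< n → ∣ ∑ k e ∣≤ # M) → ∣ ∑ n e ∣≤ # M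
    go n ih with n ℕ.≤? M
    ... | yes n≤M = ∣∣-weaken (≤-trans (≡⇒≤ (trans (∑-const n (# 1)) (solve 1 (λ a → a :* num 1 := a) refl (#
          n)))) (#-mono n≤M)) (∑-∣∣ n (λ i _ _ → one i))
    ... | no n≰M = ∣∣-cong red (ih (ℕ.∸-monoʳ-< {n} {M} {0} 1≤M M≤n))
      where
      M≤n : M ℕ.≤ n
      M≤n = ℕ.<⇒≤ (ℕ.≰⇒> n≰M)
      red : ∑ n e ≡ ∑ (n ℕ.∸ M) e
      red = trans (cong (λ k → ∑ k e) (sym (ℕ.m+[n∸m]≡n M≤n))) (trans (∑-split M (n ℕ.∸ M) e)
        (trans (cong₂ _+_ zer (∑-cong′ (n ℕ.∸ M) per)) (solve 1 (λ a → num 0 :+ a := a) refl (∑ (n ℕ.∸ M) e))))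

  inv-diff : ∀ {k} → 1 ℕ.≤ k → inv k - inv (suc k) ≡ inv k * inv (suc k)
  inv-diff {k} p = begin
    a - b ≡⟨ (solve 2 (λ a b → a :- b := num 1 :* a :- num 1 :* b) refl a b) ⟩
    # 1 * a - # 1 * b ≡⟨ cong₂ (λ x y → x * a - y * b) (sym (inv-inverse {suc k} (s≤s z≤n))) (sym (inv-inverse p)) ⟩
    # (suc k) * b * a - # k * a * b ≡⟨ cong (λ z → z * b * a - # k * a * b) (#-suc k) ⟩
    (# k + # 1) * b * a - # k * a * b ≡⟨ (solve 3 (λ a b c → (a :+ num 1) :* b :* c :- a :* c :* b := c :* b)
          refl (# k) b a) ⟩
    a * b ∎
    where
    open ≡-Reasoning
    a = inv k
    b = inv (suc k)

  -- With a = 1/k and b = 1/(k+1): v b ≤ u b + 2ab, and u a - u b = u ab ≥ 2ab.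
  decreasing₁ : ∀ {u v a b} → # 2 ≤ u → v ≤ u + # 2 * a → # 0 ≤ a → # 0 ≤ b → a - b ≡ a * b → v * b ≤ u * a
  decreasing₁ {u} {v} {a} {b} 2≤u v≤ a≥0 b≥0 e =
    (lin (↑ v≤ ⊗ b≥0 ⊕ ↑ 2≤u ⊗ (a≥0 ⊗ b≥0) ⊕ eq* (- # 1 * (u)) e) (solve 4 (λ a b c d → c :* d :- a :* b := (c
          :+ num 2 :* d :- a) :* b :+ (c :- num 2) :* (d :* b) :+ :- (num 1) :* c :* (d :* b :- (d :- b))) refl
          v b u a))

  -- The same computation requires 4u + 4a ≤ u², which holds for u ≥ 5 and a ≤ 1. This is the origin
  -- of the shift by 5 in the weights below.
  decreasing₂ : ∀ {u v a b} → # 5 ≤ u → # 0 ≤ v → v ≤ u + # 2 * a → # 0 ≤ a → a ≤ # 1 → # 0 ≤ b → a - b ≡ a * b →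
    v * v * b ≤ u * u * a
  decreasing₂ {u} {v} {a} {b} 5≤u v≥0 v≤ a≥0 a≤1 b≥0 e =
    (lin (↑ v≤ ⊗ (sum ⊗ b≥0) ⊕ ↑ 5≤u ⊗ (u+1 ⊗ (a≥0 ⊗ b≥0)) ⊕ nn 4 ⊗ (↑ a≤1 ⊗ (a≥0 ⊗ b≥0)) ⊕ (a≥0 ⊗ b≥0) ⊕ eq*
          (- # 1 * (u * u)) e) (solve 4 (λ a b c d → c :* c :* d :- a :* a :* b := (c :+ num 2 :* d :- a) :* ((c
          :+ num 2 :* d :+ a) :* b) :+ (c :- num 5) :* ((c :+ num 1) :* (d :* b)) :+ num 4 :* ((num 1 :- d) :*
          (d :* b)) :+ d :* b :+ :- (num 1) :* (c :* c) :* (d :* b :- (d :- b))) refl v b u a))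
    where
    sum : # 0 ≤ u + # 2 * a + v
    sum = lin (↑ 5≤u ⊕ nn 2 ⊗ (a≥0) ⊕ v≥0 ⊕ nn 5) (solve 3 (λ a b c → a :+ num 2 :* b :+ c :- num 0 := a :- num
          5 :+ num 2 :* b :+ c :+ num 5) refl u a v)
    u+1 : # 0 ≤ u + # 1
    u+1 = lin (↑ 5≤u ⊕ nn 6) (solve 1 (λ a → a :+ num 1 :- num 0 := a :- num 5 :+ num 6) refl u)

  -- The last term is counted twice; this gives equality for p = 2 and lets the induction go
  -- through.
  geometric : ∀ {p} J → 2 ℕ.≤ p → ∑ J (λ j → inv (p ℕ.^ j)) + inv (p ℕ.^ J) ≤ # 1
  geometric zero _ = lin (eq* (# 1) inv-1) (solve 1 (λ a → num 1 :- (num 0 :+ a) := num 1 :* (num 1 :- a)) refl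
        (inv 1))
  geometric {p} (suc J) 2≤p = lin (↑ (geometric {p} J 2≤p) ⊕ eq* (# 2) (inv-* p (p ℕ.^ J)) ⊕ ↑ half ⊗
        (inv-nonneg (p ℕ.^ J))) (solve 4 (λ a b c d → num 1 :- (a :+ b :+ b) := num 1 :- (a :+ c) :+ num 2 :* (d
        :* c :- b) :+ (num 1 :- num 2 :* d) :* c) refl (∑ J (λ j → inv (p ℕ.^ j))) (inv (p ℕ.^ suc J)) (inv (p
        ℕ.^ J)) (inv p))
    where
    half : # 2 * inv p ≤ # 1
    half = lin (↑ (#-mono 2≤p) ⊗ (inv-nonneg p) ⊕ eq* (# 1) (inv-inverse (ℕ.<⇒≤ 2≤p))) (solve 2 (λ a b → num 1
          :- num 2 :* a := (b :- num 2) :* a :+ num 1 :* (num 1 :- b :* a)) refl (inv p) (# p))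

  geometric-≤1 : ∀ {p} J → 2 ℕ.≤ p → ∑ J (λ j → inv (p ℕ.^ j)) ≤ # 1
  geometric-≤1 {p} J 2≤p = lin (↑ (geometric {p} J 2≤p) ⊕ (inv-nonneg (p ℕ.^ J))) (solve 2 (λ a b → num 1 :- a
        := num 1 :- (a :+ b) :+ b) refl (∑ J (λ j → inv (p ℕ.^ j))) (inv (p ℕ.^ J)))

  geometric-shift : ∀ p J → ∑ (suc J) (λ j → inv (p ℕ.^ j)) ≡ inv p + inv p * ∑ J (λ j → inv (p ℕ.^ j))
  geometric-shift p zero = trans (cong (λ z → # 0 + inv z) (ℕ.*-identityʳ p)) (solve 1 (λ a → num 0 :+ a := a
        :+ a :* num 0) refl (inv p))
  geometric-shift p (suc J) = trans (cong₂ _+_ (geometric-shift p J) (inv-* p (p ℕ.^ suc J)))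
    (solve 3 (λ a b c → a :+ a :* b :+ a :* c := a :+ a :* (b :+ c)) refl (inv p) (∑ J (λ j → inv (p ℕ.^ j)))
          (inv (p ℕ.^ suc J)))

  geometric-tail : ∀ {p} J → 2 ℕ.≤ p → ∑ J (λ j → inv (p ℕ.^ j)) ≤ inv p + # 2 * (inv p * inv p)
  geometric-tail {p} zero _ = inv-nonneg p ⊕ (nn 2 ⊗ (inv-nonneg p ⊗ inv-nonneg p))
  geometric-tail {p} (suc zero) _ = lin (eq* (# 1) (geometric-shift p 0) ⊕ nn 2 ⊗ ((inv-nonneg p ⊗ inv-nonneg
        p))) (solve 2 (λ a b → b :+ num 2 :* (b :* b) :- a := num 1 :* (b :+ b :* num 0 :- a) :+ num 2 :* (b :*
        b)) refl (∑ 1 (λ j → inv (p ℕ.^ j))) (inv p))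
  geometric-tail {p} (suc (suc J)) 2≤p = lin (eq* (# 1) (geometric-shift p (suc J)) ⊕ eq* (# 1 * (inv p))
        (geometric-shift p J) ⊕ ↑ (geometric-≤1 {p} J 2≤p) ⊗ (inv-nonneg p ⊗ inv-nonneg p)) (solve 4 (λ a b c d
        → b :+ num 2 :* (b :* b) :- a := num 1 :* (b :+ b :* c :- a) :+ num 1 :* b :* (b :+ b :* d :- c) :+ (num
        1 :- d) :* (b :* b)) refl (∑ (suc (suc J)) (λ j → inv (p ℕ.^ j))) (inv p) (∑ (suc J) (λ j → inv (p ℕ.^
        j))) (∑ J (λ j → inv (p ℕ.^ j))))

  ∑-𝟙-≤ : ∀ n k (f : ℕ → F) → 1 ℕ.≤ k → # 0 ≤ f k → ∑ n (λ i → 𝟙 (i ℕ.≟ k) * f i) ≤ f k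
  ∑-𝟙-≤ n k f 1≤k h with k ℕ.≤? n
  ... | yes p = ≡⇒≤ (∑-𝟙 n k f 1≤k p)
  ... | no p = subst (_≤ f k) (sym (∑-𝟙-outside n k f (ℕ.≰⇒> p))) h

  -- Sums over prime powers, oscillating sums, and Selberg's identity.

  module Estimates (B : ℕ) where

    open Log B public

    ∑Λ-≤ : ∀ x (g : ℕ → F) → (∀ a → # 0 ≤ g a) →
      ∑ x (λ a → Λ a * g a) ≤ ∑ B (λ p → 𝟙 (prime? p) * (lam p * ∑ B (λ j → g (p ℕ.^ j))))
    ∑Λ-≤ x g g≥0 = subst (_≤ ∑ B (λ p → 𝟙 (prime? p) * (lam p * ∑ B (λ j → g (p ℕ.^ j))))) (sym (∑Λ x g)) (∑-mono B (λ p _ _ → term p))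
      where
      term : ∀ p → 𝟙 (prime? p) * (lam p * ∑ B (λ j → ∑ x (λ a → 𝟙 (a ℕ.≟ p ℕ.^ j) * g a))) ≤ 𝟙 (prime? p) * (lam p * ∑ B (λ j → g (p ℕ.^ j)))
      term p with prime? p
      ... | no _ = lin (nn 0) (solve 3 (λ a b c → num 0 :* (a :* c) :- num 0 :* (a :* b) := num 0) refl (lam p)
            (∑ B (λ j → ∑ x (λ a → 𝟙 (a ℕ.≟ p ℕ.^ j) * g a))) (∑ B (λ j → g (p ℕ.^ j))))
      ... | yes pp = *-monoˡ (# 1) (nn 1) (*-monoˡ (lam p) (lam-nonneg p) (∑-mono B (λ j _ _ →
          ∑-𝟙-≤ x (p ℕ.^ j) g (ℕ.m^n>0 p {{prime⇒nonZero pp}} j) (g≥0 (p ℕ.^ j)))))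

    ℓ-prime : ∀ {p} → Prime p → p ℕ.≤ B → lam p ≡ ℓ p
    ℓ-prime {p} pp p≤B = sym (trans (cong ℓ (sym (ℕ.*-identityʳ p))) (trans (ℓ-prime-* pp ℕ.≤-refl (subst (ℕ._≤ B) (sym (ℕ.*-identityʳ p)) p≤B))
      (trans (cong (lam p +_) ℓ-1) (solve 1 (λ a → a :+ num 0 := a) refl (lam p)))))

    ℓ-≤ : ∀ {n} → 1 ℕ.≤ n → n ℕ.≤ B → ℓ n ≤ # 2 * # n
    ℓ-≤ {suc zero} _ _ = lin (eq* (# 1) ℓ-1 ⊕ nn 2) (solve 1 (λ a → num 2 :* num 1 :- a := num 1 :* (num 0 :-
          a) :+ num 2) refl (ℓ 1))
    ℓ-≤ {suc n@(suc _)} _ le = lin (↑ (ℓ-≤ {n} (s≤s z≤n) (ℕ.<⇒≤ le)) ⊕ ↑ (ℓ-step-upper {n} (s≤s z≤n) le) ⊕ nn 2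
          ⊗ (↑ (inv-≤1 n)) ⊕ eq* (- # 2) (#-suc n)) (solve 5 (λ a b c d e → num 2 :* b :- a := num 2 :* c :- d
          :+ (num 2 :* e :- (a :- d)) :+ num 2 :* (num 1 :- e) :+ :- (num 2) :* (c :+ num 1 :- b)) refl (ℓ (suc
          n)) (# (suc n)) (# n) (ℓ n) (inv n))

    -- Telescopes against (log n + 4)/n, whose decrease dominates log n / n².
    ∑ℓ/n² : ∀ {n} → 1 ℕ.≤ n → n ℕ.≤ B → ∑ n (λ k → ℓ k * (inv k * inv k)) ≤ # 4 - (ℓ n + # 4) * inv n
    ∑ℓ/n² {suc zero} _ _ = lin (eq* (# 4) inv-1 ⊕ eq* (# 1 * (inv 1 * inv 1)) ℓ-1 ⊕ eq* (# 1 * (inv 1)) ℓ-1)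
          (solve 2 (λ a b → num 4 :- (a :+ num 4) :* b :- (num 0 :+ a :* (b :* b)) := num 4 :* (num 1 :- b) :+
          num 1 :* (b :* b) :* (num 0 :- a) :+ num 1 :* b :* (num 0 :- a)) refl (ℓ 1) (inv 1))
    ∑ℓ/n² {suc n@(suc _)} _ le = lin (↑ (∑ℓ/n² {n} (s≤s z≤n) (ℕ.<⇒≤ le)) ⊕ ↑ (ℓ-step-upper {n} (s≤s z≤n) le) ⊗
          (inv-nonneg n) ⊕ ↑ (inv-≤ {n} (s≤s z≤n) (ℕ.n≤1+n n)) ⊗ (ℓ-nonneg {suc n} (s≤s z≤n) le ⊗ inv-nonneg
          (suc n)) ⊕ nn 2 ⊗ (↑ dbl ⊗ (inv-nonneg n)) ⊕ eq* (- # 1 * (L′)) (inv-diff {n} (s≤s z≤n)) ⊕ eq* (- # 4)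
          (inv-diff {n} (s≤s z≤n))) (solve 5 (λ a b c d e → num 4 :- (b :+ num 4) :* c :- (a :+ b :* (c :* c))
          := num 4 :- (d :+ num 4) :* e :- a :+ (num 2 :* e :- (b :- d)) :* e :+ (e :- c) :* (b :* c) :+ num 2
          :* ((num 2 :* c :- e) :* e) :+ :- (num 1) :* b :* (e :* c :- (e :- c)) :+ :- (num 4) :* (e :* c :- (e
          :- c))) refl (∑ n (λ k → ℓ k * (inv k * inv k))) L′ b (ℓ n) a)
      where
      L′ = ℓ (suc n)
      a = inv n
      b = inv (suc n)
      dbl : a ≤ # 2 * b
      dbl = lin (eq* (# 1) (inv-diff {n} (s≤s z≤n)) ⊕ ↑ (inv-≤1 n) ⊗ (inv-nonneg (suc n))) (solve 2 (λ a b →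
            num 2 :* b :- a := num 1 :* (a :* b :- (a :- b)) :+ (num 1 :- a) :* b) refl a b)

    -- Without the exponent 1, the powers of p contribute at most 2 log p / p², and Σ log n / n² ≤
    -- 4. This bounds the mass of a class without primes.
    Λ/-proper-powers : ∀ x (s : ℕ → F) → 1 ℕ.≤ B → (∀ a → # 0 ≤ s a) → (∀ a → s a ≤ # 1) → (∀ p → Prime p → p ℕ.≤ B → s p ≡ # 0) →
      ∑ x (λ a → s a * Λ/ a) ≤ # 8
    Λ/-proper-powers x s 1≤B s≥0 s≤1 noprime = ≤-trans (≡⇒≤ (∑-cong′ x (λ a → (solve 3 (λ a b c → a :* (b :* c)
          := b :* (a :* c)) refl (s a) (Λ a) (inv a)))))
        (≤-trans (∑Λ-≤ x (λ a → s a * inv a) (λ a → s≥0 a ⊗ inv-nonneg a)) (≤-trans (∑-mono B term) total))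
      where
      G : ℕ → ℕ → F
      G p J = ∑ J (λ j → s (p ℕ.^ j) * inv (p ℕ.^ j))
      inner : ∀ {p} J → Prime p → p ℕ.≤ B → 1 ℕ.≤ J → G p J + inv p ≤ ∑ J (λ j → inv (p ℕ.^ j))
      inner {p} (suc zero) pp p≤B _ = lin (eq* (# 1 * (inv (p ℕ.* 1))) e ⊕ eq* (- # 1) (cong inv (ℕ.*-identityʳ
            p))) (solve 3 (λ a b c → num 0 :+ b :- (num 0 :+ a :* b :+ c) := num 1 :* b :* (num 0 :- a) :+ :-
            (num 1) :* (c :- b)) refl (s (p ℕ.* 1)) (inv (p ℕ.* 1)) (inv p))
        where
        e : s (p ℕ.* 1) ≡ # 0
        e = trans (cong s (ℕ.*-identityʳ p)) (noprime p pp p≤B)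
      inner {p} (suc J@(suc _)) pp p≤B _ = lin (↑ (inner {p} J pp p≤B (s≤s z≤n)) ⊕ ↑ (s≤1 (p ℕ.^ suc J)) ⊗
            (inv-nonneg (p ℕ.^ suc J))) (solve 5 (λ a b c d e → e :+ c :- (a :+ b :* c :+ d) := e :- (a :+ d) :+
            (num 1 :- b) :* c) refl (G p J) (s (p ℕ.^ suc J)) (inv (p ℕ.^ suc J)) (inv p) (∑ J (λ j → inv (p ℕ.^
            j))))
      term : ∀ p → 1 ℕ.≤ p → p ℕ.≤ B → 𝟙 (prime? p) * (lam p * G p B) ≤ # 2 * (ℓ p * (inv p * inv p))
      term p 1≤p p≤B with prime? p
      ... | no _ = ≤-trans (lin (nn 0) (solve 2 (λ a b → num 0 :- num 0 :* (a :* b) := num 0) refl (lam p) (G p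
            B))) (nn 2 ⊗ (ℓ-nonneg 1≤p p≤B ⊗ (inv-nonneg p ⊗ inv-nonneg p)))
      ... | yes pp = lin (↑ (inner {p} B pp p≤B 1≤B) ⊗ (lam-nonneg p) ⊕ ↑ (geometric-tail {p} B (prime⇒2≤ pp))
            ⊗ (lam-nonneg p) ⊕ eq* (# 2 * (inv p * inv p)) (ℓ-prime pp p≤B)) (solve 5 (λ a b c d e → num 2 :* (c
            :* (d :* d)) :- num 1 :* (a :* b) := (e :- (b :+ d)) :* a :+ (d :+ num 2 :* (d :* d) :- e) :* a :+
            num 2 :* (d :* d) :* (c :- a)) refl (lam p) (G p B) (ℓ p) (inv p) (∑ B (λ j → inv (p ℕ.^ j))))
      total : ∑ B (λ p → # 2 * (ℓ p * (inv p * inv p))) ≤ # 8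
      total = lin (eq* (# 1) (∑-*ˡ B (# 2) (λ p → ℓ p * (inv p * inv p))) ⊕ nn 2 ⊗ (↑ (∑ℓ/n² {B} 1≤B ℕ.≤-refl))
            ⊕ nn 2 ⊗ (((ℓ-nonneg 1≤B ℕ.≤-refl ⊕ nn 4) ⊗ inv-nonneg B))) (solve 4 (λ a b c d → num 8 :- a := num
            1 :* (num 2 :* b :- a) :+ num 2 :* (num 4 :- (c :+ num 4) :* d :- b) :+ num 2 :* ((c :+ num 4) :*
            d)) refl (∑ B (λ p → # 2 * (ℓ p * (inv p * inv p)))) (∑ B (λ p → ℓ p * (inv p * inv p))) (ℓ B) (inv
            B))

    -- Applied to prime powers not coprime to the modulus: each of at most M primes contributes at
    -- most log p ≤ 2M.
    Λ/-small-primes : ∀ x M (s : ℕ → F) → M ℕ.≤ B → (∀ a → # 0 ≤ s a) → (∀ a → s a ≤ # 1) →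
      (∀ p j → Prime p → 1 ℕ.≤ j → ¬ p ℕ.≤ M → s (p ℕ.^ j) ≡ # 0) → ∑ x (λ a → s a * Λ/ a) ≤ # 2 * # M * # M
    Λ/-small-primes x M s M≤B s≥0 s≤1 large = ≤-trans (≡⇒≤ (∑-cong′ x (λ a → (solve 3 (λ a b c → a :* (b :* c)
          := b :* (a :* c)) refl (s a) (Λ a) (inv a)))))
        (≤-trans (∑Λ-≤ x (λ a → s a * inv a) (λ a → s≥0 a ⊗ inv-nonneg a)) (≤-trans (∑-mono B term)
          (≡⇒≤ (trans (∑-truncate (λ _ → # 2 * # M) M≤B) (trans (∑-const M _) (solve 1 (λ a → a :* (num 2 :* a)
                := num 2 :* a :* a) refl (# M)))))))
      where
      G : ℕ → F
      G p = ∑ B (λ j → s (p ℕ.^ j) * inv (p ℕ.^ j))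
      term : ∀ p → 1 ℕ.≤ p → p ℕ.≤ B → 𝟙 (prime? p) * (lam p * G p) ≤ 𝟙 (p ℕ.≤? M) * (# 2 * # M)
      term p 1≤p p≤B with prime? p
      ... | no _ = ≤-trans (lin (nn 0) (solve 2 (λ a b → num 0 :- num 0 :* (a :* b) := num 0) refl (lam p) (G
            p))) (𝟙-nonneg (p ℕ.≤? M) ⊗ (nn 2 ⊗ nn M))
      ... | yes pp with p ℕ.≤? M
      ... | no p≰M = ≡⇒≤ (trans (cong (λ z → # 1 * (lam p * z)) (∑-zero′ B (λ j q _ → trans (cong (_* inv (p ℕ.^ j)) (large p j pp q p≰M)) (solve
            1 (λ a → num 0 :* a := num 0) refl (inv (p ℕ.^ j))))))
          (solve 2 (λ a b → num 1 :* (a :* num 0) := num 0 :* (num 2 :* b)) refl (lam p) (# M)))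
      ... | yes p≤M = lin (↑ G≤1 ⊗ (lam-nonneg p) ⊕ eq* (# 1) (ℓ-prime pp p≤B) ⊕ ↑ (ℓ-≤ 1≤p p≤B) ⊕ nn 2 ⊗ (↑
            (#-mono p≤M))) (solve 5 (λ a b c d e → num 1 :* (num 2 :* c) :- num 1 :* (a :* b) := (num 1 :- b) :*
            a :+ num 1 :* (d :- a) :+ (num 2 :* e :- d) :+ num 2 :* (c :- e)) refl (lam p) (G p) (# M) (ℓ p) (#
            p))
        where
        G≤1 : G p ≤ # 1
        G≤1 = ≤-trans (∑-mono B (λ j _ _ → (lin (↑ (s≤1 (p ℕ.^ j)) ⊗ (inv-nonneg (p ℕ.^ j))) (solve 2 (λ a b →
              b :- a :* b := (num 1 :- a) :* b) refl (s (p ℕ.^ j)) (inv (p ℕ.^ j))))))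
          (geometric-≤1 B (prime⇒2≤ pp))

    -- log² k and log k are written through (log k + 5)² / k and (log k + 5) / k, which decrease from k = 1 on.

    module _ (e : ℕ → F) (C : F) (bound : ∀ k → ∣ ∑ k e ∣≤ C) where

      private
        u : ℕ → F
        u k = ℓ k + # 5

        5≤u : ∀ {k} → 1 ℕ.≤ k → k ℕ.≤ B → # 5 ≤ u k
        5≤u {k} p q = lin ((ℓ-nonneg p q)) (solve 1 (λ a → a :+ num 5 :- num 5 := a) refl (ℓ k))

        u-step : ∀ {k} → 1 ℕ.≤ k → suc k ℕ.≤ B → u (suc k) ≤ u k + # 2 * inv k
        u-step {k} p q = lin (↑ (ℓ-step-upper p q)) (solve 3 (λ a b c → b :+ num 5 :+ num 2 :* c :- (a :+ num
              5) := num 2 :* c :- (a :- b)) refl (ℓ (suc k)) (ℓ k) (inv k))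

        u≥0 : ∀ {k} → 1 ℕ.≤ k → k ℕ.≤ B → # 0 ≤ u k
        u≥0 p q = ≤-trans (nn 5) (5≤u p q)

      ∑e/n : ∀ n → 1 ℕ.≤ n → ∣ ∑ n (λ k → e k * inv k) ∣≤ C
      ∑e/n n 1≤n = ∣∣-weaken (lin (eq* (# 1 * (C)) inv-1) (solve 2 (λ a b → a :- a :* b := num 1 :* a :* (num 1
            :- b)) refl C (inv 1)))
        (dirichlet-test n e inv C 1≤n bound (λ i p _ → inv-≤ p (ℕ.n≤1+n i)) (inv-nonneg n))

      ∑eu/n : ∀ n → 1 ℕ.≤ n → n ℕ.≤ B → ∣ ∑ n (λ k → e k * (u k * inv k)) ∣≤ # 5 * C
      ∑eu/n n 1≤n n≤B = ∣∣-weaken (lin (eq* (# 1 * (C * (ℓ 1 + # 5))) inv-1 ⊕ eq* (# 1 * (C)) ℓ-1) (solve 3 (λ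
            a b c → num 5 :* a :- a :* ((b :+ num 5) :* c) := num 1 :* (a :* (b :+ num 5)) :* (num 1 :- c) :+
            num 1 :* a :* (num 0 :- b)) refl C (ℓ 1) (inv 1)))
        (dirichlet-test n e (λ k → u k * inv k) C 1≤n bound
          (λ i p q → decreasing₁ (≤-trans (lin (nn 3) (solve 0 (num 5 :- num 2 := num 3) refl)) (5≤u p (ℕ.≤-trans (ℕ.<⇒≤ q) n≤B))) (u-step p (ℕ.≤-trans q n≤B)) (inv-nonneg i) (inv-nonneg (suc i)) (inv-diff p))
          (u≥0 1≤n n≤B ⊗ inv-nonneg n))

      ∑eu²/n : ∀ n → 1 ℕ.≤ n → n ℕ.≤ B → ∣ ∑ n (λ k → e k * (u k * u k * inv k)) ∣≤ # 25 * C
      ∑eu²/n n 1≤n n≤B = ∣∣-weaken (lin (eq* (# 1 * (C * ((ℓ 1 + # 5) * (ℓ 1 + # 5)))) inv-1 ⊕ eq* (# 1 * (C *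
            (ℓ 1))) ℓ-1 ⊕ eq* (# 10 * (C)) ℓ-1) (solve 3 (λ a b c → num 25 :* a :- a :* ((b :+ num 5) :* (b :+
            num 5) :* c) := num 1 :* (a :* ((b :+ num 5) :* (b :+ num 5))) :* (num 1 :- c) :+ num 1 :* (a :* b)
            :* (num 0 :- b) :+ num 10 :* a :* (num 0 :- b)) refl C (ℓ 1) (inv 1)))
        (dirichlet-test n e (λ k → u k * u k * inv k) C 1≤n bound
          (λ i p q → decreasing₂ (5≤u p (ℕ.≤-trans (ℕ.<⇒≤ q) n≤B)) (u≥0 (s≤s z≤n) (ℕ.≤-trans q n≤B)) (u-step p (ℕ.≤-trans q n≤B))
            (inv-nonneg i) (inv-≤1 i) (inv-nonneg (suc i)) (inv-diff p))
          ((u≥0 1≤n n≤B ⊗ u≥0 1≤n n≤B) ⊗ inv-nonneg n))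

      ∑eℓ/n : ∀ n → 1 ℕ.≤ n → n ℕ.≤ B → ∣ ∑ n (λ k → e k * (ℓ k * inv k)) ∣≤ # 10 * C
      ∑eℓ/n n 1≤n n≤B = ∣∣-cong split (∣∣-weaken (lin (nn 0) (solve 1 (λ a → num 10 :* a :- (num 5 :* a :+ num
            5 :* a) := num 0) refl C))
          (∣∣-+ (∑eu/n n 1≤n n≤B) (∣∣-neg (∣∣-* (∣∣-of-nonneg (nn 5)) (∑e/n n 1≤n)))))
        where
        split : ∑ n (λ k → e k * (ℓ k * inv k)) ≡ ∑ n (λ k → e k * (u k * inv k)) + - (# 5 * ∑ n (λ k → e k * inv k))
        split = trans (∑-cong′ n (λ k → (solve 3 (λ a b c → a :* (b :* c) := a :* ((b :+ num 5) :* c) :- num 5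
              :* (a :* c)) refl (e k) (ℓ k) (inv k))))
          (trans (∑-- n _ _) (cong (λ z → ∑ n (λ k → e k * (u k * inv k)) - z) (∑-*ˡ n (# 5) _)))

      -- From log² = u² - 10u + 25 with u = log + 5; the constant is 25 + 10·5 + 25.
      ∑eℓ²/n : ∀ n → 1 ℕ.≤ n → n ℕ.≤ B → ∣ ∑ n (λ k → e k * (ℓ k * ℓ k * inv k)) ∣≤ # 100 * C
      ∑eℓ²/n n 1≤n n≤B = ∣∣-cong split (∣∣-weaken (lin (nn 0) (solve 1 (λ a → num 100 :* a :- (num 25 :* a :+
            num 10 :* (num 5 :* a) :+ num 25 :* a) := num 0) refl C))
          (∣∣-+ (∣∣-+ (∑eu²/n n 1≤n n≤B) (∣∣-neg (∣∣-* (∣∣-of-nonneg (nn 10)) (∑eu/n n 1≤n n≤B)))) (∣∣-* (∣∣-of-nonneg (nn 25)) (∑e/n n 1≤n))))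
        where
        split : ∑ n (λ k → e k * (ℓ k * ℓ k * inv k)) ≡
          ∑ n (λ k → e k * (u k * u k * inv k)) + - (# 10 * ∑ n (λ k → e k * (u k * inv k))) + # 25 * ∑ n (λ k → e k * inv k)
        split = trans (∑-cong′ n (λ k → (solve 3 (λ a b c → a :* (b :* b :* c) := a :* ((b :+ num 5) :* (b :+
              num 5) :* c) :- num 10 :* (a :* ((b :+ num 5) :* c)) :+ num 25 :* (a :* c)) refl (e k) (ℓ k) (inv
              k))))
          (trans (∑-+ n _ _) (cong₂ _+_ (trans (∑-- n _ _) (cong (λ z → ∑ n (λ k → e k * (u k * u k * inv k)) - z) (∑-*ˡ n (# 10) _))) (∑-*ˡ n (# 25) _)))

    -- Selberg's identity Λ log + Λ ⋆ Λ = μ ⋆ log², summed against an arbitrary function.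

    μ-collapse : ∀ {x} (w f : ℕ → F) → x ℕ.≤ B →
      ∑ x (λ d → μ d * ∑ (x ÷ d) (λ a → w a * ∑ ((x ÷ d) ÷ a) (λ b → f (d ℕ.* (a ℕ.* b))))) ≡ ∑ x (λ a → w a * f a)
    μ-collapse {x} w f x≤B = begin
      ∑ x (λ d → μ d * ∑ (x ÷ d) (λ a → w a * T d a)) ≡⟨ ∑-cong′ x (λ d → sym (∑-*ˡ (x ÷ d) (μ d) _)) ⟩
      ∑ x (λ d → ∑ (x ÷ d) (λ a → μ d * (w a * T d a))) ≡⟨ ∑-÷-swap x (λ d a → μ d * (w a * T d a)) ⟩
      ∑ x (λ a → ∑ (x ÷ a) (λ d → μ d * (w a * T d a))) ≡⟨ ∑-cong x (λ a p q → one a p q) ⟩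
      ∑ x (λ a → w a * f a) ∎
      where
      open ≡-Reasoning
      T : ℕ → ℕ → F
      T d a = ∑ ((x ÷ d) ÷ a) (λ b → f (d ℕ.* (a ℕ.* b)))
      one : ∀ a → 1 ℕ.≤ a → a ℕ.≤ x → ∑ (x ÷ a) (λ d → μ d * (w a * T d a)) ≡ w a * f a
      one a 1≤a a≤x = begin
        ∑ (x ÷ a) (λ d → μ d * (w a * T d a)) ≡⟨ ∑-cong (x ÷ a) (λ d p _ → trans (solve 3 (λ a b c → a :* (b :*
              c) := b :* (a :* c)) refl (μ d) (w a) (T d a))
           (cong (λ z → w a * (μ d * z)) (trans (cong (λ z → ∑ z (λ b → f (d ℕ.* (a ℕ.* b)))) (swap÷ d p)) (∑-cong′ ((x ÷ a) ÷ d) (λ b → cong f (perm d b)))))) ⟩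
        ∑ (x ÷ a) (λ d → w a * (μ d * ∑ ((x ÷ a) ÷ d) (λ b → f (a ℕ.* (d ℕ.* b))))) ≡⟨ ∑-*ˡ (x ÷ a) (w a) _ ⟩
        w a * ∑ (x ÷ a) (λ d → μ d * ∑ ((x ÷ a) ÷ d) (λ b → f (a ℕ.* (d ℕ.* b))))
          ≡⟨ cong (w a *_) (μ-hyperbola (λ k → f (a ℕ.* k)) (1≤÷ 1≤a a≤x) (ℕ.≤-trans (÷-≤ x a) x≤B)) ⟩
        w a * f (a ℕ.* 1) ≡⟨ cong (λ z → w a * f z) (ℕ.*-identityʳ a) ⟩
        w a * f a ∎
        where
        swap÷ : ∀ d → 1 ℕ.≤ d → (x ÷ d) ÷ a ≡ (x ÷ a) ÷ d
        swap÷ d 1≤d = trans (÷-÷ x d a 1≤d 1≤a) (trans (cong (x ÷_) (ℕ.*-comm d a)) (sym (÷-÷ x a d 1≤a 1≤d)))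
        perm : ∀ d b → d ℕ.* (a ℕ.* b) ≡ a ℕ.* (d ℕ.* b)
        perm d b = trans (sym (ℕ.*-assoc d a b)) (trans (cong (ℕ._* b) (ℕ.*-comm d a)) (ℕ.*-assoc a d b))

    -- One factor log m is opened as a sum of Λ(a) with m = a b; the other splits as log a + log b,
    -- and log b is opened once more.
    ∑ℓ²-expand : ∀ {y} (g : ℕ → F) → y ℕ.≤ B → ∑ y (λ m → ℓ m * ℓ m * g m) ≡
      ∑ y (λ a → Λ a * ℓ a * ∑ (y ÷ a) (λ b → g (a ℕ.* b))) +
      ∑ y (λ a → Λ a * ∑ (y ÷ a) (λ c → Λ c * ∑ ((y ÷ a) ÷ c) (λ b → g (a ℕ.* (c ℕ.* b)))))
    ∑ℓ²-expand {y} g y≤B = begin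
      ∑ y (λ m → ℓ m * ℓ m * g m) ≡⟨ ∑-cong′ y (λ m → (solve 2 (λ a b → a :* a :* b := a :* b :* a) refl (ℓ m)
            (g m))) ⟩
      ∑ y (λ m → ℓ m * g m * ℓ m) ≡⟨ sym (Λ-hyperbola {y} (λ m → ℓ m * g m)) ⟩
      ∑ y (λ a → Λ a * ∑ (y ÷ a) (λ b → ℓ (a ℕ.* b) * g (a ℕ.* b))) ≡⟨ ∑-cong y (λ a p _ → term a p) ⟩
      ∑ y (λ a → Λ a * ℓ a * ∑ (y ÷ a) (λ b → g (a ℕ.* b)) + Λ a * ∑ (y ÷ a) (λ c → Λ c * ∑ ((y ÷ a) ÷ c) (λ b → g (a ℕ.* (c ℕ.* b)))))
        ≡⟨ ∑-+ y _ _ ⟩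
      _ ∎
      where
      open ≡-Reasoning
      term : ∀ a → 1 ℕ.≤ a → Λ a * ∑ (y ÷ a) (λ b → ℓ (a ℕ.* b) * g (a ℕ.* b)) ≡
        Λ a * ℓ a * ∑ (y ÷ a) (λ b → g (a ℕ.* b)) + Λ a * ∑ (y ÷ a) (λ c → Λ c * ∑ ((y ÷ a) ÷ c) (λ b → g (a ℕ.* (c ℕ.* b))))
      term a 1≤a = begin
        Λ a * ∑ (y ÷ a) (λ b → ℓ (a ℕ.* b) * g (a ℕ.* b))
          ≡⟨ cong (Λ a *_) (∑-cong (y ÷ a) (λ b p q → trans (cong (_* g (a ℕ.* b)) (ℓ-* 1≤a p (ℕ.≤-trans (≤÷⇒*≤ {y} {a} q) y≤B)))
               (solve 3 (λ a b c → (a :+ b) :* c := a :* c :+ c :* b) refl (ℓ a) (ℓ b) (g (a ℕ.* b))))) ⟩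
        Λ a * ∑ (y ÷ a) (λ b → ℓ a * g (a ℕ.* b) + g (a ℕ.* b) * ℓ b)
          ≡⟨ cong (Λ a *_) (trans (∑-+ (y ÷ a) _ _) (cong₂ _+_ (∑-*ˡ (y ÷ a) (ℓ a) _) (sym (Λ-hyperbola {y ÷ a} (λ b → g (a ℕ.* b)))))) ⟩
        Λ a * (ℓ a * U + V) ≡⟨ (solve 4 (λ a b c d → a :* (b :* c :+ d) := a :* b :* c :+ a :* d) refl (Λ a) (ℓ
              a) U V) ⟩
        Λ a * ℓ a * U + Λ a * V ∎
        where
        U = ∑ (y ÷ a) (λ b → g (a ℕ.* b))
        V = ∑ (y ÷ a) (λ c → Λ c * ∑ ((y ÷ a) ÷ c) (λ b → g (a ℕ.* (c ℕ.* b))))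

    -- After `∑ℓ²-expand` a free innermost variable remains in both sums, and summing it against
    -- μ(d) collapses it.
    selberg-identity : ∀ {x} (f : ℕ → F) → x ℕ.≤ B →
      ∑ x (λ d → μ d * ∑ (x ÷ d) (λ m → ℓ m * ℓ m * f (d ℕ.* m))) ≡
      ∑ x (λ a → Λ a * ℓ a * f a) + ∑ x (λ a → Λ a * ∑ (x ÷ a) (λ b → Λ b * f (a ℕ.* b)))
    selberg-identity {x} f x≤B = begin
      ∑ x (λ d → μ d * ∑ (x ÷ d) (λ m → ℓ m * ℓ m * f (d ℕ.* m)))
        ≡⟨ ∑-cong′ x (λ d → trans (cong (μ d *_) (∑ℓ²-expand (λ m → f (d ℕ.* m)) (ℕ.≤-trans (÷-≤ x d) x≤B)))
             (solve 3 (λ a b c → a :* (b :+ c) := a :* b :+ a :* c) refl (μ d) (U d) (V d))) ⟩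
      ∑ x (λ d → μ d * U d + μ d * V d) ≡⟨ ∑-+ x _ _ ⟩
      ∑ x (λ d → μ d * U d) + ∑ x (λ d → μ d * V d) ≡⟨ cong₂ _+_ (μ-collapse (λ a → Λ a * ℓ a) f x≤B) second ⟩
      _ ∎
      where
      open ≡-Reasoning
      U V : ℕ → F
      U d = ∑ (x ÷ d) (λ a → Λ a * ℓ a * ∑ ((x ÷ d) ÷ a) (λ b → f (d ℕ.* (a ℕ.* b))))
      V d = ∑ (x ÷ d) (λ a → Λ a * ∑ ((x ÷ d) ÷ a) (λ c → Λ c * ∑ (((x ÷ d) ÷ a) ÷ c) (λ b → f (d ℕ.* (a ℕ.* (c ℕ.* b))))))
      W : ℕ → ℕ → F
      W d a = ∑ ((x ÷ d) ÷ a) (λ c → Λ c * ∑ (((x ÷ d) ÷ a) ÷ c) (λ b → f (d ℕ.* (a ℕ.* (c ℕ.* b)))))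
      W′ : ℕ → ℕ → F
      W′ a d = ∑ ((x ÷ a) ÷ d) (λ c → Λ c * ∑ (((x ÷ a) ÷ d) ÷ c) (λ b → f (a ℕ.* (d ℕ.* (c ℕ.* b)))))
      W-W′ : ∀ d a → 1 ℕ.≤ d → 1 ℕ.≤ a → W d a ≡ W′ a d
      W-W′ d a 1≤d 1≤a = trans (cong (λ z → ∑ z (λ c → Λ c * ∑ (z ÷ c) (λ b → f (d ℕ.* (a ℕ.* (c ℕ.* b))))))
          (trans (÷-÷ x d a 1≤d 1≤a) (trans (cong (x ÷_) (ℕ.*-comm d a)) (sym (÷-÷ x a d 1≤a 1≤d)))))
        (∑-cong′ ((x ÷ a) ÷ d) (λ c → cong (Λ c *_) (∑-cong′ (((x ÷ a) ÷ d) ÷ c) (λ b → cong f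
          (trans (sym (ℕ.*-assoc d a (c ℕ.* b))) (trans (cong (ℕ._* (c ℕ.* b)) (ℕ.*-comm d a)) (ℕ.*-assoc a d (c ℕ.* b))))))))
      second : ∑ x (λ d → μ d * V d) ≡ ∑ x (λ a → Λ a * ∑ (x ÷ a) (λ b → Λ b * f (a ℕ.* b)))
      second = begin
        ∑ x (λ d → μ d * V d) ≡⟨ ∑-cong′ x (λ d → sym (∑-*ˡ (x ÷ d) (μ d) _)) ⟩
        ∑ x (λ d → ∑ (x ÷ d) (λ a → μ d * (Λ a * W d a))) ≡⟨ ∑-÷-swap x (λ d a → μ d * (Λ a * W d a)) ⟩
        ∑ x (λ a → ∑ (x ÷ a) (λ d → μ d * (Λ a * W d a))) ≡⟨ ∑-cong x (λ a p _ → trans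
            (∑-cong (x ÷ a) (λ d q _ → trans (solve 3 (λ a b c → a :* (b :* c) := b :* (a :* c)) refl (μ d) (Λ
                  a) (W d a)) (cong (λ z → Λ a * (μ d * z)) (W-W′ d a q p))))
            (trans (∑-*ˡ (x ÷ a) (Λ a) _) (cong (Λ a *_) (μ-collapse Λ (λ k → f (a ℕ.* k)) (ℕ.≤-trans (÷-≤ x a) x≤B))))) ⟩
        ∑ x (λ a → Λ a * ∑ (x ÷ a) (λ b → Λ b * f (a ℕ.* b))) ∎

  -- Functions on the units modulo M.

  module Classes (m : ℕ) where

    open Residues m public

    infix 4 _≋?_
    _≋?_ : ∀ a b → Dec (a ≋ b)
    a ≋? b with a ℕ.% M ℕ.≟ b ℕ.% M
    ... | yes e = yes (mk≋ e)
    ... | no ¬e = no (λ e → ¬e (residue e))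

    δ : ℕ → ℕ → F
    δ a b = 𝟙 (a ≋? b)

    unit : ℕ → F
    unit n = 𝟙 (coprime? n M)

    Invariant : (ℕ → F) → Set
    Invariant f = ∀ {a b} → a ≋ b → f a ≡ f b

    δ-congˡ : ∀ {a a′} b → a ≋ a′ → δ a b ≡ δ a′ b
    δ-congˡ {a} {a′} b e = 𝟙-cong (a ≋? b) (a′ ≋? b) (≋-trans (≋-sym e)) (≋-trans e)

    δ-congʳ : ∀ a {b b′} → b ≋ b′ → δ a b ≡ δ a b′
    δ-congʳ a {b} {b′} e = 𝟙-cong (a ≋? b) (a ≋? b′) (λ p → ≋-trans p e) (λ p → ≋-trans p (≋-sym e))

    unit-invariant : Invariant unit
    unit-invariant {a} {b} e = 𝟙-cong (coprime? a M) (coprime? b M) (coprime-resp-≋ e) (coprime-resp-≋ (≋-sym e))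

    unit-* : ∀ a b → unit (a ℕ.* b) ≡ unit a * unit b
    unit-* a b with coprime? a M
    ... | no ¬c = trans (𝟙-no (coprime? (a ℕ.* b) M) (λ c → ¬c (coprime-factorˡ {a} {b} c))) (solve 1 (λ a →
          num 0 := num 0 :* a) refl (unit b))
    ... | yes c = trans (𝟙-cong (coprime? (a ℕ.* b) M) (coprime? b M) (coprime-factorʳ {a}) (coprime-*ˡ {a} c)) (solve
          1 (λ a → a := num 1 :* a) refl (unit b))

    ∑-δ : ∀ n {f} → Invariant f → ∑ M (λ r → δ n r * f r) ≡ f n
    ∑-δ n {f} inv-f with representative n
    ... | r₀ , 1≤r₀ , r₀≤M , e = trans (∑-cong M (λ r p q → cong (_* f r) (𝟙-cong (n ≋? r) (r ℕ.≟ r₀)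
        (λ h → representative-unique p q 1≤r₀ r₀≤M (≋-trans (≋-sym h) e)) (λ { refl → e }))))
      (trans (∑-𝟙 M r₀ f 1≤r₀ r₀≤M) (inv-f (≋-sym e)))

    ∑ᵘ : (ℕ → F) → F
    ∑ᵘ f = ∑ M (λ r → unit r * f r)

    -- The permutation is never built: f(s r) is written as a sum of δ(s r, t) f(t), the sums are
    -- exchanged, and for each t exactly one class r solves s r ≋ t.
    ∑ᵘ-permute : ∀ s {f} → Coprime s M → Invariant f → ∑ᵘ (λ r → f (s ℕ.* r)) ≡ ∑ᵘ f
    ∑ᵘ-permute s {f} c inv-f with inverse c
    ... | s′ , e = begin
      ∑ M (λ r → unit r * f (s ℕ.* r)) ≡⟨ ∑-cong′ M (λ r → trans (cong (unit r *_) (sym (∑-δ (s ℕ.* r) inv-f))) (sym (∑-*ˡ M (unit r) _))) ⟩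
      ∑ M (λ r → ∑ M (λ t → unit r * (δ (s ℕ.* r) t * f t))) ≡⟨ ∑-swap M M _ ⟩
      ∑ M (λ t → ∑ M (λ r → unit r * (δ (s ℕ.* r) t * f t))) ≡⟨ ∑-cong′ M (λ t → trans (∑-cong′ M (λ r → swap t r)) (trans (∑-*ʳ M (f t) _) (cong (_* f t) (single t)))) ⟩
      ∑ M (λ t → unit t * f t) ∎
      where
      open ≡-Reasoning
      c′ : Coprime s′ M
      c′ = inverse-coprime s e
      swap : ∀ t r → unit r * (δ (s ℕ.* r) t * f t) ≡ δ (s′ ℕ.* t) r * unit r * f t
      swap t r = trans (cong (λ z → unit r * (z * f t)) (𝟙-cong (s ℕ.* r ≋? t) (s′ ℕ.* t ≋? r) (≋-divide s s′ e) (≋-multiply s s′ e)))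
        (solve 3 (λ a b c → a :* (b :* c) := b :* a :* c) refl (unit r) (δ (s′ ℕ.* t) r) (f t))
      single : ∀ t → ∑ M (λ r → δ (s′ ℕ.* t) r * unit r) ≡ unit t
      single t = trans (∑-δ (s′ ℕ.* t) unit-invariant) (trans (unit-* s′ t) (𝟙-yes* (coprime? s′ M) c′ (unit t)))

    ∑ᵘ-δ : ∀ a → ∑ᵘ (λ g → δ a g) ≡ unit a
    ∑ᵘ-δ a = trans (∑-cong′ M (λ g → (solve 2 (λ a b → a :* b := b :* a) refl (unit g) (δ a g)))) (∑-δ a unit-invariant)

    -- One solution k if d is a unit and none otherwise. What matters is that the count does not
    -- depend on g.
    ∑-δ-multiples : ∀ d {g} → Coprime g M → ∑ M (λ k → δ (d ℕ.* k) g) ≡ unit d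
    ∑-δ-multiples d {g} cg with coprime? d M
    ... | no ¬c = ∑-zero′ M (λ k _ _ → 𝟙-no (d ℕ.* k ≋? g) (λ e → ¬c (coprime-factorˡ {d} {k} (coprime-resp-≋ (≋-sym e) cg))))
    ... | yes c with inverse c
    ... | d′ , e = trans (∑-cong′ M (λ k → trans (𝟙-cong (d ℕ.* k ≋? g) (d′ ℕ.* g ≋? k) (≋-divide d d′ e) (≋-multiply d d′ e))
        (solve 1 (λ a → a := a :* num 1) refl (δ (d′ ℕ.* g) k)))) (∑-δ (d′ ℕ.* g) {λ _ → # 1} (λ _ → refl))

    -- Comparing two unit classes gives a periodic function of mean zero. So no main term has to be
    -- computed for a single class, only for the total over all classes.
    oscillation : ℕ → ℕ → ℕ → ℕ → F
    oscillation d g g′ k = δ (d ℕ.* k) g - δ (d ℕ.* k) g′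

    oscillation-∣∣ : ∀ d {g g′} → Coprime g M → Coprime g′ M → ∀ n → ∣ ∑ n (oscillation d g g′) ∣≤ # M
    oscillation-∣∣ d {g} {g′} cg cg′ = ∑-periodic-∣∣ M (oscillation d g g′) (s≤s z≤n)
        (λ k → cong₂ _-_ (δ-congˡ g (per k)) (δ-congˡ g′ (per k)))
        (λ k → (lin (↑ (𝟙-≤1 (d ℕ.* k ≋? g)) ⊕ (𝟙-nonneg (d ℕ.* k ≋? g′))) (solve 2 (λ a b → num 1 :- (a :- b)
              := num 1 :- a :+ b) refl (δ (d ℕ.* k) g) (δ (d ℕ.* k) g′)))
             , (lin (↑ (𝟙-≤1 (d ℕ.* k ≋? g′)) ⊕ (𝟙-nonneg (d ℕ.* k ≋? g))) (solve 2 (λ a b → num 1 :- :- (a :-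
                   b) := num 1 :- b :+ a) refl (δ (d ℕ.* k) g) (δ (d ℕ.* k) g′))))
        (trans (∑-- M _ _) (trans (cong₂ _-_ (∑-δ-multiples d cg) (∑-δ-multiples d cg′)) (solve 1 (λ a → a :- a
              := num 0) refl (unit d))))
      where
      per : ∀ k → d ℕ.* (M ℕ.+ k) ≋ d ℕ.* k
      per k = ≋-*ˡ d (mk≋ (trans (cong (ℕ._% M) (ℕ.+-comm M k)) (ℕ.[m+n]%n≡m%n k M)))

  -- Selberg's formula in arithmetic progressions.

  module Selberg (B m : ℕ) (M≤B : suc m ℕ.≤ B) where

    open Estimates B public
    open Classes m public

    -- The mass of a class, the two sums of Selberg's formula, over prime powers and over pairs of
    -- them, and their total. Proper prime powers are kept.
    A P J S : ℕ → ℕ → F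
    A g x = ∑ x (λ a → δ a g * Λ/ a)
    P g x = ∑ x (λ a → δ a g * (Λ/ a * ℓ a))
    J g x = ∑ x (λ a → Λ/ a * ∑ (x ÷ a) (λ b → δ (a ℕ.* b) g * Λ/ b))
    S g x = P g x + J g x

    S-identity : ∀ g {x} → x ℕ.≤ B → S g x ≡ ∑ x (λ d → μ d * inv d * ∑ (x ÷ d) (λ k → δ (d ℕ.* k) g * (ℓ k * ℓ k * inv k)))
    S-identity g {x} x≤B = trans (cong₂ _+_ (∑-cong′ x (λ a → (solve 4 (λ a b c d → a :* (b :* c :* d) := b :*
          d :* (a :* c)) refl (δ a g) (Λ a) (inv a) (ℓ a))))
        (∑-cong′ x (λ a → trans (solve 3 (λ a b c → a :* b :* c := a :* (b :* c)) refl (Λ a) (inv a) (∑ (x ÷ a)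
              (λ b → δ (a ℕ.* b) g * Λ/ b)))
          (cong (Λ a *_) (trans (sym (∑-*ˡ (x ÷ a) (inv a) _)) (∑-cong′ (x ÷ a) (λ b → trans
            (solve 4 (λ a b c d → a :* (b :* (c :* d)) := c :* (b :* (a :* d))) refl (inv a) (δ (a ℕ.* b) g) (Λ
                  b) (inv b)) (cong (λ z → Λ b * (δ (a ℕ.* b) g * z)) (sym (inv-* a b))))))))))
      (trans (sym (selberg-identity (λ n → δ n g * inv n) x≤B))
        (∑-cong′ x (λ d → trans (cong (μ d *_) (trans (∑-cong′ (x ÷ d) (λ k → trans (cong (λ z → ℓ k * ℓ k * (δ (d ℕ.* k) g * z)) (inv-* d k))
            (solve 4 (λ a b c d → a :* a :* (b :* (c :* d)) := c :* (b :* (a :* a :* d))) refl (ℓ k) (δ (d ℕ.*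
                  k) g) (inv d) (inv k)))) (∑-*ˡ (x ÷ d) (inv d) _)))
          (solve 3 (λ a b c → a :* (b :* c) := a :* b :* c) refl (μ d) (inv d) (∑ (x ÷ d) (λ k → δ (d ℕ.* k) g
                * (ℓ k * ℓ k * inv k)))))))

    -- The trivial bound for Σ μ(d)/d suffices here.
    S-difference : ∀ {g g′ x} → Coprime g M → Coprime g′ M → x ℕ.≤ B → ∣ S g x - S g′ x ∣≤ # 100 * # M * H x
    S-difference {g} {g′} {x} cg cg′ x≤B = ∣∣-cong split (∣∣-weaken bound (∑-∣∣ x term))
      where
      T : ℕ → F
      T d = ∑ (x ÷ d) (λ k → oscillation d g g′ k * (ℓ k * ℓ k * inv k))
      split : S g x - S g′ x ≡ ∑ x (λ d → μ d * inv d * T d)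
      split = trans (cong₂ _-_ (S-identity g x≤B) (S-identity g′ x≤B)) (trans (sym (∑-- x _ _)) (∑-cong′ x (λ d → trans
        (solve 4 (λ a b c d → a :* b :* c :- a :* b :* d := a :* b :* (c :- d)) refl (μ d) (inv d) (∑ (x ÷ d)
              (λ k → δ (d ℕ.* k) g * (ℓ k * ℓ k * inv k))) (∑ (x ÷ d) (λ k → δ (d ℕ.* k) g′ * (ℓ k * ℓ k * inv
              k))))
        (cong (μ d * inv d *_) (trans (sym (∑-- (x ÷ d) _ _)) (∑-cong′ (x ÷ d) (λ k →
          (solve 4 (λ a b c d → a :* (b :* b :* c) :- d :* (b :* b :* c) := (a :- d) :* (b :* b :* c)) refl (δ
                (d ℕ.* k) g) (ℓ k) (inv k) (δ (d ℕ.* k) g′)))))))))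
      term : ∀ d → 1 ℕ.≤ d → d ℕ.≤ x → ∣ μ d * inv d * T d ∣≤ # 1 * inv d * (# 100 * # M)
      term d p q = ∣∣-* (∣∣-* (μ-∣∣ d) (∣∣-of-nonneg (inv-nonneg d)))
        (∑eℓ²/n (oscillation d g g′) (# M) (oscillation-∣∣ d cg cg′) (x ÷ d) (1≤÷ p q) (ℕ.≤-trans (÷-≤ x d) x≤B))
      bound : ∑ x (λ d → # 1 * inv d * (# 100 * # M)) ≤ # 100 * # M * H x
      bound = ≡⇒≤ (trans (∑-cong′ x (λ d → (solve 2 (λ a b → num 1 :* a :* (num 100 :* b) := num 100 :* b :* a)
            refl (inv d) (# M)))) (∑-*ˡ x (# 100 * # M) inv))

    A′ : ℕ → F
    A′ x = ∑ x (λ a → unit a * Λ/ a)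

    -- Mertens' error 8, plus the mass of the prime powers not coprime to M.
    C₁ : F
    C₁ = # 8 + # 2 * # M * # M

    A′-∣∣ : ∀ {x} → 1 ℕ.≤ x → suc x ℕ.≤ B → ∣ A′ x - ℓ x ∣≤ C₁
    A′-∣∣ {x} 1≤x x<B =
        (lin (↑ (proj₁ (mertens x 1≤x x<B)) ⊕ eq* (- # 1) split ⊕ R≥0 ⊕ nn 2 ⊗ ((nn M ⊗ nn M))) (solve 5 (λ a b
              c d e → num 8 :+ num 2 :* c :* c :- (a :- b) := num 8 :- (d :- b) :+ :- (num 1) :* (a :+ e :- d)
              :+ e :+ num 2 :* (c :* c)) refl (A′ x) (ℓ x) (# M) (∑ x Λ/) R))
      , (lin (↑ (proj₂ (mertens x 1≤x x<B)) ⊕ eq* (# 1) split ⊕ ↑ small) (solve 5 (λ a b c d e → num 8 :+ num 2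
            :* c :* c :- :- (a :- b) := num 8 :- :- (d :- b) :+ num 1 :* (a :+ e :- d) :+ (num 2 :* c :* c :-
            e)) refl (A′ x) (ℓ x) (# M) (∑ x Λ/) R))
      where
      R = ∑ x (λ a → (# 1 - unit a) * Λ/ a)
      split : ∑ x Λ/ ≡ A′ x + R
      split = trans (∑-cong′ x (λ a → (solve 2 (λ a b → a := b :* a :+ (num 1 :- b) :* a) refl (Λ/ a) (unit a)))) (∑-+ x _ _)
      1-unit : ∀ a → # 0 ≤ # 1 - unit a
      1-unit a = ↑ (𝟙-≤1 (coprime? a M))
      R≥0 : # 0 ≤ R
      R≥0 = ∑-nonneg x (λ a _ _ → 1-unit a ⊗ Λ/≥0 a)
      small : R ≤ # 2 * # M * # M
      small = Λ/-small-primes x M (λ a → # 1 - unit a) M≤B 1-unit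
        (λ a → (lin ((𝟙-nonneg (coprime? a M))) (solve 1 (λ a → num 1 :- (num 1 :- a) := a) refl (unit a))))
        (λ p j pp _ p≰M → trans (cong (λ z → # 1 - z) (𝟙-yes (coprime? (p ℕ.^ j) M) (coprime-^ˡ j (prime∤⇒coprime pp (λ d → p≰M (∣⇒≤ d)))))) (solve
              0 (num 1 :- num 1 := num 0) refl))

    ∑ᵘ-∑ : ∀ x (h : ℕ → ℕ → F) → ∑ᵘ (λ g → ∑ x (h g)) ≡ ∑ x (λ a → ∑ᵘ (λ g → h g a))
    ∑ᵘ-∑ x h = trans (∑-cong′ M (λ g → sym (∑-*ˡ x (unit g) (h g)))) (∑-swap M x _)

    ∑ᵘ-δ* : ∀ a c → ∑ᵘ (λ g → δ a g * c) ≡ unit a * c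
    ∑ᵘ-δ* a c = trans (∑-cong′ M (λ g → (solve 3 (λ a b c → a :* (b :* c) := a :* b :* c) refl (unit g) (δ a g)
          c))) (trans (∑-*ʳ M c _) (cong (_* c) (∑ᵘ-δ a)))

    ∑ᵘA : ∀ x → ∑ᵘ (λ g → A g x) ≡ A′ x
    ∑ᵘA x = trans (∑ᵘ-∑ x _) (∑-cong′ x (λ a → ∑ᵘ-δ* a (Λ/ a)))

    P′ J′ : ℕ → F
    P′ x = ∑ x (λ a → unit a * (Λ/ a * ℓ a))
    J′ x = ∑ x (λ a → unit a * Λ/ a * A′ (x ÷ a))

    ∑ᵘS : ∀ x → ∑ᵘ (λ g → S g x) ≡ P′ x + J′ x
    ∑ᵘS x = trans (∑-cong′ M (λ g → (solve 3 (λ a b c → a :* (b :+ c) := a :* b :+ a :* c) refl (unit g) (P g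
          x) (J g x)))) (trans (∑-+ M _ _) (cong₂ _+_ totP totJ))
      where
      totP : ∑ᵘ (λ g → P g x) ≡ P′ x
      totP = trans (∑ᵘ-∑ x _) (∑-cong′ x (λ a → ∑ᵘ-δ* a (Λ/ a * ℓ a)))
      totJ : ∑ᵘ (λ g → J g x) ≡ J′ x
      totJ = trans (∑ᵘ-∑ x _) (∑-cong′ x (λ a → trans (trans
          (∑-cong′ M (λ g → (solve 3 (λ a b c → a :* (b :* c) := b :* (a :* c)) refl (unit g) (Λ/ a) (∑ (x ÷ a)
                (λ b → δ (a ℕ.* b) g * Λ/ b)))))
          (trans (∑-*ˡ M (Λ/ a) _) (cong (Λ/ a *_) (trans (∑ᵘ-∑ (x ÷ a) _) (trans (∑-cong′ (x ÷ a) (λ b → trans (∑ᵘ-δ* (a ℕ.* b) (Λ/ b))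
            (trans (cong (_* Λ/ b) (unit-* a b)) (solve 3 (λ a b c → a :* b :* c := a :* (b :* c)) refl (unit
                  a) (unit b) (Λ/ b))))) (∑-*ˡ (x ÷ a) (unit a) _))))))
        (solve 3 (λ a b c → a :* (b :* c) := b :* a :* c) refl (Λ/ a) (unit a) (A′ (x ÷ a)))))

    -- a⌊x/a⌋ ≤ x ≤ 2a⌊x/a⌋, and ℓ(2) ≤ 2.
    ℓ-÷ : ∀ {x a} → 1 ℕ.≤ a → a ℕ.≤ x → x ℕ.+ x ℕ.≤ B → ∣ ℓ (x ÷ a) - (ℓ x - ℓ a) ∣≤ # 2
    ℓ-÷ {x} {a} 1≤a a≤x 2x≤B =
        (lin (eq* (- # 1) (ℓ-* 1≤a 1≤q aq≤B) ⊕ ↑ (ℓ-mono (ℕ.*-mono-≤ 1≤a 1≤q) (*-÷-≤ x a) x≤B) ⊕ nn 2) (solve 4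
              (λ a b c d → num 2 :- (a :- (b :- c)) := :- (num 1) :* (c :+ a :- d) :+ (b :- d) :+ num 2) refl (ℓ
              q) (ℓ x) (ℓ a) (ℓ (a ℕ.* q))))
      , (lin (eq* (# 1) (ℓ-* 1≤a 1≤q aq≤B) ⊕ eq* (# 1) (ℓ-* {2} {a ℕ.* q} (s≤s z≤n) (ℕ.*-mono-≤ 1≤a 1≤q) le) ⊕
            ↑ (ℓ-mono (ℕ.≤-trans 1≤a a≤x) up le) ⊕ ↑ (ℓ-2 (ℕ.≤-trans (ℕ.+-mono-≤ 1≤x 1≤x) 2x≤B))) (solve 6 (λ a
            b c d e f → num 2 :- :- (a :- (b :- c)) := num 1 :* (c :+ a :- d) :+ num 1 :* (e :+ d :- f) :+ (f :-
            b) :+ (num 2 :- e)) refl (ℓ q) (ℓ x) (ℓ a) (ℓ (a ℕ.* q)) (ℓ 2) (ℓ (2 ℕ.* (a ℕ.* q)))))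
      where
      q = x ÷ a
      1≤x : 1 ℕ.≤ x
      1≤x = ℕ.≤-trans 1≤a a≤x
      x≤B : x ℕ.≤ B
      x≤B = ℕ.≤-trans (ℕ.m≤m+n x x) 2x≤B
      1≤q : 1 ℕ.≤ q
      1≤q = 1≤÷ 1≤a a≤x
      aq≤B : a ℕ.* q ℕ.≤ B
      aq≤B = ℕ.≤-trans (*-÷-≤ x a) x≤B
      dbl : ∀ k → 2 ℕ.* k ≡ k ℕ.+ k
      dbl k = cong (k ℕ.+_) (ℕ.+-identityʳ k)
      le : 2 ℕ.* (a ℕ.* q) ℕ.≤ B
      le = ℕ.≤-trans (ℕ.≤-reflexive (dbl (a ℕ.* q))) (ℕ.≤-trans (ℕ.+-mono-≤ (*-÷-≤ x a) (*-÷-≤ x a)) 2x≤B)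
      up : x ℕ.≤ 2 ℕ.* (a ℕ.* q)
      up = ℕ.≤-trans (ℕ.<⇒≤ (<-*-suc÷ x a 1≤a)) (ℕ.≤-trans (ℕ.≤-reflexive (ℕ.*-suc a q))
        (ℕ.≤-trans (ℕ.+-monoˡ-≤ (a ℕ.* q) (ℕ.m≤m*n a q {{ℕ.>-nonZero 1≤q}})) (ℕ.≤-reflexive (sym (dbl (a ℕ.* q))))))

    private
      <B : ∀ {x} → 1 ℕ.≤ x → x ℕ.+ x ℕ.≤ B → suc x ℕ.≤ B
      <B {x} 1≤x 2x≤B = ℕ.≤-trans (ℕ.+-monoˡ-≤ x 1≤x) 2x≤B

    C₁≥0 : # 0 ≤ C₁
    C₁≥0 = nn 8 ⊕ (nn 2 ⊗ nn M ⊗ nn M)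

    -- P′ cancels: J′ = Σ Λ(a)/a · log (x/a) up to O(log x).
    ∑ᵘS-∣∣ : ∀ {x} → 1 ℕ.≤ x → x ℕ.+ x ℕ.≤ B → ∣ P′ x + J′ x - ℓ x * ℓ x ∣≤ (C₁ + # 2) * A′ x + ℓ x * C₁
    ∑ᵘS-∣∣ {x} 1≤x 2x≤B = ∣∣-cong split (∣∣-+ (∣∣-weaken total (∑-∣∣ x term)) (∣∣-* (∣∣-of-nonneg (ℓ-nonneg 1≤x (ℕ.<⇒≤ (<B 1≤x 2x≤B)))) (A′-∣∣ 1≤x (<B 1≤x 2x≤B))))
      where
      E : ℕ → F
      E a = (A′ (x ÷ a) - ℓ (x ÷ a)) + (ℓ (x ÷ a) - (ℓ x - ℓ a))
      merge : P′ x + J′ x - ℓ x * A′ x ≡ ∑ x (λ a → unit a * Λ/ a * E a)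
      merge = trans (cong₂ _-_ (sym (∑-+ x _ _)) (sym (∑-*ˡ x (ℓ x) _))) (trans (sym (∑-- x _ _)) (∑-cong′ x (λ a →
        (solve 6 (λ a b c d e f → a :* (b :* c) :+ a :* b :* d :- e :* (a :* b) := a :* b :* (d :- f :+ (f :-
              (e :- c)))) refl (unit a) (Λ/ a) (ℓ a) (A′ (x ÷ a)) (ℓ x) (ℓ (x ÷ a))))))
      split : P′ x + J′ x - ℓ x * ℓ x ≡ ∑ x (λ a → unit a * Λ/ a * E a) + ℓ x * (A′ x - ℓ x)
      split = trans (solve 4 (λ a b c d → a :+ b :- c :* c := a :+ b :- c :* d :+ c :* (d :- c)) refl (P′ x)
            (J′ x) (ℓ x) (A′ x)) (cong (_+ ℓ x * (A′ x - ℓ x)) merge)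
      term : ∀ a → 1 ℕ.≤ a → a ℕ.≤ x → ∣ unit a * Λ/ a * E a ∣≤ unit a * Λ/ a * (C₁ + # 2)
      term a p q = ∣∣-* (∣∣-of-nonneg (𝟙-nonneg (coprime? a M) ⊗ Λ/≥0 a)) (∣∣-+ (A′-∣∣ (1≤÷ p q) (ℕ.≤-trans (s≤s (÷-≤ x a)) (<B 1≤x 2x≤B))) (ℓ-÷ p q 2x≤B))
      total : ∑ x (λ a → unit a * Λ/ a * (C₁ + # 2)) ≤ (C₁ + # 2) * A′ x
      total = ≡⇒≤ (trans (∑-*ʳ x (C₁ + # 2) _) (solve 2 (λ a b → a :* (b :+ num 2) := (b :+ num 2) :* a) refl
            (A′ x) C₁))

    -- The value φ(M) as a field element.
    N : F
    N = ∑ M unit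

    N≤M : N ≤ # M
    N≤M = subst (N ≤_) (trans (∑-const M (# 1)) (solve 1 (λ a → a :* num 1 := a) refl (# M))) (∑-mono M (λ r _ _ → 𝟙-≤1 (coprime? r M)))

    N≥0 : # 0 ≤ N
    N≥0 = ∑-nonneg M (λ r _ _ → 𝟙-nonneg (coprime? r M))

    -- M times the bound of `S-difference`, with H ≤ 1 + 2 log, gives 200 M²; the rest comes from
    -- `∑ᵘS-∣∣`.
    C₂ : F
    C₂ = # 200 * # M * # M + C₁ + (C₁ + # 2) * C₁

    -- N S(g) is the sum of S(g) - S(g′) over the unit classes g′ plus the sum of the S(g′). The
    -- differences are O(log x) and the total is known.
    selberg : ∀ {g x} → Coprime g M → 1 ℕ.≤ x → x ℕ.+ x ℕ.≤ B → ∣ N * S g x - ℓ x * ℓ x ∣≤ C₂ * (# 1 + ℓ x)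
    selberg {g} {x} cg 1≤x 2x≤B = ∣∣-cong split (∣∣-weaken bound (∣∣-+ (∑-∣∣ M term) (∑ᵘS-∣∣ 1≤x 2x≤B)))
      where
      x≤B : x ℕ.≤ B
      x≤B = ℕ.<⇒≤ (<B 1≤x 2x≤B)
      split : N * S g x - ℓ x * ℓ x ≡ ∑ M (λ g′ → unit g′ * (S g x - S g′ x)) + (P′ x + J′ x - ℓ x * ℓ x)
      split = trans (solve 5 (λ a b c d e → a :* b :- c :* c := a :* b :- (d :+ e) :+ (d :+ e :- c :* c)) refl
            N (S g x) (ℓ x) (P′ x) (J′ x)) (cong (_+ (P′ x + J′ x - ℓ x * ℓ x))
        (trans (cong₂ _-_ (sym (∑-*ʳ M (S g x) unit)) (sym (∑ᵘS x))) (trans (sym (∑-- M _ _)) (∑-cong′ M (λ g′ → (solve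
              3 (λ a b c → a :* b :- a :* c := a :* (b :- c)) refl (unit g′) (S g x) (S g′ x)))))))
      h = # 100 * # M * H x
      h≥0 : # 0 ≤ h
      h≥0 = nn 100 ⊗ nn M ⊗ ∑-nonneg x (λ i _ _ → inv-nonneg i)
      term : ∀ g′ → 1 ℕ.≤ g′ → g′ ℕ.≤ M → ∣ unit g′ * (S g x - S g′ x) ∣≤ h
      term g′ _ _ with coprime? g′ M
      ... | no _ = ∣∣-cong (solve 2 (λ a b → num 0 :* (a :- b) := num 0) refl (S g x) (S g′ x)) (∣∣-weaken h≥0 ∣∣-zero)
      ... | yes cg′ = ∣∣-cong (solve 2 (λ a b → num 1 :* (a :- b) := a :- b) refl (S g x) (S g′ x)) (S-difference cg cg′ x≤B)
      1≤C₁ : # 1 ≤ C₁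
      1≤C₁ = lin (nn 2 ⊗ ((nn M ⊗ nn M)) ⊕ nn 7) (solve 1 (λ a → num 8 :+ num 2 :* a :* a :- num 1 := num 2 :*
            (a :* a) :+ num 7) refl (# M))
      L≥0 = ℓ-nonneg 1≤x x≤B
      bound : ∑ M (λ _ → h) + ((C₁ + # 2) * A′ x + ℓ x * C₁) ≤ C₂ * (# 1 + ℓ x)
      bound = lin (eq* (# 1) (∑-const M h) ⊕ nn 100 ⊗ (↑ (H-≤-ℓ 1≤x x≤B) ⊗ (nn M ⊗ nn M)) ⊕ ↑ (proj₁ (A′-∣∣ 1≤x
            (<B 1≤x 2x≤B))) ⊗ (C₁≥0 ⊕ nn 2) ⊕ ↑ 1≤C₁ ⊗ (L≥0 ⊗ (C₁≥0 ⊕ nn 2)) ⊕ nn 100 ⊗ ((nn M ⊗ nn M)) ⊕ C₁≥0)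
            (solve 6 (λ a b c d e f → (num 200 :* e :* e :+ b :+ (b :+ num 2) :* b) :* (num 1 :+ d) :- (a :+ ((b
            :+ num 2) :* c :+ d :* b)) := num 1 :* (e :* (num 100 :* e :* f) :- a) :+ num 100 :* ((num 1 :+ num
            2 :* d :- f) :* (e :* e)) :+ (b :- (c :- d)) :* (b :+ num 2) :+ (b :- num 1) :* (d :* (b :+ num 2))
            :+ num 100 :* (e :* e) :+ b) refl (∑ M (λ _ → h)) C₁ (A′ x) (ℓ x) (# M) (H x))

  -- Powers, Bernoulli's inequality and Lambert series.

  ⁻¹-nonneg : ∀ {x} → # 1 ≤ x → # 0 ≤ x ⁻¹
  ⁻¹-nonneg {x} 1≤x with ≤-total (# 0) (x ⁻¹)
  ... | inj₁ p = p
  ... | inj₂ p = ⊥-elim (1≰0 (lin (↑ 1≤x ⊗ ↑ p ⊕ ↑ p ⊕ eq* (- # 1) e) (solve 2 (λ a b → num 0 :- num 1 := (a :-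
        num 1) :* (num 0 :- b) :+ (num 0 :- b) :+ :- (num 1) :* (num 1 :- a :* b)) refl x (x ⁻¹))))
    where
    e : x * x ⁻¹ ≡ # 1
    e = ⁻¹-inverse (λ q → 1≰0 (≤-trans 1≤x q))

  pow : F → ℕ → F
  pow q zero = # 1
  pow q (suc k) = q * pow q k

  pow-+ : ∀ q a b → pow q (a ℕ.+ b) ≡ pow q a * pow q b
  pow-+ q zero b = solve 1 (λ a → a := num 1 :* a) refl (pow q b)
  pow-+ q (suc a) b = trans (cong (q *_) (pow-+ q a b)) (solve 3 (λ a b c → a :* (b :* c) := a :* b :* c) refl
        q (pow q a) (pow q b))

  pow-square : ∀ y k → pow (y * y) k ≡ pow y k * pow y k
  pow-square y zero = solve 0 (num 1 := num 1 :* num 1) refl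
  pow-square y (suc k) = trans (cong (y * y *_) (pow-square y k)) (solve 2 (λ a b → a :* a :* (b :* b) := a :*
        b :* (a :* b)) refl y (pow y k))

  pow-≥0 : ∀ {q} k → # 0 ≤ q → # 0 ≤ pow q k
  pow-≥0 zero p = nn 1
  pow-≥0 (suc k) p = p ⊗ pow-≥0 k p

  pow-≤1 : ∀ {q} k → # 0 ≤ q → q ≤ # 1 → pow q k ≤ # 1
  pow-≤1 zero p r = ≤-refl
  pow-≤1 {q} (suc k) p r = lin (↑ (pow-≤1 k p r) ⊗ p ⊕ ↑ r) (solve 2 (λ a b → num 1 :- a :* b := (num 1 :- b)
        :* a :+ (num 1 :- a)) refl q (pow q k))

  pow-anti : ∀ {q a b} → # 0 ≤ q → q ≤ # 1 → a ℕ.≤ b → pow q b ≤ pow q a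
  pow-anti {q} {a} {b} p r a≤b = subst (λ z → pow q z ≤ pow q a) (ℕ.m+[n∸m]≡n a≤b)
    (lin (eq* (# 1) (pow-+ q a k) ⊕ ↑ (pow-≤1 k p r) ⊗ (pow-≥0 a p)) (solve 3 (λ a b c → b :- a := num 1 :* (b
          :* c :- a) :+ (num 1 :- c) :* b) refl (pow q (a ℕ.+ k)) (pow q a) (pow q k)))
    where k = b ℕ.∸ a

  bernoulli : ∀ {a} k → # 0 ≤ a → a ≤ # 1 → # 1 - # k * a ≤ pow (# 1 - a) k
  bernoulli {a} zero p r = lin (nn 0) (solve 1 (λ a → num 1 :- (num 1 :- num 0 :* a) := num 0) refl a)
  bernoulli {a} (suc k) p r = lin (↑ (bernoulli {a} k p r) ⊗ ↑ r ⊕ eq* (- # 1 * (a)) (#-suc k) ⊕ (nn k ⊗ p ⊗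
        p)) (solve 4 (λ a b c d → (num 1 :- b) :* c :- (num 1 :- a :* b) := (c :- (num 1 :- d :* b)) :* (num 1
        :- b) :+ :- (num 1) :* b :* (d :+ num 1 :- a) :+ d :* b :* b) refl (# (suc k)) a (pow (# 1 - a) k) (#
        k))

  bernoulli′ : ∀ {a} k → # 0 ≤ a → a ≤ # 1 → pow (# 1 - a) k * (# 1 + # k * a) ≤ # 1
  bernoulli′ {a} zero p r = lin (nn 0) (solve 1 (λ a → num 1 :- num 1 :* (num 1 :+ num 0 :* a) := num 0) refl
        a)
  bernoulli′ {a} (suc k) p r = lin (↑ (bernoulli′ {a} k p r) ⊕ eq* (# 1 * ((# 1 - a) * pow (# 1 - a) k * a))
        (#-suc k) ⊕ (pow-≥0 k (↑ r) ⊗ (nn k ⊗ p ⊗ p)) ⊕ (pow-≥0 k (↑ r) ⊗ (p ⊗ p))) (solve 4 (λ a b c d → num 1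
        :- (num 1 :- a) :* b :* (num 1 :+ c :* a) := num 1 :- b :* (num 1 :+ d :* a) :+ num 1 :* ((num 1 :- a)
        :* b :* a) :* (d :+ num 1 :- c) :+ b :* (d :* a :* a) :+ b :* (a :* a)) refl a (pow (# 1 - a) k) (# (suc
        k)) (# k))

  -- The weights 1/d − (1−q) q^d/(1−q^d), which decrease to 0.

  module Lambert (y : F) (0≤y : # 0 ≤ y) (y≤1 : y ≤ # 1) where

    -- A square, so that the geometric mean q^(d/2) of 1, q, ..., q^d is the power y^d.
    q : F
    q = y * y

    q≥0 : # 0 ≤ q
    q≥0 = 0≤y ⊗ 0≤y

    q≤1 : q ≤ # 1
    q≤1 = lin (↑ y≤1 ⊗ 0≤y ⊕ ↑ y≤1) (solve 1 (λ a → num 1 :- a :* a := (num 1 :- a) :* a :+ (num 1 :- a)) refl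
          y)

    geo : ℕ → F
    geo zero = # 0
    geo (suc d) = geo d + pow q d

    geo-suc : ∀ d → geo (suc d) ≡ # 1 + q * geo d
    geo-suc zero = solve 1 (λ a → num 0 :+ num 1 := num 1 :+ a :* num 0) refl q
    geo-suc (suc d) = trans (cong (_+ q * pow q d) (geo-suc d)) (solve 3 (λ a b c → num 1 :+ a :* b :+ a :* c
          := num 1 :+ a :* (b :+ c)) refl q (geo d) (pow q d))

    geo-closed : ∀ d → (# 1 - q) * geo d ≡ # 1 - pow q d
    geo-closed zero = solve 1 (λ a → (num 1 :- a) :* num 0 := num 1 :- num 1) refl q
    geo-closed (suc d) = trans (solve 3 (λ a b c → (num 1 :- a) :* (b :+ c) := (num 1 :- a) :* b :+ (num 1 :-
          a) :* c) refl q (geo d) (pow q d))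
      (trans (cong (_+ (# 1 - q) * pow q d) (geo-closed d)) (solve 2 (λ a b → num 1 :- a :+ (num 1 :- b) :* a
            := num 1 :- b :* a) refl (pow q d) q))

    geo-≥0 : ∀ d → # 0 ≤ geo d
    geo-≥0 zero = nn 0
    geo-≥0 (suc d) = geo-≥0 d ⊕ pow-≥0 d q≥0

    1≤geo : ∀ d → # 1 ≤ geo (suc d)
    1≤geo d = lin (eq* (- # 1) (geo-suc d) ⊕ (q≥0 ⊗ geo-≥0 d)) (solve 3 (λ a b c → a :- num 1 := :- (num 1) :*
          (num 1 :+ b :* c :- a) :+ b :* c) refl (geo (suc d)) q (geo d))

    -- AM–GM, pairing the outermost terms.
    geo-AMGM : ∀ d → # (suc d) * pow y d ≤ geo (suc d)
    geo-AMGM zero = lin (nn 0) (solve 0 (num 0 :+ num 1 :- num 1 :* num 1 := num 0) refl)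
    geo-AMGM (suc zero) = lin (square (# 1 - y)) (solve 1 (λ a → num 0 :+ num 1 :+ a :* a :* num 1 :- num 2 :*
          (a :* num 1) := (num 1 :- a) :* (num 1 :- a)) refl y)
      where
      square : ∀ x → # 0 ≤ x * x
      square x with ≤-total (# 0) x
      ... | inj₁ p = p ⊗ p
      ... | inj₂ p = lin (↑ p ⊗ ↑ p) (solve 1 (λ a → a :* a :- num 0 := (num 0 :- a) :* (num 0 :- a)) refl x)
    geo-AMGM (suc (suc d)) = lin (eq* (- # 1) (geo-suc (suc d)) ⊕ ↑ (geo-AMGM d) ⊗ q≥0 ⊕ eq* (- # 1)
          (pow-square y (suc (suc d))) ⊕ (z≤1 ⊗ z≤1) ⊕ eq* (# 1 * (pow y (suc (suc d)))) #3 ⊕ eq* (# 1 * (# (suc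
          d))) refl) (solve 8 (λ a b c d e f g h → c :+ d :- a :* b := :- (num 1) :* (num 1 :+ e :* e :* f :- c)
          :+ (f :- g :* h) :* (e :* e) :+ :- (num 1) :* (b :* b :- d) :+ (num 1 :- b) :* (num 1 :- b) :+ num 1
          :* b :* (g :+ num 2 :- a) :+ num 1 :* g :* (e :* (e :* h) :- b)) refl (# (suc (suc (suc d)))) (pow y
          (suc (suc d))) (geo (suc (suc d))) (pow q (suc (suc d))) y (geo (suc d)) (# (suc d)) (pow y d))
      where
      z≤1 : # 0 ≤ # 1 - pow y (suc (suc d))
      z≤1 = ↑ (pow-≤1 (suc (suc d)) 0≤y y≤1)
      #3 : # (suc (suc (suc d))) ≡ # (suc d) + # 2
      #3 = trans (cong # (ℕ.+-comm 2 (suc d))) (#-+ (suc d) 2)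

    -- This is (1-q)/(1-q^d), written so that nothing is divided by 1-q.
    i : ℕ → F
    i d = geo d ⁻¹

    geo-i : ∀ {d} → 1 ℕ.≤ d → geo d * i d ≡ # 1
    geo-i {suc d} _ = ⁻¹-inverse (λ p → 1≰0 (≤-trans (1≤geo d) p))

    i≥0 : ∀ {d} → 1 ℕ.≤ d → # 0 ≤ i d
    i≥0 {suc d} _ = ⁻¹-nonneg (1≤geo d)

    i≤1 : ∀ {d} → 1 ℕ.≤ d → i d ≤ # 1
    i≤1 {suc d} p = lin (↑ (1≤geo d) ⊗ (i≥0 p) ⊕ eq* (# 1) (geo-i p)) (solve 2 (λ a b → num 1 :- a := (b :- num
          1) :* a :+ num 1 :* (num 1 :- b :* a)) refl (i (suc d)) (geo (suc d)))

    v β : ℕ → F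
    v d = pow q d * i d
    β d = inv d - v d

    v-diff : ∀ {d} → 1 ℕ.≤ d → v d - v (suc d) ≡ pow q d * (i d * i (suc d))
    v-diff {d} p = begin
      pow q d * i d - q * pow q d * i (suc d) ≡⟨ (solve 4 (λ a b c d → a :* b :- c :* a :* d := num 1 :* (a :*
            b) :- num 1 :* (c :* a :* d)) refl (pow q d) (i d) q (i (suc d))) ⟩
      # 1 * (pow q d * i d) - # 1 * (q * pow q d * i (suc d)) ≡⟨ cong₂ (λ a b → a * (pow q d * i d) - b * (q * pow q d * i (suc d))) (sym (geo-i {suc d} (s≤s z≤n))) (sym (geo-i p)) ⟩
      geo (suc d) * i (suc d) * (pow q d * i d) - geo d * i d * (q * pow q d * i (suc d)) ≡⟨ cong (λ z → z * i (suc d) * (pow q d * i d) - geo d * i d * (q * pow q d * i (suc d))) (geo-suc d) ⟩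
      (# 1 + q * geo d) * i (suc d) * (pow q d * i d) - geo d * i d * (q * pow q d * i (suc d))
        ≡⟨ (solve 5 (λ a b c d e → (num 1 :+ a :* b) :* c :* (d :* e) :- b :* e :* (a :* d :* c) := d :* (e :*
              c)) refl q (geo d) (i (suc d)) (pow q d) (i d)) ⟩
      pow q d * (i d * i (suc d)) ∎
      where open ≡-Reasoning

    geo-product : ∀ d → # (suc d) * # (suc (suc d)) * pow q (suc d) ≤ geo (suc d) * geo (suc (suc d))
    geo-product d = ≤-trans
        (lin (eq* (# 1 * (# (suc d) * # (suc (suc d)))) e ⊕ ↑ y≤1 ⊗ (nn (suc d) ⊗ nn (suc (suc d)) ⊗ (0≤y ⊗
              pow-≥0 d 0≤y ⊗ pow-≥0 d 0≤y))) (solve 5 (λ a b c d e → a :* d :* (b :* (e :* d)) :- a :* b :* c :=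
              num 1 :* (a :* b) :* (e :* d :* (e :* d) :- c) :+ (num 1 :- e) :* (a :* b :* (e :* d :* d))) refl
              (# (suc d)) (# (suc (suc d))) (pow q (suc d)) (pow y d) y))
        (*-mono (nn (suc d) ⊗ pow-≥0 d 0≤y) (geo-≥0 (suc (suc d))) (geo-AMGM d) (geo-AMGM (suc d)))
      where
      e : pow q (suc d) ≡ y * pow y d * (y * pow y d)
      e = pow-square y (suc d)

    -- The step is 1/(d(d+1)) - q^d/(geo d · geo (d+1)), and `geo-product`, two applications of
    -- AM-GM, shows that it is nonnegative.
    β-decreasing : ∀ d → 1 ℕ.≤ d → β (suc d) ≤ β d
    β-decreasing d@(suc d′) p = lin (eq* (# 1) (v-diff p) ⊕ eq* (- # 1) (inv-diff p) ⊕ ↑ key) (solve 7 (λ a b c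
          d e f g → c :- d :- (a :- b) := num 1 :* (e :* (f :* g) :- (d :- b)) :+ :- (num 1) :* (c :* a :- (c :-
          a)) :+ (c :* a :- e :* (f :* g))) refl (inv (suc d)) (v (suc d)) (inv d) (v d) (pow q d) (i d) (i (suc
          d)))
      where
      w = inv d * inv (suc d)
      w≥0 : # 0 ≤ w
      w≥0 = inv-nonneg d ⊗ inv-nonneg (suc d)
      j = i d * i (suc d)
      j≥0 : # 0 ≤ j
      j≥0 = i≥0 p ⊗ i≥0 {suc d} (s≤s z≤n)
      ew : # d * # (suc d) * w ≡ # 1
      ew = trans (solve 4 (λ a b c d → a :* b :* (c :* d) := a :* c :* (b :* d)) refl (# d) (# (suc d)) (inv d)
            (inv (suc d))) (trans (cong₂ _*_ (inv-inverse p) (inv-inverse {suc d} (s≤s z≤n))) (solve 0 (num 1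
            :* num 1 := num 1) refl))
      ej : geo d * geo (suc d) * j ≡ # 1
      ej = trans (solve 4 (λ a b c d → a :* b :* (c :* d) := a :* c :* (b :* d)) refl (geo d) (geo (suc d)) (i
            d) (i (suc d))) (trans (cong₂ _*_ (geo-i p) (geo-i {suc d} (s≤s z≤n))) (solve 0 (num 1 :* num 1 :=
            num 1) refl))
      key : pow q d * j ≤ w
      key = lin (↑ (geo-product d′) ⊗ (w≥0 ⊗ j≥0) ⊕ eq* (- # 1 * (pow q d * j)) ew ⊕ eq* (# 1 * (w)) ej) (solve
            7 (λ a b c d e f g → c :- a :* b := (d :* e :- f :* g :* a) :* (c :* b) :+ :- (num 1) :* (a :* b) :*
            (num 1 :- f :* g :* c) :+ num 1 :* c :* (num 1 :- d :* e :* b)) refl (pow q d) j w (geo d) (geo (suc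
            d)) (# d) (# (suc d)))

    β≥0 : ∀ d → 1 ℕ.≤ d → # 0 ≤ β d
    β≥0 d@(suc d′) p = lin (↑ big ⊗ (inv-nonneg d ⊗ i≥0 p) ⊕ eq* (# 1 * (inv d)) (geo-i p) ⊕ eq* (- # 1 * (pow
          q d * i d)) (inv-inverse p)) (solve 5 (λ a b c d e → a :- b :* c :- num 0 := (d :- e :* b) :* (a :* c)
          :+ num 1 :* a :* (num 1 :- d :* c) :+ :- (num 1) :* (b :* c) :* (num 1 :- e :* a)) refl (inv d) (pow q
          d) (i d) (geo d) (# d))
      where
      big : # d * pow q d ≤ geo d
      big = ≤-trans (*-monoˡ (# d) (nn d) (lin (eq* (# 1) (pow-square y d) ⊕ ↑ (pow-≤1 d 0≤y y≤1) ⊗ (pow-≥0 d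
            0≤y) ⊕ ↑ (pow-anti {y} {d′} {d} 0≤y y≤1 (ℕ.n≤1+n d′))) (solve 3 (λ a b c → b :- a := num 1 :* (c :*
            c :- a) :+ (num 1 :- c) :* c :+ (b :- c)) refl (pow q d) (pow y d′) (pow y d)))) (geo-AMGM d′)

    β-1 : β 1 ≡ # 1 - q
    β-1 = trans (cong₂ (λ a b → a - q * # 1 * b) inv-1 (trans (solve 1 (λ a → a := (num 0 :+ num 1) :* a) refl
          (i 1)) (geo-i {1} ℕ.≤-refl))) (solve 1 (λ a → num 1 :- a :* num 1 :* num 1 := num 1 :- a) refl q)

    -- A finite geometric series; the subtracted term comes from the first omitted power.
    lambert : ∀ d E → 1 ℕ.≤ d → (# 1 - q) * ∑ E (λ e → pow q (d ℕ.* e)) ≡ v d - i d * pow q (d ℕ.* suc E)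
    lambert d zero p = trans (solve 3 (λ a b c → (num 1 :- a) :* num 0 := b :* c :- c :* b) refl q (pow q d) (i
          d)) (cong (λ z → v d - i d * pow q z) (sym (ℕ.*-identityʳ d)))
    lambert d (suc E) p = begin
      (# 1 - q) * (∑ E (λ e → pow q (d ℕ.* e)) + X) ≡⟨ (solve 3 (λ a b c → (num 1 :- a) :* (b :+ c) := (num 1
            :- a) :* b :+ (num 1 :- a) :* num 1 :* c) refl q (∑ E (λ e → pow q (d ℕ.* e))) X) ⟩
      (# 1 - q) * ∑ E (λ e → pow q (d ℕ.* e)) + (# 1 - q) * # 1 * X ≡⟨ cong₂ (λ a b → a + (# 1 - q) * b * X) (lambert d E p) (sym (geo-i p)) ⟩
      v d - i d * X + (# 1 - q) * (geo d * i d) * X ≡⟨ (solve 5 (λ a b c d e → a :- b :* c :+ (num 1 :- d) :*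
            (e :* b) :* c := a :- b :* c :+ (num 1 :- d) :* e :* (b :* c)) refl (v d) (i d) X q (geo d)) ⟩
      v d - i d * X + (# 1 - q) * geo d * (i d * X) ≡⟨ cong (λ z → v d - i d * X + z * (i d * X)) (geo-closed d) ⟩
      v d - i d * X + (# 1 - pow q d) * (i d * X) ≡⟨ (solve 4 (λ a b c d → a :- b :* c :+ (num 1 :- d) :* (b :*
            c) := a :- b :* (d :* c)) refl (v d) (i d) X (pow q d)) ⟩
      v d - i d * (pow q d * X) ≡⟨ cong (λ z → v d - i d * z) (trans (sym (pow-+ q d (d ℕ.* suc E))) (cong (pow q) (sym (ℕ.*-suc d (suc E))))) ⟩
      v d - i d * pow q (d ℕ.* suc (suc E)) ∎
      where
      open ≡-Reasoning
      X = pow q (d ℕ.* suc E)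

  split-prime : ∀ r n → Prime r → 1 ℕ.≤ n → ∃ λ a → ∃ λ k → n ≡ r ℕ.^ a ℕ.* k × 1 ℕ.≤ k × ¬ r ∣ k
  split-prime r n pr = <-rec (λ n → 1 ℕ.≤ n → ∃ λ a → ∃ λ k → n ≡ r ℕ.^ a ℕ.* k × 1 ℕ.≤ k × ¬ r ∣ k) go n
    where
    go : ∀ n → (∀ {k} → k ℕ.< n → 1 ℕ.≤ k → ∃ λ a → ∃ λ l → k ≡ r ℕ.^ a ℕ.* l × 1 ℕ.≤ l × ¬ r ∣ l) → 1 ℕ.≤ n →
         ∃ λ a → ∃ λ k → n ≡ r ℕ.^ a ℕ.* k × 1 ℕ.≤ k × ¬ r ∣ k
    go n ih 1≤n with r ∣? n
    ... | no ¬d = 0 , n , sym (ℕ.*-identityˡ n) , 1≤n , ¬d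
    ... | yes (divides k e) with ih {k} k<n 1≤k
      where
      1≤k : 1 ℕ.≤ k
      1≤k = factor-pos {r} k 1≤n (trans e (ℕ.*-comm k r))
      k<n : k ℕ.< n
      k<n = subst (k ℕ.<_) (sym e) (ℕ.m<m*n k r {{ℕ.>-nonZero 1≤k}} (prime⇒2≤ pr))
    ... | a , l , e′ , 1≤l , ¬d = suc a , l , trans e (trans (ℕ.*-comm k r) (trans (cong (r ℕ.*_) e′) (sym (ℕ.*-assoc r (r ℕ.^ a) l)))) , 1≤l , ¬d

  prime-power-induction : (P : ℕ → Set) → P 1 → (∀ r a k → Prime r → 1 ℕ.≤ k → ¬ r ∣ k → P k → P (r ℕ.^ a ℕ.* k)) → ∀ n → 1 ℕ.≤ n → P n
  prime-power-induction P base step = <-rec (λ n → 1 ℕ.≤ n → P n) go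
    where
    go : ∀ n → (∀ {k} → k ℕ.< n → 1 ℕ.≤ k → P k) → 1 ℕ.≤ n → P n
    go (suc zero) ih _ = base
    go n@(suc (suc _)) ih 1≤n with prime-factor n (s≤s (s≤s z≤n))
    ... | r , pr , r∣n with split-prime r n pr 1≤n
    ... | zero , k , e , 1≤k , ¬d = ⊥-elim (¬d (subst (r ∣_) (trans e (ℕ.*-identityˡ k)) r∣n))
    ... | suc a , k , e , 1≤k , ¬d = subst P (sym e) (step r (suc a) k pr 1≤k ¬d (ih k<n 1≤k))
      where
      k<n : k ℕ.< n
      k<n = subst (k ℕ.<_) (trans (ℕ.*-comm k (r ℕ.^ suc a)) (sym e))
        (ℕ.m<m*n k (r ℕ.^ suc a) {{ℕ.>-nonZero 1≤k}} (ℕ.≤-trans (prime⇒2≤ pr) (ℕ.m≤m*n r (r ℕ.^ a) {{ℕ.m^n≢0 r a {{prime⇒nonZero pr}}}})))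

  -- Opaque, so that these large numbers are never evaluated.
  abstract

    J₀ ν₀ Z₀ : ℕ → ℕ
    J₀ m = 4 ℕ.* suc (suc m)
    ν₀ m = 4 ℕ.* (J₀ m ℕ.* J₀ m)
    Z₀ m = ν₀ m ℕ.* ν₀ m ℕ.* ν₀ m

    #J₀ : ∀ m → # (J₀ m) ≡ # 4 * # (suc (suc m))
    #J₀ m = #-* 4 (suc (suc m))

    #ν₀ : ∀ m → # (ν₀ m) ≡ # 4 * # (J₀ m ℕ.* J₀ m)
    #ν₀ m = #-* 4 (J₀ m ℕ.* J₀ m)

    #Z₀ : ∀ m → # (Z₀ m) ≡ # (ν₀ m) * # (ν₀ m) * # (ν₀ m)
    #Z₀ m = trans (#-* (ν₀ m ℕ.* ν₀ m) (ν₀ m)) (cong (_* # (ν₀ m)) (#-* (ν₀ m) (ν₀ m)))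

    1≤ν₀ : ∀ m → 1 ℕ.≤ ν₀ m
    1≤ν₀ m = s≤s z≤n

    1≤Z₀ : ∀ m → 1 ℕ.≤ Z₀ m
    1≤Z₀ m = ℕ.*-mono-≤ (ℕ.*-mono-≤ (1≤ν₀ m) (1≤ν₀ m)) (1≤ν₀ m)

    J₀²≤Z₀ : ∀ m → J₀ m ℕ.* J₀ m ℕ.≤ Z₀ m
    J₀²≤Z₀ m = ℕ.≤-trans (ℕ.m≤n*m (J₀ m ℕ.* J₀ m) 4) (ℕ.m≤n*m (ν₀ m) (ν₀ m ℕ.* ν₀ m))

    2ν₀≤Z₀ : ∀ m → 2 ℕ.* ν₀ m ℕ.≤ Z₀ m
    2ν₀≤Z₀ m = ℕ.*-monoˡ-≤ (ν₀ m) (ℕ.≤-trans (s≤s (s≤s z≤n)) (ℕ.*-mono-≤ 4≤ν 4≤ν))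
      where
      4≤ν : 4 ℕ.≤ ν₀ m
      4≤ν = ℕ.m≤m*n 4 (J₀ m ℕ.* J₀ m)

  -- L(1,χ) for a real character χ, and the sum of χ(a)Λ(a)/a.

  module RealCharacter (m : ℕ) (χ : ℕ → F) (χ-invariant : Classes.Invariant m χ) (χ-* : ∀ a b → χ (a ℕ.* b) ≡ χ a * χ b)
    (χ-values : ∀ n → χ n ≡ # 0 ⊎ χ n ≡ # 1 ⊎ χ n ≡ - # 1) (χ-1 : χ 1 ≡ # 1) (χ-sum : ∑ (suc m) χ ≡ # 0) where

    open Classes m

    χ-∣∣ : ∀ n → ∣ χ n ∣≤ # 1
    χ-∣∣ n with χ-values n
    ... | inj₁ e = ∣∣-cong e (∣∣-weaken (nn 1) ∣∣-zero)
    ... | inj₂ (inj₁ e) = ∣∣-cong e (∣∣-of-nonneg (nn 1))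
    ... | inj₂ (inj₂ e) = ∣∣-cong e (∣∣-neg (∣∣-of-nonneg (nn 1)))

    χ-partial : ∀ n → ∣ ∑ n χ ∣≤ # M
    χ-partial = ∑-periodic-∣∣ M χ (s≤s z≤n) (λ k → χ-invariant (mk≋ (trans (cong (ℕ._% M) (ℕ.+-comm M k)) (ℕ.[m+n]%n≡m%n k M)))) χ-∣∣ χ-sum

    L : ℕ → F
    L x = ∑ x (λ a → χ a * inv a)

    L-tail : ∀ {z x} → z ℕ.≤ x → ∣ L x - L z ∣≤ # 2 * # M * inv (suc z)
    L-tail {z} {x} z≤x = subst (λ w → ∣ L w - L z ∣≤ # 2 * # M * inv (suc z)) (ℕ.m+[n∸m]≡n z≤x) (go (x ℕ.∸ z))
      where
      part : ∀ n → ∣ ∑ n (λ k → χ (z ℕ.+ k)) ∣≤ # 2 * # M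
      part n = ∣∣-cong (trans (solve 2 (λ a b → a := b :+ a :+ :- b) refl (∑ n (λ k → χ (z ℕ.+ k))) (∑ z χ)) (cong (_+ - ∑ z χ) (sym (∑-split z n χ))))
        (∣∣-weaken (lin (nn 0) (solve 1 (λ a → num 2 :* a :- (a :+ a) := num 0) refl (# M))) (∣∣-+ (χ-partial (z ℕ.+ n)) (∣∣-neg (χ-partial z))))
      go : ∀ n → ∣ L (z ℕ.+ n) - L z ∣≤ # 2 * # M * inv (suc z)
      go n = ∣∣-cong (trans (cong (_- L z) (∑-split z n _)) (solve 2 (λ a b → a :+ b :- a := b) refl (L z) (∑ n
            (λ k → χ (z ℕ.+ k) * inv (z ℕ.+ k))))) (tail n)
        where
        tail : ∀ n → ∣ ∑ n (λ k → χ (z ℕ.+ k) * inv (z ℕ.+ k)) ∣≤ # 2 * # M * inv (suc z)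
        tail zero = ∣∣-weaken (nn 2 ⊗ nn M ⊗ inv-nonneg (suc z)) ∣∣-zero
        tail n@(suc _) = subst (λ w → ∣ ∑ n (λ k → χ (z ℕ.+ k) * inv (z ℕ.+ k)) ∣≤ # 2 * # M * inv w) (ℕ.+-comm z 1)
          (dirichlet-test n (λ k → χ (z ℕ.+ k)) (λ k → inv (z ℕ.+ k)) (# 2 * # M) (s≤s z≤n) part
            (λ k p _ → inv-≤ (ℕ.≤-trans p (ℕ.m≤n+m k z)) (ℕ.+-monoʳ-≤ z (ℕ.n≤1+n k))) (inv-nonneg (z ℕ.+ n)))

    divsum : ℕ → ℕ → F
    divsum x k = ∑ x (λ a → 𝟙 (a ∣? k) * χ a)

    -- The Dirichlet convolution of 1 and χ. As χ is real, it is nonnegative, and at least 1 at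
    -- squares.
    f : ℕ → F
    f k = divsum k k

    divsum-f : ∀ {x k} → 1 ℕ.≤ k → k ℕ.≤ x → divsum x k ≡ f k
    divsum-f {x} {k} 1≤k k≤x = trans (cong (λ z → divsum z k) (sym (ℕ.m+[n∸m]≡n k≤x))) (trans (∑-split k (x ℕ.∸ k) _)
      (trans (cong (f k +_) (∑-zero′ (x ℕ.∸ k) (λ i p _ → 𝟙-no* (k ℕ.+ i ∣? k) (λ d → ℕ.<⇒≱ (ℕ.m<m+n k p) (∣⇒≤ {{ℕ.>-nonZero 1≤k}} d)) _)))
        (solve 1 (λ a → a :+ num 0 := a) refl (f k))))

    prime-to : ℕ → ℕ → ℕ → F
    prime-to r x k = ∑ x (λ a → (# 1 - 𝟙 (r ∣? a)) * (𝟙 (a ∣? k) * χ a))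

    prime-to-step : ∀ {r} x k → Prime r → prime-to r x (r ℕ.* k) ≡ prime-to r x k
    prime-to-step {r} x k pr = ∑-cong′ x term
      where
      term : ∀ a → (# 1 - 𝟙 (r ∣? a)) * (𝟙 (a ∣? r ℕ.* k) * χ a) ≡ (# 1 - 𝟙 (r ∣? a)) * (𝟙 (a ∣? k) * χ a)
      term a with r ∣? a
      ... | yes _ = solve 3 (λ a b c → (num 1 :- num 1) :* (a :* b) := (num 1 :- num 1) :* (c :* b)) refl (𝟙 (a
            ∣? r ℕ.* k)) (χ a) (𝟙 (a ∣? k))
      ... | no ¬d = cong (λ z → (# 1 - # 0) * (z * χ a)) (𝟙-cong (a ∣? r ℕ.* k) (a ∣? k) (coprime-divisor (Coprimality.sym (prime∤⇒coprime pr ¬d))) (∣n⇒∣m*n r))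

    prime-to-coprime : ∀ {r} x k → ¬ r ∣ k → prime-to r x k ≡ divsum x k
    prime-to-coprime {r} x k r∤k = ∑-cong′ x term
      where
      term : ∀ a → (# 1 - 𝟙 (r ∣? a)) * (𝟙 (a ∣? k) * χ a) ≡ 𝟙 (a ∣? k) * χ a
      term a with a ∣? k
      ... | no _ = solve 2 (λ a b → (num 1 :- a) :* (num 0 :* b) := num 0 :* b) refl (𝟙 (r ∣? a)) (χ a)
      ... | yes d = trans (cong (λ z → (# 1 - z) * (# 1 * χ a)) (𝟙-no (r ∣? a) (λ e → r∤k (∣-trans e d)))) (solve
            1 (λ a → (num 1 :- num 0) :* (num 1 :* a) := num 1 :* a) refl (χ a))

    -- A divisor of r k is either prime to r or r times a divisor of k.
    f-prime-* : ∀ {r k} → Prime r → 1 ℕ.≤ k → f (r ℕ.* k) ≡ prime-to r (r ℕ.* k) k + χ r * f k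
    f-prime-* {r} {k} pr 1≤k = begin
      ∑ x (λ a → 𝟙 (a ∣? x) * χ a) ≡⟨ ∑-cong′ x (λ a → (solve 3 (λ a b c → a :* b := (num 1 :- c) :* (a :* b)
            :+ c :* (a :* b)) refl (𝟙 (a ∣? x)) (χ a) (𝟙 (r ∣? a)))) ⟩
      ∑ x (λ a → (# 1 - 𝟙 (r ∣? a)) * (𝟙 (a ∣? x) * χ a) + 𝟙 (r ∣? a) * (𝟙 (a ∣? x) * χ a)) ≡⟨ ∑-+ x _ _ ⟩
      prime-to r x x + ∑ x (λ a → 𝟙 (r ∣? a) * (𝟙 (a ∣? x) * χ a)) ≡⟨ cong₂ _+_ (prime-to-step x k pr) (sym (∑-multiples x r (λ a → 𝟙 (a ∣? x) * χ a) (prime⇒1≤ pr))) ⟩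
      prime-to r x k + ∑ (x ÷ r) (λ e → 𝟙 (r ℕ.* e ∣? x) * χ (r ℕ.* e)) ≡⟨ cong (prime-to r x k +_) (trans (cong (λ z → ∑ z (λ e → 𝟙 (r ℕ.* e ∣? x) * χ (r ℕ.* e))) x÷r)
          (trans (∑-cong′ k (λ e → trans (cong₂ _*_ (𝟙-cong (r ℕ.* e ∣? x) (e ∣? k) (*-cancelˡ-∣ r {{prime⇒nonZero pr}}) (*-monoʳ-∣ r)) (χ-* r e))
            (solve 3 (λ a b c → a :* (b :* c) := b :* (a :* c)) refl (𝟙 (e ∣? k)) (χ r) (χ e)))) (∑-*ˡ k (χ r) _))) ⟩
      prime-to r x k + χ r * f k ∎
      where
      open ≡-Reasoning
      x = r ℕ.* k
      x÷r : x ÷ r ≡ k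
      x÷r = ℕ.≤-antisym (ℕ.*-cancelˡ-≤ r {{prime⇒nonZero pr}} (*-÷-≤ x r)) (*≤⇒≤÷ (prime⇒1≤ pr) ℕ.≤-refl)

    -- The value 1 + χ(r) + ... + χ(r)^a of f at r^a, in Horner form.
    G : ℕ → ℕ → F
    G r zero = # 1
    G r (suc a) = # 1 + χ r * G r a

    f-prime-power : ∀ {r k} a → Prime r → 1 ℕ.≤ k → ¬ r ∣ k → f (r ℕ.^ a ℕ.* k) ≡ G r a * f k
    f-prime-power {r} {k} zero pr 1≤k r∤k = trans (cong f (ℕ.*-identityˡ k)) (solve 1 (λ a → a := num 1 :* a)
          refl (f k))
    f-prime-power {r} {k} (suc a) pr 1≤k r∤k = begin
      f (r ℕ.* r ℕ.^ a ℕ.* k) ≡⟨ cong f (ℕ.*-assoc r (r ℕ.^ a) k) ⟩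
      f (r ℕ.* l) ≡⟨ f-prime-* pr 1≤l ⟩
      prime-to r (r ℕ.* l) l + χ r * f l ≡⟨ cong₂ (λ u v → u + χ r * v) (reduce a (r ℕ.* l) le) (f-prime-power a pr 1≤k r∤k) ⟩
      f k + χ r * (G r a * f k) ≡⟨ (solve 3 (λ a b c → a :+ b :* (c :* a) := (num 1 :+ b :* c) :* a) refl (f k)
            (χ r) (G r a)) ⟩
      (# 1 + χ r * G r a) * f k ∎
      where
      open ≡-Reasoning
      l = r ℕ.^ a ℕ.* k
      1≤l : 1 ℕ.≤ l
      1≤l = ℕ.*-mono-≤ (ℕ.m^n>0 r {{prime⇒nonZero pr}} a) 1≤k
      le : k ℕ.≤ r ℕ.* l
      le = ℕ.≤-trans (ℕ.m≤n*m k (r ℕ.^ a) {{ℕ.m^n≢0 r a {{prime⇒nonZero pr}}}}) (ℕ.m≤n*m l r {{prime⇒nonZero pr}})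
      reduce : ∀ a x → k ℕ.≤ x → prime-to r x (r ℕ.^ a ℕ.* k) ≡ f k
      reduce zero x k≤x = trans (cong (prime-to r x) (ℕ.*-identityˡ k)) (trans (prime-to-coprime x k r∤k) (divsum-f 1≤k k≤x))
      reduce (suc a) x k≤x = trans (cong (prime-to r x) (ℕ.*-assoc r (r ℕ.^ a) k)) (trans (prime-to-step x (r ℕ.^ a ℕ.* k) pr) (reduce a x k≤x))

    -- Parity of the exponent matters for χ(r) = -1, where the sums alternate between 1 and 0.
    G-bounds : ∀ r a → (# 0 ≤ G r (a ℕ.+ a) - # 1) × (# 0 ≤ G r (suc (a ℕ.+ a)))
    G-bounds r a with χ-values r
    ... | inj₁ e = (lin (eq* (- # 1) (one (a ℕ.+ a))) (solve 1 (λ a → a :- num 1 :- num 0 := :- (num 1) :* (num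
          1 :- a)) refl (G r (a ℕ.+ a)))) , (lin (eq* (- # 1) (one (suc (a ℕ.+ a))) ⊕ nn 1) (solve 1 (λ a → a
          :- num 0 := :- (num 1) :* (num 1 :- a) :+ num 1) refl (G r (suc (a ℕ.+ a)))))
      where
      one : ∀ b → G r b ≡ # 1
      one zero = refl
      one (suc b) = trans (cong (λ z → # 1 + z * G r b) e) (solve 1 (λ a → num 1 :+ num 0 :* a := num 1) refl
            (G r b))
    ... | inj₂ (inj₁ e) = (lin (↑ (pos (a ℕ.+ a))) (solve 1 (λ a → a :- num 1 :- num 0 := a :- num 1) refl (G r
          (a ℕ.+ a)))) , ≤-trans (nn 1) (pos (suc (a ℕ.+ a)))
      where
      pos : ∀ b → # 1 ≤ G r b
      pos zero = ≤-refl
      pos (suc b) = lin (eq* (- # 1 * (G r b)) e ⊕ ↑ (pos b) ⊕ nn 1) (solve 2 (λ a b → num 1 :+ a :* b :- num 1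
            := :- (num 1) :* b :* (num 1 :- a) :+ (b :- num 1) :+ num 1) refl (χ r) (G r b))
    ... | inj₂ (inj₂ e) = (lin (eq* (- # 1) (even a)) (solve 1 (λ a → a :- num 1 :- num 0 := :- (num 1) :* (num
          1 :- a)) refl (G r (a ℕ.+ a)))) , (lin (eq* (- # 1 * (χ r)) (even a) ⊕ eq* (- # 1) e) (solve 2 (λ a b
          → num 1 :+ a :* b :- num 0 := :- (num 1) :* a :* (num 1 :- b) :+ :- (num 1) :* (:- (num 1) :- a)) refl
          (χ r) (G r (a ℕ.+ a))))
      where
      even : ∀ b → G r (b ℕ.+ b) ≡ # 1
      even zero = refl
      even (suc b) = trans (cong (G r) (cong suc (ℕ.+-suc b b))) (trans (cong₂ (λ u v → # 1 + u * (# 1 + u * v)) e (even b)) (solve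
            0 (num 1 :+ :- (num 1) :* (num 1 :+ :- (num 1) :* num 1) := num 1) refl))

    G≥0 : ∀ r a → # 0 ≤ G r a
    G≥0 r a with even-or-odd a
    ... | inj₁ (b , refl) = lin ((proj₁ (G-bounds r b)) ⊕ nn 1) (solve 1 (λ a → a :- num 0 := a :- num 1 :+ num
          1) refl (G r (b ℕ.+ b)))
    ... | inj₂ (b , refl) = proj₂ (G-bounds r b)

    f-1 : f 1 ≡ # 1
    f-1 = trans (cong₂ (λ u v → # 0 + u * v) (𝟙-yes (1 ∣? 1) ∣-refl) χ-1) (solve 0 (num 0 :+ num 1 :* num 1 :=
          num 1) refl)

    f≥0 : ∀ k → 1 ℕ.≤ k → # 0 ≤ f k
    f≥0 = prime-power-induction (λ k → # 0 ≤ f k) (subst (# 0 ≤_) (sym f-1) (nn 1))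
      (λ r a k pr 1≤k r∤k ih → subst (# 0 ≤_) (sym (f-prime-power a pr 1≤k r∤k)) (G≥0 r a ⊗ ih))

    f-square : ∀ j → 1 ℕ.≤ j → # 1 ≤ f (j ℕ.* j)
    f-square = prime-power-induction (λ j → # 1 ≤ f (j ℕ.* j)) (≡⇒≤ (sym f-1)) step
      where
      step : ∀ r a k → Prime r → 1 ℕ.≤ k → ¬ r ∣ k → # 1 ≤ f (k ℕ.* k) → # 1 ≤ f (r ℕ.^ a ℕ.* k ℕ.* (r ℕ.^ a ℕ.* k))
      step r a k pr 1≤k r∤k ih = lin (eq* (- # 1) eq ⊕ ↑ ih ⊕ (proj₁ (G-bounds r a)) ⊗ (≤-trans (nn 1) ih))
            (solve 3 (λ a b c → a :- num 1 := :- (num 1) :* (b :* c :- a) :+ (c :- num 1) :+ (b :- num 1) :* c)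
            refl (f (r ℕ.^ a ℕ.* k ℕ.* (r ℕ.^ a ℕ.* k))) (G r (a ℕ.+ a)) (f (k ℕ.* k)))
        where
        rearrange : ∀ u k → u ℕ.* k ℕ.* (u ℕ.* k) ≡ u ℕ.* u ℕ.* (k ℕ.* k)
        rearrange = solve-∀
        eq : f (r ℕ.^ a ℕ.* k ℕ.* (r ℕ.^ a ℕ.* k)) ≡ G r (a ℕ.+ a) * f (k ℕ.* k)
        eq = trans (cong f (trans (rearrange (r ℕ.^ a) k) (cong (ℕ._* (k ℕ.* k)) (sym (ℕ.^-distribˡ-+-* r a a)))))
          (f-prime-power (a ℕ.+ a) pr (ℕ.*-mono-≤ 1≤k 1≤k) (λ d → [ r∤k , r∤k ]′ (euclidsLemma k k pr d)))

    -- Monsky's argument: Σ f(k) q^k ≥ Σ q^(j²) is large as q → 1, but it is L(1,χ)/(1−q) + O(1).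

    J ν Z : ℕ
    J = J₀ m
    ν = ν₀ m
    Z = Z₀ m

    private
      a : F
      a = inv ν

      a≤1 : a ≤ # 1
      a≤1 = inv-≤1 ν

      νa : # ν * a ≡ # 1
      νa = inv-inverse (1≤ν₀ m)

      y : F
      y = # 1 - a

      y≥0 : # 0 ≤ y
      y≥0 = ↑ a≤1

      y≤1 : y ≤ # 1
      y≤1 = lin ((inv-nonneg ν)) (solve 1 (λ a → num 1 :- (num 1 :- a) := a) refl a)

      open Lambert y y≥0 y≤1

      Lam : F
      Lam = ∑ Z (λ k → pow q k * f k)

      Lam-swap : Lam ≡ ∑ Z (λ d → χ d * ∑ (Z ÷ d) (λ e → pow q (d ℕ.* e)))
      Lam-swap = begin
        ∑ Z (λ k → pow q k * f k) ≡⟨ ∑-cong Z (λ k p r → trans (cong (pow q k *_) (sym (divsum-f p r))) (sym (∑-*ˡ Z (pow q k) _))) ⟩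
        ∑ Z (λ k → ∑ Z (λ d → pow q k * (𝟙 (d ∣? k) * χ d))) ≡⟨ ∑-swap Z Z _ ⟩
        ∑ Z (λ d → ∑ Z (λ k → pow q k * (𝟙 (d ∣? k) * χ d))) ≡⟨ ∑-cong Z (λ d p _ → trans (∑-cong′ Z (λ k → (solve
              3 (λ a b c → a :* (b :* c) := c :* (b :* a)) refl (pow q k) (𝟙 (d ∣? k)) (χ d))))
            (trans (∑-*ˡ Z (χ d) _) (cong (χ d *_) (sym (∑-multiples Z d (pow q) p))))) ⟩
        ∑ Z (λ d → χ d * ∑ (Z ÷ d) (λ e → pow q (d ℕ.* e))) ∎
        where open ≡-Reasoning

      err : ℕ → F
      err d = i d * pow q (d ℕ.* suc (Z ÷ d))

      Lam-L : (# 1 - q) * Lam ≡ L Z - ∑ Z (λ d → χ d * β d) - ∑ Z (λ d → χ d * err d)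
      Lam-L = trans (cong ((# 1 - q) *_) Lam-swap) (trans (sym (∑-*ˡ Z (# 1 - q) _)) (trans (∑-cong Z (λ d p _ → trans
          (solve 3 (λ a b c → (num 1 :- a) :* (b :* c) := b :* ((num 1 :- a) :* c)) refl q (χ d) (∑ (Z ÷ d) (λ
                e → pow q (d ℕ.* e))))
          (trans (cong (χ d *_) (lambert d (Z ÷ d) p)) (solve 4 (λ a b c d → a :* (b :- c) := a :* d :- a :* (d
                :- b) :- a :* c) refl (χ d) (v d) (err d) (inv d)))))
        (trans (∑-- Z _ _) (cong (λ z → z - ∑ Z (λ d → χ d * err d)) (∑-- Z _ _)))))

      β-sum : ∣ ∑ Z (λ d → χ d * β d) ∣≤ # M * (# 1 - q)
      β-sum = subst (λ z → ∣ ∑ Z (λ d → χ d * β d) ∣≤ # M * z) β-1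
        (dirichlet-test Z χ β (# M) (1≤Z₀ m) χ-partial (λ d p _ → β-decreasing d p) (β≥0 Z (1≤Z₀ m)))

      err-sum : ∣ ∑ Z (λ d → χ d * err d) ∣≤ # Z * pow q Z
      err-sum = ∣∣-weaken (≡⇒≤ (∑-const Z (pow q Z))) (∑-∣∣ Z (λ d p _ → ∣∣-weaken (small d p) (∣∣-* (χ-∣∣ d) (∣∣-of-nonneg (i≥0 p ⊗ pow-≥0 (d ℕ.* suc (Z ÷ d)) q≥0)))))
        where
        small : ∀ d → 1 ℕ.≤ d → # 1 * err d ≤ pow q Z
        small d p = lin (↑ (i≤1 p) ⊗ (pow-≥0 (d ℕ.* suc (Z ÷ d)) q≥0) ⊕ ↑ (pow-anti {q} q≥0 q≤1 (ℕ.<⇒≤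
              (<-*-suc÷ Z d p)))) (solve 3 (λ a b c → c :- num 1 :* (a :* b) := (num 1 :- a) :* b :+ (c :- b))
              refl (i d) X (pow q Z))
          where X = pow q (d ℕ.* suc (Z ÷ d))

      -- Z = ν³ is chosen for this: with w = y^Z, Bernoulli gives w ν² ≤ 1, hence Z q^Z = ν³ w² ≤
      -- 1/ν.
      err-tiny : # Z * pow q Z ≤ a
      err-tiny = lin (eq* (# 1 * (# Z)) (pow-square y Z) ⊕ ↑ sq ⊗ (inv-nonneg ν) ⊕ eq* (- # 1 * (w * w * # ν *
            # ν * # ν)) νa ⊕ eq* (# 1 * (w * w)) Z≡) (solve 5 (λ a b c d e → c :- a :* b := num 1 :* a :* (d :*
            d :- b) :+ (num 1 :- d :* (e :* e) :* (d :* (e :* e))) :* c :+ :- (num 1) :* (d :* d :* e :* e :* e)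
            :* (num 1 :- e :* c) :+ num 1 :* (d :* d) :* (e :* e :* e :- a)) refl (# Z) (pow q Z) a w (# ν))
        where
        w = pow y Z
        w≥0 : # 0 ≤ w
        w≥0 = pow-≥0 Z y≥0
        Z≡ : # Z ≡ # ν * # ν * # ν
        Z≡ = #Z₀ m
        one : w * (# ν * # ν) ≤ # 1
        one = lin (↑ (bernoulli′ {a} Z (inv-nonneg ν) a≤1) ⊕ eq* (- # 1 * (w * a)) Z≡ ⊕ eq* (- # 1 * (w * # ν *
              # ν)) νa ⊕ w≥0) (solve 4 (λ a b c d → num 1 :- a :* (b :* b) := num 1 :- a :* (num 1 :+ c :* d) :+
              :- (num 1) :* (a :* d) :* (b :* b :* b :- c) :+ :- (num 1) :* (a :* b :* b) :* (num 1 :- b :* d)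
              :+ a) refl w (# ν) (# Z) a)
        sq : w * (# ν * # ν) * (w * (# ν * # ν)) ≤ # 1
        sq = lin (↑ one ⊗ (w≥0 ⊗ (nn ν ⊗ nn ν)) ⊕ ↑ one) (solve 2 (λ a b → num 1 :- a :* (b :* b) :* (a :* (b
              :* b)) := (num 1 :- a :* (b :* b)) :* (a :* (b :* b)) :+ (num 1 :- a :* (b :* b))) refl w (# ν))

      squares : ∀ t → ∑ t (λ j → pow q (j ℕ.* j)) ≤ ∑ (t ℕ.* t) (λ k → pow q k * f k)
      squares zero = ≤-refl
      squares (suc t) = lin (↑ (squares t) ⊕ ↑ (∑-mono-range (λ k → pow q k * f k) t*t≤s (λ k p _ → pow-≥0 k
            q≥0 ⊗ f≥0 k (ℕ.≤-trans (s≤s z≤n) p))) ⊕ ↑ (f-square (suc t) (s≤s z≤n)) ⊗ (pow-≥0 (suc t ℕ.* suc t)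
            q≥0)) (solve 5 (λ a b c d e → c :+ b :* d :- (a :+ b) := e :- a :+ (c :- e) :+ (d :- num 1) :* b)
            refl (∑ t (λ j → pow q (j ℕ.* j))) X (∑ s (λ k → pow q k * f k)) (f (suc s)) (∑ (t ℕ.* t) (λ k → pow
            q k * f k)))
        where
        X = pow q (suc t ℕ.* suc t)
        s = t ℕ.+ t ℕ.* suc t
        t*t≤s : t ℕ.* t ℕ.≤ s
        t*t≤s = ℕ.≤-trans (ℕ.*-monoʳ-≤ t (ℕ.n≤1+n t)) (ℕ.m≤n+m (t ℕ.* suc t) t)

      -- The J = 4(M+1) squares contribute at least 1/2 each, and the other terms are nonnegative.
      Lam-lower : # 2 * (# M + # 1) ≤ Lam
      Lam-lower = ≤-trans (lin/ 1 (↑ low ⊕ eq* (# 1) (∑-*ˡ J (# 2) (λ j → pow q (j ℕ.* j))) ⊕ eq* (- # 1)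
            (∑-const J (# 1)) ⊕ eq* (- # 1) (#J₀ m) ⊕ eq* (- # 4) (#-suc M)) (solve 6 (λ a b c d e f → num 2 :*
            (b :- num 2 :* (a :+ num 1)) := c :- d :+ num 1 :* (num 2 :* b :- c) :+ :- (num 1) :* (e :* num 1 :-
            d) :+ :- (num 1) :* (num 4 :* f :- e) :+ :- (num 4) :* (a :+ num 1 :- f)) refl (# M) (∑ J (λ j → pow
            q (j ℕ.* j))) (∑ J (λ j → # 2 * pow q (j ℕ.* j))) (∑ J (λ _ → # 1)) (# J) (# (suc M))))
          (≤-trans (squares J) (∑-mono-range (λ k → pow q k * f k) J²≤Z (λ k p _ → pow-≥0 k q≥0 ⊗ f≥0 k (ℕ.≤-trans (s≤s z≤n) p))))
        where
        J²≤Z : J ℕ.* J ℕ.≤ Z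
        J²≤Z = J₀²≤Z₀ m
        low : ∑ J (λ _ → # 1) ≤ ∑ J (λ j → # 2 * pow q (j ℕ.* j))
        low = ∑-mono J (λ j _ r → half j r)
          where
          -- By Bernoulli q^(j²) = y^(2j²) ≥ 1 - 2j²/ν, which is at least 1/2 because ν = 4J².
          half : ∀ j → j ℕ.≤ J → # 1 ≤ # 2 * pow q (j ℕ.* j)
          half j r = lin (eq* (- # 2) (pow-square y k) ⊕ eq* (# 2) (pow-+ y k k) ⊕ nn 2 ⊗ (↑ (bernoulli {a} (k
                ℕ.+ k) (inv-nonneg ν) a≤1)) ⊕ eq* (# 2 * (a)) (#-+ k k) ⊕ nn 4 ⊗ (↑ (#-mono (ℕ.*-mono-≤ r r)) ⊗
                (inv-nonneg ν)) ⊕ eq* (- # 1 * (a)) (#ν₀ m) ⊕ eq* (# 1) νa) (solve 8 (λ a b c d e f g h → num 2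
                :* a :- num 1 := :- (num 2) :* (b :* b :- a) :+ num 2 :* (b :* b :- c) :+ num 2 :* (c :- (num 1
                :- d :* e)) :+ num 2 :* e :* (f :+ f :- d) :+ num 4 :* ((g :- f) :* e) :+ :- (num 1) :* e :*
                (num 4 :* g :- h) :+ num 1 :* (num 1 :- h :* e)) refl (pow q k) (pow y k) (pow y (k ℕ.+ k)) (#
                (k ℕ.+ k)) a (# k) (# (J ℕ.* J)) (# ν))
            where k = j ℕ.* j

      1-q : a ≤ # 1 - q
      1-q = lin (↑ a≤1 ⊗ (inv-nonneg ν)) (solve 1 (λ a → num 1 :- (num 1 :- a) :* (num 1 :- a) :- a := (num 1
            :- a) :* a) refl a)

      -- By `Lam-L`, L(Z) is (1-q) Lam up to errors M(1-q) and 1/ν. As Lam ≥ 2(M+1) and 1-q ≥ 1/ν,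
      -- at least (M+1)/ν remains.
      L-Z : (# M + # 1) * a ≤ L Z
      L-Z = lin (eq* (# 1) Lam-L ⊕ ↑ (proj₂ β-sum) ⊕ ↑ (proj₂ err-sum) ⊕ ↑ err-tiny ⊕ ↑ Lam-lower ⊗ (≤-trans
            (inv-nonneg ν) 1-q) ⊕ ↑ 1-q ⊗ (nn M ⊕ nn 2)) (solve 9 (λ a b c d e f g h i → c :- (a :+ num 1) :* b
            := num 1 :* (c :- d :- e :- (num 1 :- f) :* g) :+ (a :* (num 1 :- f) :- :- d) :+ (h :* i :- :- e) :+
            (b :- h :* i) :+ (g :- num 2 :* (a :+ num 1)) :* (num 1 :- f) :+ (num 1 :- f :- b) :* (a :+ num 2))
            refl (# M) a (L Z) X Y q Lam (# Z) (pow q Z))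
        where
        X = ∑ Z (λ d → χ d * β d)
        Y = ∑ Z (λ d → χ d * err d)

    -- The tail beyond Z is at most 2M/(Z+1) ≤ M/ν, so 1/ν is left of `L-Z`.
    L-lower : ∀ {x} → Z ℕ.≤ x → inv ν ≤ L x
    L-lower {x} Z≤x = lin (↑ (proj₂ (L-tail Z≤x)) ⊕ ↑ L-Z ⊕ ↑ small ⊗ (nn M)) (solve 5 (λ a b c d e → b :- a :=
          num 2 :* c :* d :- :- (b :- e) :+ (e :- (c :+ num 1) :* a) :+ (a :- num 2 :* d) :* c) refl (inv ν) (L
          x) (# M) (inv (suc Z)) (L Z))
      where
      small : # 2 * inv (suc Z) ≤ inv ν
      small = ≤-trans (*-monoˡ (# 2) (nn 2) (inv-≤ {2 ℕ.* ν} {suc Z} (ℕ.*-mono-≤ {1} {2} (s≤s z≤n) (1≤ν₀ m)) 2ν≤Z))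
        (≡⇒≤ (trans (cong (# 2 *_) (inv-* 2 ν)) (trans (solve 2 (λ a b → num 2 :* (a :* b) := num 2 :* a :* b)
              refl (inv 2) (inv ν)) (trans (cong (_* inv ν) (inv-suc 1)) (solve 1 (λ a → num 1 :* a := a) refl
              (inv ν))))))
        where
        2ν≤Z : 2 ℕ.* ν ℕ.≤ suc Z
        2ν≤Z = ℕ.m≤n⇒m≤1+n (2ν₀≤Z₀ m)

    module _ (B : ℕ) where

      open Estimates B

      T : ℕ → F
      T x = ∑ x (λ a → χ a * Λ/ a)

      T-hyperbola : ∀ x → ∑ x (λ n → χ n * (ℓ n * inv n)) ≡ ∑ x (λ a → χ a * Λ/ a * L (x ÷ a))
      T-hyperbola x = trans (∑-cong′ x (λ n → (solve 3 (λ a b c → a :* (b :* c) := a :* c :* b) refl (χ n) (ℓ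
            n) (inv n)))) (trans (sym (Λ-hyperbola {x} (λ n → χ n * inv n)))
        (∑-cong′ x (λ a → trans (cong (Λ a *_) (trans (∑-cong′ (x ÷ a) (λ b → trans (cong₂ _*_ (χ-* a b) (inv-* a b)) (solve
              4 (λ a b c d → a :* b :* (c :* d) := a :* c :* (b :* d)) refl (χ a) (χ b) (inv a) (inv b))))
          (∑-*ˡ (x ÷ a) (χ a * inv a) _))) (solve 4 (λ a b c d → a :* (b :* c :* d) := b :* (a :* c) :* d) refl
                (Λ a) (χ a) (inv a) (L (x ÷ a))))))

      -- In `T-hyperbola` L(x/a) is replaced by L(x). By `L-tail` the error is at most 2M Λ(a)/x,
      -- which sums to 16M by Chebyshev; the other 10M bounds Σ χ(n) log n / n.
      LT-∣∣ : ∀ {x} → 1 ℕ.≤ x → suc x ℕ.≤ B → ∣ L x * T x ∣≤ # 26 * # M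
      LT-∣∣ {x} 1≤x x<B = ∣∣-cong split (∣∣-weaken total (∣∣-+ (∑eℓ/n χ (# M) χ-partial x 1≤x (ℕ.<⇒≤ x<B)) (∑-∣∣ x term)))
        where
        split : L x * T x ≡ ∑ x (λ n → χ n * (ℓ n * inv n)) + ∑ x (λ a → χ a * Λ/ a * (L x - L (x ÷ a)))
        split = trans (trans (solve 2 (λ a b → a :* b := b :* a) refl (L x) (T x)) (sym (∑-*ʳ x (L x) _))) (trans (∑-cong′ x (λ a → (solve
              4 (λ a b c d → a :* b :* c := a :* b :* d :+ a :* b :* (c :- d)) refl (χ a) (Λ/ a) (L x) (L (x ÷
              a)))))
          (trans (∑-+ x _ _) (cong (_+ ∑ x (λ a → χ a * Λ/ a * (L x - L (x ÷ a)))) (sym (T-hyperbola x)))))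
        near : ∀ a → 1 ℕ.≤ a → inv (suc (x ÷ a)) ≤ # a * inv x
        near a p = lin (↑ ceil ⊗ (inv-nonneg s ⊗ inv-nonneg x) ⊕ eq* (# 1 * (# a * inv x)) (inv-suc (x ÷ a)) ⊕
              eq* (- # 1 * (inv s)) (inv-inverse 1≤x)) (solve 5 (λ a b c d e → b :* c :- a := (b :* d :- e) :*
              (a :* c) :+ num 1 :* (b :* c) :* (num 1 :- d :* a) :+ :- (num 1) :* a :* (num 1 :- e :* c)) refl
              (inv s) (# a) (inv x) (# s) (# x))
          where
          s = suc (x ÷ a)
          ceil : # x ≤ # a * # s
          ceil = subst (# x ≤_) (#-* a s) (#-mono (ℕ.<⇒≤ (<-*-suc÷ x a p)))
        term : ∀ a → 1 ℕ.≤ a → a ℕ.≤ x → ∣ χ a * Λ/ a * (L x - L (x ÷ a)) ∣≤ # 2 * # M * inv x * Λ a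
        term a p _ = ∣∣-weaken (lin (nn 2 ⊗ (↑ (near a p) ⊗ (Λ/≥0 a ⊗ nn M)) ⊕ eq* (# 2 * (Λ a * # M * inv x))
              (inv-inverse p)) (solve 6 (λ a b c d e f → num 2 :* c :* e :* a :- num 1 :* (a :* b) :* (num 2 :*
              c :* d) := num 2 :* ((f :* e :- d) :* (a :* b :* c)) :+ num 2 :* (a :* c :* e) :* (num 1 :- f :*
              b)) refl (Λ a) (inv a) (# M) (inv (suc (x ÷ a))) (inv x) (# a)))
          (∣∣-* (∣∣-* (χ-∣∣ a) (∣∣-of-nonneg (Λ/≥0 a))) (L-tail (÷-≤ x a)))
        total : # 10 * # M + ∑ x (λ a → # 2 * # M * inv x * Λ a) ≤ # 26 * # M
        total = lin (eq* (# 1) (∑-*ˡ x (# 2 * # M * inv x) Λ) ⊕ nn 2 ⊗ (↑ (ψ-≤ x x<B) ⊗ (nn M ⊗ inv-nonneg x))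
              ⊕ eq* (# 16 * (# M)) (inv-inverse 1≤x)) (solve 5 (λ a b c d e → num 26 :* a :- (num 10 :* a :+ b)
              := num 1 :* (num 2 :* a :* c :* d :- b) :+ num 2 :* ((num 8 :* e :- d) :* (a :* c)) :+ num 16 :* a
              :* (num 1 :- e :* c)) refl (# M) (∑ x (λ a → # 2 * # M * inv x * Λ a)) (inv x) (ψ x) (# x))

      T-∣∣ : ∀ {x} → Z ℕ.≤ x → suc x ℕ.≤ B → ∣ T x ∣≤ # 26 * # M * # ν
      T-∣∣ {x} Z≤x x<B = bound (≤-total (# 0) (T x))
        where
        lt = LT-∣∣ (ℕ.≤-trans (1≤Z₀ m) Z≤x) x<B
        n≥0 : # 0 ≤ # 26 * # M * # ν
        n≥0 = nn 26 ⊗ nn M ⊗ nn ν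
        bound : # 0 ≤ T x ⊎ T x ≤ # 0 → ∣ T x ∣≤ # 26 * # M * # ν
        bound (inj₁ p) = lin (↑ (proj₁ lt) ⊗ (nn ν) ⊕ ↑ (L-lower Z≤x) ⊗ (p ⊗ nn ν) ⊕ eq* (- # 1 * (T x))
              (inv-inverse (1≤ν₀ m))) (solve 5 (λ a b c d e → num 26 :* b :* c :- a := (num 26 :* b :- d :* a)
              :* c :+ (d :- e) :* (a :* c) :+ :- (num 1) :* a :* (num 1 :- c :* e)) refl (T x) (# M) (# ν) (L x)
              (inv ν))
          , (lin (p ⊕ n≥0) (solve 3 (λ a b c → num 26 :* b :* c :- :- a := a :+ num 26 :* b :* c) refl (T x) (#
                M) (# ν)))
        bound (inj₂ p) = lin (↑ p ⊕ n≥0) (solve 3 (λ a b c → num 26 :* b :* c :- a := num 0 :- a :+ num 26 :* b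
              :* c) refl (T x) (# M) (# ν))
          , (lin (↑ (proj₂ lt) ⊗ (nn ν) ⊕ ↑ (L-lower Z≤x) ⊗ (↑ p ⊗ nn ν) ⊕ eq* (# 1 * (T x)) (inv-inverse (1≤ν₀
                m))) (solve 5 (λ a b c d e → num 26 :* b :* c :- :- a := (num 26 :* b :- :- (d :* a)) :* c :+ (d
                :- e) :* ((num 0 :- a) :* c) :+ num 1 :* a :* (num 1 :- c :* e)) refl (T x) (# M) (# ν) (L x)
                (inv ν)))

  -- Selberg's formula sampled at powers of Y; a class without primes.

  ∑-interval : ∀ {x y} (w φ : ℕ → F) c → x ℕ.≤ y → (∀ a → # 0 ≤ w a) → (∀ a → x ℕ.< a → a ℕ.≤ y → φ a ≤ c) →
    ∑ y (λ a → w a * φ a) - ∑ x (λ a → w a * φ a) ≤ (∑ y w - ∑ x w) * c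
  ∑-interval {x} {y} w φ c x≤y w≥0 h = subst (λ z → ∑ z (λ a → w a * φ a) - ∑ x (λ a → w a * φ a) ≤ (∑ z w - ∑ x w) * c) (ℕ.m+[n∸m]≡n x≤y)
      (lin (eq* (# 1) (∑-split x d (λ a → w a * φ a)) ⊕ eq* (- # 1 * (c)) (∑-split x d w) ⊕ ↑ le) (solve 7 (λ a
            b c d e f g → (c :- d) :* e :- (a :- b) := num 1 :* (b :+ f :- a) :+ :- (num 1) :* e :* (d :+ g :-
            c) :+ (g :* e :- f)) refl (∑ (x ℕ.+ d) (λ a → w a * φ a)) (∑ x (λ a → w a * φ a)) (∑ (x ℕ.+ d) w) (∑
            x w) c U V))
    where
    d = y ℕ.∸ x
    U = ∑ d (λ i → w (x ℕ.+ i) * φ (x ℕ.+ i))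
    V = ∑ d (λ i → w (x ℕ.+ i))
    le : U ≤ V * c
    le = subst (U ≤_) (∑-*ʳ d c _) (∑-mono d (λ i p q → *-monoˡ (w (x ℕ.+ i)) (w≥0 (x ℕ.+ i))
      (h (x ℕ.+ i) (ℕ.m<m+n x p) (subst (x ℕ.+ i ℕ.≤_) (ℕ.m+[n∸m]≡n x≤y) (ℕ.+-monoʳ-≤ x q)))))

  ∑-interval-≥ : ∀ {x y} (w φ : ℕ → F) c → x ℕ.≤ y → (∀ a → # 0 ≤ w a) → (∀ a → x ℕ.< a → a ℕ.≤ y → c ≤ φ a) →
    (∑ y w - ∑ x w) * c ≤ ∑ y (λ a → w a * φ a) - ∑ x (λ a → w a * φ a)
  ∑-interval-≥ {x} {y} w φ c x≤y w≥0 h =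
    (lin (↑ (∑-interval w (λ a → - φ a) (- c) x≤y w≥0 (λ a p q → neg (h a p q))) ⊕ eq* (- # 1) (negate y) ⊕ eq*
          (# 1) (negate x)) (solve 7 (λ a b c d e f g → d :- e :- (a :- b) :* c := (a :- b) :* :- c :- (f :- g)
          :+ :- (num 1) :* (:- d :- f) :+ num 1 :* (:- e :- g)) refl (∑ y w) (∑ x w) c (∑ y (λ a → w a * φ a))
          (∑ x (λ a → w a * φ a)) (∑ y (λ a → w a * - φ a)) (∑ x (λ a → w a * - φ a))))
    where
    neg : ∀ {u v} → u ≤ v → - v ≤ - u
    neg {u} {v} p = lin (↑ p) (solve 2 (λ a b → :- b :- :- a := a :- b) refl v u)
    negate : ∀ z → ∑ z (λ a → w a * - φ a) ≡ - ∑ z (λ a → w a * φ a)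
    negate z = trans (∑-cong′ z (λ a → (solve 2 (λ a b → a :* :- b := :- (a :* b)) refl (w a) (φ a)))) (∑-neg z _)

  ∑-abel : ∀ K (α : ℕ → F) → α 0 ≡ # 0 → ∑ K (λ i → (α i - α (ℕ.pred i)) * # (suc K ℕ.∸ i)) ≡ ∑ K α
  ∑-abel zero α e = refl
  ∑-abel (suc K) α e = begin
    ∑ (suc K) (λ i → (α i - α (ℕ.pred i)) * # (suc (suc K) ℕ.∸ i))
      ≡⟨ ∑-cong (suc K) (λ i _ q → trans (cong (λ z → (α i - α (ℕ.pred i)) * # z) (ℕ.+-∸-assoc 1 {suc K} {i} q))
           (trans (cong ((α i - α (ℕ.pred i)) *_) (#-suc (suc K ℕ.∸ i))) (solve 3 (λ a b c → (a :- b) :* (c :+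
                 num 1) := (a :- b) :* c :+ (a :- b)) refl (α i) (α (ℕ.pred i)) (# (suc K ℕ.∸ i))))) ⟩
    ∑ (suc K) (λ i → (α i - α (ℕ.pred i)) * # (suc K ℕ.∸ i) + (α i - α (ℕ.pred i))) ≡⟨ ∑-+ (suc K) _ _ ⟩
    X + (α (suc K) - α K) * # (suc K ℕ.∸ suc K) + ∑ (suc K) (λ i → α i - α (ℕ.pred i))
      ≡⟨ cong₂ (λ u v → u + (α (suc K) - α K) * # v + ∑ (suc K) (λ i → α i - α (ℕ.pred i))) (∑-abel K α e) (ℕ.n∸n≡0 K) ⟩
    ∑ K α + (α (suc K) - α K) * # 0 + ∑ (suc K) (λ i → α i - α (ℕ.pred i)) ≡⟨ cong (∑ K α + (α (suc K) - α K) * # 0 +_) (∑-telescope (suc K) α) ⟩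
    ∑ K α + (α (suc K) - α K) * # 0 + (α (suc K) - α 0) ≡⟨ cong (λ z → ∑ K α + (α (suc K) - α K) * # 0 + (α (suc K) - z)) e ⟩
    ∑ K α + (α (suc K) - α K) * # 0 + (α (suc K) - # 0) ≡⟨ (solve 3 (λ a b c → a :+ (b :- c) :* num 0 :+ (b :-
          num 0) := a :+ b) refl (∑ K α) (α (suc K)) (α K)) ⟩
    ∑ K α + α (suc K) ∎
    where
    open ≡-Reasoning
    X = ∑ K (λ i → (α i - α (ℕ.pred i)) * # (suc K ℕ.∸ i))

  -- The functions A, P, J are sampled at the powers of Y; L = log Y is the unit of length.

  module Discrete (B m : ℕ) (M≤B : suc m ℕ.≤ B) (Y k′ : ℕ) (1≤Y : 1 ℕ.≤ Y) where

    open Selberg B m M≤B public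

    -- K + 1 = 2k, so that i ≤ k implies K + 1 - i ≥ k; `X-lower` depends on this.
    k K : ℕ
    k = suc k′
    K = k′ ℕ.+ suc k′

    L : F
    L = ℓ Y

    module Sampled (range : Y ℕ.^ K ℕ.+ Y ℕ.^ K ℕ.≤ B) (1≤L : # 1 ≤ L)
      (L-large₁ : C₂ * (# 2 + (# 2 * # K + # 1) * L) ≤ L * L) (L-large₂ : C₂ * (# 1 + # K * L) + # 8 * N * # K * L ≤ L * L)
      (L-large₃ : # 2 * # K * C₁ ≤ L) (1≤N : # 1 ≤ N) where

      L≥0 : # 0 ≤ L
      L≥0 = ≤-trans (nn 1) 1≤L

      1≤Y^ : ∀ i → 1 ℕ.≤ Y ℕ.^ i
      1≤Y^ i = ℕ.m^n>0 Y {{ℕ.>-nonZero 1≤Y}} i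

      Y^-mono : ∀ {i j} → i ℕ.≤ j → Y ℕ.^ i ℕ.≤ Y ℕ.^ j
      Y^-mono = ℕ.^-monoʳ-≤ Y {{ℕ.>-nonZero 1≤Y}}

      2Y^≤B : ∀ {i} → i ℕ.≤ K → Y ℕ.^ i ℕ.+ Y ℕ.^ i ℕ.≤ B
      2Y^≤B p = ℕ.≤-trans (ℕ.+-mono-≤ (Y^-mono p) (Y^-mono p)) range

      Y^≤B : ∀ {i} → i ℕ.≤ K → Y ℕ.^ i ℕ.≤ B
      Y^≤B {i} p = ℕ.≤-trans (ℕ.m≤m+n (Y ℕ.^ i) (Y ℕ.^ i)) (2Y^≤B p)

      Y^<B : ∀ {i} → i ℕ.≤ K → suc (Y ℕ.^ i) ℕ.≤ B
      Y^<B {i} p = ℕ.≤-trans (ℕ.+-monoˡ-≤ (Y ℕ.^ i) (1≤Y^ i)) (2Y^≤B p)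

      ℓ-Y^ : ∀ i → i ℕ.≤ K → ℓ (Y ℕ.^ i) ≡ # i * L
      ℓ-Y^ zero _ = trans ℓ-1 (solve 1 (λ a → num 0 := num 0 :* a) refl L)
      ℓ-Y^ (suc i) p = trans (ℓ-* 1≤Y (1≤Y^ i) (Y^≤B p)) (trans (cong (L +_) (ℓ-Y^ i (ℕ.<⇒≤ p))) (trans (solve
            2 (λ a b → a :+ b :* a := (b :+ num 1) :* a) refl L (# i)) (cong (_* L) (sym (#-suc i)))))

      α : ℕ → ℕ → F
      α g i = A g (Y ℕ.^ i)

      A-mono : ∀ g {x y} → x ℕ.≤ y → A g x ≤ A g y
      A-mono g p = ∑-mono-range _ p (λ a _ _ → 𝟙-nonneg (a ≋? g) ⊗ Λ/≥0 a)

      A≥0 : ∀ g x → # 0 ≤ A g x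
      A≥0 g x = A-mono g {0} {x} z≤n

      α-step : ∀ g i → # 0 ≤ α g (suc i) - α g i
      α-step g i = ↑ (A-mono g (Y^-mono (ℕ.n≤1+n i)))

      α-0 : ∀ g → α g 0 ≡ # 0
      α-0 g = trans (cong (λ z → # 0 + δ 1 g * (z * inv 1)) Λ-1) (solve 2 (λ a b → num 0 :+ a :* (num 0 :* b)
            := num 0) refl (δ 1 g) (inv 1))

      A-invariant : ∀ x → Invariant (λ g → A g x)
      A-invariant x e = ∑-cong′ x (λ a → cong (_* Λ/ a) (δ-congʳ a e))

      J-mono : ∀ g {x y} → x ℕ.≤ y → J g x ≤ J g y
      J-mono g {x} {y} p = ≤-trans (∑-mono x (λ a _ _ → *-monoˡ (Λ/ a) (Λ/≥0 a) (∑-mono-range _ (÷-monoˡ a) (λ b _ _ → 𝟙-nonneg (a ℕ.* b ≋? g) ⊗ Λ/≥0 b))))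
          (∑-mono-range _ p (λ a _ _ → Λ/≥0 a ⊗ ∑-nonneg (y ÷ a) (λ b _ _ → 𝟙-nonneg (a ℕ.* b ≋? g) ⊗ Λ/≥0 b)))
        where
        ÷-monoˡ : ∀ a → x ÷ a ℕ.≤ y ÷ a
        ÷-monoˡ zero = z≤n
        ÷-monoˡ a@(suc _) = ℕ./-monoˡ-≤ a p

      P-∑ : ∀ g x → P g x ≡ ∑ x (λ a → δ a g * Λ/ a * ℓ a)
      P-∑ g x = ∑-cong′ x (λ a → (solve 3 (λ a b c → a :* (b :* c) := a :* b :* c) refl (δ a g) (Λ/ a) (ℓ a)))

      P-step : ∀ g {i} → suc i ℕ.≤ K → # i * L * (α g (suc i) - α g i) ≤ P g (Y ℕ.^ suc i) - P g (Y ℕ.^ i)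
      P-step g {i} p = lin (eq* (- # 1) (P-∑ g (Y ℕ.^ suc i)) ⊕ eq* (# 1) (P-∑ g (Y ℕ.^ i)) ⊕ ↑ (∑-interval-≥
            (λ a → δ a g * Λ/ a) ℓ (# i * L) (Y^-mono (ℕ.n≤1+n i)) (λ a → 𝟙-nonneg (a ≋? g) ⊗ Λ/≥0 a)

             (λ a q r → subst (_≤ ℓ a) (ℓ-Y^ i (ℕ.<⇒≤ p)) (ℓ-mono (1≤Y^ i) (ℕ.<⇒≤ q) (ℕ.≤-trans r (Y^≤B p))))))
            (solve 8 (λ a b c d e f g h → e :- f :- a :* b :* (c :- d) := :- (num 1) :* (g :- e) :+ num 1 :* (h
            :- f) :+ (g :- h :- (c :- d) :* (a :* b))) refl (# i) L (α g (suc i)) (α g i) (P g (Y ℕ.^ suc i)) (P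
            g (Y ℕ.^ i)) U V)
        where
        U = ∑ (Y ℕ.^ suc i) (λ a → δ a g * Λ/ a * ℓ a)
        V = ∑ (Y ℕ.^ i) (λ a → δ a g * Λ/ a * ℓ a)

      selbergᴸ : ∀ {g i} → Coprime g M → i ℕ.≤ K → ∣ N * S g (Y ℕ.^ i) - # i * L * (# i * L) ∣≤ C₂ * (# 1 + # i * L)
      selbergᴸ {g} {i} cg p = subst (λ z → ∣ N * S g (Y ℕ.^ i) - z * z ∣≤ C₂ * (# 1 + z)) (ℓ-Y^ i p) (selberg cg (1≤Y^ i) (2Y^≤B p))

      A′-Y^ : ∀ {i} → i ℕ.≤ K → ∣ A′ (Y ℕ.^ i) - # i * L ∣≤ C₁
      A′-Y^ {i} p = subst (λ z → ∣ A′ (Y ℕ.^ i) - z ∣≤ C₁) (ℓ-Y^ i p) (A′-∣∣ (1≤Y^ i) (Y^<B p))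

      C₂≥0 : # 0 ≤ C₂
      C₂≥0 = nn 200 ⊗ nn M ⊗ nn M ⊕ C₁≥0 ⊕ (C₁≥0 ⊕ nn 2) ⊗ C₁≥0

      #≤K : ∀ {i} → i ℕ.≤ K → # i ≤ # K
      #≤K = #-mono

      1≤K : 1 ℕ.≤ K
      1≤K = ℕ.≤-trans (s≤s z≤n) (ℕ.m≤n+m (suc k′) k′)

      C₁≤L : C₁ ≤ L
      C₁≤L = lin (↑ L-large₃ ⊕ nn 2 ⊗ (↑ (#≤K 1≤K) ⊗ C₁≥0) ⊕ C₁≥0) (solve 3 (λ a b c → b :- a := b :- num 2 :*
            c :* a :+ num 2 :* ((c :- num 1) :* a) :+ a) refl C₁ L (# K))

      A≤A′ : ∀ {g} x → Coprime g M → A g x ≤ A′ x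
      A≤A′ {g} x cg = ∑-mono x term
        where
        term : ∀ a → 1 ℕ.≤ a → a ℕ.≤ x → δ a g * Λ/ a ≤ unit a * Λ/ a
        term a _ _ with a ≋? g
        ... | no _ = ≤-trans (lin (nn 0) (solve 1 (λ a → num 0 :- num 0 :* a := num 0) refl (Λ/ a))) (𝟙-nonneg (coprime? a M) ⊗ Λ/≥0 a)
        ... | yes e = ≡⇒≤ (cong (_* Λ/ a) (sym (𝟙-yes (coprime? a M) (coprime-resp-≋ (≋-sym e) cg))))

      -- No class can receive more than twice its share of the primes, up to lower order terms.
      α-increment : ∀ {g i} → Coprime g M → suc i ℕ.≤ K → N * (α g (suc i) - α g i) ≤ # 2 * L + # 4 * N * inv (suc i) * L
      -- There is no log Y^i to divide by here, but Mertens' bound for all classes together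
      -- suffices.
      α-increment {g} {zero} cg p = lin (eq* (- # 1 * (N)) (α-0 g) ⊕ ↑ (A≤A′ (Y ℕ.^ 1) cg) ⊗ N≥0 ⊕ ↑ (proj₁
            (A′-Y^ p)) ⊗ N≥0 ⊕ ↑ C₁≤L ⊗ N≥0 ⊕ eq* (- # 4 * (N * L)) inv-1 ⊕ nn 2 ⊗ (L≥0) ⊕ nn 2 ⊗ ((N≥0 ⊗ L≥0)))
            (solve 7 (λ a b c d e f g → num 2 :* d :+ num 4 :* a :* e :* d :- a :* (b :- c) := :- (num 1) :* a
            :* (num 0 :- c) :+ (f :- b) :* a :+ (g :- (f :- num 1 :* d)) :* a :+ (d :- g) :* a :+ :- (num 4) :*
            (a :* d) :* (num 1 :- e) :+ num 2 :* d :+ num 2 :* (a :* d)) refl N (A g (Y ℕ.^ 1)) (α g 0) L (inv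
            1) (A′ (Y ℕ.^ 1)) C₁)
      -- Selberg's formula at both ends bounds N times the increments of P and J by (2i+1)L² plus
      -- errors. J increases and may be dropped, P grows by at least i L times the increment of α,
      -- and i L is cancelled.
      α-increment {g} {i@(suc _)} cg p = #*-cancelˡ {i} (s≤s z≤n) (L-cancel
          (lin (↑ (P-step g p) ⊗ N≥0 ⊕ ↑ (J-mono g (Y^-mono (ℕ.n≤1+n i))) ⊗ N≥0 ⊕ ↑ (proj₁ (selbergᴸ cg p)) ⊕ ↑
                (proj₂ (selbergᴸ cg (ℕ.<⇒≤ p))) ⊕ eq* (# 1 * (C₂ * L)) (#-suc i) ⊕ eq* (# 1 * (L * L * (# (suc
                i) + # i + # 1))) (#-suc i) ⊕ ↑ L-large₁ ⊕ nn 2 ⊗ (↑ (#≤K (ℕ.<⇒≤ p)) ⊗ (C₂≥0 ⊗ L≥0)) ⊕ ↑ half ⊗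
                (L≥0 ⊗ L≥0)) (solve 12 (λ a b c d e f g h i j k l → a :* (num 2 :* d :+ num 4 :* b :* e :* d) :*
                d :- a :* (b :* c) :* d := (f :- g :- a :* d :* c) :* b :+ (h :- i) :* b :+ (j :* (num 1 :+ k :*
                d) :- (b :* (f :+ h) :- k :* d :* (k :* d))) :+ (j :* (num 1 :+ a :* d) :- :- (b :* (g :+ i) :-
                a :* d :* (a :* d))) :+ num 1 :* (j :* d) :* (a :+ num 1 :- k) :+ num 1 :* (d :* d :* (k :+ a :+
                num 1)) :* (a :+ num 1 :- k) :+ (d :* d :- j :* (num 2 :+ (num 2 :* l :+ num 1) :* d)) :+ num 2
                :* ((l :- a) :* (j :* d)) :+ (num 4 :* b :* a :* e :- num 2) :* (d :* d)) refl (# i) N Δ L (inv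
                (suc i)) (P g (Y ℕ.^ suc i)) (P g (Y ℕ.^ i)) (J g (Y ℕ.^ suc i)) (J g (Y ℕ.^ i)) C₂ (# (suc i))
                (# K))))
        where
        Δ = α g (suc i) - α g i
        L-cancel : ∀ {u v} → u * L ≤ v * L → u ≤ v
        L-cancel {u} {v} h with ≤-total u v
        ... | inj₁ q = q
        ... | inj₂ q = lin (↑ h ⊕ ↑ q ⊗ ↑ 1≤L) (solve 3 (λ a b c → b :- a := b :* c :- a :* c :+ (a :- b) :* (c
              :- num 1)) refl u v L)
        half : # 2 ≤ # 4 * N * # i * inv (suc i)
        half = lin (eq* (- # 2) (inv-suc i) ⊕ eq* (# 2 * (inv (suc i))) (#-suc i) ⊕ nn 2 ⊗ (↑ (#-mono {1} {i}
              (s≤s z≤n)) ⊗ (inv-nonneg (suc i))) ⊕ nn 4 ⊗ (↑ 1≤N ⊗ (nn i ⊗ inv-nonneg (suc i)))) (solve 4 (λ a b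
              c d → num 4 :* a :* b :* c :- num 2 := :- (num 2) :* (num 1 :- d :* c) :+ num 2 :* c :* (b :+ num
              1 :- d) :+ num 2 :* ((b :- num 1) :* c) :+ num 4 :* ((a :- num 1) :* (b :* c))) refl N (# i) (inv
              (suc i)) (# (suc i)))

      -- The amount by which the class falls short of the maximum that `α-increment` allows. It
      -- starts at 0 and never decreases.
      R : ℕ → ℕ → F
      R g t = # 2 * # t * L + # 4 * N * H t * L - N * α g t

      R-step : ∀ {g t} → Coprime g M → suc t ℕ.≤ K → R g t ≤ R g (suc t)
      R-step {g} {t} cg p = lin (↑ (α-increment cg p) ⊕ eq* (- # 2 * (L)) (#-suc t)) (solve 8 (λ a b c d e f g
            h → num 2 :* f :* b :+ num 4 :* c :* (d :+ g) :* b :- c :* h :- (num 2 :* a :* b :+ num 4 :* c :* d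
            :* b :- c :* e) := num 2 :* b :+ num 4 :* c :* g :* b :- c :* (h :- e) :+ :- (num 2) :* b :* (a :+
            num 1 :- f)) refl (# t) L N (H t) (α g t) (# (suc t)) (inv (suc t)) (α g (suc t)))

      R-0 : ∀ g → R g 0 ≡ # 0
      R-0 g = trans (cong (λ z → # 2 * # 0 * L + # 4 * N * # 0 * L - N * z) (α-0 g)) (solve 2 (λ a b → num 2 :*
            num 0 :* a :+ num 4 :* b :* num 0 :* a :- b :* num 0 := num 0) refl L N)

      R-mono-+ : ∀ {g t} d → Coprime g M → d ℕ.+ t ℕ.≤ K → R g t ≤ R g (d ℕ.+ t)
      R-mono-+ zero cg p = ≤-refl
      R-mono-+ (suc d) cg p = ≤-trans (R-mono-+ d cg (ℕ.<⇒≤ p)) (R-step cg p)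

      R-mono : ∀ {g t u} → Coprime g M → t ℕ.≤ u → u ℕ.≤ K → R g t ≤ R g u
      R-mono {g} {t} {u} cg p q = subst (λ z → R g t ≤ R g z) (ℕ.m∸n+n≡m p) (R-mono-+ (u ℕ.∸ t) cg (subst (ℕ._≤ K) (sym (ℕ.m∸n+n≡m p)) q))

      R≥0 : ∀ {g t} → Coprime g M → t ℕ.≤ K → # 0 ≤ R g t
      R≥0 {g} {t} cg p = subst (_≤ R g t) (R-0 g) (R-mono cg z≤n p)

      -- A class with small deficit spends t²L² on its prime powers, all that Selberg's formula
      -- grants it up to lower order. By induction, as each step adds at least t L times the
      -- increment of α.
      P-lower : ∀ {g} t → Coprime g M → t ℕ.≤ K → (# t * # t - # t) * (L * L) - # t * L * R g t ≤ N * P g (Y ℕ.^ t)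
      P-lower {g} zero cg p = lin ((N≥0 ⊗ P≥0)) (solve 4 (λ a b c d → c :* d :- ((num 0 :* num 0 :- num 0) :*
            (a :* a) :- num 0 :* a :* b) := c :* d) refl L (R g 0) N (P g 1))
        where
        P≥0 : # 0 ≤ P g 1
        P≥0 = subst (# 0 ≤_) (sym (trans (cong (λ z → # 0 + δ 1 g * (z * inv 1 * ℓ 1)) Λ-1) (solve 3 (λ a b c →
              num 0 :+ a :* (num 0 :* b :* c) := num 0) refl (δ 1 g) (inv 1) (ℓ 1)))) ≤-refl
      P-lower {g} (suc t) cg p = lin (↑ (P-lower t cg (ℕ.<⇒≤ p)) ⊕ ↑ (P-step g p) ⊗ N≥0 ⊕ eq* (- # 1 * (# t *
            L)) diff ⊕ nn 4 ⊗ ((nn t ⊗ L≥0 ⊗ (N≥0 ⊗ inv-nonneg (suc t) ⊗ L≥0))) ⊕ (L≥0 ⊗ R≥0 cg p) ⊕ eq* (# 1 *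
            ((# (suc t) + # t) * (L * L))) (#-suc t) ⊕ eq* (- # 1 * (L * R g (suc t))) (#-suc t)) (solve 11 (λ a
            b c d e f g h i j k → d :* e :- ((a :* a :- a) :* (b :* b) :- a :* b :* c) := d :* f :- ((g :* g :-
            g) :* (b :* b) :- g :* b :* h) :+ (e :- f :- g :* b :* (i :- j)) :* d :+ :- (num 1) :* (g :* b) :*
            (num 2 :* b :+ num 4 :* d :* k :* b :- (c :- h) :- d :* (i :- j)) :+ num 4 :* (g :* b :* (d :* k :*
            b)) :+ b :* c :+ num 1 :* ((a :+ g) :* (b :* b)) :* (g :+ num 1 :- a) :+ :- (num 1) :* (b :* c) :*
            (g :+ num 1 :- a)) refl (# (suc t)) L (R g (suc t)) N (P g (Y ℕ.^ suc t)) (P g (Y ℕ.^ t)) (# t) (R g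
            t) (α g (suc t)) (α g t) (inv (suc t)))
        where
        diff : N * (α g (suc t) - α g t) ≡ # 2 * L + # 4 * N * inv (suc t) * L - (R g (suc t) - R g t)
        diff = trans (solve 7 (λ a b c d e f g → a :* (b :- c) := num 2 :* d :+ num 4 :* a :* e :* d :- (num 2
              :* (f :+ num 1) :* d :+ num 4 :* a :* (g :+ e) :* d :- a :* b :- (num 2 :* f :* d :+ num 4 :* a :*
              g :* d :- a :* c))) refl N (α g (suc t)) (α g t) L (inv (suc t)) (# t) (H t))
          (cong (λ z → # 2 * L + # 4 * N * inv (suc t) * L - (# 2 * z * L + # 4 * N * (H t + inv (suc t)) * L - N * α g (suc t) - R g t)) (sym (#-suc t)))

      module _ (c : ℕ) (coprime-c : Coprime c M) where

        -- The class c/h. The default 1 for nonunits keeps every value coprime to M.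
        partner : ℕ → ℕ
        partner h with coprime? h M
        ... | yes ch = proj₁ (inverse ch) ℕ.* c
        ... | no _ = 1

        partner-≋ : ∀ {h} → Coprime h M → ∀ b → (h ℕ.* b ≋ c → partner h ≋ b) × (partner h ≋ b → h ℕ.* b ≋ c)
        partner-≋ {h} ch b with coprime? h M
        ... | no ¬ch = ⊥-elim (¬ch ch)
        ... | yes ch′ = ≋-divide h (proj₁ (inverse ch′)) (proj₂ (inverse ch′)) , ≋-multiply h (proj₁ (inverse ch′)) (proj₂ (inverse ch′))

        partner-coprime : ∀ h → Coprime (partner h) M
        partner-coprime h with coprime? h M
        ... | yes ch = coprime-*ˡ {proj₁ (inverse ch)} (inverse-coprime h (proj₂ (inverse ch))) coprime-c
        ... | no _ = λ (d , _) → ∣1⇒≡1 d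

        J-split : ∀ x → J c x ≡ ∑ᵘ (λ h → ∑ x (λ a → δ a h * Λ/ a * A (partner h) (x ÷ a)))
        J-split x = trans (∑-cong′ x term) (sym (∑ᵘ-∑ x (λ h a → δ a h * Λ/ a * A (partner h) (x ÷ a))))
          where
          inner : ∀ a h → Coprime h M → a ≋ h → ∀ y → ∑ y (λ b → δ (a ℕ.* b) c * Λ/ b) ≡ A (partner h) y
          inner a h ch e y = ∑-cong′ y (λ b → cong (_* Λ/ b) (𝟙-cong (a ℕ.* b ≋? c) (b ≋? partner h)
            (λ p → ≋-sym (proj₁ (partner-≋ ch b) (≋-trans (≋-*ʳ b (≋-sym e)) p))) (λ p → ≋-trans (≋-*ʳ b e) (proj₂ (partner-≋ ch b) (≋-sym p)))))
          term : ∀ a → Λ/ a * ∑ (x ÷ a) (λ b → δ (a ℕ.* b) c * Λ/ b) ≡ ∑ᵘ (λ h → δ a h * Λ/ a * A (partner h) (x ÷ a))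
          term a = begin
            Λ/ a * I ≡⟨ unit-I ⟩
            unit a * (Λ/ a * I) ≡⟨ sym (∑ᵘ-δ* a (Λ/ a * I)) ⟩
            ∑ᵘ (λ h → δ a h * (Λ/ a * I)) ≡⟨ ∑-cong′ M per ⟩
            ∑ᵘ (λ h → δ a h * Λ/ a * A (partner h) (x ÷ a)) ∎
            where
            open ≡-Reasoning
            I = ∑ (x ÷ a) (λ b → δ (a ℕ.* b) c * Λ/ b)
            unit-I : Λ/ a * I ≡ unit a * (Λ/ a * I)
            unit-I with coprime? a M
            ... | yes _ = solve 2 (λ a b → a :* b := num 1 :* (a :* b)) refl (Λ/ a) I
            ... | no ¬ca = trans (cong (Λ/ a *_) (∑-zero′ (x ÷ a) (λ b _ _ → 𝟙-no* (a ℕ.* b ≋? c) (λ e → ¬ca (coprime-factorˡ {a} {b} (coprime-resp-≋ (≋-sym e) coprime-c))) (Λ/ b))))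
              (solve 2 (λ a b → a :* num 0 := num 0 :* (a :* b)) refl (Λ/ a) I)
            per : ∀ h → unit h * (δ a h * (Λ/ a * I)) ≡ unit h * (δ a h * Λ/ a * A (partner h) (x ÷ a))
            per h = 𝟙-guard (coprime? h M) (λ ch → trans (𝟙-guard (a ≋? h) (λ e → cong (Λ/ a *_) (inner a h ch e (x ÷ a))))
              (solve 3 (λ a b c → a :* (b :* c) := a :* b :* c) refl (δ a h) (Λ/ a) (A (partner h) (x ÷ a))))

        -- For Y^(i-1) < a ≤ Y^i the quotient Y^K/a is at most Y^(K+1-i).
        blocks : ∀ h g t → t ℕ.≤ K → ∑ (Y ℕ.^ t) (λ a → δ a h * Λ/ a * A g (Y ℕ.^ K ÷ a)) ≤
          ∑ t (λ i → (α h i - α h (ℕ.pred i)) * α g (suc K ℕ.∸ i))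
        blocks h g zero _ = ≡⇒≤ (trans (cong (λ z → # 0 + δ 1 h * (z * inv 1) * A g (Y ℕ.^ K ÷ 1)) Λ-1) (solve
              3 (λ a b c → num 0 :+ a :* (num 0 :* b) :* c := num 0) refl (δ 1 h) (inv 1) (A g (Y ℕ.^ K ÷ 1))))
        blocks h g (suc t) p = lin (↑ (blocks h g t (ℕ.<⇒≤ p)) ⊕ ↑ (∑-interval (λ a → δ a h * Λ/ a) (λ a → A g
              (Y ℕ.^ K ÷ a)) (α g (K ℕ.∸ t)) (Y^-mono (ℕ.n≤1+n t)) (λ a → 𝟙-nonneg (a ≋? h) ⊗ Λ/≥0 a) (λ a q _ →
              A-mono g (quot a q)))) (solve 6 (λ a b c d e f → b :+ (c :- d) :* e :- a := b :- f :+ ((c :- d) :*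
              e :- (a :- f))) refl (∑ (Y ℕ.^ suc t) term) (∑ t (λ i → (α h i - α h (ℕ.pred i)) * α g (suc K ℕ.∸
              i))) (α h (suc t)) (α h t) (α g (K ℕ.∸ t)) (∑ (Y ℕ.^ t) term))
          where
          term : ℕ → F
          term a = δ a h * Λ/ a * A g (Y ℕ.^ K ÷ a)
          quot : ∀ a → Y ℕ.^ t ℕ.< a → Y ℕ.^ K ÷ a ℕ.≤ Y ℕ.^ (K ℕ.∸ t)
          quot a q = ℕ.*-cancelˡ-≤ (Y ℕ.^ t) {{ℕ.>-nonZero (1≤Y^ t)}} (ℕ.≤-trans (ℕ.*-monoˡ-≤ (Y ℕ.^ K ÷ a) (ℕ.<⇒≤ q)) (ℕ.≤-trans (*-÷-≤ (Y ℕ.^ K) a)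
            (ℕ.≤-reflexive (trans (cong (Y ℕ.^_) (sym (ℕ.m+[n∸m]≡n (ℕ.<⇒≤ p)))) (ℕ.^-distribˡ-+-* Y t (K ℕ.∸ t))))))

        -- What the convolution of h with its partner loses because the partner falls short of the
        -- maximum.
        X : ℕ → F
        X h = ∑ K (λ i → (α h i - α h (ℕ.pred i)) * R (partner h) (suc K ℕ.∸ i))

        1+K∸i≤K : ∀ {i} → 1 ℕ.≤ i → suc K ℕ.∸ i ℕ.≤ K
        1+K∸i≤K {suc i} _ = ℕ.m∸n≤m K i

        α-diff≥0 : ∀ h {i} → 1 ℕ.≤ i → # 0 ≤ α h i - α h (ℕ.pred i)
        α-diff≥0 h {suc i} _ = α-step h i

        -- The partner's mass is expressed through its deficit; summation by parts turns the main
        -- term into 2L Σ α, and the harmonic sums are bounded by H(K).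
        J-X : ∀ h → N * ∑ K (λ i → (α h i - α h (ℕ.pred i)) * α (partner h) (suc K ℕ.∸ i)) + X h ≤ # 2 * L * ∑ K (α h) + # 4 * N * H K * L * α h K
        J-X h = ≤-trans (≡⇒≤ (trans (cong (_+ X h) (sym (∑-*ˡ K N _))) (sym (∑-+ K _ _)))) (≤-trans (∑-mono K term)
            (≡⇒≤ (trans (∑-+ K _ _) (cong₂ _+_ (trans (∑-*ˡ K (# 2 * L) _) (cong (# 2 * L *_) (∑-abel K (α h) (α-0 h))))
              (trans (∑-*ˡ K (# 4 * N * H K * L) _) (cong (# 4 * N * H K * L *_) (trans (∑-telescope K (α h)) (trans (cong (λ z → α h K - z) (α-0 h)) (solve
                    1 (λ a → a :- num 0 := a) refl (α h K))))))))))
          where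
          term : ∀ i → 1 ℕ.≤ i → i ℕ.≤ K → N * ((α h i - α h (ℕ.pred i)) * α (partner h) (suc K ℕ.∸ i)) + (α h i - α h (ℕ.pred i)) * R (partner h) (suc K ℕ.∸ i) ≤
            # 2 * L * ((α h i - α h (ℕ.pred i)) * # (suc K ℕ.∸ i)) + # 4 * N * H K * L * (α h i - α h (ℕ.pred i))
          term i p q = lin (nn 4 ⊗ (↑ (H-mono (1+K∸i≤K p)) ⊗ (α-diff≥0 h p ⊗ (N≥0 ⊗ L≥0)))) (solve 7 (λ a b c d
                e f g → num 2 :* e :* (b :* d) :+ num 4 :* a :* g :* e :* b :- (a :* (b :* c) :+ b :* (num 2 :*
                d :* e :+ num 4 :* a :* f :* e :- a :* c)) := num 4 :* ((g :- f) :* (b :* (a :* e)))) refl N D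
                (α (partner h) s) (# s) L (H s) (H K))
            where
            s = suc K ℕ.∸ i
            D = α h i - α h (ℕ.pred i)

        X≥0 : ∀ h → # 0 ≤ X h
        X≥0 h = ∑-nonneg K (λ i p _ → α-diff≥0 h p ⊗ R≥0 (partner-coprime h) (1+K∸i≤K p))

        -- Only i ≤ k is kept; there K + 1 - i ≥ k, so the deficit is at least its value at k.
        X-lower : ∀ h → α h k * R (partner h) k ≤ X h
        X-lower h = ≤-trans (≤-trans (≡⇒≤ (trans (cong (_* R (partner h) k) (sym tele)) (sym (∑-*ʳ k (R (partner h) k) _))))
            (∑-mono k (λ i p q → *-monoˡ (α h i - α h (ℕ.pred i)) (α-diff≥0 h p) (R-mono (partner-coprime h) (far i q) (1+K∸i≤K p)))))
            (∑-mono-range _ (ℕ.m≤n+m (suc k′) k′) (λ i p q → α-diff≥0 h (ℕ.≤-trans (s≤s z≤n) p) ⊗ R≥0 (partner-coprime h) (1+K∸i≤K (ℕ.≤-trans (s≤s z≤n) p))))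
          where
          tele : ∑ k (λ i → α h i - α h (ℕ.pred i)) ≡ α h k
          tele = trans (∑-telescope k (α h)) (trans (cong (λ z → α h k - z) (α-0 h)) (solve 1 (λ a → a :- num 0
                := a) refl (α h k)))
          far : ∀ i → i ℕ.≤ k → k ℕ.≤ suc K ℕ.∸ i
          far i q = subst (ℕ._≤ suc K ℕ.∸ i) (ℕ.m+n∸n≡m k k) (ℕ.∸-monoʳ-≤ (k ℕ.+ k) q)

        -- From here on the class of c is assumed to contain almost no primes.
        module _ (A-c : A c (Y ℕ.^ K) ≤ # 8) where

          -- As A(c) ≤ 8, the sum P(c) is at most 8 K L, and J(c) has to supply the whole main term
          -- of Selberg's formula.
          J-lower : # K * # K * (L * L) - L * L ≤ N * J c (Y ℕ.^ K)
          J-lower = lin (↑ (proj₂ (selbergᴸ coprime-c ℕ.≤-refl)) ⊕ ↑ P-upper ⊗ N≥0 ⊕ ↑ L-large₂) (solve 6 (λ a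
                b c d e f → c :* d :- (a :* a :* (b :* b) :- b :* b) := e :* (num 1 :+ a :* b) :- :- (c :* (f :+
                d) :- a :* b :* (a :* b)) :+ (num 8 :* (a :* b) :- f) :* c :+ (b :* b :- (e :* (num 1 :+ a :* b)
                :+ num 8 :* c :* a :* b))) refl (# K) L N (J c (Y ℕ.^ K)) C₂ (P c (Y ℕ.^ K)))
            where
            P-upper : P c (Y ℕ.^ K) ≤ # 8 * (# K * L)
            P-upper = ≤-trans (≡⇒≤ (P-∑ c (Y ℕ.^ K))) (≤-trans (∑-mono (Y ℕ.^ K) (λ a p q → *-monoˡ (δ a c * Λ/ a) (𝟙-nonneg (a ≋? c) ⊗ Λ/≥0 a)
                (subst (ℓ a ≤_) (ℓ-Y^ K ℕ.≤-refl) (ℓ-mono p q (Y^≤B ℕ.≤-refl)))))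
              (≤-trans (≡⇒≤ (∑-*ʳ (Y ℕ.^ K) (# K * L) _)) (lin (↑ A-c ⊗ (nn K ⊗ L≥0)) (solve 3 (λ a b c → num 8
                    :* (b :* c) :- a :* (b :* c) := (num 8 :- a) :* (b :* c)) refl (A c (Y ℕ.^ K)) (# K) L))))

          J-upper : J c (Y ℕ.^ K) ≤ ∑ᵘ (λ h → ∑ K (λ i → (α h i - α h (ℕ.pred i)) * α (partner h) (suc K ℕ.∸ i)))
          J-upper = ≤-trans (≡⇒≤ (J-split (Y ℕ.^ K))) (∑-mono M (λ h _ _ → *-monoˡ (unit h) (𝟙-nonneg (coprime? h M)) (blocks h (partner h) K ℕ.≤-refl)))

          -- K²L² is a lower bound for N J(c) up to L², and by Mertens it is also the main term of
          -- the upper bound given by `J-X`. The losses have to fit into the error terms.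
          ∑ᵘX : ∑ᵘ X ≤ # k * (# 8 * N * H (k ℕ.+ k) + # 4) * (L * L)
          ∑ᵘX = lin (↑ J-lower ⊕ ↑ J-upper ⊗ N≥0 ⊕ ↑ all ⊕ ↑ U-upper ⊗ L≥0 ⊕ ↑ L-large₃ ⊗ L≥0 ⊕ nn 4 ⊗ (↑
                (proj₁ (A′-Y^ ℕ.≤-refl)) ⊗ (N≥0 ⊗ HK≥0 ⊗ L≥0)) ⊕ nn 4 ⊗ (↑ C₁≤L ⊗ (N≥0 ⊗ HK≥0 ⊗ L≥0)) ⊕ nn 8 ⊗
                (↑ (H-mono (ℕ.n≤1+n K)) ⊗ (N≥0 ⊗ nn k ⊗ (L≥0 ⊗ L≥0))) ⊕ eq* (# 4 * (N * H K * L * L)) 2k ⊕ eq*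
                (# 1 * (L * L)) 2k ⊕ nn 2 ⊗ (↑ (#-mono {1} {k} (s≤s z≤n)) ⊗ (L≥0 ⊗ L≥0)) ⊕ (L≥0 ⊗ L≥0)) (solve
                12 (λ a b c d e f g h i j k l → b :* (num 8 :* c :* d :+ num 4) :* (e :* e) :- a := c :* f :- (g
                :* g :* (e :* e) :- e :* e) :+ (h :- f) :* c :+ (num 2 :* e :* i :+ num 4 :* c :* j :* e :* k :-
                (c :* h :+ a)) :+ (g :* (g :+ num 1) :* e :+ num 2 :* g :* l :- num 2 :* i) :* e :+ (e :- num 2
                :* g :* l) :* e :+ num 4 :* ((l :- (k :- g :* e)) :* (c :* j :* e)) :+ num 4 :* ((e :- l) :* (c
                :* j :* e)) :+ num 8 :* ((d :- j) :* (c :* b :* (e :* e))) :+ num 4 :* (c :* j :* e :* e) :* (b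
                :+ b :- (g :+ num 1)) :+ num 1 :* (e :* e) :* (b :+ b :- (g :+ num 1)) :+ num 2 :* ((b :- num 1)
                :* (e :* e)) :+ e :* e) refl (∑ᵘ X) (# k) N (H (k ℕ.+ k)) L (J c (Y ℕ.^ K)) (# K) V U (H K) (A′
                (Y ℕ.^ K)) C₁)
            where
            HK≥0 : # 0 ≤ H K
            HK≥0 = ∑-nonneg K (λ i _ _ → inv-nonneg i)
            U V : F
            U = ∑ K (λ i → A′ (Y ℕ.^ i))
            V = ∑ᵘ (λ h → ∑ K (λ i → (α h i - α h (ℕ.pred i)) * α (partner h) (suc K ℕ.∸ i)))
            2k : # K + # 1 ≡ # k + # k
            2k = trans (sym (#-suc K)) (#-+ k k)
            all : N * V + ∑ᵘ X ≤ # 2 * L * U + # 4 * N * H K * L * A′ (Y ℕ.^ K)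
            all = ≤-trans (≡⇒≤ (trans (cong (_+ ∑ᵘ X) (sym (∑-*ˡ M N _))) (sym (∑-+ M _ _)))) (≤-trans (∑-mono M (λ h _ _ → ≤-trans
                (≡⇒≤ (solve 4 (λ a b c d → a :* (b :* c) :+ b :* d := b :* (a :* c :+ d)) refl N (unit h) (V′
                      h) (X h))) (*-monoˡ (unit h) (𝟙-nonneg (coprime? h M)) (J-X h))))
              (≡⇒≤ (trans (∑-cong′ M (λ h → (solve 6 (λ a b c d e f → a :* (num 2 :* b :* c :+ num 4 :* d :* e
                    :* b :* f) := num 2 :* b :* (a :* c) :+ num 4 :* d :* e :* b :* (a :* f)) refl (unit h) L (∑
                    K (α h)) N (H K) (α h K))))
                (trans (∑-+ M _ _) (cong₂ _+_ (trans (∑-*ˡ M (# 2 * L) _) (cong (# 2 * L *_) (trans (∑ᵘ-∑ K (λ h i → α h i)) (∑-cong′ K (λ i → ∑ᵘA (Y ℕ.^ i))))))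
                  (trans (∑-*ˡ M (# 4 * N * H K * L) _) (cong (# 4 * N * H K * L *_) (∑ᵘA (Y ℕ.^ K)))))))))
              where
              V′ : ℕ → F
              V′ h = ∑ K (λ i → (α h i - α h (ℕ.pred i)) * α (partner h) (suc K ℕ.∸ i))
            triangle : ∀ t → # 2 * ∑ t # ≡ # t * (# t + # 1)
            triangle zero = solve 0 (num 2 :* num 0 := num 0 :* (num 0 :+ num 1)) refl
            triangle (suc t) = trans (solve 2 (λ a b → num 2 :* (a :+ b) := num 2 :* a :+ num 2 :* b) refl (∑ t
                  #) (# (suc t))) (trans (cong₂ (λ u v → u + # 2 * v) (triangle t) (#-suc t))
              (trans (solve 1 (λ a → a :* (a :+ num 1) :+ num 2 :* (a :+ num 1) := (a :+ num 1) :* (a :+ num 1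
                    :+ num 1)) refl (# t)) (cong (λ v → v * (v + # 1)) (sym (#-suc t)))))
            U-upper : # 2 * U ≤ # K * (# K + # 1) * L + # 2 * # K * C₁
            U-upper = ≤-trans (*-monoˡ (# 2) (nn 2) (∑-mono K {λ i → A′ (Y ℕ.^ i)} {λ i → # i * L + C₁} (λ i _ q → (lin
                  (↑ (proj₁ (A′-Y^ q))) (solve 4 (λ a b c d → b :* c :+ d :- a := d :- (a :- b :* c)) refl (A′
                  (Y ℕ.^ i)) (# i) L C₁)))))
              (≡⇒≤ (trans (cong (# 2 *_) (trans (∑-+ K _ _) (cong₂ _+_ (∑-*ʳ K L #) (∑-const K C₁))))
                (trans (solve 4 (λ a b c d → num 2 :* (a :* b :+ c :* d) := num 2 :* a :* b :+ num 2 :* c :* d)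
                      refl (∑ K #) L (# K) C₁) (cong (λ z → z * L + # 2 * # K * C₁) (triangle K)))))

          -- Each class and its partner are together either nearly empty or nearly full.
          pairing : ∀ {h h′} → h ℕ.* h′ ≋ c → α h k * R h′ k ≤ # k * (# 8 * N * H (k ℕ.+ k) + # 4) * (L * L)
          pairing {h} {h′} e with representative h
          ... | r , 1≤r , r≤M , h≋r = ≤-trans (≡⇒≤ (cong₂ _*_ (A-invariant (Y ℕ.^ k) h≋r) R-eq)) (≤-trans (X-lower r) (≤-trans single ∑ᵘX))
            where
            cr : Coprime r M
            cr = coprime-resp-≋ h≋r (coprime-factorˡ {h} {h′} (coprime-resp-≋ (≋-sym e) coprime-c))
            R-eq : R h′ k ≡ R (partner r) k
            R-eq = cong (λ z → # 2 * # k * L + # 4 * N * H k * L - N * z) (A-invariant (Y ℕ.^ k) (≋-sym (proj₁ (partner-≋ cr h′) (≋-trans (≋-*ʳ h′ (≋-sym h≋r)) e))))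
            single : X r ≤ ∑ᵘ X
            single = ≤-trans (≡⇒≤ (sym (trans (∑-𝟙 M r (λ i → unit i * X i) 1≤r r≤M) (𝟙-yes* (coprime? r M) cr (X r)))))
              (∑-mono M (λ i _ _ → (lin (↑ (𝟙-≤1 (i ℕ.≟ r)) ⊗ (𝟙-nonneg (coprime? i M) ⊗ X≥0 i)) (solve 3 (λ a
                    b c → b :* c :- a :* (b :* c) := (num 1 :- a) :* (b :* c)) refl (𝟙 (i ℕ.≟ r)) (unit i) (X
                    i)))))

  -- Empty and full classes, and the character that they define.

  *-cancelʳ-≤ : ∀ {u v w} → # 1 ≤ w → u * w ≤ v * w → u ≤ v
  *-cancelʳ-≤ {u} {v} {w} 1≤w h with ≤-total u v
  ... | inj₁ q = q
  ... | inj₂ q = lin (↑ h ⊕ ↑ q ⊗ ↑ 1≤w) (solve 3 (λ a b c → b :- a := b :* c :- a :* c :+ (a :- b) :* (c :-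
        num 1)) refl u v w)

  ≰⇒≥ : ∀ {u v} → ¬ u ≤ v → v ≤ u
  ≰⇒≥ {u} {v} h with ≤-total u v
  ... | inj₁ p = ⊥-elim (h p)
  ... | inj₂ p = p

  -- Integrality of counts; it turns the approximate count of empty classes into an exact one.
  ∑-𝟙-natural : ∀ {P : ℕ → Set} n (d : ∀ i → Dec (P i)) → ∃ λ j → ∑ n (λ i → 𝟙 (d i)) ≡ # j
  ∑-𝟙-natural zero d = 0 , refl
  ∑-𝟙-natural (suc n) d with ∑-𝟙-natural n d | d (suc n)
  ... | j , e | yes _ = suc j , trans (cong (_+ # 1) e) (sym (#-suc j))
  ... | j , e | no _ = j , trans (cong (_+ # 0) e) (solve 1 (λ a → a :+ num 0 := a) refl (# j))

  -- k = 2 k₂ is even, so that Y^k is the square of Y^k₂, where `full-full` multiplies two masses.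
  module Contradiction (B m : ℕ) (M≤B : suc m ℕ.≤ B) (Y k₂ k′ : ℕ) (1≤Y : 1 ℕ.≤ Y) (k≡ : suc k′ ≡ k₂ ℕ.+ k₂) where

    open Discrete B m M≤B Y k′ 1≤Y

    module _ (range : Y ℕ.^ K ℕ.+ Y ℕ.^ K ℕ.≤ B) (1≤L : # 1 ≤ L)
      (L-large₁ : C₂ * (# 2 + (# 2 * # K + # 1) * L) ≤ L * L) (L-large₂ : C₂ * (# 1 + # K * L) + # 8 * N * # K * L ≤ L * L)
      (L-large₃ : # 2 * # K * C₁ ≤ L) (1≤N : # 1 ≤ N)
      (Q : F) (Q-large : # 16 * N * N ≤ Q) (L-large₄ : Q * C₁ ≤ L)
      (k-large₁ : Q * (# 8 * N * H (k ℕ.+ k) + # 4) ≤ # k) (k-large₂ : # 16 * N + # 1 ≤ # k)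
      (c : ℕ) (coprime-c : Coprime c (suc m)) (A-c : A c (Y ℕ.^ K) ≤ # 8) where

      open Sampled range 1≤L L-large₁ L-large₂ L-large₃ 1≤N

      k≤K : k ℕ.≤ K
      k≤K = ℕ.m≤n+m (suc k′) k′

      W : F
      W = # k * L

      1≤k : # 1 ≤ # k
      1≤k = #-mono {1} {k} (s≤s z≤n)

      L≤W : L ≤ W
      L≤W = lin (↑ 1≤k ⊗ L≥0) (solve 2 (λ a b → b :* a :- a := (b :- num 1) :* a) refl L (# k))

      1≤W : # 1 ≤ W
      1≤W = ≤-trans 1≤L L≤W

      W≥0 : # 0 ≤ W
      W≥0 = ≤-trans (nn 1) 1≤W

      N≤N² : N ≤ N * N
      N≤N² = lin (↑ 1≤N ⊗ N≥0) (solve 1 (λ a → a :* a :- a := (a :- num 1) :* a) refl N)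

      16N≤Q : # 16 * N ≤ Q
      16N≤Q = lin (↑ Q-large ⊕ nn 16 ⊗ (↑ N≤N²)) (solve 2 (λ a b → b :- num 16 :* a := b :- num 16 :* a :* a :+
            num 16 :* (a :* a :- a)) refl N Q)

      16≤Q : # 16 ≤ Q
      16≤Q = lin (↑ 16N≤Q ⊕ nn 16 ⊗ (↑ 1≤N)) (solve 2 (λ a b → a :- num 16 := a :- num 16 :* b :+ num 16 :* (b
            :- num 1)) refl Q N)

      Q≥0 : # 0 ≤ Q
      Q≥0 = ≤-trans (nn 16) 16≤Q

      -- z h compares the mass of the class h with the average mass.
      abstract

        z : ℕ → F
        z h = N * α h k * W ⁻¹

        WW⁻¹ : W * W ⁻¹ ≡ # 1
        WW⁻¹ = ⁻¹-inverse (λ p → 1≰0 (≤-trans 1≤W p))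

        zW : ∀ h → z h * W ≡ N * α h k
        zW h = trans (solve 4 (λ a b c d → a :* b :* c :* d := a :* b :* (d :* c)) refl N (α h k) (W ⁻¹) W) (trans (cong (N * α h k *_) WW⁻¹) (solve
              2 (λ a b → a :* b :* num 1 := a :* b) refl N (α h k)))

        z≥0 : ∀ h → # 0 ≤ z h
        z≥0 h = N≥0 ⊗ A≥0 h (Y ℕ.^ k) ⊗ ⁻¹-nonneg 1≤W

        z-invariant : Invariant z
        z-invariant e = cong (λ w → N * w * W ⁻¹) (A-invariant (Y ℕ.^ k) e)

      H≥0 : ∀ t → # 0 ≤ H t
      H≥0 t = ∑-nonneg t (λ i _ _ → inv-nonneg i)

      QH : Q * (# 4 * N * H k) ≤ # k
      QH = lin (↑ k-large₁ ⊕ nn 8 ⊗ (↑ (H-mono (ℕ.m≤m+n k k)) ⊗ (Q≥0 ⊗ N≥0)) ⊕ nn 4 ⊗ ((Q≥0 ⊗ N≥0 ⊗ H≥0 k)) ⊕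
            nn 4 ⊗ (Q≥0)) (solve 5 (λ a b c d e → d :- a :* (num 4 :* b :* c) := d :- a :* (num 8 :* b :* e :+
            num 4) :+ num 8 :* ((e :- c) :* (a :* b)) :+ num 4 :* (a :* b :* c) :+ num 4 :* a) refl Q N (H k) (#
            k) (H (k ℕ.+ k)))

      -- The normalised form of `pairing`. Used for (h, h′) and (h′, h), it forces both values near
      -- 0 or both near 2.
      z-pairing : ∀ {h h′} → h ℕ.* h′ ≋ c → Q * (z h * (# 2 - z h′)) ≤ N
      z-pairing {h} {h′} e = *-cancelʳ-≤ 1≤W (*-cancelʳ-≤ 1≤W
        (lin (eq* (# 1 * (Q * (# 2 * W - z h′ * W))) (zW h) ⊕ eq* (- # 1 * (Q * N * α h k)) (zW h′) ⊕ ↑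
              (pairing c coprime-c A-c {h} {h′} e) ⊗ (Q≥0 ⊗ N≥0) ⊕ ↑ k-large₁ ⊗ (N≥0 ⊗ nn k ⊗ (L≥0 ⊗ L≥0)) ⊕ nn
              4 ⊗ ((Q≥0 ⊗ N≥0 ⊗ A≥0 h (Y ℕ.^ k) ⊗ (N≥0 ⊗ H≥0 k ⊗ L≥0))) ⊕ eq* (- # 1 * (N * W)) refl ⊕ eq* (- #
              1 * (N * # k * L)) refl ⊕ eq* (# 2 * (Q * N * α h k)) refl) (solve 11 (λ a b c d e f g h i j k → e
              :* d :* d :- a :* (b :* (num 2 :- c)) :* d :* d := num 1 :* (a :* (num 2 :* d :- c :* d)) :* (e :*
              f :- b :* d) :+ :- (num 1) :* (a :* e :* f) :* (e :* g :- c :* d) :+ (h :* (num 8 :* e :* i :+ num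
              4) :* (j :* j) :- f :* (num 2 :* h :* j :+ num 4 :* e :* k :* j :- e :* g)) :* (a :* e) :+ (h :- a
              :* (num 8 :* e :* i :+ num 4)) :* (e :* h :* (j :* j)) :+ num 4 :* (a :* e :* f :* (e :* k :* j))
              :+ :- (num 1) :* (e :* d) :* (h :* j :- d) :+ :- (num 1) :* (e :* h :* j) :* (h :* j :- d) :+ num
              2 :* (a :* e :* f) :* (h :* j :- d)) refl Q (z h) (z h′) W N (α h k) (α h′ k) (# k) (H (k ℕ.+ k))
              L (H k))))

      z-upper : ∀ {h} → Coprime h M → Q * (z h - # 2) ≤ # 1
      z-upper {h} ch = *-cancelʳ-≤ 1≤W
        (lin (eq* (# 1 * (Q)) (zW h) ⊕ (R≥0 ch k≤K) ⊗ Q≥0 ⊕ ↑ QH ⊗ L≥0 ⊕ eq* (- # 2 * (Q)) refl ⊕ eq* (- # 1)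
              refl) (solve 8 (λ a b c d e f g h → num 1 :* c :- a :* (b :- num 2) :* c := num 1 :* a :* (d :* e
              :- b :* c) :+ (num 2 :* f :* g :+ num 4 :* d :* h :* g :- d :* e) :* a :+ (f :- a :* (num 4 :* d
              :* h)) :* g :+ :- (num 2) :* a :* (f :* g :- c) :+ :- (num 1) :* (f :* g :- c)) refl Q (z h) W N
              (α h k) (# k) L (H k)))

      ∑ᵘz-∣∣ : ∣ Q * (∑ᵘ z - N) ∣≤ N
      ∑ᵘz-∣∣ = *-cancelʳ-≤ 1≤W (lin (eq* (# 1 * (Q)) total ⊕ ↑ (proj₁ (A′-Y^ k≤K)) ⊗ (Q≥0 ⊗ N≥0) ⊕ ↑ L-large₄ ⊗
            N≥0 ⊕ ↑ L≤W ⊗ N≥0 ⊕ eq* (- # 1 * (Q * N)) refl) (solve 8 (λ a b c d e f g h → c :* d :- a :* (b :-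
            c) :* d := num 1 :* a :* (c :* e :- b :* d) :+ (f :- (e :- g :* h)) :* (a :* c) :+ (h :- a :* f) :*
            c :+ (d :- h) :* c :+ :- (num 1) :* (a :* c) :* (g :* h :- d)) refl Q (∑ᵘ z) N W (A′ (Y ℕ.^ k)) C₁
            (# k) L))
        , *-cancelʳ-≤ 1≤W (lin (eq* (- # 1 * (Q)) total ⊕ ↑ (proj₂ (A′-Y^ k≤K)) ⊗ (Q≥0 ⊗ N≥0) ⊕ ↑ L-large₄ ⊗
              N≥0 ⊕ ↑ L≤W ⊗ N≥0 ⊕ eq* (# 1 * (Q * N)) refl) (solve 8 (λ a b c d e f g h → c :* d :- :- (a :* (b
              :- c)) :* d := :- (num 1) :* a :* (c :* e :- b :* d) :+ (f :- :- (e :- g :* h)) :* (a :* c) :+ (h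
              :- a :* f) :* c :+ (d :- h) :* c :+ num 1 :* (a :* c) :* (g :* h :- d)) refl Q (∑ᵘ z) N W (A′ (Y
              ℕ.^ k)) C₁ (# k) L))
        where
        total : ∑ᵘ z * W ≡ N * A′ (Y ℕ.^ k)
        total = trans (sym (∑-*ʳ M W _)) (trans (∑-cong′ M (λ h → trans (solve 3 (λ a b c → a :* b :* c := a :*
              (b :* c)) refl (unit h) (z h) W) (trans (cong (unit h *_) (zW h)) (solve 3 (λ a b c → a :* (b :*
              c) := b :* (a :* c)) refl (unit h) N (α h k)))))
          (trans (∑-*ˡ M N _) (cong (N *_) (∑ᵘA (Y ℕ.^ k)))))

      private
        drop-full : ∀ {x y} → # 1 ≤ x → Q * (x * (# 2 - y)) ≤ N → Q * (# 2 - y) ≤ N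
        drop-full {x} {y} 1≤x h with ≤-total y (# 2)
        ... | inj₁ p = lin (↑ h ⊕ ↑ 1≤x ⊗ (Q≥0 ⊗ ↑ p)) (solve 4 (λ a b c d → c :- a :* (num 2 :- b) := c :- a
              :* (d :* (num 2 :- b)) :+ (d :- num 1) :* (a :* (num 2 :- b))) refl Q y N x)
        ... | inj₂ p = lin (↑ p ⊗ Q≥0 ⊕ N≥0) (solve 3 (λ a b c → c :- a :* (num 2 :- b) := (b :- num 2) :* a :+
              c) refl Q y N)

        drop-empty : ∀ {x y} → x ≤ # 1 → # 0 ≤ y → Q * (y * (# 2 - x)) ≤ N → Q * y ≤ N
        drop-empty {x} {y} x≤1 y≥0 h = lin (↑ h ⊕ ↑ x≤1 ⊗ (Q≥0 ⊗ y≥0)) (solve 4 (λ a b c d → c :- a :* b := c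
              :- a :* (b :* (num 2 :- d)) :+ (num 1 :- d) :* (a :* b)) refl Q y N x)

        1≤Q : # 1 ≤ Q
        1≤Q = ≤-trans (lin (nn 15) (solve 0 (num 16 :- num 1 := num 15) refl)) 16≤Q

      module _ {h} (ch : Coprime h M) where

        private
          h′ = partner c coprime-c h

          hh′ : h ℕ.* h′ ≋ c
          hh′ = proj₂ (partner-≋ c coprime-c ch h′) ≋-refl

          h′h : h′ ℕ.* h ≋ c
          h′h = ≋-trans (≡⇒≋ (ℕ.*-comm h′ h)) hh′

        -- The pairing is used twice: z(h) ≥ 1 puts z(h′) near 2, in particular above 1, and this in
        -- turn puts z(h) near 2.
        full : ¬ z h ≤ # 1 → Q * (# 2 - z h) ≤ N
        full ¬e = drop-full 1≤z′ (z-pairing {h′} {h} h′h)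
          where
          1≤z′ : # 1 ≤ z h′
          1≤z′ = *-cancelʳ-≤ 1≤Q (lin (↑ (drop-full (≰⇒≥ ¬e) (z-pairing {h} {h′} hh′)) ⊕ ↑ 16N≤Q ⊕ nn 15 ⊗
                (N≥0)) (solve 3 (λ a b c → b :* a :- num 1 :* a := c :- a :* (num 2 :- b) :+ (a :- num 16 :* c)
                :+ num 15 :* c) refl Q (z h′) N))

        empty : z h ≤ # 1 → Q * z h ≤ N
        empty e = drop-empty z′≤1 (z≥0 h) (z-pairing {h} {h′} hh′)
          where
          z′≤1 : z h′ ≤ # 1
          z′≤1 = *-cancelʳ-≤ 1≤Q (lin (↑ (drop-empty e (z≥0 h′) (z-pairing {h′} {h} h′h)) ⊕ ↑ 16N≤Q ⊕ nn 15 ⊗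
                (N≥0)) (solve 3 (λ a b c → num 1 :* b :- a :* b := c :- b :* a :+ (b :- num 16 :* c) :+ num 15
                :* c) refl (z h′) Q N))

      e : ℕ → F
      e h = 𝟙 (z h ≤? # 1)

      e-invariant : Invariant e
      e-invariant {a} {b} p = 𝟙-cong (z a ≤? # 1) (z b ≤? # 1) (subst (_≤ # 1) (z-invariant p)) (subst (_≤ # 1) (sym (z-invariant p)))

      E : F
      E = ∑ᵘ e

      E≥0 : # 0 ≤ E
      E≥0 = ∑-nonneg M (λ h _ _ → 𝟙-nonneg (coprime? h M) ⊗ 𝟙-nonneg (z h ≤? # 1))

      E≤N : E ≤ N
      E≤N = ∑-mono M (λ h _ _ → (lin (↑ (𝟙-≤1 (z h ≤? # 1)) ⊗ (𝟙-nonneg (coprime? h M))) (solve 2 (λ a b → a :-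
            a :* b := (num 1 :- b) :* a) refl (unit h) (e h))))

      ∑ᵘ-mono : ∀ {f g} → (∀ h → Coprime h M → f h ≤ g h) → ∑ᵘ f ≤ ∑ᵘ g
      ∑ᵘ-mono {f} {g} p = ∑-mono M term
        where
        term : ∀ h → 1 ℕ.≤ h → h ℕ.≤ M → unit h * f h ≤ unit h * g h
        term h _ _ with coprime? h M
        ... | yes ch = *-monoˡ (# 1) (nn 1) (p h ch)
        ... | no _ = lin (nn 0) (solve 2 (λ a b → num 0 :* b :- num 0 :* a := num 0) refl (f h) (g h))

      ∑ᵘ-affine : ∀ a b → ∑ᵘ (λ h → a + b * e h) ≡ a * N + b * E
      ∑ᵘ-affine a b = trans (∑-cong′ M (λ h → (solve 4 (λ a b c d → a :* (b :+ c :* d) := b :* a :+ c :* (a :*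
            d)) refl (unit h) a b (e h)))) (trans (∑-+ M _ _) (cong₂ _+_ (∑-*ˡ M a unit) (∑-*ˡ M b _)))

      z-lower′ : ∀ h → Coprime h M → (# 2 * Q - N) + (N - # 2 * Q) * e h ≤ Q * z h
      z-lower′ h ch with z h ≤? # 1
      ... | yes _ = lin ((Q≥0 ⊗ z≥0 h)) (solve 3 (λ a b c → a :* c :- (num 2 :* a :- b :+ (b :- num 2 :* a) :*
            num 1) := a :* c) refl Q N (z h))
      ... | no ¬p = lin (↑ (full ch ¬p)) (solve 3 (λ a b c → a :* c :- (num 2 :* a :- b :+ (b :- num 2 :* a) :*
            num 0) := b :- a :* (num 2 :- c)) refl Q N (z h))

      z-upper′ : ∀ h → Coprime h M → Q * z h ≤ (# 2 * Q + # 1) + (N - # 2 * Q - # 1) * e h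
      z-upper′ h ch with z h ≤? # 1
      ... | yes p = lin (↑ (empty ch p)) (solve 3 (λ a b c → num 2 :* a :+ num 1 :+ (c :- num 2 :* a :- num 1)
            :* num 1 :- a :* b := c :- a :* b) refl Q (z h) N)
      ... | no ¬p = lin (↑ (z-upper ch)) (solve 3 (λ a b c → num 2 :* a :+ num 1 :+ (c :- num 2 :* a :- num 1)
            :* num 0 :- a :* b := num 1 :- a :* (b :- num 2)) refl Q (z h) N)

      ∑ᵘQz : ∑ᵘ (λ h → Q * z h) ≡ Q * ∑ᵘ z
      ∑ᵘQz = trans (∑-cong′ M (λ h → (solve 3 (λ a b c → a :* (b :* c) := b :* (a :* c)) refl (unit h) Q (z h)))) (∑-*ˡ M Q _)

      -- The z(h) sum to nearly N, while each full class has z near 2, so the number N - E of full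
      -- classes cannot be much larger than N/2.
      excess-full : Q * (N - # 2 * E) ≤ # 3 * (N * N)
      excess-full = lin (↑ (∑ᵘ-mono z-lower′) ⊕ eq* (- # 1) (∑ᵘ-affine (# 2 * Q - N) (N - # 2 * Q)) ⊕ eq* (# 1)
            ∑ᵘQz ⊕ ↑ (proj₁ ∑ᵘz-∣∣) ⊕ ↑ N≤N² ⊕ (N≥0 ⊗ E≥0) ⊕ (N≥0 ⊗ N≥0)) (solve 6 (λ a b c d e f → num 3 :* (b
            :* b) :- a :* (b :- num 2 :* c) := d :- e :+ :- (num 1) :* ((num 2 :* a :- b) :* b :+ (b :- num 2 :*
            a) :* c :- e) :+ num 1 :* (a :* f :- d) :+ (b :- a :* (f :- b)) :+ (b :* b :- b) :+ b :* c :+ b :*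
            b) refl Q N E (∑ᵘ (λ h → Q * z h)) (∑ᵘ (λ h → (# 2 * Q - N) + (N - # 2 * Q) * e h)) (∑ᵘ z))

      excess-empty : Q * (# 2 * E - N) ≤ # 3 * (N * N)
      excess-empty = lin (↑ (∑ᵘ-mono z-upper′) ⊕ eq* (# 1) (∑ᵘ-affine (# 2 * Q + # 1) (N - # 2 * Q - # 1)) ⊕
            eq* (- # 1) ∑ᵘQz ⊕ ↑ (proj₂ ∑ᵘz-∣∣) ⊕ nn 2 ⊗ (↑ N≤N²) ⊕ ↑ E≤N ⊗ N≥0 ⊕ E≥0) (solve 6 (λ a b c d e f →
            num 3 :* (c :* c) :- a :* (num 2 :* b :- c) := d :- e :+ num 1 :* ((num 2 :* a :+ num 1) :* c :+ (c
            :- num 2 :* a :- num 1) :* b :- d) :+ :- (num 1) :* (a :* f :- e) :+ (c :- :- (a :* (f :- c))) :+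
            num 2 :* (c :* c :- c) :+ (c :- b) :* c :+ b) refl Q E N (∑ᵘ (λ h → (# 2 * Q + # 1) + (N - # 2 * Q -
            # 1) * e h)) (∑ᵘ (λ h → Q * z h)) (∑ᵘ z))

      both : ∀ h → Dec (Coprime h M × z h ≤ # 1)
      both h with coprime? h M | z h ≤? # 1
      ... | yes p | yes q = yes (p , q)
      ... | no p | _ = no (λ x → p (proj₁ x))
      ... | yes _ | no q = no (λ x → q (proj₂ x))

      -- N and E are integers, and a difference of at least 1 would give Q ≤ 3N², against Q ≥ 16N².
      N≡2E : N ≡ # 2 * E
      N≡2E with ∑-𝟙-natural M (λ h → coprime? h M) | ∑-𝟙-natural M both
      ... | n₀ , N≡ | e₀ , both≡ = trans N≡ (trans (cong # n₀≡) (trans (#-* 2 e₀) (cong (# 2 *_) (sym E≡))))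
        where
        E≡ : E ≡ # e₀
        E≡ = trans (∑-cong′ M term) both≡
          where
          term : ∀ h → unit h * e h ≡ 𝟙 (both h)
          term h with coprime? h M | z h ≤? # 1
          ... | yes _ | yes _ = solve 0 (num 1 :* num 1 := num 1) refl
          ... | yes _ | no _ = solve 0 (num 1 :* num 0 := num 0) refl
          ... | no _ | yes _ = solve 0 (num 0 :* num 1 := num 0) refl
          ... | no _ | no _ = solve 0 (num 0 :* num 0 := num 0) refl
        gap : ∀ {d} → # 1 ≤ d → Q * d ≤ # 3 * (N * N) → ⊥
        gap {d} 1≤d h = 1≰0 (lin/ 12 (↑ h ⊕ ↑ 1≤d ⊗ Q≥0 ⊕ ↑ Q-large ⊕ nn 13 ⊗ (↑ N≤N²) ⊕ nn 13 ⊗ (↑ 1≤N))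
              (solve 3 (λ a b c → num 13 :* (num 0 :- num 1) := num 3 :* (a :* a) :- b :* c :+ (c :- num 1) :* b
              :+ (b :- num 16 :* a :* a) :+ num 13 :* (a :* a :- a) :+ num 13 :* (a :- num 1)) refl N Q d))
        n₀≡ : n₀ ≡ 2 ℕ.* e₀
        n₀≡ with ℕ.<-cmp n₀ (2 ℕ.* e₀)
        ... | tri≈ _ p _ = p
        ... | tri< p _ _ = ⊥-elim (gap (lin (↑ (#-mono p) ⊕ eq* (- # 1) (#-suc n₀) ⊕ eq* (# 1) (#-* 2 e₀) ⊕ eq*
              (- # 2) E≡ ⊕ eq* (# 1) N≡) (solve 6 (λ a b c d e f → num 2 :* a :- b :- num 1 := c :- d :+ :- (num
              1) :* (e :+ num 1 :- d) :+ num 1 :* (num 2 :* f :- c) :+ :- (num 2) :* (f :- a) :+ num 1 :* (e :-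
              b)) refl E N (# (2 ℕ.* e₀)) (# (suc n₀)) (# n₀) (# e₀))) excess-empty)
        ... | tri> _ _ p = ⊥-elim (gap (lin (↑ (#-mono p) ⊕ eq* (- # 1) (#-suc (2 ℕ.* e₀)) ⊕ eq* (- # 1) (#-* 2
              e₀) ⊕ eq* (# 2) E≡ ⊕ eq* (- # 1) N≡) (solve 6 (λ a b c d e f → a :- num 2 :* b :- num 1 := c :- d
              :+ :- (num 1) :* (e :+ num 1 :- d) :+ :- (num 1) :* (num 2 :* f :- e) :+ num 2 :* (f :- b) :+ :-
              (num 1) :* (c :- a)) refl N E (# n₀) (# (suc (2 ℕ.* e₀))) (# (2 ℕ.* e₀)) (# e₀))) excess-full)

      -- Two factors a, b ≤ x have a b ≤ x².
      J-product : ∀ h h′ x → A h x * A h′ x ≤ J (h ℕ.* h′) (x ℕ.* x)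
      J-product h h′ zero = ≡⇒≤ (solve 0 (num 0 :* num 0 := num 0) refl)
      J-product h h′ x@(suc _) = ≤-trans (≡⇒≤ (sym (∑-*ʳ x (A h′ x) _))) (≤-trans (∑-mono x term) (∑-mono-range _ (ℕ.m≤m*n x x)
          (λ a _ _ → Λ/≥0 a ⊗ ∑-nonneg (x ℕ.* x ÷ a) (λ b _ _ → 𝟙-nonneg (a ℕ.* b ≋? h ℕ.* h′) ⊗ Λ/≥0 b))))
        where
        term : ∀ a → 1 ℕ.≤ a → a ℕ.≤ x → δ a h * Λ/ a * A h′ x ≤ Λ/ a * ∑ (x ℕ.* x ÷ a) (λ b → δ (a ℕ.* b) (h ℕ.* h′) * Λ/ b)
        term a p q = ≤-trans (≡⇒≤ (trans (solve 3 (λ a b c → a :* b :* c := b :* (a :* c)) refl (δ a h) (Λ/ a)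
              (A h′ x)) (cong (Λ/ a *_) (sym (∑-*ˡ x (δ a h) _)))))
            (*-monoˡ (Λ/ a) (Λ/≥0 a) (≤-trans (∑-mono x (λ b _ _ → each b)) (∑-mono-range _ (*≤⇒≤÷ p (ℕ.*-monoˡ-≤ x q)) (λ b _ _ → 𝟙-nonneg (a ℕ.* b ≋? h ℕ.* h′) ⊗ Λ/≥0 b))))
          where
          each : ∀ b → δ a h * (δ b h′ * Λ/ b) ≤ δ (a ℕ.* b) (h ℕ.* h′) * Λ/ b
          each b with a ≋? h
          ... | no _ = ≤-trans (lin (nn 0) (solve 2 (λ a b → num 0 :- num 0 :* (a :* b) := num 0) refl (δ b h′)
                (Λ/ b))) (𝟙-nonneg (a ℕ.* b ≋? h ℕ.* h′) ⊗ Λ/≥0 b)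
          ... | yes r with b ≋? h′
          ... | no _ = ≤-trans (lin (nn 0) (solve 1 (λ a → num 0 :- num 1 :* (num 0 :* a) := num 0) refl (Λ/
                b))) (𝟙-nonneg (a ℕ.* b ≋? h ℕ.* h′) ⊗ Λ/≥0 b)
          ... | yes s = ≡⇒≤ (trans (solve 1 (λ a → num 1 :* (num 1 :* a) := num 1 :* a) refl (Λ/ b)) (cong (_* Λ/ b) (sym (𝟙-yes (a ℕ.* b ≋? h ℕ.* h′) (≋-* r s)))))

      -- A product of two full classes is empty: otherwise it would receive too many products of two primes.
      full-full : ∀ {h h′} → Coprime h M → Coprime h′ M → ¬ z h ≤ # 1 → ¬ z h′ ≤ # 1 → z (h ℕ.* h′) ≤ # 1
      full-full {h} {h′} ch ch′ f f′ with z (h ℕ.* h′) ≤? # 1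
      ... | yes p = p
      ... | no f″ = ⊥-elim (1≰0 (*-cancelʳ-≤ 1≤k (lin (↑ k²≤ ⊕ ↑ k-large₂ ⊗ (nn k) ⊕ nn 8 ⊗ (↑ 1≤k ⊗ N≥0))
            (solve 2 (λ a b → num 0 :* a :- num 1 :* a := num 8 :* b :* (num 1 :+ a) :- a :* a :+ (a :- (num 16
            :* b :+ num 1)) :* a :+ num 8 :* ((a :- num 1) :* b)) refl (# k) N))))
        where
        g = h ℕ.* h′
        cg : Coprime g M
        cg = coprime-*ˡ {h} ch ch′
        R-small : ∀ {g} → Coprime g M → ¬ z g ≤ # 1 → Q * R g k ≤ (N + # 1) * W
        R-small {g} cg f = lin (↑ (full cg f) ⊗ W≥0 ⊕ eq* (# 1 * (Q)) (zW g) ⊕ ↑ QH ⊗ L≥0 ⊕ eq* (- # 2 * (Q))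
              refl ⊕ eq* (- # 1) refl) (solve 8 (λ a b c d e f g h → (d :+ num 1) :* g :- a :* (num 2 :* b :* c
              :+ num 4 :* d :* e :* c :- d :* f) := (d :- a :* (num 2 :- h)) :* g :+ num 1 :* a :* (d :* f :- h
              :* g) :+ (b :- a :* (num 4 :* d :* e)) :* c :+ :- (num 2) :* a :* (b :* c :- g) :+ :- (num 1) :*
              (b :* c :- g)) refl Q (# k) L N (H k) (α g k) W (z g))
        k₂≤k : k₂ ℕ.≤ k
        k₂≤k = subst (k₂ ℕ.≤_) (sym k≡) (ℕ.m≤m+n k₂ k₂)
        #k≡ : # k ≡ # k₂ + # k₂
        #k≡ = trans (cong # k≡) (#-+ k₂ k₂)
        -- The deficit is monotone, so a class full at Y^k has a small deficit at Y^k₂ too. There N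
        -- α is nearly 2 k₂ L = W; half of this is enough.
        half : ∀ {g} → Coprime g M → ¬ z g ≤ # 1 → W ≤ # 2 * (N * α g k₂)
        half {g} cg f = *-cancelʳ-≤ 1≤Q (lin/ 7 (nn 16 ⊗ (↑ (R-mono cg k₂≤k k≤K) ⊗ Q≥0) ⊕ nn 16 ⊗ (↑ (R-small
              cg f)) ⊕ nn 64 ⊗ ((Q≥0 ⊗ (N≥0 ⊗ H≥0 k₂ ⊗ L≥0))) ⊕ ↑ 16N≤Q ⊗ W≥0 ⊕ nn 7 ⊗ (↑ 16≤Q ⊗ W≥0) ⊕ nn 96 ⊗
              (W≥0) ⊕ eq* (# 16 * (Q * L)) #k≡ ⊕ eq* (# 16 * (Q)) refl) (solve 9 (λ a b c d e f g h i → num 8 :*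
              (num 2 :* (c :* d) :* b :- a :* b) := num 16 :* ((e :- (num 2 :* f :* g :+ num 4 :* c :* h :* g :-
              c :* d)) :* b) :+ num 16 :* ((c :+ num 1) :* a :- b :* e) :+ num 64 :* (b :* (c :* h :* g)) :+ (b
              :- num 16 :* c) :* a :+ num 7 :* ((b :- num 16) :* a) :+ num 96 :* a :+ num 16 :* (b :* g) :* (f
              :+ f :- i) :+ num 16 :* b :* (i :* g :- a)) refl W Q N (α g k₂) (R g k) (# k₂) L (H k₂) (# k)))
        J-large : W * W ≤ # 4 * N * N * J g (Y ℕ.^ k)
        J-large = ≤-trans (*-mono W≥0 (nn 2 ⊗ (N≥0 ⊗ A≥0 h′ (Y ℕ.^ k₂))) (half ch f) (half ch′ f′))
          (lin (nn 4 ⊗ (↑ (J-product h h′ (Y ℕ.^ k₂)) ⊗ (N≥0 ⊗ N≥0)) ⊕ eq* (# 4 * (N * N)) (cong (J g) Y^k≡))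
                (solve 5 (λ a b c d e → num 4 :* a :* a :* d :- num 2 :* (a :* b) :* (num 2 :* (a :* c)) := num
                4 :* ((e :- b :* c) :* (a :* a)) :+ num 4 :* (a :* a) :* (d :- e)) refl N (α h k₂) (α h′ k₂) (J
                g (Y ℕ.^ k)) (J g (Y ℕ.^ k₂ ℕ.* Y ℕ.^ k₂))))
          where
          Y^k≡ : Y ℕ.^ k₂ ℕ.* Y ℕ.^ k₂ ≡ Y ℕ.^ k
          Y^k≡ = trans (sym (ℕ.^-distribˡ-+-* Y k₂ k₂)) (cong (Y ℕ.^_) (sym k≡))
        S-upper : N * (P g (Y ℕ.^ k) + J g (Y ℕ.^ k)) ≤ W * W + L * L
        S-upper = lin (↑ (proj₁ (selbergᴸ cg k≤K)) ⊕ ↑ (#≤K k≤K) ⊗ (C₂≥0 ⊗ L≥0) ⊕ ↑ L-large₂ ⊕ nn 8 ⊗ ((N≥0 ⊗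
              nn K ⊗ L≥0)) ⊕ eq* (- # 1 * (W)) refl ⊕ eq* (- # 1 * (# k * L)) refl) (solve 8 (λ a b c d e f g h
              → d :* d :+ e :* e :- a :* (b :+ c) := f :* (num 1 :+ g :* e) :- (a :* (b :+ c) :- g :* e :* (g :*
              e)) :+ (h :- g) :* (f :* e) :+ (e :* e :- (f :* (num 1 :+ h :* e) :+ num 8 :* a :* h :* e)) :+ num
              8 :* (a :* h :* e) :+ :- (num 1) :* d :* (g :* e :- d) :+ :- (num 1) :* (g :* e) :* (g :* e :- d))
              refl N (P g (Y ℕ.^ k)) (J g (Y ℕ.^ k)) W L C₂ (# k) (# K))
        -- If the product class were full as well, `P-lower` would leave only lower order terms for
        -- its J, against `J-large`.
        W²≤ : W * W ≤ # 4 * N * (L * L + W * L + W * R g k)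
        W²≤ = lin (↑ J-large ⊕ nn 4 ⊗ (↑ S-upper ⊗ N≥0) ⊕ nn 4 ⊗ (↑ (P-lower k cg k≤K) ⊗ N≥0) ⊕ eq* (# 4 * (N *
              W)) refl ⊕ eq* (# 4 * (N * # k * L)) refl ⊕ eq* (- # 4 * (N * R g k)) refl ⊕ eq* (- # 4 * (N * L))
              refl) (solve 7 (λ a b c d e f g → num 4 :* b :* (c :* c :+ a :* c :+ a :* d) :- a :* a := num 4 :*
              b :* b :* e :- a :* a :+ num 4 :* ((a :* a :+ c :* c :- b :* (f :+ e)) :* b) :+ num 4 :* ((b :* f
              :- ((g :* g :- g) :* (c :* c) :- g :* c :* d)) :* b) :+ num 4 :* (b :* a) :* (g :* c :- a) :+ num
              4 :* (b :* g :* c) :* (g :* c :- a) :+ :- (num 4) :* (b :* d) :* (g :* c :- a) :+ :- (num 4) :* (b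
              :* c) :* (g :* c :- a)) refl W N L (R g k) (J g (Y ℕ.^ k)) (P g (Y ℕ.^ k)) (# k))
        W²≤′ : W * W ≤ # 8 * N * (L * L + W * L)
        W²≤′ = *-cancelʳ-≤ 1≤Q (lin (nn 2 ⊗ (↑ W²≤ ⊗ Q≥0) ⊕ nn 8 ⊗ (↑ (R-small cg f″) ⊗ (N≥0 ⊗ W≥0)) ⊕ ↑
              Q-large ⊗ (W≥0 ⊗ W≥0) ⊕ nn 8 ⊗ (↑ N≤N² ⊗ (W≥0 ⊗ W≥0))) (solve 5 (λ a b c d e → num 8 :* c :* (d :*
              d :+ a :* d) :* b :- a :* a :* b := num 2 :* ((num 4 :* c :* (d :* d :+ a :* d :+ a :* e) :- a :*
              a) :* b) :+ num 8 :* (((c :+ num 1) :* a :- b :* e) :* (c :* a)) :+ (b :- num 16 :* c :* c) :* (a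
              :* a) :+ num 8 :* ((c :* c :- c) :* (a :* a))) refl W Q N L (R g k)))
        k²≤ : # k * # k ≤ # 8 * N * (# 1 + # k)
        k²≤ = *-cancelʳ-≤ 1≤L (*-cancelʳ-≤ 1≤L (lin (↑ W²≤′ ⊕ eq* (- # 1 * (W)) refl ⊕ eq* (- # 1 * (# k * L))
              refl ⊕ eq* (# 8 * (N * L)) refl) (solve 4 (λ a b c d → num 8 :* c :* (num 1 :+ a) :* b :* b :- a
              :* a :* b :* b := num 8 :* c :* (b :* b :+ d :* b) :- d :* d :+ :- (num 1) :* d :* (a :* b :- d)
              :+ :- (num 1) :* (a :* b) :* (a :* b :- d) :+ num 8 :* (c :* b) :* (a :* b :- d)) refl (# k) L N
              W)))

      module _ {s} (cs : Coprime s M) where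

        private
          e-yes : ∀ {h} → z h ≤ # 1 → e h ≡ # 1
          e-yes {h} = 𝟙-yes (z h ≤? # 1)

          ∑ᵘ-es : ∑ᵘ (λ r → e (s ℕ.* r)) ≡ E
          ∑ᵘ-es = ∑ᵘ-permute s cs e-invariant

          ∑ᵘ-affine-δ : ∀ a b h → Coprime h M → ∑ᵘ (λ r → a + b * e r + δ h r) ≡ a * N + b * E + # 1
          ∑ᵘ-affine-δ a b h ch = trans (∑-cong′ M (λ r → (solve 5 (λ a b c d e → a :* (b :+ c :* d :+ e) := a
                :* (b :+ c :* d) :+ a :* e) refl (unit r) a b (e r) (δ h r))))
            (trans (∑-+ M _ _) (cong₂ _+_ (∑ᵘ-affine a b) (trans (∑ᵘ-δ h) (𝟙-yes (coprime? h M) ch))))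

        -- By `full-full`, multiplication by s sends the N - E = E full classes injectively into the
        -- E empty ones. An empty h with s h empty would be one too many.
        full-empty : ¬ z s ≤ # 1 → ∀ {h} → Coprime h M → z h ≤ # 1 → ¬ z (s ℕ.* h) ≤ # 1
        full-empty fs {h} ch eh esh = 1≰0 (lin (↑ (∑ᵘ-mono {λ r → # 1 + - # 1 * e r + δ h r} {λ r → e (s ℕ.*
              r)} more) ⊕ eq* (- # 1) (∑ᵘ-affine-δ (# 1) (- # 1) h ch) ⊕ eq* (# 1) ∑ᵘ-es ⊕ eq* (- # 1) N≡2E)
              (solve 4 (λ a b c d → num 0 :- num 1 := a :- b :+ :- (num 1) :* (num 1 :* c :+ :- (num 1) :* d :+
              num 1 :- b) :+ num 1 :* (d :- a) :+ :- (num 1) :* (num 2 :* d :- c)) refl (∑ᵘ (λ r → e (s ℕ.* r)))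
              (∑ᵘ (λ r → # 1 + - # 1 * e r + δ h r)) N E))
          where
          more : ∀ r → Coprime r M → # 1 + - # 1 * e r + δ h r ≤ e (s ℕ.* r)
          more r cr with h ≋? r
          ... | yes h≋r = lin (eq* (- # 1) (e-yes (subst (_≤ # 1) (z-invariant h≋r) eh)) ⊕ eq* (- # 1) (e-yes
                (subst (_≤ # 1) (z-invariant (≋-*ˡ s h≋r)) esh))) (solve 2 (λ a b → b :- (num 1 :+ :- (num 1) :*
                a :+ num 1) := :- (num 1) :* (num 1 :- a) :+ :- (num 1) :* (num 1 :- b)) refl (e r) (e (s ℕ.*
                r)))
          ... | no _ = rest
            where
            rest : # 1 + - # 1 * e r + # 0 ≤ e (s ℕ.* r)
            rest with z r ≤? # 1
            ... | yes _ = ≤-trans (lin (nn 0) (solve 0 (num 0 :- (num 1 :+ :- (num 1) :* num 1 :+ num 0) := num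
                  0) refl)) (𝟙-nonneg (z (s ℕ.* r) ≤? # 1))
            ... | no fr = lin (eq* (- # 1) (e-yes (full-full cs cr fs fr))) (solve 1 (λ a → a :- (num 1 :+ :-
                  (num 1) :* num 0 :+ num 0) := :- (num 1) :* (num 1 :- a)) refl (e (s ℕ.* r)))

      -- By `full-empty` multiplication by s keeps full classes full, so e(s r) ≤ e(r) for all r.
      -- Both sides have the same sum, so a strict inequality at r = h is impossible.
      empty-empty : ∀ {s h} → Coprime s M → Coprime h M → z s ≤ # 1 → z h ≤ # 1 → z (s ℕ.* h) ≤ # 1
      empty-empty {s} {h} cs ch es eh with z (s ℕ.* h) ≤? # 1
      ... | yes p = p
      ... | no fsh = ⊥-elim (1≰0 (lin (↑ (∑ᵘ-mono {λ r → e (s ℕ.* r) + δ h r} {e} fewer) ⊕ eq* (- # 1) total)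
            (solve 2 (λ a b → num 0 :- num 1 := a :- b :+ :- (num 1) :* (a :+ num 1 :- b)) refl (∑ᵘ e) (∑ᵘ (λ r
            → e (s ℕ.* r) + δ h r)))))
        where
        total : ∑ᵘ (λ r → e (s ℕ.* r) + δ h r) ≡ ∑ᵘ e + # 1
        total = trans (∑-cong′ M (λ r → (solve 3 (λ a b c → a :* (b :+ c) := a :* b :+ a :* c) refl (unit r) (e
              (s ℕ.* r)) (δ h r))))
          (trans (∑-+ M _ _) (cong₂ _+_ (∑ᵘ-permute s cs e-invariant) (trans (∑ᵘ-δ h) (𝟙-yes (coprime? h M) ch))))
        fewer : ∀ r → Coprime r M → e (s ℕ.* r) + δ h r ≤ e r
        fewer r cr with h ≋? r
        ... | yes h≋r = lin (eq* (# 1) (𝟙-no (z (s ℕ.* r) ≤? # 1) (λ p → fsh (subst (_≤ # 1) (z-invariant (≋-*ˡ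
              s (≋-sym h≋r))) p))) ⊕ eq* (- # 1) (𝟙-yes (z r ≤? # 1) (subst (_≤ # 1) (z-invariant h≋r) eh)))
              (solve 2 (λ a b → b :- (a :+ num 1) := num 1 :* (num 0 :- a) :+ :- (num 1) :* (num 1 :- b)) refl
              (e (s ℕ.* r)) (e r))
        ... | no _ = rest
          where
          rest : e (s ℕ.* r) + # 0 ≤ e r
          rest with z r ≤? # 1
          ... | yes _ = lin (↑ (𝟙-≤1 (z (s ℕ.* r) ≤? # 1))) (solve 1 (λ a → num 1 :- (a :+ num 0) := num 1 :-
                a) refl (e (s ℕ.* r)))
          ... | no fr = lin (eq* (# 1) (𝟙-no (z (s ℕ.* r) ≤? # 1) (λ p → full-empty cr fr cs es (subst (_≤ # 1)
                (cong z (ℕ.*-comm s r)) p)))) (solve 1 (λ a → num 0 :- (a :+ num 0) := num 1 :* (num 0 :- a))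
                refl (e (s ℕ.* r)))

      -- 1 on empty classes, -1 on full ones, 0 on nonunits.
      χ : ℕ → F
      χ h = unit h * (# 2 * e h - # 1)

      χ-invariant : Invariant χ
      χ-invariant p = cong₂ (λ u v → u * (# 2 * v - # 1)) (unit-invariant p) (e-invariant p)

      χ-* : ∀ a b → χ (a ℕ.* b) ≡ χ a * χ b
      χ-* a b with coprime? a M
      ... | no ¬ca = trans (cong (_* (# 2 * e (a ℕ.* b) - # 1)) (𝟙-no (coprime? (a ℕ.* b) M) (λ c → ¬ca (coprime-factorˡ {a} {b} c))))
          (solve 4 (λ a b c d → num 0 :* (num 2 :* a :- num 1) := num 0 :* (num 2 :* b :- num 1) :* (c :* (num
                2 :* d :- num 1))) refl (e (a ℕ.* b)) (e a) (unit b) (e b))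
      ... | yes ca with coprime? b M
      ... | no ¬cb = trans (cong (_* (# 2 * e (a ℕ.* b) - # 1)) (𝟙-no (coprime? (a ℕ.* b) M) (λ c → ¬cb (coprime-factorʳ {a} {b} c))))
          (solve 3 (λ a b c → num 0 :* (num 2 :* a :- num 1) := num 1 :* (num 2 :* b :- num 1) :* (num 0 :*
                (num 2 :* c :- num 1))) refl (e (a ℕ.* b)) (e a) (e b))
      ... | yes cb = trans (cong (_* (# 2 * e (a ℕ.* b) - # 1)) (𝟙-yes (coprime? (a ℕ.* b) M) (coprime-*ˡ {a} ca cb))) signs
        where
        signs : # 1 * (# 2 * e (a ℕ.* b) - # 1) ≡ # 1 * (# 2 * e a - # 1) * (# 1 * (# 2 * e b - # 1))
        signs with z a ≤? # 1 | z b ≤? # 1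
        ... | yes p | yes q = trans (cong (λ w → # 1 * (# 2 * w - # 1)) (𝟙-yes (z (a ℕ.* b) ≤? # 1) (empty-empty ca cb p q))) (solve
              0 (num 1 :* (num 2 :* num 1 :- num 1) := num 1 :* (num 2 :* num 1 :- num 1) :* (num 1 :* (num 2 :*
              num 1 :- num 1))) refl)
        ... | no p | no q = trans (cong (λ w → # 1 * (# 2 * w - # 1)) (𝟙-yes (z (a ℕ.* b) ≤? # 1) (full-full ca cb p q))) (solve
              0 (num 1 :* (num 2 :* num 1 :- num 1) := num 1 :* (num 2 :* num 0 :- num 1) :* (num 1 :* (num 2 :*
              num 0 :- num 1))) refl)
        ... | no p | yes q = trans (cong (λ w → # 1 * (# 2 * w - # 1)) (𝟙-no (z (a ℕ.* b) ≤? # 1) (full-empty ca p cb q))) (solve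
              0 (num 1 :* (num 2 :* num 0 :- num 1) := num 1 :* (num 2 :* num 0 :- num 1) :* (num 1 :* (num 2 :*
              num 1 :- num 1))) refl)
        ... | yes p | no q = trans (cong (λ w → # 1 * (# 2 * w - # 1)) (𝟙-no (z (a ℕ.* b) ≤? # 1) (λ r → full-empty cb q ca p (subst (_≤ # 1) (cong z (ℕ.*-comm a b)) r))))
            (solve 0 (num 1 :* (num 2 :* num 0 :- num 1) := num 1 :* (num 2 :* num 1 :- num 1) :* (num 1 :*
                  (num 2 :* num 0 :- num 1))) refl)

      χ-values : ∀ n → χ n ≡ # 0 ⊎ χ n ≡ # 1 ⊎ χ n ≡ - # 1
      χ-values n with coprime? n M
      ... | no _ = inj₁ (solve 1 (λ a → num 0 :* (num 2 :* a :- num 1) := num 0) refl (e n))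
      ... | yes _ with z n ≤? # 1
      ... | yes _ = inj₂ (inj₁ (solve 0 (num 1 :* (num 2 :* num 1 :- num 1) := num 1) refl))
      ... | no _ = inj₂ (inj₂ (solve 0 (num 1 :* (num 2 :* num 0 :- num 1) := :- (num 1)) refl))

      coprime-1 : Coprime 1 M
      coprime-1 (d , _) = ∣1⇒≡1 d

      χ-1 : χ 1 ≡ # 1
      χ-1 = trans (cong₂ (λ u v → u * (# 2 * v - # 1)) (𝟙-yes (coprime? 1 M) coprime-1) (𝟙-yes (z 1 ≤? # 1) z1)) (solve
            0 (num 1 :* (num 2 :* num 1 :- num 1) := num 1) refl)
        where
        z1 : z 1 ≤ # 1
        z1 with z 1 ≤? # 1
        ... | yes p = p
        -- Were the class of 1 full, its square, again the class of 1, would be empty.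
        ... | no p = ⊥-elim (p (full-full coprime-1 coprime-1 p p))

      χ-sum : ∑ M χ ≡ # 0
      χ-sum = trans (∑-cong′ M (λ h → (solve 2 (λ a b → a :* (num 2 :* b :- num 1) := a :* (:- (num 1) :+ num 2
            :* b)) refl (unit h) (e h)))) (trans (∑ᵘ-affine (- # 1) (# 2)) (trans (cong (λ w → - # 1 * w + # 2 * E) N≡2E) (solve
            1 (λ a → :- (num 1) :* (num 2 :* a) :+ num 2 :* a := num 0) refl E)))

      open RealCharacter m χ χ-invariant χ-* χ-values χ-1 χ-sum using (T; T-∣∣; Z; ν)

      -- Almost all primes would lie where χ = -1, against L(1,χ) ≠ 0.
      contradiction : Z ℕ.≤ Y → # 52 * # M * # ν + # 1 ≤ L → ⊥
      contradiction Z≤Y L-large₅ = 1≰0 (lin (nn 2 ⊗ (↑ (proj₂ (T-∣∣ B Z≤Y^k (Y^<B k≤K)))) ⊕ ↑ T-upper ⊕ ↑ L≤W ⊕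
            ↑ L-large₅) (solve 5 (λ a b c d e → num 0 :- num 1 := num 2 :* (num 26 :* a :* b :- :- c) :+ (:- d
            :- num 2 :* c) :+ (d :- e) :+ (e :- (num 52 :* a :* b :+ num 1))) refl (# M) (# ν) (T B x) W L))
        where
        x = Y ℕ.^ k
        Z≤Y^k : Z ℕ.≤ x
        Z≤Y^k = ℕ.≤-trans Z≤Y (ℕ.m≤m*n Y (Y ℕ.^ k′) {{ℕ.>-nonZero (1≤Y^ k′)}})
        T-split : T B x ≡ ∑ᵘ (λ h → (# 2 * e h - # 1) * α h k)
        T-split = sym (trans (trans (∑-cong′ M (λ h → cong (unit h *_) (sym (∑-*ˡ x (# 2 * e h - # 1) _)))) (∑ᵘ-∑ x (λ h a → (# 2 * e h - # 1) * (δ a h * Λ/ a))))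
          (∑-cong′ x (λ a → trans (trans (∑-cong′ M (λ h → (solve 4 (λ a b c d → a :* ((num 2 :* b :- num 1) :*
                (c :* d)) := c :* (a :* (num 2 :* b :- num 1)) :* d) refl (unit h) (e h) (δ a h) (Λ/ a)))) (∑-*ʳ M (Λ/ a) _)) (cong (_* Λ/ a) (∑-δ a χ-invariant)))))
        QNT : Q * N * T B x ≡ ∑ᵘ (λ h → Q * ((# 2 * e h - # 1) * z h)) * W
        QNT = trans (cong (Q * N *_) T-split) (trans (sym (∑-*ˡ M (Q * N) _)) (trans (∑-cong′ M (λ h → trans
            (solve 5 (λ a b c d e → a :* b :* (c :* ((num 2 :* d :- num 1) :* e)) := c :* (a :* (num 2 :* d :-
                  num 1)) :* (b :* e)) refl Q N (unit h) (e h) (α h k)) (trans (cong (unit h * (Q * (# 2 * e h - # 1)) *_) (sym (zW h)))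
            (solve 5 (λ a b c d e → a :* (b :* (num 2 :* c :- num 1)) :* (d :* e) := a :* (b :* ((num 2 :* c :-
                  num 1) :* d)) :* e) refl (unit h) Q (e h) (z h) W)))) (∑-*ʳ M W _)))
        term : ∀ h → Coprime h M → Q * ((# 2 * e h - # 1) * z h) ≤ (N - # 2 * Q) + # 2 * Q * e h
        term h ch with z h ≤? # 1
        ... | yes p = lin (↑ (empty ch p)) (solve 3 (λ a b c → c :- num 2 :* a :+ num 2 :* a :* num 1 :- a :*
              ((num 2 :* num 1 :- num 1) :* b) := c :- a :* b) refl Q (z h) N)
        ... | no p = lin (↑ (full ch p)) (solve 3 (λ a b c → c :- num 2 :* a :+ num 2 :* a :* num 0 :- a :*
              ((num 2 :* num 0 :- num 1) :* b) := c :- a :* (num 2 :- b)) refl Q (z h) N)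
        Σ-upper : ∑ᵘ (λ h → Q * ((# 2 * e h - # 1) * z h)) ≤ (N - # 2 * Q) * N + # 2 * Q * E
        Σ-upper = ≤-trans (∑ᵘ-mono term) (≡⇒≤ (∑ᵘ-affine (N - # 2 * Q) (# 2 * Q)))
        1≤NQ : # 1 ≤ N * Q
        1≤NQ = lin (↑ 1≤N ⊗ Q≥0 ⊕ ↑ 1≤Q) (solve 2 (λ a b → a :* b :- num 1 := (a :- num 1) :* b :+ (b :- num
              1)) refl N Q)
        -- χ z is near -2 on the N/2 full classes and near 0 on the others, so T is near -W; half of
        -- it is enough.
        T-upper : # 2 * T B x ≤ - W
        T-upper = *-cancelʳ-≤ 1≤NQ (lin (eq* (# 2) QNT ⊕ nn 2 ⊗ (↑ Σ-upper ⊗ W≥0) ⊕ eq* (- # 2 * (Q * W)) N≡2E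
              ⊕ ↑ 16N≤Q ⊗ (N≥0 ⊗ W≥0) ⊕ nn 14 ⊗ ((N≥0 ⊗ N≥0 ⊗ W≥0))) (solve 6 (λ a b c d e f → :- d :* (b :* c)
              :- num 2 :* a :* (b :* c) := num 2 :* (e :* d :- c :* b :* a) :+ num 2 :* (((b :- num 2 :* c) :* b
              :+ num 2 :* c :* f :- e) :* d) :+ :- (num 2) :* (c :* d) :* (num 2 :* f :- b) :+ (c :- num 16 :*
              b) :* (b :* d) :+ num 14 :* (b :* b :* d)) refl (T B x) N Q W (∑ᵘ (λ h → Q * ((# 2 * e h - # 1) *
              z h))) E))

  -- Choice of the constants.

  -- The first j terms are at most 1, the remaining j² - j at most 1/j. This square root bound is
  -- enough for k to beat H(2k).
  H-square : ∀ j → H (j ℕ.* j) ≤ # 2 * # j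
  H-square zero = lin (nn 0) (solve 0 (num 2 :* num 0 :- num 0 := num 0) refl)
  H-square j@(suc j′) = lin (eq* (# 1) (∑-split j (j′ ℕ.* j) inv) ⊕ ↑ start ⊕ ↑ rest) (solve 4 (λ a b c d → num
        2 :* b :- a := num 1 :* (c :+ d :- a) :+ (b :- c) :+ (b :- d)) refl (H (j ℕ.* j)) (# j) (H j) T)
    where
    T = ∑ (j′ ℕ.* j) (λ i → inv (j ℕ.+ i))
    start : H j ≤ # j
    start = ≤-trans (∑-mono j (λ i _ _ → inv-≤1 i)) (≡⇒≤ (trans (∑-const j (# 1)) (solve 1 (λ a → a :* num 1 :=
          a) refl (# j))))
    rest : T ≤ # j
    rest = ≤-trans (∑-mono (j′ ℕ.* j) (λ i _ _ → inv-≤ (s≤s z≤n) (ℕ.m≤m+n j i))) (≤-trans (≡⇒≤ (∑-const (j′ ℕ.* j) (inv j)))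
      (lin (eq* (# 1 * (inv j)) (#-* j′ j) ⊕ eq* (# 1 * (# j′)) (inv-suc j′) ⊕ ↑ (#-mono (ℕ.n≤1+n j′))) (solve
            4 (λ a b c d → c :- a :* b := num 1 :* b :* (d :* c :- a) :+ num 1 :* d :* (num 1 :- c :* b) :+ (c
            :- d)) refl (# (j′ ℕ.* j)) (inv j) (# j) (# j′))))

  H-2^ : ∀ r → # r ≤ # 2 * H (2 ℕ.^ r)
  H-2^ zero = lin (nn 2 ⊗ ((inv-nonneg 1))) (solve 1 (λ a → num 2 :* (num 0 :+ a) :- num 0 := num 2 :* a) refl
        (inv 1))
  H-2^ (suc r) = lin (↑ (H-2^ r) ⊕ nn 2 ⊗ (↑ (H-block-lower x 1 (ℕ.m^n>0 2 r))) ⊕ eq* (- # 2) (cong H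
        (ℕ.*-identityʳ x)) ⊕ eq* (# 2) (cong H (ℕ.*-comm x 2)) ⊕ eq* (- # 1) (inv-suc 1) ⊕ eq* (# 1) (#-suc r))
        (solve 7 (λ a b c d e f g → num 2 :* b :- a := num 2 :* c :- d :+ num 2 :* (e :- f :- g) :+ :- (num 2)
        :* (c :- f) :+ num 2 :* (b :- e) :+ :- (num 1) :* (num 1 :- num 2 :* g) :+ num 1 :* (d :+ num 1 :- a))
        refl (# (suc r)) (H (2 ℕ.* x)) (H x) (# r) (H (x ℕ.* 2)) (H (x ℕ.* 1)) (inv 2))
    where x = 2 ℕ.^ r

  -- The bound that log Y must exceed is a field element; it has to be a natural number to enter the
  -- exponent of Y.
  IsNatural : F → Set
  IsNatural x = ∃ λ n → x ≡ # n

  #-natural : ∀ n → IsNatural (# n)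
  #-natural n = n , refl

  +-natural : ∀ {x y} → IsNatural x → IsNatural y → IsNatural (x + y)
  +-natural (m , refl) (n , refl) = m ℕ.+ n , sym (#-+ m n)

  *-natural : ∀ {x y} → IsNatural x → IsNatural y → IsNatural (x * y)
  *-natural (m , refl) (n , refl) = m ℕ.* n , sym (#-* m n)

  -- Opaque, so that these large numbers are never evaluated.
  abstract

    Q₀ t₀ k₀ j₀ K₀ : ℕ → ℕ
    Q₀ m = 16 ℕ.* suc m ℕ.* suc m
    t₀ m = Q₀ m ℕ.* (16 ℕ.* suc m ℕ.+ 4)
    k₀ m = 4 ℕ.* t₀ m ℕ.* t₀ m
    j₀ m = 4 ℕ.* t₀ m
    K₀ m = ℕ.pred (k₀ m ℕ.+ k₀ m) ℕ.+ (k₀ m ℕ.+ k₀ m)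

    K₀-def : ∀ m → K₀ m ≡ ℕ.pred (k₀ m ℕ.+ k₀ m) ℕ.+ (k₀ m ℕ.+ k₀ m)
    K₀-def m = refl

    1≤t₀ : ∀ m → 1 ℕ.≤ t₀ m
    1≤t₀ m = ℕ.*-mono-≤ {1} {Q₀ m} (s≤s z≤n) (ℕ.≤-trans (s≤s z≤n) (ℕ.m≤n+m 4 (16 ℕ.* suc m)))

    t₀≤k₀ : ∀ m → t₀ m ℕ.≤ k₀ m
    t₀≤k₀ m = ℕ.m≤n*m (t₀ m) (4 ℕ.* t₀ m) {{ℕ.>-nonZero (ℕ.*-mono-≤ {1} {4} (s≤s z≤n) (1≤t₀ m))}}

    4k₀≡j₀² : ∀ m → (k₀ m ℕ.+ k₀ m) ℕ.+ (k₀ m ℕ.+ k₀ m) ≡ j₀ m ℕ.* j₀ m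
    4k₀≡j₀² m = identity (t₀ m)
      where
      identity : ∀ t → (4 ℕ.* t ℕ.* t ℕ.+ 4 ℕ.* t ℕ.* t) ℕ.+ (4 ℕ.* t ℕ.* t ℕ.+ 4 ℕ.* t ℕ.* t) ≡ 4 ℕ.* t ℕ.* (4 ℕ.* t)
      identity = solve-∀

    #Q₀ : ∀ m → # (Q₀ m) ≡ # 16 * # (suc m) * # (suc m)
    #Q₀ m = trans (#-* (16 ℕ.* suc m) (suc m)) (cong (_* # (suc m)) (#-* 16 (suc m)))

    #t₀ : ∀ m → # (t₀ m) ≡ # (Q₀ m) * (# 16 * # (suc m) + # 4)
    #t₀ m = trans (#-* (Q₀ m) (16 ℕ.* suc m ℕ.+ 4)) (cong (# (Q₀ m) *_) (trans (#-+ (16 ℕ.* suc m) 4) (cong (_+ # 4) (#-* 16 (suc m)))))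

    #j₀ : ∀ m → # (j₀ m) ≡ # 4 * # (t₀ m)
    #j₀ m = #-* 4 (t₀ m)

    #k₀ : ∀ m → # (k₀ m) ≡ # 4 * # (t₀ m) * # (t₀ m)
    #k₀ m = trans (#-* (4 ℕ.* t₀ m) (t₀ m)) (cong (_* # (t₀ m)) (#-* 4 (t₀ m)))

    16M≤t₀ : ∀ m → 16 ℕ.* suc m ℕ.+ 4 ℕ.≤ t₀ m
    16M≤t₀ m = ℕ.m≤n*m (16 ℕ.* suc m ℕ.+ 4) (Q₀ m)

  module Parameters (m : ℕ) where

    M Q t k₂ k j K : ℕ
    M = suc m
    Q = Q₀ m
    t = t₀ m
    k₂ = k₀ m
    k = k₂ ℕ.+ k₂
    j = j₀ m
    K = K₀ m

    1≤k : 1 ℕ.≤ k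
    1≤k = ℕ.≤-trans (1≤t₀ m) (ℕ.≤-trans (t₀≤k₀ m) (ℕ.m≤m+n k₂ k₂))

    suc-pred-k : suc (ℕ.pred k) ≡ k
    suc-pred-k = ℕ.suc-pred k {{ℕ.>-nonZero 1≤k}}

    -- Here 2k = j² with j = 4t and k = 8t². By `H-square` the left side is at most Q(16M+4) j = t j
    -- = 4t².
    k-large₁ : ∀ {N} → # 0 ≤ N → N ≤ # M → # Q * (# 8 * N * H (k ℕ.+ k) + # 4) ≤ # k
    k-large₁ {N} N≥0 N≤M = ≤-trans (*-monoˡ (# Q) (nn Q) inner) (lin (eq* (- # 1 * (# j)) (#t₀ m) ⊕ eq* (# 1 *
          (# t)) (#j₀ m) ⊕ eq* (- # 1) k≡ ⊕ nn 4 ⊗ ((nn t ⊗ nn t))) (solve 5 (λ a b c d e → d :- a :* ((num 16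
          :* b :+ num 4) :* c) := :- (num 1) :* c :* (a :* (num 16 :* b :+ num 4) :- e) :+ num 1 :* e :* (num 4
          :* e :- c) :+ :- (num 1) :* (num 8 :* (e :* e) :- d) :+ num 4 :* (e :* e)) refl (# Q) (# M) (# j) (#
          k) (# t)))
      where
      k≡ : # k ≡ # 8 * (# t * # t)
      k≡ = trans (#-+ k₂ k₂) (trans (cong (λ z → z + z) (#k₀ m)) (solve 1 (λ a → num 4 :* a :* a :+ num 4 :* a
            :* a := num 8 :* (a :* a)) refl (# t)))
      1≤j : # 1 ≤ # j
      1≤j = lin (nn 4 ⊗ (↑ (#-mono (1≤t₀ m))) ⊕ eq* (- # 1) (#j₀ m) ⊕ nn 3) (solve 2 (λ a b → a :- num 1 := num
            4 :* (b :- num 1) :+ :- (num 1) :* (num 4 :* b :- a) :+ num 3) refl (# j) (# t))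
      inner : # 8 * N * H (k ℕ.+ k) + # 4 ≤ (# 16 * # M + # 4) * # j
      inner = lin (eq* (# 8 * (N)) (cong H (4k₀≡j₀² m)) ⊕ nn 8 ⊗ (↑ (H-square j) ⊗ N≥0) ⊕ nn 16 ⊗ (↑ N≤M ⊗ (nn
            j)) ⊕ nn 4 ⊗ (↑ 1≤j)) (solve 5 (λ a b c d e → (num 16 :* c :+ num 4) :* d :- (num 8 :* a :* b :+ num
            4) := num 8 :* a :* (e :- b) :+ num 8 :* ((num 2 :* d :- e) :* a) :+ num 16 :* ((c :- a) :* d) :+
            num 4 :* (d :- num 1)) refl N (H (k ℕ.+ k)) (# M) (# j) (H (j ℕ.* j)))

    k-large₂ : ∀ {N} → N ≤ # M → # 16 * N + # 1 ≤ # k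
    k-large₂ {N} N≤M = ≤-trans (lin (nn 16 ⊗ (↑ N≤M) ⊕ eq* (- # 1) (#-+ (16 ℕ.* M) 4) ⊕ eq* (- # 1) (#-* 16 M)
          ⊕ nn 3) (solve 4 (λ a b c d → b :- (num 16 :* a :+ num 1) := num 16 :* (c :- a) :+ :- (num 1) :* (d :+
          num 4 :- b) :+ :- (num 1) :* (num 16 :* c :- d) :+ num 3) refl N (# (16 ℕ.* M ℕ.+ 4)) (# M) (# (16 ℕ.*
          M))))
      (#-mono (ℕ.≤-trans (16M≤t₀ m) (ℕ.≤-trans (t₀≤k₀ m) (ℕ.m≤m+n k₂ k₂))))

    c₁ c₂ : F
    c₁ = # 8 + # 2 * # M * # M
    c₂ = # 200 * # M * # M + c₁ + (c₁ + # 2) * c₁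

    ν Z : ℕ
    ν = ν₀ m
    Z = Z₀ m

    -- The sum of everything that log Y has to exceed, so that the single inequality D ≤ L yields
    -- all the `L-large` conditions.
    D : F
    D = c₂ * (# 2 * # K + # 3) + # 8 * # M * # K + # 2 * # K * c₁ + # Q * c₁ + # 52 * # M * # ν + # 1

    c₁-natural : IsNatural c₁
    c₁-natural = +-natural (#-natural 8) (*-natural (*-natural (#-natural 2) (#-natural M)) (#-natural M))

    c₂-natural : IsNatural c₂
    c₂-natural = +-natural (+-natural (*-natural (*-natural (#-natural 200) (#-natural M)) (#-natural M)) c₁-natural) (*-natural (+-natural c₁-natural (#-natural 2)) c₁-natural)

    abstract

      D-natural : IsNatural D
      D-natural = +-natural (+-natural (+-natural (+-natural (+-natural (*-natural c₂-natural (+-natural (*-natural (#-natural 2) (#-natural K)) (#-natural 3)))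
        (*-natural (*-natural (#-natural 8) (#-natural M)) (#-natural K))) (*-natural (*-natural (#-natural 2) (#-natural K)) c₁-natural)) (*-natural (#-natural Q) c₁-natural))
        (*-natural (*-natural (#-natural 52) (#-natural M)) (#-natural ν))) (#-natural 1)

    c₁≥0 : # 0 ≤ c₁
    c₁≥0 = nn 8 ⊕ nn 2 ⊗ nn M ⊗ nn M

    c₂≥0 : # 0 ≤ c₂
    c₂≥0 = nn 200 ⊗ nn M ⊗ nn M ⊕ c₁≥0 ⊕ (c₁≥0 ⊕ nn 2) ⊗ c₁≥0

    abstract

      -- r/2 ≤ H(Y) ≤ 1 + 2 log Y turns r ≥ 4D + 2 into log Y ≥ D; the summand Z ensures Y ≥ Z. `B`
      -- has room for 2 Y^K and for M.
      r Y B : ℕ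
      r = 4 ℕ.* proj₁ D-natural ℕ.+ 2 ℕ.+ Z
      Y = 2 ℕ.^ r
      B = Y ℕ.^ K ℕ.+ Y ℕ.^ K ℕ.+ M

      1≤Y : 1 ℕ.≤ Y
      1≤Y = ℕ.m^n>0 2 r

      r≤2H : # r ≤ # 2 * H Y
      r≤2H = H-2^ r

      4D≤r : # 4 * D + # 2 ≤ # r
      4D≤r = subst (λ z → # 4 * z + # 2 ≤ # r) (sym (proj₂ D-natural))
        (subst (_≤ # r) (trans (#-+ (4 ℕ.* d) 2) (cong (_+ # 2) (#-* 4 d))) (#-mono (ℕ.m≤m+n (4 ℕ.* d ℕ.+ 2) Z)))
        where
        d : ℕ
        d = proj₁ D-natural

      Z≤Y : Z ℕ.≤ Y
      Z≤Y = ℕ.≤-trans (ℕ.m≤n+m Z (4 ℕ.* proj₁ D-natural ℕ.+ 2)) (ℕ.<⇒≤ (n<2^n r))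

      M≤B : M ℕ.≤ B
      M≤B = ℕ.m≤n+m M (Y ℕ.^ K ℕ.+ Y ℕ.^ K)

      range : Y ℕ.^ K ℕ.+ Y ℕ.^ K ℕ.≤ B
      range = ℕ.m≤m+n (Y ℕ.^ K ℕ.+ Y ℕ.^ K) M

    1≤K : 1 ℕ.≤ K
    1≤K = subst (1 ℕ.≤_) (sym (K₀-def m)) (ℕ.≤-trans 1≤k (ℕ.m≤n+m k (ℕ.pred k)))

    Y≤B : Y ℕ.≤ B
    Y≤B = ℕ.≤-trans (ℕ.≤-trans (ℕ.≤-reflexive (sym (ℕ.^-identityʳ Y))) (ℕ.^-monoʳ-≤ Y {{ℕ.>-nonZero 1≤Y}} 1≤K)) (ℕ.≤-trans (ℕ.m≤m+n (Y ℕ.^ K) (Y ℕ.^ K)) range)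

    open Selberg B m M≤B using (ℓ; H-≤-ℓ; N; N≥0; N≤M; unit; A; _≋_; _≋?_; Λ/-proper-powers; δ)

    D≤ℓY : D ≤ ℓ Y
    D≤ℓY = lin/ 3 (nn 2 ⊗ (↑ (H-≤-ℓ 1≤Y Y≤B)) ⊕ ↑ r≤2H ⊕ ↑ 4D≤r) (solve 4 (λ a b c d → num 4 :* (b :- a) := num
          2 :* (num 1 :+ num 2 :* b :- c) :+ (num 2 :* c :- d) :+ (d :- (num 4 :* a :+ num 2))) refl D (ℓ Y) (H
          Y) (# r))

    1≤N : # 1 ≤ N
    1≤N = ≤-trans (≡⇒≤ (sym (trans (∑-𝟙 M 1 unit ℕ.≤-refl (s≤s z≤n)) (𝟙-yes (coprime? 1 M) (λ (d , _) → ∣1⇒≡1 d)))))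
      (∑-mono M (λ i _ _ → (lin (↑ (𝟙-≤1 (i ℕ.≟ 1)) ⊗ (𝟙-nonneg (coprime? i M))) (solve 2 (λ a b → b :- a :* b
            := (num 1 :- a) :* b) refl (𝟙 (i ℕ.≟ 1)) (unit i)))))

    module _ {L : F} (D≤L : D ≤ L) where

      private
        a₁ : # 0 ≤ c₂ * (# 2 * # K + # 3)
        a₁ = c₂≥0 ⊗ (nn 2 ⊗ nn K ⊕ nn 3)
        a₂ : # 0 ≤ # 8 * # M * # K
        a₂ = nn 8 ⊗ nn M ⊗ nn K
        a₃ : # 0 ≤ # 2 * # K * c₁
        a₃ = nn 2 ⊗ nn K ⊗ c₁≥0
        a₄ : # 0 ≤ # Q * c₁
        a₄ = nn Q ⊗ c₁≥0
        a₅ : # 0 ≤ # 52 * # M * # ν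
        a₅ = nn 52 ⊗ nn M ⊗ nn ν
        x₁ = c₂ * (# 2 * # K + # 3)
        x₂ = # 8 * # M * # K
        x₃ = # 2 * # K * c₁
        x₄ = # Q * c₁
        x₅ = # 52 * # M * # ν

      1≤L : # 1 ≤ L
      1≤L = lin (↑ D≤L ⊕ a₁ ⊕ a₂ ⊕ a₃ ⊕ a₄ ⊕ a₅) (solve 6 (λ a b c d e f → a :- num 1 := a :- (b :+ c :+ d :+ e
            :+ f :+ num 1) :+ b :+ c :+ d :+ e :+ f) refl L x₁ x₂ x₃ x₄ x₅)

      L≥0 : # 0 ≤ L
      L≥0 = ≤-trans (nn 1) 1≤L

      x₁+x₂≤L : c₂ * (# 2 * # K + # 3) + # 8 * # M * # K ≤ L
      x₁+x₂≤L = lin (↑ D≤L ⊕ a₃ ⊕ a₄ ⊕ a₅ ⊕ nn 1) (solve 6 (λ a b c d e f → c :- (a :+ b) := c :- (a :+ b :+ d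
            :+ e :+ f :+ num 1) :+ d :+ e :+ f :+ num 1) refl x₁ x₂ L x₃ x₄ x₅)

      L-large₁ : c₂ * (# 2 + (# 2 * # K + # 1) * L) ≤ L * L
      L-large₁ = lin (↑ x₁+x₂≤L ⊗ L≥0 ⊕ nn 2 ⊗ (↑ 1≤L ⊗ c₂≥0) ⊕ nn 8 ⊗ ((nn M ⊗ nn K ⊗ L≥0))) (solve 4 (λ a b c
            d → c :* c :- a :* (num 2 :+ (num 2 :* b :+ num 1) :* c) := (c :- (a :* (num 2 :* b :+ num 3) :+ num
            8 :* d :* b)) :* c :+ num 2 :* ((c :- num 1) :* a) :+ num 8 :* (d :* b :* c)) refl c₂ (# K) L (# M))

      L-large₂ : ∀ {N} → # 0 ≤ N → N ≤ # M → c₂ * (# 1 + # K * L) + # 8 * N * # K * L ≤ L * L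
      L-large₂ {N} N≥0 N≤M = lin (↑ x₁+x₂≤L ⊗ L≥0 ⊕ ↑ 1≤L ⊗ c₂≥0 ⊕ nn 8 ⊗ (↑ N≤M ⊗ (nn K ⊗ L≥0)) ⊕ (c₂≥0 ⊗ nn K
            ⊗ L≥0) ⊕ nn 2 ⊗ ((c₂≥0 ⊗ L≥0))) (solve 5 (λ a b c d e → c :* c :- (a :* (num 1 :+ b :* c) :+ num 8
            :* d :* b :* c) := (c :- (a :* (num 2 :* b :+ num 3) :+ num 8 :* e :* b)) :* c :+ (c :- num 1) :* a
            :+ num 8 :* ((e :- d) :* (b :* c)) :+ a :* b :* c :+ num 2 :* (a :* c)) refl c₂ (# K) L N (# M))

      L-large₃ : # 2 * # K * c₁ ≤ L
      L-large₃ = lin (↑ D≤L ⊕ a₁ ⊕ a₂ ⊕ a₄ ⊕ a₅ ⊕ nn 1) (solve 6 (λ a b c d e f → b :- a := b :- (c :+ d :+ a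
            :+ e :+ f :+ num 1) :+ c :+ d :+ e :+ f :+ num 1) refl x₃ L x₁ x₂ x₄ x₅)

      L-large₄ : # Q * c₁ ≤ L
      L-large₄ = lin (↑ D≤L ⊕ a₁ ⊕ a₂ ⊕ a₃ ⊕ a₅ ⊕ nn 1) (solve 6 (λ a b c d e f → b :- a := b :- (c :+ d :+ e
            :+ a :+ f :+ num 1) :+ c :+ d :+ e :+ f :+ num 1) refl x₄ L x₁ x₂ x₃ x₅)

      L-large₅ : # 52 * # M * # ν + # 1 ≤ L
      L-large₅ = lin (↑ D≤L ⊕ a₁ ⊕ a₂ ⊕ a₃ ⊕ a₄) (solve 6 (λ a b c d e f → b :- (a :+ num 1) := b :- (c :+ d :+
            e :+ f :+ a :+ num 1) :+ c :+ d :+ e :+ f) refl x₅ L x₁ x₂ x₃ x₄)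

    Q-large : # 16 * N * N ≤ # Q
    Q-large = lin (eq* (- # 1) (#Q₀ m) ⊕ nn 16 ⊗ (↑ N≤M ⊗ N≥0) ⊕ nn 16 ⊗ (↑ N≤M ⊗ (nn M))) (solve 3 (λ a b c →
          b :- num 16 :* a :* a := :- (num 1) :* (num 16 :* c :* c :- b) :+ num 16 :* ((c :- a) :* a) :+ num 16
          :* ((c :- a) :* c)) refl N (# Q) (# M))

    not-prime-free : ∀ {c} → Coprime c M → ¬ (∀ p → p ℕ.≤ B → Prime p → ¬ p ≋ c)
    not-prime-free {c} cc none = impossible (ℕ.pred k) suc-pred-k
      where
      A-c : ∀ x → A c x ≤ # 8
      A-c x = Λ/-proper-powers x (λ a → δ a c) (ℕ.≤-trans (s≤s z≤n) M≤B) (λ a → 𝟙-nonneg (a ≋? c)) (λ a → 𝟙-≤1 (a ≋? c)) (λ p pp p≤B → 𝟙-no (p ≋? c) (none p p≤B pp))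
      -- The predecessor of k is generalised to a variable, so that the huge k stays unevaluated.
      impossible : ∀ k′ → suc k′ ≡ k → ⊥
      impossible k′ e = Contradiction.contradiction B m M≤B Y k₂ k′ 1≤Y e
          (subst (λ K → Y ℕ.^ K ℕ.+ Y ℕ.^ K ℕ.≤ B) (sym K≡′) range) (1≤L D≤ℓY)
          (subst (λ K → c₂ * (# 2 + (# 2 * # K + # 1) * ℓ Y) ≤ ℓ Y * ℓ Y) (sym K≡′) (L-large₁ D≤ℓY))
          (subst (λ K → c₂ * (# 1 + # K * ℓ Y) + # 8 * N * # K * ℓ Y ≤ ℓ Y * ℓ Y) (sym K≡′) (L-large₂ D≤ℓY N≥0 N≤M))
          (subst (λ K → # 2 * # K * c₁ ≤ ℓ Y) (sym K≡′) (L-large₃ D≤ℓY)) 1≤N (# Q) Q-large (L-large₄ D≤ℓY)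
          (subst (λ k → # Q * (# 8 * N * H (k ℕ.+ k) + # 4) ≤ # k) (sym e) (k-large₁ N≥0 N≤M)) (subst (λ k → # 16 * N + # 1 ≤ # k) (sym e) (k-large₂ N≤M))
          c cc (A-c (Y ℕ.^ (k′ ℕ.+ suc k′))) Z≤Y (L-large₅ D≤ℓY)
        where
        K≡′ : k′ ℕ.+ suc k′ ≡ K
        K≡′ = trans (cong (λ z → ℕ.pred z ℕ.+ z) e) (sym (K₀-def m))

  -- Dirichlet's theorem.

  search : ∀ {P : ℕ → Set} → (∀ p → Dec (P p)) → ∀ n → (∃ P) ⊎ (∀ p → p ℕ.≤ n → ¬ P p)
  search P? zero with P? 0
  ... | yes p = inj₁ (0 , p)
  ... | no ¬p = inj₂ (λ { zero _ → ¬p })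
  search P? (suc n) with search P? n | P? (suc n)
  ... | inj₁ w | _ = inj₁ w
  ... | inj₂ _ | yes p = inj₁ (suc n , p)
  ... | inj₂ h | no ¬p = inj₂ (λ p p≤ q → [ (λ p<1+n → h p (ℕ.≤-pred p<1+n) q) , (λ { refl → ¬p q }) ]′ (ℕ.m≤n⇒m<n∨m≡n p≤))

  -- The search up to `B` either finds a prime or supplies the assumption refuted above.
  prime-in-class : ∀ m {c} → Coprime c (suc m) → ∃ λ p → Prime p × p ℕ.% suc m ≡ c ℕ.% suc m
  prime-in-class m {c} cc with search both? B
    where
    open Parameters m
    both? : ∀ p → Dec (Prime p × p ℕ.% suc m ≡ c ℕ.% suc m)
    both? p with prime? p | p ℕ.% suc m ℕ.≟ c ℕ.% suc m
    ... | yes a | yes b = yes (a , b)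
    ... | no a | _ = no (λ x → a (proj₁ x))
    ... | yes _ | no b = no (λ x → b (proj₂ x))
  ... | inj₁ w = w
  ... | inj₂ h = ⊥-elim (Parameters.not-prime-free m cc (λ p p≤B pp e → h p p≤B (pp , Residues.residue e)))

  abstract

    -- A single prime in each class suffices: c is replaced by c′ = c + (n+1)M and M by a power
    -- exceeding c′. A prime in this class leaves the remainder c′, so it is at least c′ > n.
    dirichlet : ∀ M c n → 2 ℕ.≤ M → .{{_ : ℕ.NonZero M}} → Coprime c M → ∃ λ p → Prime p × n ℕ.< p × p ℕ.% M ≡ c ℕ.% M
    dirichlet M c n 2≤M cc with prime-in-class (ℕ.pred M′) {c′} (subst (Coprime c′) (sym suc-pred) cc′)
      where
      c′ M′ : ℕ
      c′ = c ℕ.+ suc n ℕ.* M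
      M′ = M ℕ.^ suc c′
      instance
        M′≢0 : ℕ.NonZero M′
        M′≢0 = ℕ.m^n≢0 M (suc c′)
      suc-pred : suc (ℕ.pred M′) ≡ M′
      suc-pred = ℕ.suc-pred M′
      cc′ : Coprime c′ M′
      cc′ = Coprimality.sym (coprime-^ˡ (suc c′) (Coprimality.sym (shift (suc n))))
        where
        shift : ∀ i → Coprime (c ℕ.+ i ℕ.* M) M
        shift zero = subst (λ z → Coprime z M) (sym (ℕ.+-identityʳ c)) cc
        shift (suc i) = subst (λ z → Coprime z M) rearr (Coprimality.coprime-+ (shift i))
          where
          rearr : M ℕ.+ (c ℕ.+ i ℕ.* M) ≡ c ℕ.+ (M ℕ.+ i ℕ.* M)
          rearr = trans (sym (ℕ.+-assoc M c (i ℕ.* M))) (trans (cong (ℕ._+ i ℕ.* M) (ℕ.+-comm M c)) (ℕ.+-assoc c M (i ℕ.* M)))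
    ... | p , pp , e = p , pp , n<p , p≡c
      where
      c′ M′ : ℕ
      c′ = c ℕ.+ suc n ℕ.* M
      M′ = M ℕ.^ suc c′
      instance
        M′≢0 : ℕ.NonZero M′
        M′≢0 = ℕ.m^n≢0 M (suc c′)
      e′ : p ℕ.% M′ ≡ c′
      e′ = trans (ℕ.%-congʳ {m = M′} {n = suc (ℕ.pred M′)} (sym (ℕ.suc-pred M′))) (trans e (trans (ℕ.%-congʳ (ℕ.suc-pred M′))
        (ℕ.m<n⇒m%n≡m (ℕ.<-trans (ℕ.n<1+n c′) (n<p^n (suc c′) 2≤M)))))
      n<p : n ℕ.< p
      n<p = ℕ.≤-trans (ℕ.m≤m*n (suc n) M) (ℕ.≤-trans (ℕ.m≤n+m (suc n ℕ.* M) c) (ℕ.≤-trans (ℕ.≤-reflexive (sym e′)) (ℕ.m%n≤m p M′)))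
      p≡c : p ℕ.% M ≡ c ℕ.% M
      p≡c = trans (sym (ℕ.m∣n⇒o%n%m≡o%m M M′ p (m∣m*n (M ℕ.^ c′)))) (trans (cong (ℕ._% M) e′) (ℕ.[m+kn]%n≡m%n c (suc n) M))

  -- Euler's function.

  length-filter-∑ : ∀ {P : ℕ → Set} (P? : Decidable P) n → # (length (filter P? (range1 n))) ≡ ∑ n (λ k → 𝟙 (P? k))
  length-filter-∑ P? zero = refl
  length-filter-∑ P? (suc n) = begin
    # (length (filter P? (range1 (suc n)))) ≡⟨ cong (λ l → # (length (filter P? l))) (sym (applyUpTo-∷ʳ suc n)) ⟩
    # (length (filter P? (range1 n ∷ʳ suc n))) ≡⟨ cong (λ l → # (length l)) (filter-++ P? (range1 n) (suc n ∷ [])) ⟩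
    # (length (filter P? (range1 n) ++ filter P? (suc n ∷ []))) ≡⟨ cong # (length-++ (filter P? (range1 n))) ⟩
    # (length (filter P? (range1 n)) ℕ.+ length (filter P? (suc n ∷ []))) ≡⟨ #-+ (length (filter P? (range1 n))) _ ⟩
    # (length (filter P? (range1 n))) + # (length (filter P? (suc n ∷ []))) ≡⟨ cong₂ _+_ (length-filter-∑ P? n) last ⟩
    ∑ n (λ k → 𝟙 (P? k)) + 𝟙 (P? (suc n)) ∎
    where
    open ≡-Reasoning
    last : # (length (filter P? (suc n ∷ []))) ≡ 𝟙 (P? (suc n))
    last with P? (suc n)
    ... | yes _ = refl
    ... | no _ = refl

  cop : ℕ → ℕ → F
  cop d k = 𝟙 (coprime? k d)

  φ-∑ : ∀ n → # (φ n) ≡ ∑ n (cop n)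
  φ-∑ n = trans (length-filter-∑ (λ k → gcd k n ℕ.≟ 1) n) (∑-cong′ n (λ k → 𝟙-cong (gcd k n ℕ.≟ 1) (coprime? k n) gcd≡1⇒coprime coprime⇒gcd≡1))

  cop-shift : ∀ d k → cop d (d ℕ.+ k) ≡ cop d k
  cop-shift d k = 𝟙-cong (coprime? (d ℕ.+ k) d) (coprime? k d)
    (λ c (x , y) → c (∣m∣n⇒∣m+n y x , y)) (λ c (x , y) → c (∣m+n∣m⇒∣n x y , y))

  ∑-periodic : ∀ d (g : ℕ → F) → (∀ k → g (d ℕ.+ k) ≡ g k) → ∀ q → ∑ (q ℕ.* d) g ≡ # q * ∑ d g
  ∑-periodic d g per zero = solve 1 (λ a → num 0 := num 0 :* a) refl (∑ d g)
  ∑-periodic d g per (suc q) = begin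
    ∑ (d ℕ.+ q ℕ.* d) g ≡⟨ ∑-split d (q ℕ.* d) g ⟩
    ∑ d g + ∑ (q ℕ.* d) (λ i → g (d ℕ.+ i)) ≡⟨ cong (∑ d g +_) (trans (∑-cong′ (q ℕ.* d) per) (∑-periodic d g per q)) ⟩
    ∑ d g + # q * ∑ d g ≡⟨ (solve 2 (λ a b → a :+ b :* a := (b :+ num 1) :* a) refl (∑ d g) (# q)) ⟩
    (# q + # 1) * ∑ d g ≡⟨ cong (_* ∑ d g) (sym (#-suc q)) ⟩
    # (suc q) * ∑ d g ∎
    where open ≡-Reasoning

  coprime-*ʳ : ∀ {k a b} → Coprime k a → Coprime k b → Coprime k (a ℕ.* b)
  coprime-*ʳ {k} {a} {b} p q = Coprimality.sym (coprime-*ˡ {a} {b} (Coprimality.sym p) (Coprimality.sym q))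

  -- Being coprime to q d is the same as being coprime to d, and q d comprises q periods of length
  -- d.
  φ-*-∣ : ∀ {q d} → Prime q → q ∣ d → φ (q ℕ.* d) ≡ q ℕ.* φ d
  φ-*-∣ {q} {d} pq q∣d = #-injective (begin
    # (φ (q ℕ.* d)) ≡⟨ φ-∑ (q ℕ.* d) ⟩
    ∑ (q ℕ.* d) (cop (q ℕ.* d)) ≡⟨ ∑-cong′ (q ℕ.* d) (λ k → 𝟙-cong (coprime? k (q ℕ.* d)) (coprime? k d)
        (coprime-∣ ∣-refl (n∣m*n q)) (λ c → coprime-*ʳ (coprime-∣ ∣-refl q∣d c) c)) ⟩
    ∑ (q ℕ.* d) (cop d) ≡⟨ ∑-periodic d (cop d) (cop-shift d) q ⟩
    # q * ∑ d (cop d) ≡⟨ cong (# q *_) (sym (φ-∑ d)) ⟩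
    # q * # (φ d) ≡⟨ sym (#-* q (φ d)) ⟩
    # (q ℕ.* φ d) ∎)
    where open ≡-Reasoning

  -- Of the q φ(d) numbers up to q d that are coprime to d, the multiples q e are removed; they
  -- correspond to the e ≤ d coprime to d.
  φ-*-∤ : ∀ {q d} → Prime q → ¬ q ∣ d → φ (q ℕ.* d) ≡ ℕ.pred q ℕ.* φ d
  φ-*-∤ {q@(suc q′)} {d} pq q∤d = #-injective (begin
    # (φ (q ℕ.* d)) ≡⟨ φ-∑ (q ℕ.* d) ⟩
    ∑ (q ℕ.* d) (cop (q ℕ.* d)) ≡⟨ ∑-cong′ (q ℕ.* d) split ⟩
    ∑ (q ℕ.* d) (λ k → cop d k - 𝟙 (q ∣? k) * cop d k) ≡⟨ ∑-- (q ℕ.* d) _ _ ⟩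
    ∑ (q ℕ.* d) (cop d) - ∑ (q ℕ.* d) (λ k → 𝟙 (q ∣? k) * cop d k) ≡⟨ cong₂ _-_ (∑-periodic d (cop d) (cop-shift d) q) (sym (∑-multiples (q ℕ.* d) q (cop d) (s≤s z≤n))) ⟩
    # q * ∑ d (cop d) - ∑ (q ℕ.* d ÷ q) (λ e → cop d (q ℕ.* e)) ≡⟨ cong (λ z → # q * ∑ d (cop d) - z) (trans (cong (λ z → ∑ z (λ e → cop d (q ℕ.* e))) qd÷q) (∑-cong′ d mult)) ⟩
    # q * ∑ d (cop d) - ∑ d (cop d) ≡⟨ cong (λ z → z * ∑ d (cop d) - ∑ d (cop d)) (#-suc q′) ⟩
    (# q′ + # 1) * ∑ d (cop d) - ∑ d (cop d) ≡⟨ (solve 2 (λ a b → (a :+ num 1) :* b :- b := a :* b) refl (# q′)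
          (∑ d (cop d))) ⟩
    # q′ * ∑ d (cop d) ≡⟨ cong (# q′ *_) (sym (φ-∑ d)) ⟩
    # q′ * # (φ d) ≡⟨ sym (#-* q′ (φ d)) ⟩
    # (q′ ℕ.* φ d) ∎)
    where
    open ≡-Reasoning
    cqd : Coprime q d
    cqd = prime∤⇒coprime pq q∤d
    qd÷q : q ℕ.* d ÷ q ≡ d
    qd÷q = ℕ.≤-antisym (ℕ.*-cancelˡ-≤ q (*-÷-≤ (q ℕ.* d) q)) (*≤⇒≤÷ (s≤s z≤n) ℕ.≤-refl)
    mult : ∀ e → cop d (q ℕ.* e) ≡ cop d e
    mult e = 𝟙-cong (coprime? (q ℕ.* e) d) (coprime? e d) (coprime-∣ (n∣m*n q) ∣-refl) (coprime-*ˡ {q} {e} cqd)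
    split : ∀ k → cop (q ℕ.* d) k ≡ cop d k - 𝟙 (q ∣? k) * cop d k
    split k with q ∣? k
    ... | yes q∣k = trans (𝟙-no (coprime? k (q ℕ.* d)) (λ c → ℕ.<⇒≢ (prime⇒2≤ pq) (sym (c (q∣k , m∣m*n d))))) (solve
          1 (λ a → num 0 := a :- num 1 :* a) refl (cop d k))
    ... | no q∤k = trans (𝟙-cong (coprime? k (q ℕ.* d)) (coprime? k d) (coprime-∣ ∣-refl (n∣m*n q)) (λ c → coprime-*ʳ (Coprimality.sym (prime∤⇒coprime pq q∤k)) c))
        (solve 1 (λ a → a := a :- num 0 :* a) refl (cop d k))

  φ-prime-power : ∀ {q d} j → Prime q → ¬ q ∣ d → φ (q ℕ.^ suc j ℕ.* d) ≡ q ℕ.^ j ℕ.* (ℕ.pred q ℕ.* φ d)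
  φ-prime-power {q} {d} zero pq q∤d = trans (cong (λ z → φ (z ℕ.* d)) (ℕ.*-identityʳ q)) (trans (φ-*-∤ pq q∤d) (sym (ℕ.*-identityˡ _)))
  φ-prime-power {q} {d} (suc j) pq q∤d = trans (cong φ (ℕ.*-assoc q (q ℕ.^ suc j) d)) (trans (φ-*-∣ pq (∣m⇒∣m*n d (m∣m*n (q ℕ.^ j))))
    (trans (cong (q ℕ.*_) (φ-prime-power j pq q∤d)) (sym (ℕ.*-assoc q (q ℕ.^ j) _))))

  φ-positive : ∀ {d} → 1 ℕ.≤ d → 1 ℕ.≤ φ d
  φ-positive {d} 1≤d = #-cancel-≤ (≤-trans (≤-trans (≡⇒≤ (sym (trans (∑-𝟙 d 1 (cop d) ℕ.≤-refl 1≤d) (𝟙-yes (coprime? 1 d) (λ (x , _) → ∣1⇒≡1 x)))))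
      (∑-mono d (λ i _ _ → (lin (↑ (𝟙-≤1 (i ℕ.≟ 1)) ⊗ (𝟙-nonneg (coprime? i d))) (solve 2 (λ a b → b :- a :* b
            := (num 1 :- a) :* b) refl (𝟙 (i ℕ.≟ 1)) (cop d i)))))) (≡⇒≤ (sym (φ-∑ d))))

-- Congruences over the integers and their solutions in units.

module Totients where

  open Elementary using (prime⇒1≤; prime⇒2≤; prime∤⇒coprime; prime∣prime⇒≡; prime-factor; coprime-^ˡ)
  open Analysis using (dirichlet; split-prime; search; φ-*-∤; φ-prime-power; φ-positive; even-or-odd; factor-pos)

  abstract

    𝕫 : ℤ-Algebra
    𝕫 = record
      { Carrier = ℤ ; _+_ = ℤ._+_ ; _*_ = ℤ._*_ ; -_ = ℤ.-_ ; ι = λ z → z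
      ; isCommutativeRing = ℤ.+-*-isCommutativeRing
      ; ι-+ = λ _ _ → refl ; ι-* = λ _ _ → refl ; ι-neg = λ _ → refl }

  open ℤ-Algebra 𝕫 renaming (Carrier to Z)
  open RingSolver 𝕫

  abstract

    reduce : ∀ z M .{{_ : ℕ.NonZero M}} → ∃ λ c → ∃ λ k → z ≡ # c + k * # M
    reduce z M = z ℤ.%ℕ M , z ℤ./ℕ M , ℤ.a≡a%ℕn+[a/ℕn]*n z M

    *-cast≡1 : ∀ x d → x * # d ≡ # 1 → d ≡ 1
    *-cast≡1 x d e = ℕ.m*n≡1⇒n≡1 ℤ.∣ x ∣ d (trans (sym (ℤ.abs-* x (ℤ.+ d))) (cong ℤ.∣_∣ e))

    #-quotient : ∀ {t a} M f → a ℕ.< t → # t ≡ # a + f * # M → ∃ λ k → t ≡ a ℕ.+ k ℕ.* M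
    #-quotient {t} {a} M (ℤ.+ k) _ e = k , ℤ.+-injective (trans e (cong (λ z → ℤ.+ a ℤ.+ z) (sym (ℤ.pos-* k M))))
    #-quotient {t} {a} M -[1+ k ] a<t e = ⊥-elim (ℕ.<⇒≱ a<t (ℕ.≤-trans (ℕ.m≤m+n t (suc k ℕ.* M)) (ℕ.≤-reflexive (ℤ.+-injective (begin
      ℤ.+ t ℤ.+ ℤ.+ (suc k ℕ.* M) ≡⟨ cong₂ ℤ._+_ e (ℤ.pos-* (suc k) M) ⟩
      ℤ.+ a ℤ.+ ℤ.- s ℤ.* ℤ.+ M ℤ.+ s ℤ.* ℤ.+ M ≡⟨ cong (λ z → ℤ.+ a ℤ.+ z ℤ.+ s ℤ.* ℤ.+ M) (sym (ℤ.neg-distribˡ-* s (ℤ.+ M))) ⟩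
      ℤ.+ a ℤ.+ ℤ.- (s ℤ.* ℤ.+ M) ℤ.+ s ℤ.* ℤ.+ M ≡⟨ ℤ.+-assoc (ℤ.+ a) (ℤ.- (s ℤ.* ℤ.+ M)) (s ℤ.* ℤ.+ M) ⟩
      ℤ.+ a ℤ.+ (ℤ.- (s ℤ.* ℤ.+ M) ℤ.+ s ℤ.* ℤ.+ M) ≡⟨ cong (λ z → ℤ.+ a ℤ.+ z) (ℤ.+-inverseˡ (s ℤ.* ℤ.+ M)) ⟩
      ℤ.+ a ℤ.+ ℤ.+ 0 ≡⟨ ℤ.+-identityʳ (ℤ.+ a) ⟩
      ℤ.+ a ∎)))))
      where
      open ≡-Reasoning
      s : ℤ
      s = ℤ.+ suc k

  #-+ : ∀ m n → # (m ℕ.+ n) ≡ # m + # n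
  #-+ m n = ι-+ (ℤ.+ m) (ℤ.+ n)

  #-* : ∀ m n → # (m ℕ.* n) ≡ # m * # n
  #-* m n = trans (cong ι (ℤ.pos-* m n)) (ι-* (ℤ.+ m) (ℤ.+ n))

  *-comm : ∀ a b → a * b ≡ b * a
  *-comm a b = solve 2 (λ a b → a :* b := b :* a) refl a b

  *-assoc : ∀ a b c → a * b * c ≡ a * (b * c)
  *-assoc a b c = solve 3 (λ a b c → a :* b :* c := a :* (b :* c)) refl a b c

  *-identityʳ : ∀ a → a * # 1 ≡ a
  *-identityʳ a = solve 1 (λ a → a :* num 1 := a) refl a

  *-identityˡ : ∀ a → # 1 * a ≡ a
  *-identityˡ a = solve 1 (λ a → num 1 :* a := a) refl a

  infixr 9 _^_
  _^_ : Z → ℕ → Z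
  z ^ zero = # 1
  z ^ suc j = z * z ^ j

  infix 4 _≡_[mod_]
  record _≡_[mod_] (a b n : Z) : Set where
    constructor mod-by
    field
      factor : Z
      equation : a ≡ b + factor * n

  mod-refl : ∀ {a n} → a ≡ a [mod n ]
  mod-refl {a} {n} = mod-by (# 0) (ring a n)
    where
    ring : ∀ a n → a ≡ a + # 0 * n
    ring a n = solve 2 (λ a b → a := a :+ num 0 :* b) refl a n

  mod-reflexive : ∀ {a b n} → a ≡ b → a ≡ b [mod n ]
  mod-reflexive refl = mod-refl

  mod-sym : ∀ {a b n} → a ≡ b [mod n ] → b ≡ a [mod n ]
  mod-sym {b = b} {n} (mod-by k refl) = mod-by (- k) (ring b k n)
    where
    ring : ∀ b k n → b ≡ b + k * n + - k * n
    ring b k n = solve 3 (λ a b c → a := a :+ b :* c :+ :- b :* c) refl b k n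

  mod-trans : ∀ {a b c n} → a ≡ b [mod n ] → b ≡ c [mod n ] → a ≡ c [mod n ]
  mod-trans {c = c} {n} (mod-by k refl) (mod-by l refl) = mod-by (k + l) (ring c k l n)
    where
    ring : ∀ c k l n → c + l * n + k * n ≡ c + (k + l) * n
    ring c k l n = solve 4 (λ a b c d → a :+ b :* c :+ d :* c := a :+ (d :+ b) :* c) refl c l n k

  mod-+ : ∀ {a b c d n} → a ≡ b [mod n ] → c ≡ d [mod n ] → a + c ≡ b + d [mod n ]
  mod-+ {b = b} {d = d} {n} (mod-by k refl) (mod-by l refl) = mod-by (k + l) (ring b d k l n)
    where
    ring : ∀ b d k l n → b + k * n + (d + l * n) ≡ b + d + (k + l) * n
    ring b d k l n = solve 5 (λ a b c d e → a :+ b :* c :+ (d :+ e :* c) := a :+ d :+ (b :+ e) :* c) refl b k n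
          d l

  mod-* : ∀ {a b c d n} → a ≡ b [mod n ] → c ≡ d [mod n ] → a * c ≡ b * d [mod n ]
  mod-* {b = b} {d = d} {n} (mod-by k refl) (mod-by l refl) = mod-by (b * l + k * d + k * l * n) (ring b d k l n)
    where
    ring : ∀ b d k l n → (b + k * n) * (d + l * n) ≡ b * d + (b * l + k * d + k * l * n) * n
    ring b d k l n = solve 5 (λ a b c d e → (a :+ b :* c) :* (d :+ e :* c) := a :* d :+ (a :* e :+ b :* d :+ b
          :* e :* c) :* c) refl b k n d l

  mod-^ : ∀ {a b n} j → a ≡ b [mod n ] → a ^ j ≡ b ^ j [mod n ]
  mod-^ zero e = mod-refl
  mod-^ (suc j) e = mod-* e (mod-^ j e)

  mod-divisor : ∀ {a b} n u → a ≡ b [mod n * u ] → a ≡ b [mod n ]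
  mod-divisor {b = b} n u (mod-by k refl) = mod-by (k * u) (ring b k n u)
    where
    ring : ∀ b k n u → b + k * (n * u) ≡ b + k * u * n
    ring b k n u = solve 4 (λ a b c d → a :+ b :* (c :* d) := a :+ b :* d :* c) refl b k n u

  mod-scale : ∀ {a b n} c → a ≡ b [mod n ] → c * a ≡ c * b [mod c * n ]
  mod-scale {b = b} {n} c (mod-by k refl) = mod-by k (ring b c k n)
    where
    ring : ∀ b c k n → c * (b + k * n) ≡ c * b + k * (c * n)
    ring b c k n = solve 4 (λ a b c d → a :* (b :+ c :* d) := a :* b :+ c :* (a :* d)) refl c b k n

  record Comaximal (P R : Z) : Set where
    constructor comaximal
    field
      x y : Z
      identity : x * P + y * R ≡ # 1

  mod-combine : ∀ {a b P R} → Comaximal P R → a ≡ b [mod P ] → a ≡ b [mod R ] → a ≡ b [mod P * R ]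
  mod-combine {a} {b} {P} {R} (comaximal x y e) (mod-by k p) (mod-by l q) = mod-by (l * x + k * y) (begin
    a ≡⟨ ring₁ a b ⟩
    b + (a - b) * # 1 ≡⟨ cong (λ z → b + (a - b) * z) (sym e) ⟩
    b + (a - b) * (x * P + y * R) ≡⟨ ring₂ b (a - b) (x * P) (y * R) ⟩
    b + ((a - b) * (x * P) + (a - b) * (y * R)) ≡⟨ cong₂ (λ u v → b + (u * (x * P) + v * (y * R))) (diff l R q) (diff k P p) ⟩
    b + (l * R * (x * P) + k * P * (y * R)) ≡⟨ ring₃ b k l x y P R ⟩
    b + (l * x + k * y) * (P * R) ∎)
    where
    open ≡-Reasoning
    ring₁ : ∀ a b → a ≡ b + (a - b) * # 1
    ring₁ a b = solve 2 (λ a b → a := b :+ (a :- b) :* num 1) refl a b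
    ring₂ : ∀ b d s t → b + d * (s + t) ≡ b + (d * s + d * t)
    ring₂ b d s t = solve 4 (λ a b c d → a :+ b :* (c :+ d) := a :+ (b :* c :+ b :* d)) refl b d s t
    ring₃ : ∀ b k l x y P R → b + (l * R * (x * P) + k * P * (y * R)) ≡ b + (l * x + k * y) * (P * R)
    ring₃ b k l x y P R = solve 7 (λ a b c d e f g → a :+ (b :* c :* (d :* e) :+ f :* e :* (g :* c)) := a :+ (b
          :* d :+ f :* g) :* (e :* c)) refl b l R x P k y
    diff : ∀ k n → a ≡ b + k * n → a - b ≡ k * n
    diff k n e = trans (cong (_- b) e) (ring₄ b (k * n))
      where
      ring₄ : ∀ b t → b + t - b ≡ t
      ring₄ b t = solve 2 (λ a b → a :+ b :- a := b) refl b t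

  record Unit (z n : Z) : Set where
    constructor unit
    field
      inverse : Z
      is-inverse : z * inverse ≡ # 1 [mod n ]

  unit-1 : ∀ {n} → Unit (# 1) n
  unit-1 = unit (# 1) (mod-reflexive (*-identityʳ (# 1)))

  unit-resp : ∀ {z z′ n} → z ≡ z′ [mod n ] → Unit z n → Unit z′ n
  unit-resp e (unit w h) = unit w (mod-trans (mod-* (mod-sym e) mod-refl) h)

  -- 1 - (1 - z w) (1 - z w′) is a multiple of z.
  unit-modulus-* : ∀ {z P R} → Unit z P → Unit z R → Unit z (P * R)
  unit-modulus-* {z} {P} {R} (unit w (mod-by k p)) (unit w′ (mod-by l q)) = unit (w + w′ - z * w * w′) (mod-by (- (k * l)) (begin
    z * (w + w′ - z * w * w′) ≡⟨ ring₁ z w w′ ⟩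
    z * w + z * w′ - z * w * (z * w′) ≡⟨ cong₂ (λ u v → u + v - u * v) p q ⟩
    # 1 + k * P + (# 1 + l * R) - (# 1 + k * P) * (# 1 + l * R) ≡⟨ ring₂ k l P R ⟩
    # 1 + - (k * l) * (P * R) ∎))
    where
    open ≡-Reasoning
    ring₁ : ∀ z w w′ → z * (w + w′ - z * w * w′) ≡ z * w + z * w′ - z * w * (z * w′)
    ring₁ z w w′ = solve 3 (λ a b c → a :* (b :+ c :- a :* b :* c) := a :* b :+ a :* c :- a :* b :* (a :* c))
          refl z w w′
    ring₂ : ∀ k l P R → # 1 + k * P + (# 1 + l * R) - (# 1 + k * P) * (# 1 + l * R) ≡ # 1 + - (k * l) * (P * R)
    ring₂ k l P R = solve 4 (λ a b c d → num 1 :+ a :* b :+ (num 1 :+ c :* d) :- (num 1 :+ a :* b) :* (num 1 :+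
          c :* d) := num 1 :+ :- (a :* c) :* (b :* d)) refl k P l R

  unit-modulus-1 : ∀ z → Unit z (# 1)
  unit-modulus-1 z = unit (# 0) (mod-by (- # 1) (ring z))
    where
    ring : ∀ z → z * # 0 ≡ # 1 + - # 1 * # 1
    ring z = solve 1 (λ a → a :* num 0 := num 1 :+ :- (num 1) :* num 1) refl z

  unit-modulus-^ : ∀ {z p} e → Unit z p → Unit z (p ^ e)
  unit-modulus-^ {z} zero u = unit-modulus-1 z
  unit-modulus-^ (suc e) u = unit-modulus-* u (unit-modulus-^ e u)

  unit-^ : ∀ {z n} j → Unit z n → Unit (z ^ j) n
  unit-^ zero u = unit-1
  unit-^ {z} {n} (suc j) u@(unit w h) with unit-^ j u
  ... | unit w′ h′ = unit (w * w′) (mod-trans (mod-reflexive (ring z (z ^ j) w w′)) (mod-trans (mod-* h h′) (mod-reflexive (*-identityʳ (# 1)))))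
    where
    ring : ∀ z t w w′ → z * t * (w * w′) ≡ z * w * (t * w′)
    ring z t w w′ = solve 4 (λ a b c d → a :* b :* (c :* d) := a :* c :* (b :* d)) refl z t w w′

  coprime⇒comaximal : ∀ {m n} → Coprime m n → Comaximal (# m) (# n)
  coprime⇒comaximal {m} {n} c with coprime-Bézout c
  ... | Bézout.+- x y eq = comaximal (# x) (- # y) (trans (cong (_+ - # y * # n) lifted) (ring (# y) (# n)))
    where
    lifted : # x * # m ≡ # 1 + # y * # n
    lifted = trans (sym (#-* x m)) (trans (cong # (sym eq)) (trans (#-+ 1 (y ℕ.* n)) (cong (λ i → # 1 + i) (#-* y n))))
    ring : ∀ y n → # 1 + y * n + - y * n ≡ # 1
    ring y n = solve 2 (λ a b → num 1 :+ a :* b :+ :- a :* b := num 1) refl y n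
  ... | Bézout.-+ x y eq = comaximal (- # x) (# y) (trans (cong (λ i → - # x * # m + i) lifted) (ring (# x) (# m)))
    where
    lifted : # y * # n ≡ # 1 + # x * # m
    lifted = trans (sym (#-* y n)) (trans (cong # (sym eq)) (trans (#-+ 1 (x ℕ.* m)) (cong (λ i → # 1 + i) (#-* x m))))
    ring : ∀ x m → - x * m + (# 1 + x * m) ≡ # 1
    ring x m = solve 2 (λ a b → :- a :* b :+ (num 1 :+ a :* b) := num 1) refl x m

  coprime⇒unit : ∀ {m n} → Coprime m n → Unit (# m) (# n)
  coprime⇒unit {m} {n} c with coprime⇒comaximal c
  ... | comaximal x y e = unit x (mod-by (- y) (trans (ring₁ (# m) x y (# n)) (cong (_+ - y * # n) e)))
    where
    ring₁ : ∀ m x y n → m * x ≡ x * m + y * n + - y * n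
    ring₁ m x y n = solve 4 (λ a b c d → a :* b := b :* a :+ c :* d :+ :- c :* d) refl m x y n

  unit⇒coprime : ∀ {m n} → Unit (# m) (# n) → Coprime m n
  unit⇒coprime {m} {n} (unit w (mod-by k e)) {d} (divides i m≡ , divides j n≡) = *-cast≡1 (# i * w - k * # j) d one
    where
    open ≡-Reasoning
    one : (# i * w - k * # j) * # d ≡ # 1
    one = begin
      (# i * w - k * # j) * # d ≡⟨ ring₁ (# i) w k (# j) (# d) ⟩
      (# i * # d) * w - k * (# j * # d) ≡⟨ cong₂ (λ u v → u * w - k * v) (trans (sym (#-* i d)) (cong # (sym m≡))) (trans (sym (#-* j d)) (cong # (sym n≡))) ⟩
      # m * w - k * # n ≡⟨ cong (_- k * # n) e ⟩
      # 1 + k * # n - k * # n ≡⟨ ring₂ (k * # n) ⟩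
      # 1 ∎
      where
      ring₁ : ∀ i w k j d → (i * w - k * j) * d ≡ (i * d) * w - k * (j * d)
      ring₁ i w k j d = solve 5 (λ a b c d e → (a :* b :- c :* d) :* e := a :* e :* b :- c :* (d :* e)) refl i
            w k j d
      ring₂ : ∀ t → # 1 + t - t ≡ # 1
      ring₂ t = solve 1 (λ a → num 1 :+ a :- a := num 1) refl t

  mod-% : ∀ a n .{{_ : ℕ.NonZero n}} → # a ≡ # (a ℕ.% n) [mod # n ]
  mod-% a n = mod-by (# (a ℕ./ n)) (trans (cong # (ℕ.m≡m%n+[m/n]*n a n)) (trans (#-+ (a ℕ.% n) (a ℕ./ n ℕ.* n)) (cong (λ i → # (a ℕ.% n) + i) (#-* (a ℕ./ n) n))))

  prime-in-unit-class : ∀ M z n → 2 ℕ.≤ M → Unit z (# M) → ∃ λ q → Prime q × n ℕ.< q × # q ≡ z [mod # M ]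
  prime-in-unit-class M@(suc _) z n 2≤M u with reduce z M
  ... | c , k , z≡c with dirichlet M c n 2≤M (unit⇒coprime (unit-resp (mod-by k z≡c) u))
  ... | q , pq , n<q , e = q , pq , n<q , mod-trans (mod-% q M) (mod-trans (mod-reflexive (cong # e)) (mod-sym (mod-trans (mod-by k z≡c) (mod-% c M))))

  -- Two unknowns, so that one Chinese remainder step serves both kinds of replacement;
  -- `prime-power-g` ignores the second.
  Solution : (Z → Z → Z) → Z → Z → Set
  Solution g κ n = ∃ λ u → ∃ λ v → Unit u n × Unit v n × g u v ≡ κ [mod n ]

  Congruential : (Z → Z → Z) → Set
  Congruential g = ∀ {u u′ v v′ n} → u ≡ u′ [mod n ] → v ≡ v′ [mod n ] → g u v ≡ g u′ v′ [mod n ]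

  chinese : ∀ {P R} → Comaximal P R → ∀ u v → ∃ λ z → z ≡ u [mod P ] × z ≡ v [mod R ]
  chinese {P} {R} (comaximal x y e) u v = z , mod-by ((v - u) * x) (begin
      z ≡⟨ ring₁ u v x y P R ⟩
      u * (x * P + y * R) + (v - u) * x * P ≡⟨ cong (λ t → u * t + (v - u) * x * P) e ⟩
      u * # 1 + (v - u) * x * P ≡⟨ cong (_+ (v - u) * x * P) (*-identityʳ u) ⟩
      u + (v - u) * x * P ∎) , mod-by ((u - v) * y) (begin
      z ≡⟨ ring₂ u v x y P R ⟩
      v * (x * P + y * R) + (u - v) * y * R ≡⟨ cong (λ t → v * t + (u - v) * y * R) e ⟩
      v * # 1 + (u - v) * y * R ≡⟨ cong (_+ (u - v) * y * R) (*-identityʳ v) ⟩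
      v + (u - v) * y * R ∎)
    where
    open ≡-Reasoning
    z : Z
    z = u * (y * R) + v * (x * P)
    ring₁ : ∀ u v x y P R → u * (y * R) + v * (x * P) ≡ u * (x * P + y * R) + (v - u) * x * P
    ring₁ u v x y P R = solve 6 (λ a b c d e f → a :* (b :* c) :+ d :* (e :* f) := a :* (e :* f :+ b :* c) :+
          (d :- a) :* e :* f) refl u y R v x P
    ring₂ : ∀ u v x y P R → u * (y * R) + v * (x * P) ≡ v * (x * P + y * R) + (u - v) * y * R
    ring₂ u v x y P R = solve 6 (λ a b c d e f → a :* (b :* c) :+ d :* (e :* f) := d :* (e :* f :+ b :* c) :+
          (a :- d) :* b :* c) refl u y R v x P

  solution-* : ∀ {g κ P R} → Congruential g → Comaximal P R → Solution g κ P → Solution g κ R → Solution g κ (P * R)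
  solution-* resp c (u , v , uu , uv , e) (u′ , v′ , uu′ , uv′ , e′) with chinese c u u′ | chinese c v v′
  ... | z , z≡u , z≡u′ | t , t≡v , t≡v′ = z , t , unit-modulus-* (unit-resp (mod-sym z≡u) uu) (unit-resp (mod-sym z≡u′) uu′)
    , unit-modulus-* (unit-resp (mod-sym t≡v) uv) (unit-resp (mod-sym t≡v′) uv′)
    , mod-combine c (mod-trans (resp z≡u t≡v) e) (mod-trans (resp z≡u′ t≡v′) e′)

  -- y = 1 + A y^(-j) is solved p-adically by iteration, because p divides A.
  record Lift (p A′ : Z) (j e : ℕ) : Set where
    constructor lifted
    field
      y w : Z
      y≡1 : y ≡ # 1 [mod p ]
      wy≡1 : w * y ^ j ≡ # 1 [mod p ^ e ]
      y≡ : y ≡ # 1 + p * A′ * w [mod p ^ e ]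

  lift : ∀ p A′ j e → Lift p A′ j e
  lift p A′ j zero = lifted (# 1) (# 1) mod-refl (modulo-1 _ _) (modulo-1 _ _)
    where
    modulo-1 : ∀ a b → a ≡ b [mod # 1 ]
    modulo-1 a b = mod-by (a - b) (solve 2 (λ a b → a := b :+ (a :- b) :* num 1) refl a b)
  lift p A′ j (suc e) = step (lift p A′ j e)
    where
    pe = p ^ e
    step : Lift p A′ j e → Lift p A′ j (suc e)
    step (lifted y w y≡1 wy≡1 y≡) = next (unit-^ j (unit-modulus-^ (suc e) (unit-resp (mod-sym y′≡1) unit-1)))
      where
      y′ = # 1 + p * A′ * w
      y′≡1 : y′ ≡ # 1 [mod p ]
      y′≡1 = mod-by (A′ * w) (solve 3 (λ a b c → num 1 :+ a :* b :* c := num 1 :+ b :* c :* a) refl p A′ w)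
      next : Unit (y′ ^ j) (p ^ suc e) → Lift p A′ j (suc e)
      next (unit w′ y′w′) = lifted y′ w′ y′≡1 (mod-trans (mod-reflexive (*-comm w′ (y′ ^ j))) y′w′)
          (mod-+ (mod-refl {# 1}) (mod-trans (mod-reflexive (*-assoc p A′ w)) (mod-trans (mod-scale p (mod-* (mod-refl {A′}) w≡w′)) (mod-reflexive (sym (*-assoc p A′ w′))))))
        where
        weak : y′ ^ j * w′ ≡ # 1 [mod pe ]
        weak = mod-divisor pe p (subst (λ n → y′ ^ j * w′ ≡ # 1 [mod n ]) (*-comm p pe) y′w′)
        -- y and its successor y′ agree modulo p^e, so the inverses of their j-th powers do too. The
        -- factor p before A′ raises this to modulus p^(e+1).
        w≡w′ : w ≡ w′ [mod pe ]
        w≡w′ = mod-trans (mod-reflexive (sym (*-identityʳ w))) (mod-trans (mod-* (mod-refl {w}) (mod-sym weak))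
          (mod-trans (mod-* (mod-refl {w}) (mod-* (mod-^ j (mod-sym y≡)) (mod-refl {w′}))) (mod-trans (mod-reflexive (sym (*-assoc w (y ^ j) w′)))
            (mod-trans (mod-* wy≡1 (mod-refl {w′})) (mod-reflexive (*-identityˡ w′))))))

  prime-power-g : ℕ → Z → Z → Z
  prime-power-g j u _ = u ^ j * (u - # 1)

  prime-power-g-resp : ∀ j → Congruential (prime-power-g j)
  prime-power-g-resp j e _ = mod-* (mod-^ j e) (mod-+ e mod-refl)

  lift-solution : ∀ p A′ j e → Solution (prime-power-g j) (p * A′) (p ^ e)
  lift-solution p A′ j e = solution (lift p A′ j e)
    where
    solution : Lift p A′ j e → Solution (prime-power-g j) (p * A′) (p ^ e)
    solution (lifted y w y≡1 wy≡1 y≡) = y , # 1 , unit-modulus-^ e (unit-resp (mod-sym y≡1) unit-1) , unit-1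
      , mod-trans (mod-* (mod-refl {y ^ j}) (mod-+ y≡ (mod-refl { - # 1}))) (mod-trans (mod-reflexive (ring (y ^ j) (p * A′) w))
          (mod-trans (mod-* (mod-refl {p * A′}) wy≡1) (mod-reflexive (*-identityʳ (p * A′)))))
      where
      ring : ∀ t A w → t * (# 1 + A * w + - # 1) ≡ A * (w * t)
      ring t A w = solve 3 (λ a b c → a :* (num 1 :+ b :* c :+ :- (num 1)) := b :* (c :* a)) refl t A w

  two-primes-g : Z → Z → Z
  two-primes-g u v = (u - # 1) * (v - # 1)

  two-primes-g-resp : Congruential two-primes-g
  two-primes-g-resp e f = mod-* (mod-+ e mod-refl) (mod-+ f mod-refl)

  pos-^ : ∀ p e → # (p ℕ.^ e) ≡ (# p) ^ e
  pos-^ p zero = refl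
  pos-^ p (suc e) = trans (#-* p (p ℕ.^ e)) (cong (λ i → # p * i) (pos-^ p e))

  pos-pred : ∀ {q} → 1 ℕ.≤ q → # (ℕ.pred q) ≡ # q - # 1
  pos-pred {suc q} _ = trans (solve 1 (λ a → a := num 1 :+ a :- num 1) refl (# q)) (cong (_- # 1) (sym (#-+ 1 q)))

  -- p and r are replaced modulo a power of p by 2 and 1 + (p-1)(r-1), or, if the latter is divisible by p, by 3 and 1 + (p-1)(r-1)/2.
  two-factors : ∀ p h e → Prime p → 3 ℕ.< p → Solution two-primes-g ((# p - # 1) * (# 2 * # h)) ((# p) ^ e)
  two-factors p h e pp 3<p with p ∣? V
    where
    V : ℕ
    V = 1 ℕ.+ ℕ.pred p ℕ.* (2 ℕ.* h)
  ... | no p∤V = # 2 , # V , unit-modulus-^ e (coprime⇒unit (small 2 (s≤s z≤n) (ℕ.<⇒≤ 3<p))) , unit-modulus-^ e (coprime⇒unit (Coprimality.sym (prime∤⇒coprime pp p∤V)))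
      , mod-reflexive (trans (cong (λ z → (# 2 - # 1) * (z - # 1)) V≡) (ring (# p) (# h)))
    where
    V : ℕ
    V = 1 ℕ.+ ℕ.pred p ℕ.* (2 ℕ.* h)
    small : ∀ a → 1 ℕ.≤ a → a ℕ.< p → Coprime a p
    small a 1≤a a<p = Coprimality.sym (prime∤⇒coprime pp (λ d → ℕ.<⇒≱ a<p (∣⇒≤ {{ℕ.>-nonZero 1≤a}} d)))
    V≡ : # V ≡ # 1 + (# p - # 1) * (# 2 * # h)
    V≡ = trans (#-+ 1 _) (cong (λ i → # 1 + i) (trans (#-* (ℕ.pred p) (2 ℕ.* h)) (cong₂ _*_ (pos-pred (prime⇒1≤ pp)) (#-* 2 h))))
    ring : ∀ p h → (# 2 - # 1) * (# 1 + (p - # 1) * (# 2 * h) - # 1) ≡ (p - # 1) * (# 2 * h)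
    ring p h = solve 2 (λ a b → (num 2 :- num 1) :* (num 1 :+ (a :- num 1) :* (num 2 :* b) :- num 1) := (a :-
          num 1) :* (num 2 :* b)) refl p h
  ... | yes (divides i V≡ip) = # 3 , W , unit-modulus-^ e (coprime⇒unit (small 3 (s≤s z≤n) 3<p)) , unit-modulus-^ e (unit (# 2) (mod-by (# i) half))
      , mod-reflexive (ring (# p) (# h))
    where
    V : ℕ
    V = 1 ℕ.+ ℕ.pred p ℕ.* (2 ℕ.* h)
    W : Z
    W = # 1 + (# p - # 1) * # h
    small : ∀ a → 1 ℕ.≤ a → a ℕ.< p → Coprime a p
    small a 1≤a a<p = Coprimality.sym (prime∤⇒coprime pp (λ d → ℕ.<⇒≱ a<p (∣⇒≤ {{ℕ.>-nonZero 1≤a}} d)))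
    -- 2W = 1 + V and p divides V, so 2 inverts W modulo p.
    half : W * # 2 ≡ # 1 + # i * # p
    half = trans (ring₁ (# p) (# h)) (cong (λ i → # 1 + i) (trans (sym V≡) (trans (cong # V≡ip) (#-* i p))))
      where
      V≡ : # V ≡ # 1 + (# p - # 1) * (# 2 * # h)
      V≡ = trans (#-+ 1 _) (cong (λ i → # 1 + i) (trans (#-* (ℕ.pred p) (2 ℕ.* h)) (cong₂ _*_ (pos-pred (prime⇒1≤ pp)) (#-* 2 h))))
      ring₁ : ∀ p h → (# 1 + (p - # 1) * h) * # 2 ≡ # 1 + (# 1 + (p - # 1) * (# 2 * h))
      ring₁ p h = solve 2 (λ a b → (num 1 :+ (a :- num 1) :* b) :* num 2 := num 1 :+ (num 1 :+ (a :- num 1) :*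
            (num 2 :* b))) refl p h
    ring : ∀ p h → (# 3 - # 1) * (# 1 + (p - # 1) * h - # 1) ≡ (p - # 1) * (# 2 * h)
    ring p h = solve 2 (λ a b → (num 3 :- num 1) :* (num 1 :+ (a :- num 1) :* b :- num 1) := (a :- num 1) :*
          (num 2 :* b)) refl p h

  -- Totients recurring in a residue class.

  module _ (M : ℕ) (2≤M : 2 ℕ.≤ M) where

    InfinitelyOften : Z → Set
    InfinitelyOften a = ∀ n → ∃ λ k → 1 ℕ.≤ k × n ℕ.< φ k × # (φ k) ≡ a [mod # M ]

    private
      ∤-large : ∀ {q d n} → 1 ℕ.≤ d → n ℕ.+ d ℕ.< q → ¬ q ∣ d
      ∤-large {q} {d} {n} 1≤d lt dv = ℕ.<⇒≱ (ℕ.≤-<-trans (ℕ.m≤n+m d n) lt) (∣⇒≤ {{ℕ.>-nonZero 1≤d}} dv)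

      <-pred : ∀ {q d n} → 1 ℕ.≤ d → n ℕ.+ d ℕ.< q → n ℕ.< ℕ.pred q
      <-pred {suc q} {d} {n} 1≤d (s≤s lt) = ℕ.≤-trans (ℕ.≤-trans (ℕ.≤-reflexive (ℕ.+-comm 1 n)) (ℕ.+-monoʳ-≤ n 1≤d)) lt

    -- Taking q > n + d serves twice: q does not divide d, and the totient exceeds n.
    one-prime : ∀ {j κ d} → 1 ℕ.≤ d → Solution (prime-power-g j) κ (# M) → InfinitelyOften (κ * # (φ d))
    one-prime {j} {κ} {d} 1≤d (u , _ , uu , _ , e) n with prime-in-unit-class M u (n ℕ.+ d) 2≤M uu
    ... | q , pq , lt , q≡u = q ℕ.^ suc j ℕ.* d , ℕ.*-mono-≤ (ℕ.m^n>0 q {{prime⇒nonZero pq}} (suc j)) 1≤d , big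
        , mod-trans (mod-reflexive value) (mod-* (mod-trans (prime-power-g-resp j q≡u (mod-refl {# 0})) e) mod-refl)
      where
      φ≡ : φ (q ℕ.^ suc j ℕ.* d) ≡ q ℕ.^ j ℕ.* (ℕ.pred q ℕ.* φ d)
      φ≡ = φ-prime-power j pq (∤-large 1≤d lt)
      big : n ℕ.< φ (q ℕ.^ suc j ℕ.* d)
      big = subst (n ℕ.<_) (sym φ≡) (ℕ.≤-trans (<-pred 1≤d lt) (ℕ.≤-trans (ℕ.m≤m*n (ℕ.pred q) (φ d) {{ℕ.>-nonZero (φ-positive 1≤d)}})
        (ℕ.m≤n*m _ (q ℕ.^ j) {{ℕ.m^n≢0 q j {{prime⇒nonZero pq}}}})))
      value : # (φ (q ℕ.^ suc j ℕ.* d)) ≡ prime-power-g j (# q) (# 0) * # (φ d)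
      value = trans (cong # φ≡) (trans (#-* (q ℕ.^ j) _) (trans (cong₂ _*_ (pos-^ q j) (trans (#-* (ℕ.pred q) (φ d)) (cong (_* # (φ d)) (pos-pred (prime⇒1≤ pq)))))
        (sym (*-assoc ((# q) ^ j) (# q - # 1) (# (φ d))))))

    two-primes : ∀ {κ d} → 1 ℕ.≤ d → Solution two-primes-g κ (# M) → InfinitelyOften (κ * # (φ d))
    two-primes {κ} {d} 1≤d (u , v , uu , uv , e) n with prime-in-unit-class M v d 2≤M uv
    -- q is chosen after r and beyond r d, hence does not divide r d.
    ... | r , pr , d<r , r≡v with prime-in-unit-class M u (n ℕ.+ r ℕ.* d) 2≤M uu
    ... | q , pq , lt , q≡u = q ℕ.* (r ℕ.* d) , ℕ.*-mono-≤ (prime⇒1≤ pq) 1≤rd , big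
        , mod-trans (mod-reflexive value) (mod-* (mod-trans (two-primes-g-resp q≡u r≡v) e) mod-refl)
      where
      1≤rd : 1 ℕ.≤ r ℕ.* d
      1≤rd = ℕ.*-mono-≤ (prime⇒1≤ pr) 1≤d
      φ≡ : φ (q ℕ.* (r ℕ.* d)) ≡ ℕ.pred q ℕ.* (ℕ.pred r ℕ.* φ d)
      φ≡ = trans (φ-*-∤ pq (∤-large 1≤rd lt)) (cong (ℕ.pred q ℕ.*_) (φ-*-∤ pr (∤-large {n = 0} 1≤d d<r)))
      big : n ℕ.< φ (q ℕ.* (r ℕ.* d))
      big = subst (n ℕ.<_) (sym (φ-*-∤ pq (∤-large 1≤rd lt))) (ℕ.≤-trans (<-pred 1≤rd lt) (ℕ.m≤m*n (ℕ.pred q) (φ (r ℕ.* d)) {{ℕ.>-nonZero (φ-positive 1≤rd)}}))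
      value : # (φ (q ℕ.* (r ℕ.* d))) ≡ two-primes-g (# q) (# r) * # (φ d)
      value = trans (cong # φ≡) (trans (#-* (ℕ.pred q) _) (trans (cong₂ _*_ (pos-pred (prime⇒1≤ pq)) (trans (#-* (ℕ.pred r) (φ d)) (cong (_* # (φ d)) (pos-pred (prime⇒1≤ pr)))))
        (sym (*-assoc (# q - # 1) (# r - # 1) (# (φ d))))))

    private
      1≤M : 1 ℕ.≤ M
      1≤M = ℕ.<⇒≤ 2≤M

      -- Separates the p-part of the modulus, where `local` applies, from a cofactor prime to p.
      split-modulus : ∀ {g κ p} → Prime p → Congruential g → (∀ e → Solution g κ ((# p) ^ e)) →
        ∀ n → 1 ℕ.≤ n → (∀ n′ → 1 ℕ.≤ n′ → n′ ∣ n → ¬ p ∣ n′ → Solution g κ (# n′)) → Solution g κ (# n)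
      split-modulus {g} {κ} {p} pp resp local n 1≤n rest with split-prime p n pp 1≤n
      ... | e , n′ , n≡ , 1≤n′ , p∤n′ = subst (Solution g κ) (sym (trans (cong # n≡) (trans (#-* (p ℕ.^ e) n′) (cong (_* # n′) (pos-^ p e)))))
        (solution-* {g} {κ} resp (subst (λ z → Comaximal z (# n′)) (pos-^ p e) (coprime⇒comaximal (coprime-^ˡ e (prime∤⇒coprime pp p∤n′)))) (local e)
          (rest n′ 1≤n′ (divides (p ℕ.^ e) n≡) p∤n′))

    square-case : ∀ {p j d} → Prime p → ¬ p ∣ d → 1 ℕ.≤ d → InfinitelyOften (# (φ (p ℕ.^ suc (suc j) ℕ.* d)))
    square-case {p} {j} {d} pp p∤d 1≤d = subst InfinitelyOften (sym value) (one-prime {suc j} 1≤d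
        (split-modulus {κ = κ} pp (prime-power-g-resp (suc j)) (lift-solution (# p) A′ (suc j)) M 1≤M
          -- Away from p the prime p itself is a solution.
          (λ n′ _ _ p∤n′ → # p , # 1 , coprime⇒unit (prime∤⇒coprime pp p∤n′) , unit-1 , mod-reflexive (*-assoc (# p) ((# p) ^ j) (# p - # 1)))))
      where
      A′ = (# p) ^ j * (# p - # 1)
      κ = # p * A′
      value : # (φ (p ℕ.^ suc (suc j) ℕ.* d)) ≡ κ * # (φ d)
      value = trans (cong # (φ-prime-power (suc j) pp p∤d)) (trans (#-* (p ℕ.^ suc j) _) (trans (cong₂ _*_ (pos-^ p (suc j))
        (trans (#-* (ℕ.pred p) (φ d)) (cong (_* # (φ d)) (pos-pred (prime⇒1≤ pp))))) (ring (# p) ((# p) ^ j) (# p - # 1) (# (φ d)))))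
        where
        ring : ∀ p t s f → p * t * (s * f) ≡ p * (t * s) * f
        ring p t s f = solve 4 (λ a b c d → a :* b :* (c :* d) := a :* (b :* c) :* d) refl p t s f

    -- 2 = (-1)² - (-1).
    three-case : ∀ {d} → Prime 3 → ¬ 3 ∣ d → 1 ℕ.≤ d → InfinitelyOften (# (φ (3 ℕ.* d)))
    three-case {d} p3 3∤d 1≤d = subst InfinitelyOften (sym (trans (cong # (φ-*-∤ p3 3∤d)) (#-* 2 (φ d))))
      (one-prime {1} {# 2} 1≤d (- # 1 , # 1 , unit (- # 1) (mod-reflexive (solve 0 (:- (num 1) :* :- (num 1) :=
            num 1) refl)) , unit-1 , mod-reflexive (solve 0 (:- (num 1) :* num 1 :* (:- (num 1) :- num 1) :=
            num 2) refl)))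

    -- The modulus falls into its p-part, its r-part and the rest. On the first two `two-factors`
    -- applies, with r - 1 or p - 1 as the even factor; on the rest p and r themselves serve.
    two-primes-case : ∀ {p r d} → Prime p → Prime r → 3 ℕ.< p → 3 ℕ.< r → (∃ λ h → p ≡ suc (h ℕ.+ h)) → (∃ λ h → r ≡ suc (h ℕ.+ h)) →
      ¬ p ∣ r ℕ.* d → ¬ r ∣ d → 1 ℕ.≤ d → InfinitelyOften (# (φ (p ℕ.* (r ℕ.* d))))
    two-primes-case {p} {r} {d} pp pr 3<p 3<r (hp , p≡) (hr , r≡) p∤rd r∤d 1≤d = subst InfinitelyOften (sym value) (two-primes 1≤d
        (split-modulus {κ = κ} pp two-primes-g-resp (λ e → subst (λ z → Solution two-primes-g z ((# p) ^ e)) (cong (λ i → (# p - # 1) * i) (sym (odd r≡))) (two-factors p hr e pp 3<p)) M 1≤M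
          (λ n′ 1≤n′ _ p∤n′ → split-modulus {κ = κ} pr two-primes-g-resp
            (λ e → subst (λ z → Solution two-primes-g z ((# r) ^ e)) (trans (*-comm (# r - # 1) _) (cong (_* (# r - # 1)) (sym (odd p≡)))) (two-factors r hp e pr 3<r)) n′ 1≤n′
            (λ n″ _ n″∣n′ r∤n″ → # p , # r , coprime⇒unit (prime∤⇒coprime pp (λ dv → p∤n′ (∣-trans dv n″∣n′))) , coprime⇒unit (prime∤⇒coprime pr r∤n″) , mod-refl))))
      where
      κ = (# p - # 1) * (# r - # 1)
      odd : ∀ {x h} → x ≡ suc (h ℕ.+ h) → # x - # 1 ≡ # 2 * # h
      odd {h = h} refl = trans (cong (_- # 1) (trans (#-+ 1 (h ℕ.+ h)) (cong (λ i → # 1 + i) (#-+ h h)))) (solve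
            1 (λ a → num 1 :+ (a :+ a) :- num 1 := num 2 :* a) refl (# h))
      value : # (φ (p ℕ.* (r ℕ.* d))) ≡ κ * # (φ d)
      value = trans (cong # (trans (φ-*-∤ pp p∤rd) (cong (ℕ.pred p ℕ.*_) (φ-*-∤ pr r∤d)))) (trans (#-* (ℕ.pred p) _)
        (trans (cong₂ _*_ (pos-pred (prime⇒1≤ pp)) (trans (#-* (ℕ.pred r) (φ d)) (cong (_* # (φ d)) (pos-pred (prime⇒1≤ pr))))) (sym (*-assoc (# p - # 1) (# r - # 1) (# (φ d))))))

    private
      odd-prime : ∀ {p} → Prime p → ¬ p ≡ 2 → ∃ λ h → p ≡ suc (h ℕ.+ h)
      odd-prime {p} pp p≢2 with even-or-odd p
      ... | inj₂ w = w
      ... | inj₁ (h , e) = ⊥-elim (p≢2 (sym (prime∣prime⇒≡ prime[2] pp (divides h (trans e (trans (cong (h ℕ.+_) (sym (ℕ.+-identityʳ h))) (ℕ.*-comm 2 h)))))))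

      3<prime : ∀ {p} → Prime p → ¬ p ≡ 2 → ¬ p ≡ 3 → 3 ℕ.< p
      3<prime pp p≢2 p≢3 = ℕ.≤∧≢⇒< (ℕ.≤∧≢⇒< (prime⇒2≤ pp) (λ e → p≢2 (sym e))) (λ e → p≢3 (sym e))

    -- b = c b′ with c ∈ {1, 2} and b′ odd.
    squarefree-case : ∀ c b′ → 1 ℕ.≤ c → 2 ℕ.≤ b′ → (∀ p → Prime p → p ∣ b′ → ¬ p ≡ 2 × ¬ p ≡ 3 × ¬ p ∣ c) →
      (∀ p → Prime p → ¬ p ℕ.* p ∣ b′) → ¬ Prime b′ → InfinitelyOften (# (φ (c ℕ.* b′)))
    squarefree-case c b′ 1≤c 2≤b′ avoid sqf ¬pb′ with prime-factor b′ 2≤b′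
    ... | p , pp , p∣b′@(divides x b′≡) with 2 ℕ.≤? x
    ... | no ¬2≤x = ⊥-elim (¬pb′ (subst Prime (sym (x≡1⇒ x refl)) pp))
      where
      x≡1⇒ : ∀ y → y ≡ x → b′ ≡ p
      x≡1⇒ zero e = ⊥-elim (ℕ.<⇒≱ 2≤b′ (subst (ℕ._≤ 1) (sym (trans b′≡ (cong (ℕ._* p) (sym e)))) z≤n))
      x≡1⇒ (suc zero) e = trans b′≡ (trans (cong (ℕ._* p) (sym e)) (ℕ.*-identityˡ p))
      x≡1⇒ (suc (suc y)) e = ⊥-elim (¬2≤x (subst (2 ℕ.≤_) e (s≤s (s≤s z≤n))))
    ... | yes 2≤x with prime-factor x 2≤x
    ... | r , pr , r∣x@(divides y x≡) = subst (λ z → InfinitelyOften (# (φ z))) (sym b≡)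
        (two-primes-case pp pr (3<prime pp p≢2 (proj₁ (proj₂ (avoid p pp p∣b′)))) (3<prime pr r≢2 (proj₁ (proj₂ (avoid r pr r∣b′)))) (odd-prime pp p≢2) (odd-prime pr r≢2)
          p∤ryc r∤yc 1≤yc)
      where
      r∣b′ : r ∣ b′
      r∣b′ = subst (r ∣_) (sym b′≡) (∣-trans r∣x (m∣m*n p))
      p≢2 = proj₁ (avoid p pp p∣b′)
      r≢2 = proj₁ (avoid r pr r∣b′)
      b≡ : c ℕ.* b′ ≡ p ℕ.* (r ℕ.* (y ℕ.* c))
      b≡ = trans (cong (c ℕ.*_) (trans b′≡ (cong (ℕ._* p) x≡))) (ring c y r p)
        where
        ring : ∀ c y r p → c ℕ.* (y ℕ.* r ℕ.* p) ≡ p ℕ.* (r ℕ.* (y ℕ.* c))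
        ring = solve-∀
      p∤x : ¬ p ∣ x
      p∤x dv = sqf p pp (subst (p ℕ.* p ∣_) (trans (ℕ.*-comm p x) (sym b′≡)) (*-monoʳ-∣ p dv))
      r∤y : ¬ r ∣ y
      r∤y dv = sqf r pr (∣-trans (subst (r ℕ.* r ∣_) (trans (ℕ.*-comm r y) (sym x≡)) (*-monoʳ-∣ r dv)) (subst (x ∣_) (sym b′≡) (m∣m*n p)))
      p∤ryc : ¬ p ∣ r ℕ.* (y ℕ.* c)
      p∤ryc dv with euclidsLemma (r ℕ.* y) c pp (subst (p ∣_) (sym (ℕ.*-assoc r y c)) dv)
      ... | inj₁ z = p∤x (subst (p ∣_) (trans (ℕ.*-comm r y) (sym x≡)) z)
      ... | inj₂ z = proj₂ (proj₂ (avoid p pp p∣b′)) z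
      r∤yc : ¬ r ∣ y ℕ.* c
      r∤yc dv with euclidsLemma y c pr dv
      ... | inj₁ z = r∤y z
      ... | inj₂ z = proj₂ (proj₂ (avoid r pr r∣b′)) z
      1≤y : 1 ℕ.≤ y
      1≤y = factor-pos {r} y (ℕ.<⇒≤ 2≤x) (trans x≡ (ℕ.*-comm y r))
      1≤yc : 1 ℕ.≤ y ℕ.* c
      1≤yc = ℕ.*-mono-≤ 1≤y 1≤c

    totients-recur : ∀ {b} → 1 ℕ.≤ b → ¬ Prime b → ¬ (∃ λ p → Prime p × p ℕ.% 2 ≡ 1 × b ≡ 2 ℕ.* p) → 1 ℕ.< φ b → InfinitelyOften (# (φ b))
    totients-recur {b} 1≤b ¬pb ¬2p 1<φb with search (λ p → prime? p ×-dec (p ℕ.* p ∣? b)) b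
    ... | inj₁ (p , pp , p²∣b) with split-prime p b pp 1≤b
    ... | zero , d , e , 1≤d , p∤d = ⊥-elim (p∤d (∣-trans (m∣m*n p) (subst (p ℕ.* p ∣_) (trans e (ℕ.*-identityˡ d)) p²∣b)))
    ... | suc zero , d , e , 1≤d , p∤d = ⊥-elim (p∤d (*-cancelˡ-∣ p {{prime⇒nonZero pp}} (subst (p ℕ.* p ∣_) (trans e (cong (ℕ._* d) (ℕ.*-identityʳ p))) p²∣b)))
    ... | suc (suc j) , d , e , 1≤d , p∤d = subst (λ z → InfinitelyOften (# (φ z))) (sym e) (square-case {p} {j} pp p∤d 1≤d)
    totients-recur {b} 1≤b ¬pb ¬2p 1<φb | inj₂ none with 3 ∣? b
    ... | yes (divides d e) = subst (λ z → InfinitelyOften (# (φ z))) (trans (ℕ.*-comm 3 d) (sym e))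
        (three-case prime3 (λ dv → none 3 3≤b (prime3 , subst (9 ∣_) (trans (ℕ.*-comm 3 d) (sym e)) (*-monoʳ-∣ 3 dv))) 1≤d)
      where
      prime3 : Prime 3
      prime3 = from-yes (prime? 3)
      1≤d : 1 ℕ.≤ d
      1≤d = factor-pos {3} d 1≤b (trans e (ℕ.*-comm d 3))
      3≤b : 3 ℕ.≤ b
      3≤b = ∣⇒≤ {{ℕ.>-nonZero 1≤b}} (divides d e)
    ... | no 3∤b with 2 ∣? b
    ... | no 2∤b = subst (λ z → InfinitelyOften (# (φ z))) (ℕ.*-identityˡ b) (squarefree-case 1 b ℕ.≤-refl 2≤b
        (λ p pp p∣b → (λ { refl → 2∤b p∣b }) , (λ { refl → 3∤b p∣b }) , (λ p∣1 → ℕ.<⇒≱ (prime⇒2≤ pp) (∣⇒≤ p∣1)))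
        (λ p pp p²∣b → none p (ℕ.≤-trans (ℕ.m≤m*n p p {{prime⇒nonZero pp}}) (∣⇒≤ {{ℕ.>-nonZero 1≤b}} p²∣b)) (pp , p²∣b)) ¬pb)
      where
      2≤b : 2 ℕ.≤ b
      -- b = 1 is excluded because φ(1) = 1.
      2≤b = ℕ.≤∧≢⇒< 1≤b (λ { refl → ℕ.<-irrefl refl 1<φb })
    ... | yes (divides d e) = subst (λ z → InfinitelyOften (# (φ z))) (sym b≡2d) (squarefree-case 2 d (s≤s z≤n) 2≤d
        (λ p pp p∣d → (λ { refl → 2∤d p∣d }) , (λ { refl → 3∤b (subst (3 ∣_) (sym b≡2d) (∣n⇒∣m*n 2 p∣d)) })
          , (λ p∣2 → 2∤d (subst (_∣ d) (prime∣prime⇒≡ pp prime[2] p∣2) p∣d)))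
        (λ p pp p²∣d → sqf p pp (∣-trans p²∣d (divides 2 b≡2d))) ¬pd)
      where
      b≡2d : b ≡ 2 ℕ.* d
      b≡2d = trans e (ℕ.*-comm d 2)
      sqf : ∀ p → Prime p → ¬ p ℕ.* p ∣ b
      sqf p pp p²∣b = none p (ℕ.≤-trans (ℕ.m≤m*n p p {{prime⇒nonZero pp}}) (∣⇒≤ {{ℕ.>-nonZero 1≤b}} p²∣b)) (pp , p²∣b)
      2∤d : ¬ 2 ∣ d
      2∤d dv = sqf 2 prime[2] (subst (4 ∣_) (sym b≡2d) (*-monoʳ-∣ 2 dv))
      2≤d : 2 ℕ.≤ d
      2≤d = ℕ.≤∧≢⇒< (factor-pos {2} d 1≤b b≡2d) (λ { refl → ℕ.<-irrefl refl (subst (λ z → 1 ℕ.< φ z) b≡2d 1<φb) })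
      ¬pd : ¬ Prime d
      ¬pd pd with even-or-odd d
      ... | inj₁ (h , d≡) = 2∤d (divides h (trans d≡ (trans (cong (h ℕ.+_) (sym (ℕ.+-identityʳ h))) (ℕ.*-comm 2 h))))
      ... | inj₂ (h , d≡) = ¬2p (d , pd , trans (cong (ℕ._% 2) (trans d≡ (cong suc (trans (cong (h ℕ.+_) (sym (ℕ.+-identityʳ h))) (ℕ.*-comm 2 h))))) (ℕ.[m+kn]%n≡m%n 1 h 2) , b≡2d)

open import Data.Nat using (_*_; _^_; _≤_; _<_; _%_; _+_)

theorem1 : (s m a b : ℕ) → 2 ≤ s → 1 ≤ m → m % 2 ≡ 1 →
    1 ≤ b → ¬ Prime b → ¬ (∃ λ p → Prime p × p % 2 ≡ 1 × b ≡ 2 * p) →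
    a ≡ φ b → 1 < a →
    (N : ℕ) → ∃ λ t → N < t × IsTotient t ×
    (∃ λ k → t ≡ a + k * (2 ^ s * m))
theorem1 s m a b 2≤s 1≤m _ 1≤b ¬pb ¬2p refl 1<a N
  -- A totient beyond N + φ b exceeds N and also a = φ b, so the quotient in the congruence is a
  -- natural number k.
  with Totients.totients-recur (2 ^ s * m) 2≤M 1≤b ¬pb ¬2p 1<a (N + φ b)
  where
  2≤M : 2 ≤ 2 ^ s * m
  2≤M = ℕ.*-mono-≤ (ℕ.^-monoʳ-≤ 2 {x = 1} (ℕ.<⇒≤ 2≤s)) 1≤m
... | n , 1≤n , lt , Totients.mod-by f e = φ n , ℕ.≤-<-trans (ℕ.m≤m+n N (φ b)) lt , (n , 1≤n , refl) ,
  Totients.#-quotient (2 ^ s * m) f (ℕ.≤-<-trans (ℕ.m≤n+m (φ b) N) lt) e
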